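{- Let $\alpha$ be a constant. Suppose there is a polynomial-time algorithm for the disk multicover problem that, on every feasible instance $(P,D,d,w)$, computes a disk multicover of weight at most $\alpha\cdot\sum_{i\in D}w(i)x(i)$, where $x$ is an optimal solution to the linear program $$\begin{array}{ll}\text{minimize} & \sum_{i\in D}w(i)x(i)\\ \text{subject to} & \sum_{i\in D:\,p\in i}x(i)\ge d(p)\quad \forall p\in P,\\ & 0\le x(i)\le 1\quad\forall i\in D.\end{array}$$ Then there exists a (polynomial-time) $2\alpha$-approximation algorithm for the weighted $m$-dominating set problem in unit disk graphs.
   Context: Disk multicover problem: given a set $P$ of points and a set $D$ of disks in the Euclidean plane, an (integer) demand $d(p)$ for each $p\in P$, and a nonnegative weight $w(i)$ for each $i\in D$, a subset $D'\subseteq D$ is a disk multicover if each $p\in P$ is contained in at least $d(p)$ disks of $D'$; the problem is to find a disk multicover $D'$ minimizing $\sum_{i\in D'}w(i)$. The notation $p\in i$ means that point $p$ is contained in disk $i$. In a unit disk graph, each node is placed at a point of the Euclidean plane (given as part of the input), and two nodes are joined by an edge if and only if their distance is at most a unit length. For a graph $G=(V,E)$ and a positive integer $m$, a set $S\subseteq V$ is an $m$-dominating set if every node in $V\setminus S$ has at least $m$ neighbors in $S$. The weighted $m$-dominating set problem: given $G$, a positive integer $m$, and nonnegative node weights $w(v)$, find an $m$-dominating set $S$ minimizing $\sum_{v\in S}w(v)$. A $\beta$-approximation algorithm is a polynomial-time algorithm that outputs a feasible solution of weight at most $\beta$ times the minimum weight.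
   Formalization: The points, disk centres, radii and weights given as input are rational rather than real, as usual for polynomial time in the bit model; the LP solutions x range over rationals, which leaves the optimum unchanged for such data; α is an arbitrary real. -}

module Defs where

open import Algebra.Properties.CommutativeMonoid.Sum using (sum)
open import Data.Bool.Base using (Bool; true; false; if_then_else_)
open import Data.Fin.Base using (Fin)
import Data.Fin.Properties as Fin
open import Data.Fin.Subset using (Subset; _∉_; _∩_; ∣_∣)
open import Data.Integer.Base as ℤ using (ℤ; +_; -[1+_])
open import Data.List.Base as List using (List; []; _∷_; _++_; length)
open import Data.Nat.Base as ℕ using (ℕ; suc; NonZero)
open import Data.Nat.Binary.Base using (ℕᵇ; zero; 2[1+_]; 1+[2_]; fromℕ)
open import Data.Product.Base using (Σ; ∃; ∃-syntax; _×_; _,_)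
open import Data.Rational.Base
  using (ℚ; 0ℚ; 1ℚ; ½; _+_; _*_; _-_; _≤_; _<_; Positive; ↥_; ↧ₙ_; _/_)
open import Data.Rational.Properties
  using (_≤?_; +-0-commutativeMonoid; *-identityˡ; *-assoc; *-monoʳ-<-pos)
open import Data.Rational.Solver using (module +-*-Solver)
open import Data.Sum.Base using (_⊎_)
open import Data.Unit.Base using (⊤)
open import Data.Vec.Base as Vec using (Vec; lookup; tabulate; _[_]≔_)
open import Data.Vec.Functional using (Vector)
open import Function.Base using (_∘_)
open import Function.Definitions using (Injective)
open import Level using (0ℓ)
open import Relation.Binary.Core using (Rel)
open import Relation.Binary.Definitions using (Decidable; Irreflexive; Symmetric)
open import Relation.Binary.PropositionalEquality
  using (_≡_; _≢_; refl; sym; trans; subst)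
open import Relation.Nullary using (¬_; does; ¬?; _×-dec_)

-- Two-sided Dedekind cuts.
record ℝ : Set₁ where
  field
    Lower Upper     : ℚ → Set
    lower-inhabited : ∃ Lower
    upper-inhabited : ∃ Upper
    lower-closed    : ∀ {p q} → p < q → Lower q → Lower p
    upper-closed    : ∀ {p q} → p < q → Upper p → Upper q
    lower-open      : ∀ {p} → Lower p → ∃[ q ] p < q × Lower q
    upper-open      : ∀ {q} → Upper q → ∃[ p ] p < q × Upper p
    disjoint        : ∀ {q} → ¬ (Lower q × Upper q)
    located         : ∀ {p q} → p < q → Lower p ⊎ Upper q

open ℝ

2ℚ : ℚ
2ℚ = + 2 / 1

private
  ½*2* : ∀ q → ½ * (2ℚ * q) ≡ q
  ½*2* q = trans (sym (*-assoc ½ 2ℚ q)) (*-identityˡ q)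

  2*½* : ∀ q → 2ℚ * (½ * q) ≡ q
  2*½* q = trans (sym (*-assoc 2ℚ ½ q)) (*-identityˡ q)

  ½-mono : ∀ {p q} → p < q → ½ * p < ½ * q
  ½-mono = *-monoʳ-<-pos ½

  2-mono : ∀ {p q} → p < q → 2ℚ * p < 2ℚ * q
  2-mono = *-monoʳ-<-pos 2ℚ

twice : ℝ → ℝ
twice α = record
  { Lower           = λ q → Lower α (½ * q)
  ; Upper           = λ q → Upper α (½ * q)
  ; lower-inhabited = let q , l = lower-inhabited α in
                      2ℚ * q , subst (Lower α) (sym (½*2* q)) l
  ; upper-inhabited = let q , u = upper-inhabited α in
                      2ℚ * q , subst (Upper α) (sym (½*2* q)) u
  ; lower-closed    = lower-closed α ∘ ½-mono
  ; upper-closed    = upper-closed α ∘ ½-mono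
  ; lower-open      = λ {p} l → let q , p/2<q , l′ = lower-open α l in
                      2ℚ * q
                      , subst (_< 2ℚ * q) (2*½* p) (2-mono p/2<q)
                      , subst (Lower α) (sym (½*2* q)) l′
  ; upper-open      = λ {q} u → let p , p<q/2 , u′ = upper-open α u in
                      2ℚ * p
                      , subst (2ℚ * p <_) (2*½* q) (2-mono p<q/2)
                      , subst (Upper α) (sym (½*2* p)) u′
  ; disjoint        = disjoint α
  ; located         = located α ∘ ½-mono
  }

-- W ≤[ β · v ] is the inequality W ≤ β v, for rationals W and v with
-- v ≥ 0. Every v it is applied to is a sum of nonnegative numbers.
_≤[_·_] : ℚ → ℝ → ℚ → Set
W ≤[ β · v ] = ∀ q → Upper β q → W ≤ q * v

module _ {X : Set} where

  IsMinimizer : (Feasible : X → Set) (cost : X → ℚ) → X → Set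
  IsMinimizer Feasible cost x =
    Feasible x × (∀ y → Feasible y → cost x ≤ cost y)

  -- W is at most β times the minimum, which is required to be attained.
  -- All minimizers have the same cost, so the choice of x is immaterial.
  AtMostTimesMin : ℚ → ℝ → (Feasible : X → Set) (cost : X → ℚ) → Set
  AtMostTimesMin W β Feasible cost =
    ∃[ x ] IsMinimizer Feasible cost x × W ≤[ β · cost x ]

Σℚ : ∀ {n} → Vector ℚ n → ℚ
Σℚ = sum +-0-commutativeMonoid

weightOf : ∀ {n} → Vector ℚ n → Subset n → ℚ
weightOf w S = Σℚ λ i → if lookup S i then w i else 0ℚ

-- Machines: structured programs over k stacks of bits, equivalent to
-- multitape Turing machines up to a polynomial change in running time
-- (a tape is a pair of stacks). Each operation moves at most one bit.

Store : ℕ → Set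
Store k = Vec (List Bool) k

infixr 5 _⨟_

data Program (k : ℕ) : Set where
  skip  : Program k
  push  : Fin k → Bool → Program k
  pop   : Fin k → Program k
  _⨟_   : Program k → Program k → Program k
  -- Three branches: the stack is empty, its top is false, its top is true.
  case  : Fin k → (empty top-false top-true : Program k) → Program k
  -- Iterate as long as the stack is nonempty.
  while : Fin k → Program k → Program k

-- ⟨ P , s ⟩⇓[ t ] s′ : started in store s, program P halts after
-- exactly t steps in store s′. Popping and testing leave an empty
-- stack empty.
data ⟨_,_⟩⇓[_]_ {k : ℕ} : Program k → Store k → ℕ → Store k → Set where
  skip⇓       : ∀ {s} → ⟨ skip , s ⟩⇓[ 1 ] s
  push⇓       : ∀ {s i b} → ⟨ push i b , s ⟩⇓[ 1 ] (s [ i ]≔ (b ∷ lookup s i))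
  pop⇓        : ∀ {s i} → ⟨ pop i , s ⟩⇓[ 1 ] (s [ i ]≔ List.drop 1 (lookup s i))
  ⨟⇓          : ∀ {P Q s s′ s″ t u} →
                ⟨ P , s ⟩⇓[ t ] s′ → ⟨ Q , s′ ⟩⇓[ u ] s″ →
                ⟨ P ⨟ Q , s ⟩⇓[ t ℕ.+ u ] s″
  case-empty⇓ : ∀ {P Q R s s′ i t} → lookup s i ≡ [] →
                ⟨ P , s ⟩⇓[ t ] s′ → ⟨ case i P Q R , s ⟩⇓[ suc t ] s′
  case-false⇓ : ∀ {P Q R s s′ i t bs} → lookup s i ≡ false ∷ bs →
                ⟨ Q , s ⟩⇓[ t ] s′ → ⟨ case i P Q R , s ⟩⇓[ suc t ] s′
  case-true⇓  : ∀ {P Q R s s′ i t bs} → lookup s i ≡ true ∷ bs →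
                ⟨ R , s ⟩⇓[ t ] s′ → ⟨ case i P Q R , s ⟩⇓[ suc t ] s′
  while-stop⇓ : ∀ {P s i} → lookup s i ≡ [] → ⟨ while i P , s ⟩⇓[ 1 ] s
  while-step⇓ : ∀ {P s s′ s″ i t u b bs} → lookup s i ≡ b ∷ bs →
                ⟨ P , s ⟩⇓[ t ] s′ → ⟨ while i P , s′ ⟩⇓[ u ] s″ →
                ⟨ while i P , s ⟩⇓[ suc (t ℕ.+ u) ] s″

-- Input and output are on stack zero; the other stacks start empty and
-- may hold anything at the end.
_OnInput_Outputs_Within_ :
  ∀ {k} → Program (suc k) → List Bool → List Bool → ℕ → Set
_OnInput_Outputs_Within_ {k} P input output T =
  ∃[ t ] ∃[ s ] ⟨ P , input Vec.∷ Vec.replicate k [] ⟩⇓[ t ] s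
              × Vec.head s ≡ output
              × t ℕ.≤ T

-- A search problem asks, on each admissible instance, for some solution
-- meeting the specification.
record SearchProblem : Set₁ where
  field
    Instance       : Set
    Solution       : Instance → Set
    encodeInstance : Instance → List Bool
    encodeSolution : ∀ {I} → Solution I → List Bool
    Admissible     : Instance → Set
    Meets          : ∀ I → Solution I → Set

PolynomialTimeAlgorithm : SearchProblem → Set
PolynomialTimeAlgorithm Π =
  ∃[ k ] Σ (Program (suc k)) λ P → ∃[ c ] ∃[ e ]
    ∀ I → Admissible I → ∃[ S ]
      Meets I S ×
      P OnInput encodeInstance I Outputs encodeSolution S
        Within (c ℕ.* length (encodeInstance I) ℕ.^ e ℕ.+ c)
  where open SearchProblem Π

-- The encodings are binary (bijective base 2) and self-delimiting: a true
-- announces a further digit and a false ends the number.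
encodeℕᵇ : ℕᵇ → List Bool
encodeℕᵇ zero     = false ∷ []
encodeℕᵇ 2[1+ n ] = true ∷ false ∷ encodeℕᵇ n
encodeℕᵇ 1+[2 n ] = true ∷ true ∷ encodeℕᵇ n

encodeℕ : ℕ → List Bool
encodeℕ = encodeℕᵇ ∘ fromℕ

encodeℤ : ℤ → List Bool
encodeℤ (+ n)    = false ∷ encodeℕ n
encodeℤ -[1+ n ] = true ∷ encodeℕ n

encodeℚ : ℚ → List Bool
encodeℚ q = encodeℤ (↥ q) ++ encodeℕ (↧ₙ q)

encodeVector : ∀ {A : Set} {n} → (A → List Bool) → Vector A n → List Bool
encodeVector {n = n} enc v = encodeℕ n ++ List.concatMap enc (List.tabulate v)

encodeSubset : ∀ {n} → Subset n → List Bool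
encodeSubset = Vec.toList

-- The geometric data are rational, being input to a machine.
record Point : Set where
  constructor _,_
  field x y : ℚ

open Point
open +-*-Solver using (solve; _:+_; _:*_; _:-_; _:=_)

dist² : Point → Point → ℚ
dist² p q = (x p - x q) * (x p - x q) + (y p - y q) * (y p - y q)

dist²-sym : ∀ p q → dist² p q ≡ dist² q p
dist²-sym p q = solve 4
  (λ a b c d → ((a :- b) :* (a :- b)) :+ ((c :- d) :* (c :- d))
            := ((b :- a) :* (b :- a)) :+ ((d :- c) :* (d :- c)))
  refl (x p) (x q) (y p) (y q)

-- The radius condition is irrelevant so that equal centre and radius
-- give equal disks.
record Disk : Set where
  field
    centre : Point
    radius : ℚ
    .{{radius-positive}} : Positive radius

open Disk

_∈ᵈ_ : Point → Disk → Set
p ∈ᵈ i = dist² p (centre i) ≤ radius i * radius i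

_∈ᵈ?_ : Decidable _∈ᵈ_
p ∈ᵈ? i = dist² p (centre i) ≤? radius i * radius i

encodePoint : Point → List Bool
encodePoint p = encodeℚ (x p) ++ encodeℚ (y p)

encodeDisk : Disk → List Bool
encodeDisk i = encodePoint (centre i) ++ encodeℚ (radius i)

-- The points and the disks each form a set, hence the distinctness
-- conditions; the rational LP below has the same optimum as over the
-- reals because its data are rational.
record DiskMulticover : Set where
  field
    {#P #D}           : ℕ
    point             : Vector Point #P
    points-distinct   : Injective _≡_ _≡_ point
    demand            : Vector ℤ #P
    disk              : Vector Disk #D
    disks-distinct    : Injective _≡_ _≡_ disk
    weight            : Vector ℚ #D
    weight-nonneg     : ∀ i → 0ℚ ≤ weight i

  disksContaining : Fin #P → Subset #D
  disksContaining p = tabulate λ i → does (point p ∈ᵈ? disk i)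

  IsMulticover : Subset #D → Set
  IsMulticover D′ = ∀ p → demand p ℤ.≤ + ∣ D′ ∩ disksContaining p ∣

  Feasible : Set
  Feasible = ∃ IsMulticover

  LPFeasible : Vector ℚ #D → Set
  LPFeasible x =
    (∀ p → demand p / 1 ≤ Σℚ λ i → if does (point p ∈ᵈ? disk i) then x i else 0ℚ)
    × (∀ i → 0ℚ ≤ x i × x i ≤ 1ℚ)

  LPObjective : Vector ℚ #D → ℚ
  LPObjective x = Σℚ λ i → weight i * x i

  encode : List Bool
  encode = encodeVector encodePoint point ++ encodeVector encodeℤ demand
        ++ encodeVector encodeDisk disk   ++ encodeVector encodeℚ weight

LPRelativeDiskMulticover : ℝ → SearchProblem
LPRelativeDiskMulticover α = record
  { Instance       = DiskMulticover
  ; Solution       = Subset ∘ #D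
  ; encodeInstance = encode
  ; encodeSolution = encodeSubset
  ; Admissible     = Feasible
  ; Meets          = λ I D′ → IsMulticover I D′
      × AtMostTimesMin (weightOf (weight I) D′) α (LPFeasible I) (LPObjective I)
  }
  where open DiskMulticover

record Graph (n : ℕ) : Set₁ where
  field
    _~_     : Rel (Fin n) 0ℓ
    _~?_    : Decidable _~_
    ~-irrefl : Irreflexive _≡_ _~_
    ~-sym    : Symmetric _~_

  neighbours : Fin n → Subset n
  neighbours v = tabulate λ u → does (v ~? u)

  IsDominating : ℕ → Subset n → Set
  IsDominating m S = ∀ v → v ∉ S → m ℕ.≤ ∣ S ∩ neighbours v ∣

unitDiskGraph : ∀ {n} → Vector Point n → Graph n
unitDiskGraph pos = record
  { _~_      = λ u v → u ≢ v × dist² (pos u) (pos v) ≤ 1ℚ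
  ; _~?_     = λ u v → ¬? (u Fin.≟ v) ×-dec (dist² (pos u) (pos v) ≤? 1ℚ)
  ; ~-irrefl = λ { u≡v (u≢v , _) → u≢v u≡v }
  ; ~-sym    = λ { {u} {v} (u≢v , d) →
                   (u≢v ∘ sym) , subst (_≤ 1ℚ) (dist²-sym (pos u) (pos v)) d }
  }

record UnitDiskDomination : Set where
  field
    {#V}          : ℕ
    position      : Vector Point #V
    m             : ℕ
    {{m-positive}} : NonZero m
    weight        : Vector ℚ #V
    weight-nonneg : ∀ v → 0ℚ ≤ weight v

  graph : Graph #V
  graph = unitDiskGraph position

  IsMDominating : Subset #V → Set
  IsMDominating = Graph.IsDominating graph m

  encode : List Bool
  encode = encodeVector encodePoint position ++ encodeℕ m
        ++ encodeVector encodeℚ weight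

-- Every instance is feasible, via the full vertex set.
ApproximateUnitDiskDomination : ℝ → SearchProblem
ApproximateUnitDiskDomination β = record
  { Instance       = UnitDiskDomination
  ; Solution       = Subset ∘ #V
  ; encodeInstance = encode
  ; encodeSolution = encodeSubset
  ; Admissible     = λ _ → ⊤
  ; Meets          = λ I S → IsMDominating I S
      × AtMostTimesMin (weightOf (weight I) S) β (IsMDominating I) (weightOf (weight I))
  }
  where open UnitDiskDomination

{-# OPTIONS --safe #-}
-- No exact LP solver is needed, because the hypothesis has slack: on four
-- disks each containing three of four points every multicover costs 2 while
-- the LP costs 4/3, so every rational bound q on α is at least 3/2.
--
-- Let z v u say that u dominates v, and relax m-domination to
--   Σ_{u ∈ N(v)} z v u + m x v ≥ m,   z v u ≤ x u,   z v u + x v ≤ 1.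
-- Guessing the largest weight of an optimal solution, the drift-plus-penalty
-- method averages 0/1 assignments into an almost feasible solution of at most
-- 9/8 times the minimum weight. Vertices with x v ≥ 3/8 are heavy and are
-- taken. On the light neighbours of a light vertex, x sums to at least 9/16 of
-- what the heavy neighbours leave open, so 16/9 x on the light vertices and 1
-- on the heavy ones, made free, is feasible for the LP of the multicover
-- instance with the light vertices as points and a disk around every vertex.
-- Its multicover and the heavy vertices together weigh at most
-- q · 16/9 · 9/8 = 2q times the minimum, because a heavy vertex v contributes
-- w v ≤ 8/3 w v x v ≤ 16q/9 w v x v.
--
-- Points and disks have to be distinct: of coincident light vertices only the
-- first becomes a point, and the disks get different radii so close to 1 that
-- they contain the same points as unit disks.

module Submission where

open import Data.Bool.Base using (Bool; true; false; if_then_else_; not; _∧_; _∨_)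
open import Data.Fin.Base as Fin using (Fin; zero; suc)
import Data.Fin.Properties as Fin
open import Data.Integer.Base as ℤ using (ℤ)
open import Data.List.Base as List using (List; []; _∷_; _++_; length; map; foldr; foldl; _ʳ++_; upTo)
import Data.List.Properties as List
open import Data.Bool.ListAction using (all)
open import Data.Nat.ListAction using (sum)
open import Data.Nat.ListAction.Properties using (sum-++)
open import Data.Maybe.Base using (Maybe; just; nothing; maybe′)
open import Data.Nat.Base
open import Data.Nat.Properties
open import Data.Product.Base using (∃; ∃-syntax; _×_; _,_; proj₁; proj₂)
open import Data.Sum.Base using (_⊎_; inj₁; inj₂)
open import Data.Unit.Base using (⊤; tt)
open import Data.Vec.Base as Vec using (Vec; []; _∷_; lookup; _[_]≔_)
open import Function.Base using (_∘_; id; const)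
open import Relation.Binary.PropositionalEquality
open import Relation.Nullary using (¬_; Dec; yes; no; does; contradiction)
open import Data.Nat.Tactic.RingSolver using (solve-∀)
open import Defs renaming (_,_ to point)
open import Data.Nat.Binary.Base using (ℕᵇ; zero; 2[1+_]; 1+[2_]; toℕ; fromℕ)
import Data.Nat.Binary.Properties as ℕᵇ
open import Data.Rational.Base as ℚ using (ℚ; 0ℚ; 1ℚ; ↥_; ↧ₙ_)
import Data.Vec.Properties as Vec
open import Data.List.Membership.Propositional using (_∈_; find; lose)
open import Data.List.Relation.Unary.Any using (here; there)
import Data.List.Membership.Propositional.Properties as ∈
import Data.Integer.Properties as ℤ
import Data.Rational.Properties as ℚ
import Data.Rational.Unnormalised.Base as ℚᵘ
import Data.Rational.Unnormalised.Properties as ℚᵘ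
import Data.Rational.Solver as ℚ-Solver
open import Data.Nat.Coprimality as Coprime using (Coprime)
open import Relation.Binary.Definitions using (Tri; tri<; tri≈; tri>)
open import Data.Fin.Subset as Subset using (Subset; _∩_; _∪_; ∣_∣)
import Data.Fin.Subset.Properties as Subset
open import Relation.Nullary.Decidable using (¬?; _→-dec_; toWitness)
import Data.List.Relation.Unary.All as All

-- With an exact LP solution one could take the vertices with x at least 1/2 and double the rest,
-- but any relative error in the LP would push the factor beyond 2. The lower threshold lets the
-- light part be scaled by less than 2, which makes room for that error. The price is that a heavy
-- vertex costs more than twice its share, and this is what the slack in the hypothesis pays for.
-- The variables z exist because of the heavy neighbours. If z v u were bounded by x u alone, A
-- heavy neighbours could contribute A, and the light ones would be guaranteed only m (1 - x v) - A.
-- The cap 1 - x v on each contribution raises this to (m - A) (1 - x v), a fixed fraction of the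
-- residual demand m - A. The fraction 9/16 is 1 - 3/8 less 1/16 for the errors in the constraints.
-- Both sides of the theorem speak about stack programs, so whatever the reduction computes has to
-- come with a program and a polynomial bound. Functions on coded trees, closed under composition,
-- case distinction and folds of controlled size, provide this. Loop counters are unary, numbers
-- from the input are lists of digits, and the number of rounds depends on n alone.

-- Programs on selected stacks and their running times

record Frame {k l : ℕ} (ρ : Fin k → Fin l) : Set where
  field
    plug   : Store k → Store l
    lookup-plug : ∀ s i → lookup (plug s) (ρ i) ≡ lookup s i
    update-plug : ∀ s i v → plug s [ ρ i ]≔ v ≡ plug (s [ i ]≔ v)

open Frame public

rename : ∀ {k l} → (Fin k → Fin l) → Program k → Program l
rename ρ skip           = skip
rename ρ (push i b)     = push (ρ i) b
rename ρ (pop i)        = pop (ρ i)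
rename ρ (P ⨟ Q)        = rename ρ P ⨟ rename ρ Q
rename ρ (case i P Q R) = case (ρ i) (rename ρ P) (rename ρ Q) (rename ρ R)
rename ρ (while i P)    = while (ρ i) (rename ρ P)

-- A step reads and writes single stacks, so a program for k stacks runs with the same number of
-- steps on k chosen ones among l, while the others keep whatever `plug` put there. Programs can
-- thus be written for the few stacks that they touch and be placed afterwards.
rename-⇓ : ∀ {k l} {ρ : Fin k → Fin l} (F : Frame ρ) {P s t s′} →
           ⟨ P , s ⟩⇓[ t ] s′ → ⟨ rename ρ P , plug F s ⟩⇓[ t ] plug F s′
rename-⇓ F skip⇓ = skip⇓
rename-⇓ F {push i b} {s} push⇓ = subst (⟨ push _ b , plug F s ⟩⇓[ 1 ]_)
  (trans (cong (λ v → plug F s [ _ ]≔ (b ∷ v)) (lookup-plug F s i)) (update-plug F s i _)) push⇓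
rename-⇓ F {pop i} {s} pop⇓ = subst (⟨ pop _ , plug F s ⟩⇓[ 1 ]_)
  (trans (cong (λ v → plug F s [ _ ]≔ List.drop 1 v) (lookup-plug F s i)) (update-plug F s i _)) pop⇓
rename-⇓ F (⨟⇓ p q) = ⨟⇓ (rename-⇓ F p) (rename-⇓ F q)
rename-⇓ F (case-empty⇓ e p) = case-empty⇓ (trans (lookup-plug F _ _) e) (rename-⇓ F p)
rename-⇓ F (case-false⇓ e p) = case-false⇓ (trans (lookup-plug F _ _) e) (rename-⇓ F p)
rename-⇓ F (case-true⇓ e p) = case-true⇓ (trans (lookup-plug F _ _) e) (rename-⇓ F p)
rename-⇓ F (while-stop⇓ e) = while-stop⇓ (trans (lookup-plug F _ _) e)
rename-⇓ F (while-step⇓ e p q) =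
  while-step⇓ (trans (lookup-plug F _ _) e) (rename-⇓ F p) (rename-⇓ F q)

totalLength : ∀ {k} → Store k → ℕ
totalLength []      = 0
totalLength (x ∷ s) = length x + totalLength s

totalLength-update : ∀ {k} (s : Store k) i v →
  totalLength (s [ i ]≔ v) + length (lookup s i) ≡ totalLength s + length v
totalLength-update (x ∷ s) zero v = swap-ends (length v) (totalLength s) (length x)
  where
  swap-ends : ∀ a b c → a + b + c ≡ c + b + a
  swap-ends = solve-∀
totalLength-update (x ∷ s) (suc i) v = trans (+-assoc (length x) _ _)
  (trans (cong (length x +_) (totalLength-update s i v)) (sym (+-assoc (length x) _ _)))

-- A step adds at most one bit to the store. Hence a time bound is at the same time a bound on the
-- size of the result, and time bounds compose without separate size bounds.
totalLength-growth : ∀ {k} {P : Program k} {s t s′} → ⟨ P , s ⟩⇓[ t ] s′ →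
  totalLength s′ ≤ totalLength s + t
totalLength-growth {s = s} skip⇓ = m≤m+n (totalLength s) 1
totalLength-growth (push⇓ {s} {i} {b}) = +-cancelʳ-≤ (length (lookup s i)) _ _ (≤-reflexive
  (trans (totalLength-update s i (b ∷ lookup s i)) (+-suc-assoc (totalLength s) (length (lookup s i)))))
  where
  +-suc-assoc : ∀ a b → a + suc b ≡ a + 1 + b
  +-suc-assoc = solve-∀
totalLength-growth (pop⇓ {s} {i}) = +-cancelʳ-≤ (length (lookup s i)) _ _ (begin
  totalLength (s [ i ]≔ List.drop 1 (lookup s i)) + length (lookup s i)
    ≡⟨ totalLength-update s i (List.drop 1 (lookup s i)) ⟩
  totalLength s + length (List.drop 1 (lookup s i))
    ≤⟨ +-mono-≤ (m≤m+n (totalLength s) 1) (≤-trans (≤-reflexive (List.length-drop 1 (lookup s i))) (m∸n≤m _ 1)) ⟩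
  totalLength s + 1 + length (lookup s i) ∎)
  where open ≤-Reasoning
totalLength-growth (⨟⇓ {s = s} {t = t} {u} p q) = ≤-trans (totalLength-growth q)
  (≤-trans (+-monoˡ-≤ u (totalLength-growth p)) (≤-reflexive (+-assoc (totalLength s) t u)))
totalLength-growth (case-empty⇓ {s = s} _ p) = ≤-trans (totalLength-growth p) (+-monoʳ-≤ (totalLength s) (n≤1+n _))
totalLength-growth (case-false⇓ {s = s} _ p) = ≤-trans (totalLength-growth p) (+-monoʳ-≤ (totalLength s) (n≤1+n _))
totalLength-growth (case-true⇓ {s = s} _ p) = ≤-trans (totalLength-growth p) (+-monoʳ-≤ (totalLength s) (n≤1+n _))
totalLength-growth {s = s} (while-stop⇓ _) = m≤m+n (totalLength s) 1
totalLength-growth (while-step⇓ {s = s} {t = t} {u} _ p q) = ≤-trans (totalLength-growth q)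
  (≤-trans (+-monoˡ-≤ u (totalLength-growth p))
  (≤-trans (≤-reflexive (+-assoc (totalLength s) t u)) (+-monoʳ-≤ (totalLength s) (n≤1+n _))))

-- An upper bound replaces the exact number of steps because the branches of a `case` take different
-- times.
record Runs {k : ℕ} (P : Program k) (s : Store k) (bound : ℕ) (s′ : Store k) : Set where
  constructor ran
  field
    {time}  : ℕ
    time≤   : time ≤ bound
    halts   : ⟨ P , s ⟩⇓[ time ] s′

exactly : ∀ {k} {P : Program k} {s s′ T} → ⟨ P , s ⟩⇓[ T ] s′ → Runs P s T s′
exactly = ran ≤-refl

module _ {k : ℕ} {s s′ : Store k} {T : ℕ} where

  within : ∀ {P U} → T ≤ U → Runs P s T s′ → Runs P s U s′
  within T≤U (ran t≤T p) = ran (≤-trans t≤T T≤U) p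

  infixr 5 _then_
  _then_ : ∀ {P Q U s″} → Runs P s T s′ → Runs Q s′ U s″ → Runs (P ⨟ Q) s (T + U) s″
  ran t≤T p then ran u≤U q = ran (+-mono-≤ t≤T u≤U) (⨟⇓ p q)

  on-false : ∀ {P Q R i bs} → lookup s i ≡ false ∷ bs → Runs Q s T s′ →
             Runs (case i P Q R) s (suc T) s′
  on-false e (ran t≤T p) = ran (s≤s t≤T) (case-false⇓ e p)

  on-true : ∀ {P Q R i bs} → lookup s i ≡ true ∷ bs → Runs R s T s′ →
            Runs (case i P Q R) s (suc T) s′
  on-true e (ran t≤T p) = ran (s≤s t≤T) (case-true⇓ e p)

  iterate-once : ∀ {P U s″ i b bs} → lookup s i ≡ b ∷ bs → Runs P s T s′ →
                 Runs (while i P) s′ U s″ → Runs (while i P) s (suc (T + U)) s″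
  iterate-once e (ran t≤T p) (ran u≤U q) = ran (s≤s (+-mono-≤ t≤T u≤U)) (while-step⇓ e p q)

rename-runs : ∀ {k l} {ρ : Fin k → Fin l} (F : Frame ρ) {P s T s′} →
              Runs P s T s′ → Runs (rename ρ P) (plug F s) T (plug F s′)
rename-runs F (ran t≤T p) = ran t≤T (rename-⇓ F p)

per-bit : ∀ c n → suc (c + (1 + suc c * n)) ≡ 1 + suc c * suc n
per-bit = solve-∀

move : Program 2
move = while zero (case zero skip (pop zero ⨟ push (suc zero) false)
                                  (pop zero ⨟ push (suc zero) true))

move-runs : ∀ x y → Runs move (x ∷ y ∷ []) (1 + 4 * length x) ([] ∷ (x ʳ++ y) ∷ [])
move-runs [] y = exactly (while-stop⇓ refl)
move-runs (false ∷ x) y = within (≤-reflexive (per-bit 3 (length x)))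
  (iterate-once refl (on-false refl (exactly pop⇓ then exactly push⇓)) (move-runs x (false ∷ y)))
move-runs (true ∷ x) y = within (≤-reflexive (per-bit 3 (length x)))
  (iterate-once refl (on-true refl (exactly pop⇓ then exactly push⇓)) (move-runs x (true ∷ y)))

moveBoth : Program 3
moveBoth = while zero (case zero skip
  (pop zero ⨟ push (suc zero) false ⨟ push (suc (suc zero)) false)
  (pop zero ⨟ push (suc zero) true ⨟ push (suc (suc zero)) true))

moveBoth-runs : ∀ x y z → Runs moveBoth (x ∷ y ∷ z ∷ []) (1 + 5 * length x)
                                        ([] ∷ (x ʳ++ y) ∷ (x ʳ++ z) ∷ [])
moveBoth-runs [] y z = exactly (while-stop⇓ refl)
moveBoth-runs (false ∷ x) y z = within (≤-reflexive (per-bit 4 (length x)))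
  (iterate-once refl (on-false refl (exactly pop⇓ then exactly push⇓ then exactly push⇓))
    (moveBoth-runs x (false ∷ y) (false ∷ z)))
moveBoth-runs (true ∷ x) y z = within (≤-reflexive (per-bit 4 (length x)))
  (iterate-once refl (on-true refl (exactly pop⇓ then exactly push⇓ then exactly push⇓))
    (moveBoth-runs x (true ∷ y) (true ∷ z)))

clear : Program 1
clear = while zero (pop zero)

clear-runs : ∀ x → Runs clear (x ∷ []) (1 + 2 * length x) ([] ∷ [])
clear-runs [] = exactly (while-stop⇓ refl)
clear-runs (b ∷ x) = within (≤-reflexive (per-bit 1 (length x)))
  (iterate-once refl (exactly pop⇓) (clear-runs x))

-- Trees and their codes on a stack

data Tree : Set where
  leaf : Tree
  node : Tree → Tree → Tree

-- Preorder with one bit per node is self-delimiting: a tree can be taken off the top of a stack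
-- without any mark between it and the data below.
code : Tree → List Bool
code leaf       = false ∷ []
code (node l r) = true ∷ code l ++ code r

size : Tree → ℕ
size leaf       = 1
size (node l r) = suc (size l + size r)

length-code : ∀ t → length (code t) ≡ size t
length-code leaf       = refl
length-code (node l r) = cong suc (trans (List.length-++ (code l)) (cong₂ _+_ (length-code l) (length-code r)))

length-reversed : ∀ t → length (code t ʳ++ []) ≡ size t
length-reversed t = trans (List.length-ʳ++ (code t)) (trans (+-identityʳ _) (length-code t))

-- The third stack counts the subtrees still to be read.
pullLoop : Program 3
pullLoop = while (suc (suc zero)) (case zero skip
  (pop zero ⨟ push (suc zero) false ⨟ pop (suc (suc zero)))
  (pop zero ⨟ push (suc zero) true ⨟ push (suc (suc zero)) true))

pull-leaf : ∀ a → suc (4 + a) ≡ a + 5 * 1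
pull-leaf = solve-∀

pull-node : ∀ a b c → suc (4 + (a + 5 * c + 5 * b)) ≡ a + 5 * suc (b + c)
pull-node = solve-∀

-- The statement extends an arbitrary remaining run of the loop. The two subtrees of a node are read
-- by consecutive iterations of one and the same loop, so an induction over trees cannot treat them
-- as separate complete runs.
pullLoop-runs : ∀ t {x y n T s′} →
  Runs pullLoop (x ∷ (code t ʳ++ y) ∷ n ∷ []) T s′ →
  Runs pullLoop ((code t ++ x) ∷ y ∷ (true ∷ n) ∷ []) (T + 5 * size t) s′
pullLoop-runs leaf {T = T} p = within (≤-reflexive (pull-leaf T))
  (iterate-once refl (on-false refl (exactly pop⇓ then exactly push⇓ then exactly pop⇓)) p)
pullLoop-runs (node l r) {x} {y} {n} {T} {s′} p =
  within (≤-reflexive (pull-node T (size l) (size r)))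
  (iterate-once refl (on-true refl (exactly pop⇓ then exactly push⇓ then exactly push⇓))
    (subst (λ z → Runs pullLoop (z ∷ (true ∷ y) ∷ (true ∷ true ∷ n) ∷ []) (T + 5 * size r + 5 * size l) s′)
      (sym (List.++-assoc (code l) (code r) x))
      (pullLoop-runs l (pullLoop-runs r
        (subst (λ z → Runs pullLoop (x ∷ z ∷ n ∷ []) T s′)
          (List.++-ʳ++ (code l)) p)))))

pull : Program 3
pull = push (suc (suc zero)) true ⨟ pullLoop

pull-runs : ∀ t x y → Runs pull ((code t ++ x) ∷ y ∷ [] ∷ []) (2 + 5 * size t)
                                (x ∷ (code t ʳ++ y) ∷ [] ∷ [])
pull-runs t x y = exactly push⇓ then pullLoop-runs t (exactly (while-stop⇓ refl))

open Runs public

-- Polynomial bounds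

infixl 6 _⊕_
infixl 7 _⊗_

-- Natural coefficients without subtraction make every polynomial monotone, so that a bound on a
-- size may be substituted into a bound on a time.
data Polynomial : Set where
  constant : ℕ → Polynomial
  var      : Polynomial
  _⊕_ _⊗_  : Polynomial → Polynomial → Polynomial

eval : Polynomial → ℕ → ℕ
eval (constant c) n = c
eval var          n = n
eval (p ⊕ q)      n = eval p n + eval q n
eval (p ⊗ q)      n = eval p n * eval q n

eval-mono : ∀ p {m n} → m ≤ n → eval p m ≤ eval p n
eval-mono (constant c) _   = ≤-refl
eval-mono var          m≤n = m≤n
eval-mono (p ⊕ q)      m≤n = +-mono-≤ (eval-mono p m≤n) (eval-mono q m≤n)
eval-mono (p ⊗ q)      m≤n = *-mono-≤ (eval-mono p m≤n) (eval-mono q m≤n)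

infixr 9 _⊚_
_⊚_ : Polynomial → Polynomial → Polynomial
constant c ⊚ q = constant c
var        ⊚ q = q
(p ⊕ p′)   ⊚ q = (p ⊚ q) ⊕ (p′ ⊚ q)
(p ⊗ p′)   ⊚ q = (p ⊚ q) ⊗ (p′ ⊚ q)

eval-⊚ : ∀ p q n → eval (p ⊚ q) n ≡ eval p (eval q n)
eval-⊚ (constant c) q n = refl
eval-⊚ var          q n = refl
eval-⊚ (p ⊕ p′)     q n = cong₂ _+_ (eval-⊚ p q n) (eval-⊚ p′ q n)
eval-⊚ (p ⊗ p′)     q n = cong₂ _*_ (eval-⊚ p q n) (eval-⊚ p′ q n)

-- The base is `suc n`, not `n`, because raising the exponent must not decrease the power, not even
-- at n = 0.
monomial-bound : ∀ p → ∃[ c ] ∃[ e ] ∀ n → eval p n ≤ c * suc n ^ e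
monomial-bound (constant c) = c , 0 , λ n → ≤-reflexive (sym (*-identityʳ c))
monomial-bound var = 1 , 1 , λ n → ≤-trans (n≤1+n n) (≤-reflexive
  (sym (trans (*-identityˡ _) (*-identityʳ (suc n)))))
monomial-bound (p ⊕ q) with monomial-bound p | monomial-bound q
... | c , e , P | d , f , Q = c + d , e + f , λ n → begin
  eval p n + eval q n               ≤⟨ +-mono-≤ (P n) (Q n) ⟩
  c * suc n ^ e + d * suc n ^ f
    ≤⟨ +-mono-≤ (*-monoʳ-≤ c (^-monoʳ-≤ (suc n) (m≤m+n e f)))
                (*-monoʳ-≤ d (^-monoʳ-≤ (suc n) (m≤n+m f e))) ⟩
  c * suc n ^ (e + f) + d * suc n ^ (e + f)
    ≡⟨ *-distribʳ-+ (suc n ^ (e + f)) c d ⟨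
  (c + d) * suc n ^ (e + f)         ∎
  where open ≤-Reasoning
monomial-bound (p ⊗ q) with monomial-bound p | monomial-bound q
... | c , e , P | d , f , Q = c * d , e + f , λ n → begin
  eval p n * eval q n                 ≤⟨ *-mono-≤ (P n) (Q n) ⟩
  c * suc n ^ e * (d * suc n ^ f)     ≡⟨ exchange c (suc n ^ e) d (suc n ^ f) ⟩
  c * d * (suc n ^ e * suc n ^ f)     ≡⟨ cong (c * d *_) (^-distribˡ-+-* (suc n) e f) ⟨
  c * d * suc n ^ (e + f)             ∎
  where
  open ≤-Reasoning
  exchange : ∀ a b c d → a * b * (c * d) ≡ a * c * (b * d)
  exchange = solve-∀

^-distribʳ-* : ∀ a b e → (a * b) ^ e ≡ a ^ e * b ^ e
^-distribʳ-* a b zero    = refl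
^-distribʳ-* a b (suc e) = trans (cong (a * b *_) (^-distribʳ-* a b e)) (exchange a b (a ^ e) (b ^ e))
  where
  exchange : ∀ a b c d → a * b * (c * d) ≡ a * c * (b * d)
  exchange = solve-∀

-- For positive n the base `suc n` is at most 2 n, which costs the factor 2 ^ e; the additive
-- constant takes care of n = 0.
eval-bound : ∀ p → ∃[ c ] ∃[ e ] ∀ n → eval p n ≤ c * n ^ e + c
eval-bound p with monomial-bound p
... | c , e , P = c * 2 ^ e , e , λ n → ≤-trans (P n) (below n)
  where
  open ≤-Reasoning
  below : ∀ n → c * suc n ^ e ≤ c * 2 ^ e * n ^ e + c * 2 ^ e
  below zero = ≤-trans (*-monoʳ-≤ c (^-monoˡ-≤ e {1} {2} (s≤s z≤n))) (m≤n+m _ _)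
  below n@(suc k) = begin
    c * suc n ^ e           ≤⟨ *-monoʳ-≤ c (^-monoˡ-≤ e
      (≤-trans (+-monoˡ-≤ n (s≤s (z≤n {k}))) (≤-reflexive (cong (n +_) (sym (+-identityʳ n)))))) ⟩
    c * (2 * n) ^ e         ≡⟨ cong (c *_) (^-distribʳ-* 2 n e) ⟩
    c * (2 ^ e * n ^ e)     ≡⟨ *-assoc c (2 ^ e) (n ^ e) ⟨
    c * 2 ^ e * n ^ e       ≤⟨ m≤m+n _ _ ⟩
    c * 2 ^ e * n ^ e + c * 2 ^ e ∎

-- Scratch stacks are listed after the data stack 0 and are empty
-- between operations.
pattern #b = suc zero
pattern #c = suc (suc zero)
pattern #d = suc (suc (suc zero))

pair-to : Fin 4 → Fin 4 → Fin 2 → Fin 4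
pair-to i j zero = i
pair-to i j #b   = j

b⇒a : ∀ c d → Frame (pair-to #b zero)
b⇒a c d = record
  { plug = λ { (y ∷ x ∷ []) → x ∷ y ∷ c ∷ d ∷ [] }
  ; lookup-plug = λ { (_ ∷ _ ∷ []) zero → refl ; (_ ∷ _ ∷ []) #b → refl }
  ; update-plug = λ { (_ ∷ _ ∷ []) zero _ → refl ; (_ ∷ _ ∷ []) #b _ → refl } }

d⇒a : ∀ b c → Frame (pair-to #d zero)
d⇒a b c = record
  { plug = λ { (y ∷ x ∷ []) → x ∷ b ∷ c ∷ y ∷ [] }
  ; lookup-plug = λ { (_ ∷ _ ∷ []) zero → refl ; (_ ∷ _ ∷ []) #b → refl }
  ; update-plug = λ { (_ ∷ _ ∷ []) zero _ → refl ; (_ ∷ _ ∷ []) #b _ → refl } }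

d⇒b : ∀ a c → Frame (pair-to #d #b)
d⇒b a c = record
  { plug = λ { (y ∷ x ∷ []) → a ∷ x ∷ c ∷ y ∷ [] }
  ; lookup-plug = λ { (_ ∷ _ ∷ []) zero → refl ; (_ ∷ _ ∷ []) #b → refl }
  ; update-plug = λ { (_ ∷ _ ∷ []) zero _ → refl ; (_ ∷ _ ∷ []) #b _ → refl } }

triple-to : Fin 4 → Fin 4 → Fin 4 → Fin 3 → Fin 4
triple-to i j k zero = i
triple-to i j k #b   = j
triple-to i j k #c   = k

abc : ∀ d → Frame (triple-to zero #b #c)
abc d = record
  { plug = λ { (x ∷ y ∷ z ∷ []) → x ∷ y ∷ z ∷ d ∷ [] }
  ; lookup-plug = λ { (_ ∷ _ ∷ _ ∷ []) zero → refl ; (_ ∷ _ ∷ _ ∷ []) #b → refl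
                    ; (_ ∷ _ ∷ _ ∷ []) #c → refl }
  ; update-plug = λ { (_ ∷ _ ∷ _ ∷ []) zero _ → refl ; (_ ∷ _ ∷ _ ∷ []) #b _ → refl
                    ; (_ ∷ _ ∷ _ ∷ []) #c _ → refl } }

adc : ∀ b → Frame (triple-to zero #d #c)
adc b = record
  { plug = λ { (x ∷ y ∷ z ∷ []) → x ∷ b ∷ z ∷ y ∷ [] }
  ; lookup-plug = λ { (_ ∷ _ ∷ _ ∷ []) zero → refl ; (_ ∷ _ ∷ _ ∷ []) #b → refl
                    ; (_ ∷ _ ∷ _ ∷ []) #c → refl }
  ; update-plug = λ { (_ ∷ _ ∷ _ ∷ []) zero _ → refl ; (_ ∷ _ ∷ _ ∷ []) #b _ → refl
                    ; (_ ∷ _ ∷ _ ∷ []) #c _ → refl } }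

bad : ∀ c → Frame (triple-to #b zero #d)
bad c = record
  { plug = λ { (x ∷ y ∷ z ∷ []) → y ∷ x ∷ c ∷ z ∷ [] }
  ; lookup-plug = λ { (_ ∷ _ ∷ _ ∷ []) zero → refl ; (_ ∷ _ ∷ _ ∷ []) #b → refl
                    ; (_ ∷ _ ∷ _ ∷ []) #c → refl }
  ; update-plug = λ { (_ ∷ _ ∷ _ ∷ []) zero _ → refl ; (_ ∷ _ ∷ _ ∷ []) #b _ → refl
                    ; (_ ∷ _ ∷ _ ∷ []) #c _ → refl } }

b-only : ∀ a c d → Frame {1} {4} (λ _ → #b)
b-only a c d = record
  { plug = λ { (x ∷ []) → a ∷ x ∷ c ∷ d ∷ [] }
  ; lookup-plug = λ { (_ ∷ []) zero → refl }
  ; update-plug = λ { (_ ∷ []) zero _ → refl } }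

replace-target : ∀ {k} {P : Program k} {s T U} {x y : Store k} →
                 x ≡ y → T ≡ U → Runs P s T x → Runs P s U y
replace-target refl refl p = p

restore-runs : ∀ {ρ : Fin 2 → Fin 4} (F : Frame ρ) t x →
  Runs (rename ρ move) (plug F ((code t ʳ++ []) ∷ x ∷ [])) (1 + 4 * size t)
       (plug F ([] ∷ (code t ++ x) ∷ []))
restore-runs F t x = replace-target
  (cong (λ z → plug F ([] ∷ z ∷ [])) (List.ʳ++-ʳ++ (code t)))
  (cong (λ z → 1 + 4 * z) (length-reversed t))
  (rename-runs F (move-runs (code t ʳ++ []) x))

-- Dropping, swapping and duplicating trees

drop-program : Program 4
drop-program = rename (triple-to zero #b #c) pull ⨟ rename (λ _ → #b) clear

drop-runs : ∀ t x → Runs drop-program ((code t ++ x) ∷ [] ∷ [] ∷ [] ∷ []) (3 + 7 * size t)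
                                      (x ∷ [] ∷ [] ∷ [] ∷ [])
drop-runs t x = within (≤-reflexive (time-eq (size t)))
  (rename-runs (abc []) (pull-runs t x []) then replace-target refl
    (cong (λ z → 1 + 2 * z) (length-reversed t))
    (rename-runs (b-only x [] []) (clear-runs (code t ʳ++ []))))
  where
  time-eq : ∀ n → 2 + 5 * n + (1 + 2 * n) ≡ 3 + 7 * n
  time-eq = solve-∀

swap-program : Program 4
swap-program = rename (triple-to zero #b #c) pull ⨟ rename (triple-to zero #d #c) pull
             ⨟ rename (pair-to #b zero) move ⨟ rename (pair-to #d zero) move

swap-runs : ∀ s t x → Runs swap-program ((code s ++ code t ++ x) ∷ [] ∷ [] ∷ [] ∷ [])
  (6 + 9 * (size s + size t)) ((code t ++ code s ++ x) ∷ [] ∷ [] ∷ [] ∷ [])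
swap-runs s t x = within (≤-reflexive (time-eq (size s) (size t)))
  (rename-runs (abc []) (pull-runs s (code t ++ x) [])
    then rename-runs (adc (code s ʳ++ [])) (pull-runs t x [])
    then restore-runs (b⇒a [] (code t ʳ++ [])) s x
    then restore-runs (d⇒a [] []) t (code s ++ x))
  where
  time-eq : ∀ m n → 2 + 5 * m + (2 + 5 * n + (1 + 4 * m + (1 + 4 * n))) ≡ 6 + 9 * (m + n)
  time-eq = solve-∀

dup-program : Program 4
dup-program = rename (triple-to zero #b #c) pull ⨟ rename (triple-to #b zero #d) moveBoth
            ⨟ rename (pair-to #d #b) move ⨟ rename (pair-to #b zero) move

dup-runs : ∀ t x → Runs dup-program ((code t ++ x) ∷ [] ∷ [] ∷ [] ∷ []) (5 + 18 * size t)
                                    ((code t ++ code t ++ x) ∷ [] ∷ [] ∷ [] ∷ [])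
dup-runs t x = within (≤-reflexive (time-eq (size t)))
  (rename-runs (abc []) (pull-runs t x [])
    then replace-target
      (cong₂ (λ y z → y ∷ [] ∷ [] ∷ z ∷ []) (List.ʳ++-ʳ++ (code t))
        (trans (List.ʳ++-ʳ++ (code t)) (List.++-identityʳ (code t))))
      (cong (λ z → 1 + 5 * z) (length-reversed t))
      (rename-runs (bad []) (moveBoth-runs (code t ʳ++ []) x []))
    then rename-runs (d⇒b (code t ++ x) []) (replace-target refl (cong (λ z → 1 + 4 * z) (length-code t)) (move-runs (code t) []))
    then restore-runs (b⇒a [] []) t (code t ++ x))
  where
  time-eq : ∀ n → 2 + 5 * n + (1 + 5 * n + (1 + 4 * n + (1 + 4 * n))) ≡ 5 + 18 * n
  time-eq = solve-∀

under : ∀ {k} → List Bool → Frame {k} suc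
under x = record { plug = x ∷_ ; lookup-plug = λ _ _ → refl ; update-plug = λ _ _ _ → refl }

beneath : ∀ d {k} → Frame {k} (d Fin.↑ʳ_)
beneath zero    = record { plug = id ; lookup-plug = λ _ _ → refl ; update-plug = λ _ _ _ → refl }
beneath (suc d) = record
  { plug        = λ s → [] ∷ plug (beneath d) s
  ; lookup-plug = λ s i → lookup-plug (beneath d) s i
  ; update-plug = λ s i v → cong ([] ∷_) (update-plug (beneath d) s i v) }

-- The `d` stacks in front are reserved for the control bits of nested loops, one for each level of
-- nesting, and are empty between operations.
dataStore : ∀ d → List Bool → Store (d + 4)
dataStore d x = plug (beneath d) (x ∷ [] ∷ [] ∷ [] ∷ [])

totalLength-dataStore : ∀ d x → totalLength (dataStore d x) ≡ length x
totalLength-dataStore zero x = +-identityʳ _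
totalLength-dataStore (suc d) x = totalLength-dataStore d x

deepen : ∀ {d e} → d ≤′ e → Program (d + 4) → Program (e + 4)
deepen ≤′-refl       P = P
deepen (≤′-step d≤e) P = rename suc (deepen d≤e P)

deepen-runs : ∀ {d e} (d≤e : d ≤′ e) {P x T y} → Runs P (dataStore d x) T (dataStore d y) →
              Runs (deepen d≤e P) (dataStore e x) T (dataStore e y)
deepen-runs ≤′-refl       p = p
deepen-runs (≤′-step d≤e) p = rename-runs (under []) (deepen-runs d≤e p)

-- Polynomial-time functions

record Coding (A : Set) : Set where
  field ⌜_⌝ : A → Tree

open Coding {{...}} public

∥_∥ : ∀ {A} {{_ : Coding A}} → A → ℕ
∥ a ∥ = size ⌜ a ⌝

instance
  coding-Tree : Coding Tree
  coding-Tree = record { ⌜_⌝ = id }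

  coding-⊤ : Coding ⊤
  coding-⊤ = record { ⌜_⌝ = const leaf }

  coding-Bool : Coding Bool
  coding-Bool = record { ⌜_⌝ = λ b → if b then node leaf leaf else leaf }

  -- Unary, so that a number can drive a loop and its size is linear in its value. Numbers that may
  -- be exponential in the length of the input are kept as lists of digits instead.
  coding-ℕ : Coding ℕ
  coding-ℕ = record { ⌜_⌝ = unary }
    where
    unary : ℕ → Tree
    unary zero    = leaf
    unary (suc n) = node leaf (unary n)

  coding-× : ∀ {A B} {{_ : Coding A}} {{_ : Coding B}} → Coding (A × B)
  coding-× = record { ⌜_⌝ = λ (a , b) → node ⌜ a ⌝ ⌜ b ⌝ }

  coding-List : ∀ {A} {{_ : Coding A}} → Coding (List A)
  coding-List {A} = record { ⌜_⌝ = spine }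
    where
    spine : List A → Tree
    spine []       = leaf
    spine (x ∷ xs) = node ⌜ x ⌝ (spine xs)

-- The arbitrary `rest` below the argument is what makes these programs usable as subroutines: other
-- values may wait further down on the same stack.
record Poly {A B : Set} {{_ : Coding A}} {{_ : Coding B}} (f : A → B) : Set where
  field
    {depth} : ℕ
    program : Program (depth + 4)
    bound   : Polynomial
    runs    : ∀ a rest → Runs program (dataStore depth (code ⌜ a ⌝ ++ rest)) (eval bound ∥ a ∥)
                                      (dataStore depth (code ⌜ f a ⌝ ++ rest))

  growth : Polynomial
  growth = var ⊕ bound

  size-bound : ∀ a → ∥ f a ∥ ≤ eval growth ∥ a ∥
  size-bound a = begin
    ∥ f a ∥                                          ≡⟨ length-[] (f a) ⟨
    length (code ⌜ f a ⌝ ++ [])                      ≡⟨ totalLength-dataStore depth _ ⟨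
    totalLength (dataStore depth (code ⌜ f a ⌝ ++ [])) ≤⟨ totalLength-growth (halts (runs a [])) ⟩
    totalLength (dataStore depth (code ⌜ a ⌝ ++ [])) + time (runs a [])
      ≤⟨ +-mono-≤ (≤-reflexive (trans (totalLength-dataStore depth _) (length-[] a))) (time≤ (runs a [])) ⟩
    eval growth ∥ a ∥                                ∎
    where
    open ≤-Reasoning
    length-[] : ∀ {C} {{_ : Coding C}} (c : C) → length (code ⌜ c ⌝ ++ []) ≡ ∥ c ∥
    length-[] c = trans (cong length (List.++-identityʳ (code ⌜ c ⌝))) (length-code ⌜ c ⌝)

open Poly public

atDepth : ∀ e → Program 4 → Program (e + 4)
atDepth e = rename (e Fin.↑ʳ_)

atDepth-runs : ∀ e {P x y T} → Runs P (x ∷ [] ∷ [] ∷ [] ∷ []) T (y ∷ [] ∷ [] ∷ [] ∷ []) →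
               Runs (atDepth e P) (dataStore e x) T (dataStore e y)
atDepth-runs e = rename-runs (beneath e)

push-a : Bool → Program 4
push-a = push zero

pop-a : Program 4
pop-a = pop zero

lookup-dataStore : ∀ e x → lookup (dataStore e x) (e Fin.↑ʳ zero) ≡ x
lookup-dataStore e x = lookup-plug (beneath e) (x ∷ [] ∷ [] ∷ [] ∷ []) zero

module _ {A : Set} {{_ : Coding A}} where

  abstract

    -- A program sees codes only. Types whose values share their codes therefore share programs, and
    -- cons, pairing and successor are all the formation of a node.
    recode : ∀ {B C} {{_ : Coding B}} {{_ : Coding C}} {f : A → B} {g : A → C} →
             (∀ a → ⌜ f a ⌝ ≡ ⌜ g a ⌝) → Poly f → Poly g
    recode eq p = record
      { program = program p ; bound = bound p
      ; runs = λ a rest → subst (λ t → Runs _ _ _ (dataStore (depth p) (code t ++ rest))) (eq a) (runs p a rest) }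

  extensional : ∀ {B} {{_ : Coding B}} {f g : A → B} → (∀ a → f a ≡ g a) → Poly f → Poly g
  extensional eq = recode (λ a → cong ⌜_⌝ (eq a))

  abstract

    idᴾ : Poly (λ (a : A) → a)
    idᴾ = record { depth = 0 ; program = skip ; bound = constant 1 ; runs = λ a rest → exactly skip⇓ }

  runs-at : ∀ {B} {{_ : Coding B}} {f : A → B} (p : Poly f) {e} (d≤e : depth p ≤′ e) a rest →
            Runs (deepen d≤e (program p)) (dataStore e (code ⌜ a ⌝ ++ rest)) (eval (bound p) ∥ a ∥)
                 (dataStore e (code ⌜ f a ⌝ ++ rest))
  runs-at p d≤e a rest = deepen-runs d≤e (runs p a rest)

≤ˡ : ∀ m n → m ≤′ m ⊔ n
≤ˡ m n = ≤⇒≤′ (m≤m⊔n m n)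

≤ʳ : ∀ m n → n ≤′ m ⊔ n
≤ʳ m n = ≤⇒≤′ (m≤n⊔m m n)

abstract

  infixr 9 _∘ᴾ_
  _∘ᴾ_ : ∀ {A B C} {{_ : Coding A}} {{_ : Coding B}} {{_ : Coding C}} {g : B → C} {f : A → B} →
         Poly g → Poly f → Poly (λ a → g (f a))
  _∘ᴾ_ {f = f} q p = record
    { depth   = depth p ⊔ depth q
    ; program = deepen (≤ˡ _ _) (program p) ⨟ deepen (≤ʳ (depth p) _) (program q)
    ; bound   = bound p ⊕ (bound q ⊚ growth p)
    ; runs    = λ a rest → runs-at p (≤ˡ _ _) a rest
        then within (≤-trans (eval-mono (bound q) (size-bound p a))
                             (≤-reflexive (sym (eval-⊚ (bound q) (growth p) _))))
                    (runs-at q (≤ʳ (depth p) _) (f a) rest)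
    }

size-left : ∀ l r → size l ≤ size (node l r)
size-left l r = ≤-trans (m≤m+n _ (size r)) (n≤1+n _)

size-right : ∀ l r → size r ≤ size (node l r)
size-right l r = ≤-trans (m≤n+m _ (size l)) (n≤1+n _)

size-both : ∀ l r → size l + size r ≤ size (node l r)
size-both l r = n≤1+n _

fst-program snd-program : Program 4
fst-program = pop-a ⨟ swap-program ⨟ drop-program
snd-program = pop-a ⨟ drop-program

push-code : List Bool → Program 4
push-code []       = skip
push-code (b ∷ bs) = push-code bs ⨟ push-a b

push-code-runs : ∀ bs x → Runs (push-code bs) (x ∷ [] ∷ [] ∷ [] ∷ []) (1 + length bs)
                                              ((bs ++ x) ∷ [] ∷ [] ∷ [] ∷ [])
push-code-runs []       x = exactly skip⇓
push-code-runs (b ∷ bs) x = within (≤-reflexive (+-comm _ 1)) (push-code-runs bs x then exactly push⇓)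

module _ {A B : Set} {{_ : Coding A}} {{_ : Coding B}} where

  abstract

    constᴾ : (b : B) → Poly (λ (_ : A) → b)
    constᴾ b = record
      { depth   = 0
      ; program = drop-program ⨟ push-code (code ⌜ b ⌝)
      ; bound   = constant 3 ⊕ constant 7 ⊗ var ⊕ constant (1 + ∥ b ∥)
      ; runs    = λ a rest → drop-runs ⌜ a ⌝ rest then
          within (≤-reflexive (cong suc (length-code ⌜ b ⌝))) (push-code-runs (code ⌜ b ⌝) rest)
      }

    nodeᴾ : ∀ {C} {{_ : Coding C}} {f : A → B} {g : A → C} →
            Poly f → Poly g → Poly (λ a → node ⌜ f a ⌝ ⌜ g a ⌝)
    nodeᴾ {f = f} {g} p q = record
      { depth   = e
      ; program = atDepth e dup-program ⨟ deepen (≤ˡ _ _) (program p) ⨟ atDepth e swap-program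
                ⨟ deepen (≤ʳ (depth p) _) (program q) ⨟ atDepth e swap-program ⨟ atDepth e (push-a true)
      ; bound   = (constant 5 ⊕ constant 18 ⊗ var)
                ⊕ (bound p ⊕ (constant 6 ⊕ constant 9 ⊗ (growth p ⊕ var)
                ⊕ (bound q ⊕ ((constant 6 ⊕ constant 9 ⊗ (growth q ⊕ growth p)) ⊕ constant 1))))
      ; runs    = λ a rest →
          atDepth-runs e (dup-runs ⌜ a ⌝ rest)
          then runs-at p (≤ˡ _ _) a (code ⌜ a ⌝ ++ rest)
          then (within (+-monoˡ-≤ _ (+-monoʳ-≤ 6 (*-monoʳ-≤ 9 (+-monoˡ-≤ ∥ a ∥ (size-bound p a)))))
            (atDepth-runs e (swap-runs ⌜ f a ⌝ ⌜ a ⌝ rest)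
          then runs-at q (≤ʳ (depth p) _) a (code ⌜ f a ⌝ ++ rest)
          then within (+-monoʳ-≤ 6 (*-monoʳ-≤ 9 (+-mono-≤ (size-bound q a) (size-bound p a))))
            (atDepth-runs e (swap-runs ⌜ g a ⌝ ⌜ f a ⌝ rest))
          then subst (λ z → Runs (atDepth e (push-a true)) (dataStore e (code ⌜ f a ⌝ ++ code ⌜ g a ⌝ ++ rest)) 1
                                 (dataStore e (true ∷ z)))
                 (sym (List.++-assoc (code ⌜ f a ⌝) _ rest)) (atDepth-runs e (exactly push⇓))))
      }
      where
      e : ℕ
      e = depth p ⊔ depth q

    fstᴾ : Poly (proj₁ {A = A} {B = λ _ → B})
    fstᴾ = record
      { depth = 0 ; program = fst-program ; bound = constant 1 ⊕ ((constant 6 ⊕ constant 9 ⊗ var) ⊕ (constant 3 ⊕ constant 7 ⊗ var))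
      ; runs = λ (a , b) rest →
          exactly pop⇓ then (subst (λ z → Runs (swap-program ⨟ drop-program) (z ∷ [] ∷ [] ∷ [] ∷ []) _ _)
            (sym (List.++-assoc (code ⌜ a ⌝) _ rest))
            (within (+-monoʳ-≤ 6 (*-monoʳ-≤ 9 (size-both ⌜ a ⌝ ⌜ b ⌝))) (swap-runs ⌜ a ⌝ ⌜ b ⌝ rest)
            then within (+-monoʳ-≤ 3 (*-monoʳ-≤ 7 (size-right ⌜ a ⌝ ⌜ b ⌝))) (drop-runs ⌜ b ⌝ (code ⌜ a ⌝ ++ rest)))) }

    sndᴾ : Poly (proj₂ {A = A} {B = λ _ → B})
    sndᴾ = record
      { depth = 0 ; program = snd-program ; bound = constant 1 ⊕ (constant 3 ⊕ constant 7 ⊗ var)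
      ; runs = λ (a , b) rest →
          exactly pop⇓ then (subst (λ z → Runs drop-program (z ∷ [] ∷ [] ∷ [] ∷ []) _ _)
            (sym (List.++-assoc (code ⌜ a ⌝) _ rest))
            (within (+-monoʳ-≤ 3 (*-monoʳ-≤ 7 (size-left ⌜ a ⌝ ⌜ b ⌝))) (drop-runs ⌜ a ⌝ (code ⌜ b ⌝ ++ rest)))) }

instance
  -- No tag is spent on `just`: absence is a leaf and a pair is a node. Lists, unary numbers and
  -- Booleans have codes of the same shape, so that one case distinction serves them all.
  coding-Maybe-× : ∀ {A B} {{_ : Coding A}} {{_ : Coding B}} → Coding (Maybe (A × B))
  coding-Maybe-× = record { ⌜_⌝ = maybe′ ⌜_⌝ leaf }

module _ {Γ B L R : Set} {{_ : Coding Γ}} {{_ : Coding B}} {{_ : Coding L}} {{_ : Coding R}} where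

  abstract

    maybeᴾ : {s : Γ → Maybe (L × R)} {F : Γ → B} {G : Γ × L × R → B} →
             Poly s → Poly F → Poly G →
             Poly (λ γ → maybe′ (λ lr → G (γ , lr)) (F γ) (s γ))
    maybeᴾ {s} {F} {G} sᴾ Fᴾ Gᴾ = record
      { program = deepen p≤ (program p) ⨟ atDepth e pop-a ⨟ branch
      ; bound   = bound p ⊕ (constant 1 ⊕ (constant 1 ⊕ ((constant 1 ⊕ bound Fᴾ)
                ⊕ ((constant 6 ⊕ constant 9 ⊗ growth p) ⊕ (constant 1 ⊕ (bound Gᴾ ⊚ growth p))))))
      ; runs    = λ γ rest →
          runs-at p p≤ γ rest
          then atDepth-runs e (exactly pop⇓)
          then subst (λ z → Runs branch (dataStore e z) _ (dataStore e (result γ ++ rest)))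
                 (sym (List.++-assoc (code ⌜ s γ ⌝) _ rest)) (branch-runs (s γ) γ rest (size-bound p γ))
      }
      where
      p : Poly (λ γ → node ⌜ s γ ⌝ ⌜ γ ⌝)
      p = nodeᴾ sᴾ idᴾ
      e : ℕ
      e = depth p ⊔ (depth Fᴾ ⊔ depth Gᴾ)
      p≤ : depth p ≤′ e
      p≤ = ≤ˡ _ _
      F≤ : depth Fᴾ ≤′ e
      F≤ = ≤⇒≤′ (≤-trans (m≤m⊔n _ _) (m≤n⊔m (depth p) _))
      G≤ : depth Gᴾ ≤′ e
      G≤ = ≤⇒≤′ (≤-trans (m≤n⊔m (depth Fᴾ) _) (m≤n⊔m (depth p) _))
      branch : Program (e + 4)
      branch = case (e Fin.↑ʳ zero) skip
        (atDepth e pop-a ⨟ deepen F≤ (program Fᴾ))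
        (atDepth e swap-program ⨟ atDepth e (push-a true) ⨟ deepen G≤ (program Gᴾ))
      outcome : Maybe (L × R) → Γ → B
      outcome t γ = maybe′ (λ lr → G (γ , lr)) (F γ) t
      result : Γ → List Bool
      result γ = code ⌜ outcome (s γ) γ ⌝
      branch-runs : ∀ t γ rest → size (node ⌜ t ⌝ ⌜ γ ⌝) ≤ eval (growth p) ∥ γ ∥ →
        Runs branch (dataStore e (code ⌜ t ⌝ ++ code ⌜ γ ⌝ ++ rest))
          (1 + ((1 + eval (bound Fᴾ) ∥ γ ∥)
              + ((6 + 9 * eval (growth p) ∥ γ ∥) + (1 + eval (bound Gᴾ ⊚ growth p) ∥ γ ∥))))
          (dataStore e (code ⌜ outcome t γ ⌝ ++ rest))
      branch-runs nothing γ rest _ = on-false (lookup-dataStore e _)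
        (within (m≤m+n _ _) (atDepth-runs e (exactly pop⇓) then runs-at Fᴾ F≤ γ rest))
      branch-runs (just (l , r)) γ rest size≤ = on-true (lookup-dataStore e _)
        (within (m≤n+m _ (1 + eval (bound Fᴾ) ∥ γ ∥))
          (within (+-monoʳ-≤ 6 (*-monoʳ-≤ 9 (≤-trans (size-both ⌜ l , r ⌝ ⌜ γ ⌝) size≤)))
            (atDepth-runs e (swap-runs ⌜ l , r ⌝ ⌜ γ ⌝ rest))
          then atDepth-runs e (exactly push⇓)
          then within (≤-trans (eval-mono (bound Gᴾ) (≤-trans (≤-reflexive swapped) size≤))
                               (≤-reflexive (sym (eval-⊚ (bound Gᴾ) (growth p) _))))
            (subst (λ z → Runs (deepen G≤ (program Gᴾ)) (dataStore e (true ∷ z)) _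
                               (dataStore e (code ⌜ G (γ , l , r) ⌝ ++ rest)))
              (List.++-assoc (code ⌜ γ ⌝) _ rest)
              (runs-at Gᴾ G≤ (γ , l , r) rest))))
        where
        swapped : size (node ⌜ γ ⌝ ⌜ l , r ⌝) ≡ size (node ⌜ l , r ⌝ ⌜ γ ⌝)
        swapped = cong suc (+-comm ∥ γ ∥ _)

-- On codes this is the length of a list and the value of a unary number, so that either may count
-- the rounds of a loop.
spine : Tree → ℕ
spine leaf       = 0
spine (node l r) = suc (spine r)

spine-≤ : ∀ t → spine t ≤ size t
spine-≤ leaf       = z≤n
spine-≤ (node l r) = s≤s (≤-trans (spine-≤ r) (m≤n+m _ (size l)))

spine-List : ∀ {A} {{_ : Coding A}} (xs : List A) → spine ⌜ xs ⌝ ≡ length xs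
spine-List []       = refl
spine-List (x ∷ xs) = cong suc (spine-List xs)

iter : {S : Set} → (S → S) → ℕ → S → S
iter f zero    s = s
iter f (suc n) s = iter f n (f s)

beside : ∀ d {k} → List Bool → Frame {k} (suc d Fin.↑ʳ_)
beside d x = record
  { plug        = λ s → x ∷ plug (beneath d) s
  ; lookup-plug = λ s i → lookup-plug (beneath d) s i
  ; update-plug = λ s i v → cong (x ∷_) (update-plug (beneath d) s i v) }

module _ {S : Set} {{_ : Coding S}} {f : S → S} (fᴾ : Poly f) where

  private
    d = depth fᴾ

    loop-body : Program (suc d + 4)
    loop-body = case (suc d Fin.↑ʳ zero) skip
      (atDepth (suc d) pop-a ⨟ pop zero)
      (atDepth (suc d) (pop-a ⨟ drop-program ⨟ swap-program) ⨟ rename suc (program fᴾ)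
        ⨟ atDepth (suc d) swap-program)

    round-time : Polynomial → Polynomial → Polynomial
    round-time N B = constant 3 ⊕ ((constant 3 ⊕ constant 7 ⊗ N) ⊕ (constant 6 ⊕ constant 9 ⊗ (N ⊕ B)))
                   ⊕ ((bound fᴾ ⊚ B) ⊕ (constant 6 ⊕ constant 9 ⊗ (N ⊕ B)))

  -- The counter lies above the state. A round drops the head of the counter, brings the state to
  -- the top for `f` and swaps back; the leaf that ends the counter also clears the control bit.
  loop-program : Program (suc d + 4)
  loop-program = while zero loop-body

  loop-runs : ∀ N B x n s rest → (∀ i → i ≤ spine n → ∥ iter f i s ∥ ≤ eval B x) → size n ≤ eval N x →
    Runs loop-program ((true ∷ []) ∷ dataStore d (code n ++ code ⌜ s ⌝ ++ rest))
      (spine n * eval (round-time N B) x + 5)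
      ([] ∷ dataStore d (code ⌜ iter f (spine n) s ⌝ ++ rest))
  loop-runs N B x leaf s rest _ _ = iterate-once refl
    (on-false (lookup-dataStore d _) (rename-runs (beside d (true ∷ [])) {pop-a} (exactly pop⇓) then exactly pop⇓))
    (exactly (while-stop⇓ refl))
  loop-runs N B x (node l r) s rest small size≤ = within
    (≤-reflexive (rearrange τ-drop τ-body τ-swap (spine r * eval (round-time N B) x)))
    (iterate-once refl
      (on-true (lookup-dataStore d _)
        (subst (λ z → Runs (atDepth (suc d) (pop-a ⨟ drop-program ⨟ swap-program))
                        ((true ∷ []) ∷ dataStore d (true ∷ z)) _ ((true ∷ []) ∷ dataStore d _))
          (sym (List.++-assoc (code l) (code r) _))
          (rename-runs (beside d (true ∷ [])) (exactly pop⇓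
            then within (+-monoʳ-≤ 3 (*-monoʳ-≤ 7 (≤-trans (size-left l r) size≤))) (drop-runs l _)
            then within (+-monoʳ-≤ 6 (*-monoʳ-≤ 9 (+-mono-≤ r≤ (small 0 z≤n)))) (swap-runs r ⌜ s ⌝ rest)))
        then within (≤-trans (eval-mono (bound fᴾ) (small 0 z≤n)) (≤-reflexive (sym (eval-⊚ (bound fᴾ) B x))))
               (rename-runs (under (true ∷ [])) (runs fᴾ s (code r ++ rest)))
        then rename-runs (beside d (true ∷ []))
               (within (+-monoʳ-≤ 6 (*-monoʳ-≤ 9 (≤-trans (+-monoˡ-≤ (size r) (small 1 (s≤s z≤n)))
                         (≤-trans (≤-reflexive (+-comm _ (size r))) (+-monoˡ-≤ (eval B x) r≤)))))
                 (swap-runs ⌜ f s ⌝ r rest))))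
      (loop-runs N B x r (f s) rest (λ i i≤ → small (suc i) (s≤s i≤)) r≤))
    where
    r≤ : size r ≤ eval N x
    r≤ = ≤-trans (size-right l r) size≤
    τ-drop = 3 + 7 * eval N x
    τ-swap = 6 + 9 * (eval N x + eval B x)
    τ-body = eval (bound fᴾ ⊚ B) x
    rearrange : ∀ a b c k → suc (suc (1 + (a + c) + (b + c)) + (k + 5)) ≡ 3 + (a + c) + (b + c) + k + 5
    rearrange = solve-∀

  abstract

    -- Polynomial time is not closed under iteration, since the state might double in every round.
    -- The hypothesis therefore bounds all intermediate states by a polynomial in the size of the
    -- original argument.
    iterᴾ : ∀ {Γ M} {{_ : Coding Γ}} {{_ : Coding M}} {num : Γ → M} {start : Γ → S} →
            Poly num → Poly start → (B : Polynomial) →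
            (∀ γ i → i ≤ spine ⌜ num γ ⌝ → ∥ iter f i (start γ) ∥ ≤ eval B ∥ γ ∥) →
            Poly (λ γ → iter f (spine ⌜ num γ ⌝) (start γ))
    iterᴾ {num = num} {start} numᴾ startᴾ B small = record
      { program = deepen p≤ (program p) ⨟ atDepth e pop-a ⨟ deepen l≤ (push zero true ⨟ loop-program)
      ; bound   = bound p ⊕ (constant 1 ⊕ (constant 1 ⊕ (growth p ⊗ round-time (growth p) B ⊕ constant 5)))
      ; runs    = λ γ rest → runs-at p p≤ γ rest
          then atDepth-runs e (exactly pop⇓)
          then subst (λ z → Runs (deepen l≤ (push zero true ⨟ loop-program)) (dataStore e z) _
                                 (dataStore e (code ⌜ iter f (spine ⌜ num γ ⌝) (start γ) ⌝ ++ rest)))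
            (sym (List.++-assoc (code ⌜ num γ ⌝) _ rest))
            (deepen-runs l≤ (exactly push⇓
              then within (+-monoˡ-≤ 5 (*-monoˡ-≤ (eval (round-time (growth p) B) ∥ γ ∥)
                            (≤-trans (spine-≤ ⌜ num γ ⌝) (num≤ γ))))
                (loop-runs (growth p) B ∥ γ ∥ ⌜ num γ ⌝ (start γ) rest (small γ) (num≤ γ))))
      }
      where
      p : Poly (λ γ → node ⌜ num γ ⌝ ⌜ start γ ⌝)
      p = nodeᴾ numᴾ startᴾ
      e : ℕ
      e = depth p ⊔ suc d
      p≤ : depth p ≤′ e
      p≤ = ≤ˡ _ _
      l≤ : suc d ≤′ e
      l≤ = ≤ʳ (depth p) _
      num≤ : ∀ γ → ∥ num γ ∥ ≤ eval (growth p) ∥ γ ∥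
      num≤ γ = ≤-trans (size-left ⌜ num γ ⌝ ⌜ start γ ⌝) (size-bound p γ)

size-ℕ : ∀ n → ∥ n ∥ ≡ suc (2 * n)
size-ℕ zero    = refl
size-ℕ (suc n) = cong suc (trans (cong suc (size-ℕ n)) (sym (*-suc 2 n)))

size-Bool : ∀ (b : Bool) → ∥ b ∥ ≤ 3
size-Bool true  = ≤-refl
size-Bool false = s≤s z≤n

uncons : {A : Set} → List A → Maybe (A × List A)
uncons []       = nothing
uncons (x ∷ xs) = just (x , xs)

tail : {A : Set} → List A → List A
tail []       = []
tail (_ ∷ xs) = xs

size-tail : ∀ {A} {{_ : Coding A}} (ys : List A) → ∥ tail ys ∥ ≤ ∥ ys ∥
size-tail []       = ≤-refl
size-tail (y ∷ ys) = size-right ⌜ y ⌝ ⌜ ys ⌝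

at : {A : Set} → A → List A → ℕ → A
at d []       _       = d
at d (x ∷ xs) zero    = x
at d (x ∷ xs) (suc n) = at d xs n

isZero : ℕ → Bool
isZero zero    = true
isZero (suc _) = false

leq : ℕ → ℕ → Bool
leq m n = isZero (m ∸ n)

module _ {Γ A B : Set} {{_ : Coding Γ}} {{_ : Coding A}} {{_ : Coding B}} where

  infixr 4 _,ᴾ_
  _,ᴾ_ : {f : Γ → A} {g : Γ → B} → Poly f → Poly g → Poly (λ γ → f γ , g γ)
  p ,ᴾ q = recode (λ _ → refl) (nodeᴾ p q)

  fst-of : {f : Γ → A × B} → Poly f → Poly (λ γ → proj₁ (f γ))
  fst-of p = fstᴾ ∘ᴾ p

  snd-of : {f : Γ → A × B} → Poly f → Poly (λ γ → proj₂ (f γ))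
  snd-of p = sndᴾ ∘ᴾ p

  weaken : {f : Γ → B} → Poly f → Poly {Γ × A} (λ (γ , _) → f γ)
  weaken p = p ∘ᴾ fstᴾ

module _ {Γ A : Set} {{_ : Coding Γ}} {{_ : Coding A}} where

  infixr 5 _∷ᴾ_
  _∷ᴾ_ : {f : Γ → A} {g : Γ → List A} → Poly f → Poly g → Poly (λ γ → f γ ∷ g γ)
  p ∷ᴾ q = recode (λ _ → refl) (nodeᴾ p q)

  unconsᴾ : {f : Γ → List A} → Poly f → Poly (λ γ → uncons (f γ))
  unconsᴾ {f} = recode (λ γ → view (f γ))
    where
    view : ∀ (xs : List A) → ⌜ xs ⌝ ≡ ⌜ uncons xs ⌝
    view []       = refl
    view (x ∷ xs) = refl

module _ {Γ A B : Set} {{_ : Coding Γ}} {{_ : Coding A}} {{_ : Coding B}} where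

  caseListᴾ : {xs : Γ → List A} {F : Γ → B} {G : Γ × A × List A → B} {h : Γ → B} →
              Poly xs → Poly F → Poly G →
              (∀ γ → maybe′ (λ lr → G (γ , lr)) (F γ) (uncons (xs γ)) ≡ h γ) → Poly h
  caseListᴾ xsᴾ Fᴾ Gᴾ eq = extensional eq (maybeᴾ (unconsᴾ xsᴾ) Fᴾ Gᴾ)

module _ {Γ B : Set} {{_ : Coding Γ}} {{_ : Coding B}} where

  caseℕᴾ : {n : Γ → ℕ} {F : Γ → B} {G : Γ × ⊤ × ℕ → B} {h : Γ → B} →
           Poly n → Poly F → Poly G →
           (∀ γ k → n γ ≡ suc k → G (γ , tt , k) ≡ h γ) → (∀ γ → n γ ≡ 0 → F γ ≡ h γ) → Poly h
  caseℕᴾ {n} {F} {G} {h} nᴾ Fᴾ Gᴾ eq-suc eq-zero =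
    extensional (λ γ → eq γ (n γ) refl) (maybeᴾ {s = λ γ → predecessor (n γ)} (recode (λ γ → view (n γ)) nᴾ) Fᴾ Gᴾ)
    where
    predecessor : ℕ → Maybe (⊤ × ℕ)
    predecessor zero    = nothing
    predecessor (suc k) = just (tt , k)
    view : ∀ k → ⌜ k ⌝ ≡ ⌜ predecessor k ⌝
    view zero    = refl
    view (suc k) = refl
    eq : ∀ γ k → n γ ≡ k → maybe′ (λ lr → G (γ , lr)) (F γ) (predecessor (n γ)) ≡ h γ
    eq γ k e with n γ in e′
    ... | zero  = eq-zero γ e′
    ... | suc _ = eq-suc γ _ e′

module _ {Γ A : Set} {{_ : Coding Γ}} {{_ : Coding A}} where

  ifᴾ : {b : Γ → Bool} {f g : Γ → A} → Poly b → Poly f → Poly g → Poly (λ γ → if b γ then f γ else g γ)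
  ifᴾ {b} {f} {g} bᴾ fᴾ gᴾ = extensional (λ γ → choice (b γ)) (maybeᴾ {s = λ γ → test (b γ)} (recode (λ γ → view (b γ)) bᴾ) gᴾ (fᴾ ∘ᴾ fstᴾ))
    where
    test : Bool → Maybe (⊤ × ⊤)
    test true  = just (tt , tt)
    test false = nothing
    view : ∀ c → ⌜ c ⌝ ≡ ⌜ test c ⌝
    view true  = refl
    view false = refl
    choice : ∀ {x y : A} c → maybe′ (λ _ → x) y (test c) ≡ (if c then x else y)
    choice true  = refl
    choice false = refl

module _ {Γ : Set} {{_ : Coding Γ}} where

  sucᴾ : {f : Γ → ℕ} → Poly f → Poly (λ γ → suc (f γ))
  sucᴾ p = recode (λ _ → refl) (nodeᴾ (constᴾ tt) p)

  asListᴾ : {f : Γ → ℕ} → Poly f → Poly (λ γ → List.replicate (f γ) tt)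
  asListᴾ {f} = recode (λ γ → view (f γ))
    where
    view : ∀ n → ⌜ n ⌝ ≡ ⌜ List.replicate n tt ⌝
    view zero    = refl
    view (suc n) = cong (node leaf) (view n)

module _ {Γ A S : Set} {{_ : Coding Γ}} {{_ : Coding A}} {{_ : Coding S}}
         {step : Γ × A × S → S} {init : Γ → S} {xs : Γ → List A}
         (stepᴾ : Poly step) (initᴾ : Poly init) (xsᴾ : Poly xs) where

  private
    advance : Γ × List A × S → Γ × List A × S
    advance (γ , []     , s) = γ , [] , s
    advance (γ , x ∷ xs , s) = γ , xs , step (γ , x , s)

    advanceᴾ : Poly advance
    advanceᴾ = caseListᴾ (fst-of sndᴾ) idᴾ
      (fst-of fstᴾ ,ᴾ snd-of sndᴾ ,ᴾ (stepᴾ ∘ᴾ (fst-of fstᴾ ,ᴾ fst-of sndᴾ ,ᴾ snd-of (snd-of fstᴾ))))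
      (λ { (_ , [] , _) → refl ; (_ , _ ∷ _ , _) → refl })

    fold : Γ → List A → S → S
    fold γ ys s = foldl (λ s x → step (γ , x , s)) s ys

    iter-advance : ∀ γ ys s → proj₂ (proj₂ (iter advance (length ys) (γ , ys , s))) ≡ fold γ ys s
    iter-advance γ []       s = refl
    iter-advance γ (y ∷ ys) s = iter-advance γ ys (step (γ , y , s))

  -- B bounds the fold over every prefix of the list.
  foldl-boundedᴾ : (B : Polynomial) →
    (∀ γ ys zs → xs γ ≡ ys ++ zs → ∥ fold γ ys (init γ) ∥ ≤ eval B ∥ γ ∥) →
    Poly (λ γ → foldl (λ s x → step (γ , x , s)) (init γ) (xs γ))
  foldl-boundedᴾ B small = extensional
    (λ γ → trans (cong (λ k → proj₂ (proj₂ (iter advance k (γ , xs γ , init γ)))) (spine-List (xs γ)))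
                 (iter-advance γ (xs γ) (init γ)))
    (snd-of (snd-of (iterᴾ advanceᴾ xsᴾ (idᴾ ,ᴾ xsᴾ ,ᴾ initᴾ)
      (constant 2 ⊕ var ⊕ growth xsᴾ ⊕ B) (λ γ i _ → states γ i (xs γ) (init γ) (λ ys zs → small γ ys zs) (size-bound xsᴾ γ)))))
    where
    states : ∀ (γ : Γ) i (zs : List A) (s : S) {X Y} → (∀ us vs → zs ≡ us ++ vs → ∥ fold γ us s ∥ ≤ Y) → ∥ zs ∥ ≤ X →
             ∥ iter advance i (γ , zs , s) ∥ ≤ 2 + ∥ γ ∥ + X + Y
    states γ zero zs s {X} {Y} small≤ zs≤ = begin
      ∥ γ , zs , s ∥                     ≡⟨ refl ⟩
      suc (∥ γ ∥ + suc (∥ zs ∥ + ∥ s ∥)) ≤⟨ s≤s (+-monoʳ-≤ ∥ γ ∥ (s≤s (+-mono-≤ zs≤ (small≤ [] zs refl)))) ⟩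
      suc (∥ γ ∥ + suc (X + Y))          ≡⟨ rearrange ∥ γ ∥ X Y ⟩
      2 + ∥ γ ∥ + X + Y                  ∎
      where
      open ≤-Reasoning
      rearrange : ∀ a b c → suc (a + suc (b + c)) ≡ 2 + a + b + c
      rearrange = solve-∀
    states γ (suc i) []       s small≤ zs≤ = states γ i [] s small≤ zs≤
    states γ (suc i) (z ∷ zs) s small≤ zs≤ = states γ i zs (step (γ , z , s))
      (λ us vs eq → small≤ (z ∷ us) vs (cong (z ∷_) eq)) (≤-trans (size-right ⌜ z ⌝ ⌜ zs ⌝) zs≤)

  -- The growth caused by one element may depend on the context and the element but not on the
  -- state. Over polynomially many elements it then adds up to a polynomial, and every prefix is
  -- bounded at once.
  foldlᴾ : (q : Polynomial) → (∀ γ x s → ∥ step (γ , x , s) ∥ ≤ ∥ s ∥ + eval q ∥ γ , x ∥) →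
    Poly (λ γ → foldl (λ s x → step (γ , x , s)) (init γ) (xs γ))
  foldlᴾ q step≤ = foldl-boundedᴾ (growth initᴾ ⊕ growth xsᴾ ⊗ (q ⊚ N)) (λ γ ys zs eq → begin
      ∥ fold γ ys (init γ) ∥        ≤⟨ additive γ (eval N ∥ γ ∥) ys (init γ) (elements γ ys zs eq) ⟩
      ∥ init γ ∥ + length ys * eval q (eval N ∥ γ ∥)
        ≤⟨ +-mono-≤ (size-bound initᴾ γ) (*-mono-≤ (≤-trans (length≤ γ ys zs eq) (size-bound xsᴾ γ))
             (≤-reflexive (sym (eval-⊚ q N ∥ γ ∥)))) ⟩
      eval (growth initᴾ ⊕ growth xsᴾ ⊗ (q ⊚ N)) ∥ γ ∥ ∎)
    where
    open ≤-Reasoning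
    N = constant 1 ⊕ (var ⊕ growth xsᴾ)
    additive : ∀ (γ : Γ) n (ys : List A) (s : S) → (∀ y ys₁ ys₂ → ys ≡ ys₁ ++ y ∷ ys₂ → ∥ γ , y ∥ ≤ n) →
               ∥ fold γ ys s ∥ ≤ ∥ s ∥ + length ys * eval q n
    additive γ n []       s _   = m≤m+n _ _
    additive γ n (y ∷ ys) s el≤ = begin
      ∥ fold γ ys (step (γ , y , s)) ∥
        ≤⟨ additive γ n ys _ (λ z us vs eq → el≤ z (y ∷ us) vs (cong (y ∷_) eq)) ⟩
      ∥ step (γ , y , s) ∥ + length ys * eval q n
        ≤⟨ +-monoˡ-≤ _ (≤-trans (step≤ γ y s) (+-monoʳ-≤ ∥ s ∥ (eval-mono q (el≤ y [] ys refl)))) ⟩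
      ∥ s ∥ + eval q n + length ys * eval q n ≡⟨ +-assoc ∥ s ∥ _ _ ⟩
      ∥ s ∥ + suc (length ys) * eval q n ∎
    length≤ : ∀ γ ys zs → xs γ ≡ ys ++ zs → length ys ≤ ∥ xs γ ∥
    length≤ γ ys zs eq = ≤-trans (m≤m+n _ (length zs)) (≤-trans (≤-reflexive
      (trans (sym (List.length-++ ys)) (trans (cong length (sym eq)) (sym (spine-List (xs γ)))))) (spine-≤ ⌜ xs γ ⌝))
    suffix : ∀ (ys zs : List A) → ∥ zs ∥ ≤ ∥ ys ++ zs ∥
    suffix []       zs = ≤-refl
    suffix (y ∷ ys) zs = ≤-trans (suffix ys zs) (size-right ⌜ y ⌝ ⌜ ys ++ zs ⌝)
    elements : ∀ γ ys zs → xs γ ≡ ys ++ zs → ∀ y ys₁ ys₂ → ys ≡ ys₁ ++ y ∷ ys₂ → ∥ γ , y ∥ ≤ eval N ∥ γ ∥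
    elements γ ys zs eq y ys₁ ys₂ refl = begin
      ∥ γ , y ∥            ≡⟨⟩
      suc (∥ γ ∥ + ∥ y ∥)   ≤⟨ s≤s (+-monoʳ-≤ ∥ γ ∥ (≤-trans (size-left ⌜ y ⌝ ⌜ ys₂ ++ zs ⌝)
                                (≤-trans (suffix ys₁ (y ∷ ys₂ ++ zs)) (≤-trans (≤-reflexive (cong ∥_∥
                                  (trans (sym (List.++-assoc ys₁ (y ∷ ys₂) zs)) (sym eq)))) (size-bound xsᴾ γ))))) ⟩
      eval N ∥ γ ∥          ∎

module _ {Γ A : Set} {{_ : Coding Γ}} {{_ : Coding A}} where

  reverseᴾ : {xs : Γ → List A} → Poly xs → Poly (λ γ → List.reverse (xs γ))
  reverseᴾ xsᴾ = foldlᴾ (fst-of sndᴾ ∷ᴾ snd-of sndᴾ) (constᴾ []) xsᴾ (constant 1 ⊕ var) (λ γ x s → begin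
    ∥ x ∷ s ∥           ≡⟨⟩
    suc (∥ x ∥ + ∥ s ∥)  ≡⟨ cong suc (+-comm ∥ x ∥ ∥ s ∥) ⟩
    suc (∥ s ∥ + ∥ x ∥)  ≡⟨ +-suc ∥ s ∥ ∥ x ∥ ⟨
    ∥ s ∥ + suc ∥ x ∥    ≤⟨ +-monoʳ-≤ ∥ s ∥ (s≤s (size-right ⌜ γ ⌝ ⌜ x ⌝)) ⟩
    ∥ s ∥ + (1 + ∥ γ , x ∥) ∎)
    where open ≤-Reasoning

module _ {Γ A S : Set} {{_ : Coding Γ}} {{_ : Coding A}} {{_ : Coding S}} where

  foldrᴾ : {step : Γ × A × S → S} {init : Γ → S} {xs : Γ → List A} →
    Poly step → Poly init → Poly xs →
    (q : Polynomial) → (∀ γ x s → ∥ step (γ , x , s) ∥ ≤ ∥ s ∥ + eval q ∥ γ , x ∥) →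
    Poly (λ γ → foldr (λ x s → step (γ , x , s)) (init γ) (xs γ))
  foldrᴾ {step} {init} {xs} stepᴾ initᴾ xsᴾ q step≤ = extensional
    (λ γ → List.reverse-foldl (λ s x → step (γ , x , s)) (init γ) (xs γ))
    (foldlᴾ stepᴾ initᴾ (reverseᴾ xsᴾ) q step≤)

module _ {Γ A S : Set} {{_ : Coding Γ}} {{_ : Coding A}} {{_ : Coding S}} where

  mapᴾ : {f : Γ × A → S} {xs : Γ → List A} → Poly f → Poly xs → Poly (λ γ → map (λ x → f (γ , x)) (xs γ))
  mapᴾ {f} {xs} fᴾ xsᴾ = extensional (λ γ → fold-map (λ x → f (γ , x)) (xs γ))
    (foldrᴾ ((fᴾ ∘ᴾ (fstᴾ ,ᴾ fst-of sndᴾ)) ∷ᴾ snd-of sndᴾ) (constᴾ []) xsᴾ (constant 1 ⊕ growth fᴾ) (λ γ x s → begin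
      ∥ f (γ , x) ∷ s ∥           ≡⟨⟩
      suc (∥ f (γ , x) ∥ + ∥ s ∥) ≡⟨ cong suc (+-comm ∥ f (γ , x) ∥ ∥ s ∥) ⟩
      suc (∥ s ∥ + ∥ f (γ , x) ∥) ≡⟨ +-suc ∥ s ∥ ∥ f (γ , x) ∥ ⟨
      ∥ s ∥ + suc ∥ f (γ , x) ∥   ≤⟨ +-monoʳ-≤ ∥ s ∥ (s≤s (size-bound fᴾ (γ , x))) ⟩
      ∥ s ∥ + suc (eval (growth fᴾ) ∥ γ , x ∥) ∎))
    where
    open ≤-Reasoning
    fold-map : ∀ (g : A → S) ys → foldr (λ x s → g x ∷ s) [] ys ≡ map g ys
    fold-map g []       = refl
    fold-map g (y ∷ ys) = cong (g y ∷_) (fold-map g ys)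

module _ {Γ : Set} {{_ : Coding Γ}} where

  lengthᴾ : ∀ {A} {{_ : Coding A}} {xs : Γ → List A} → Poly xs → Poly (λ γ → length (xs γ))
  lengthᴾ {A} {xs} xsᴾ = extensional (λ γ → fold-length (xs γ))
    (foldrᴾ (sucᴾ (snd-of sndᴾ)) (constᴾ 0) xsᴾ (constant 2) (λ _ _ n →
      ≤-reflexive (+-comm 2 ∥ n ∥)))
    where
    fold-length : ∀ (ys : List A) → foldr (λ _ n → suc n) 0 ys ≡ length ys
    fold-length []       = refl
    fold-length (y ∷ ys) = cong suc (fold-length ys)

  infixl 6 _+ᴾ_ _∸ᴾ_

  _+ᴾ_ : {f g : Γ → ℕ} → Poly f → Poly g → Poly (λ γ → f γ + g γ)
  _+ᴾ_ {f} {g} fᴾ gᴾ = extensional (λ γ → fold-suc (f γ) (g γ))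
    (foldlᴾ (sucᴾ (snd-of sndᴾ)) gᴾ (asListᴾ fᴾ) (constant 2) (λ _ _ n →
      ≤-reflexive (+-comm 2 ∥ n ∥)))
    where
    fold-suc : ∀ m n → foldl (λ s _ → suc s) n (List.replicate m tt) ≡ m + n
    fold-suc zero    n = refl
    fold-suc (suc m) n = trans (fold-suc m (suc n)) (+-suc m n)

  _∸ᴾ_ : {f g : Γ → ℕ} → Poly f → Poly g → Poly (λ γ → f γ ∸ g γ)
  _∸ᴾ_ {f} {g} fᴾ gᴾ = extensional (λ γ → fold-pred (f γ) (g γ))
    (foldlᴾ (caseℕᴾ (snd-of sndᴾ) (constᴾ 0) (snd-of sndᴾ)
              (λ γ k eq → cong pred (sym eq)) (λ γ eq → cong pred (sym eq))) fᴾ (asListᴾ gᴾ) (constant 0)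
      (λ _ _ n → ≤-trans (pred-size n) (≤-reflexive (sym (+-identityʳ _)))))
    where
    pred-size : ∀ n → ∥ pred n ∥ ≤ ∥ n ∥
    pred-size zero    = ≤-refl
    pred-size (suc n) = size-right leaf ⌜ n ⌝
    fold-pred : ∀ m n → foldl (λ s _ → pred s) m (List.replicate n tt) ≡ m ∸ n
    fold-pred m zero    = refl
    fold-pred m (suc n) = trans (fold-pred (pred m) n) (trans (∸-suc m n) refl)
      where
      ∸-suc : ∀ m n → pred m ∸ n ≡ m ∸ suc n
      ∸-suc zero    zero    = refl
      ∸-suc zero    (suc n) = refl
      ∸-suc (suc m) n       = refl

size-+ : ∀ m n → ∥ m + n ∥ ≤ ∥ n ∥ + ∥ m ∥
size-+ m n = begin
  ∥ m + n ∥                       ≡⟨ size-ℕ (m + n) ⟩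
  suc (2 * (m + n))               ≤⟨ n≤1+n _ ⟩
  2 + 2 * (m + n)                 ≡⟨ rearrange m n ⟩
  suc (2 * n) + suc (2 * m)       ≡⟨ cong₂ _+_ (size-ℕ n) (size-ℕ m) ⟨
  ∥ n ∥ + ∥ m ∥                   ∎
  where
  open ≤-Reasoning
  rearrange : ∀ m n → 2 + 2 * (m + n) ≡ suc (2 * n) + suc (2 * m)
  rearrange = solve-∀

module _ {Γ : Set} {{_ : Coding Γ}} where

  sumᴾ : ∀ {A} {{_ : Coding A}} {f : Γ × A → ℕ} {xs : Γ → List A} → Poly f → Poly xs →
         Poly (λ γ → sum (map (λ x → f (γ , x)) (xs γ)))
  sumᴾ {A} {f} {xs} fᴾ xsᴾ = extensional (λ γ → fold-sum (λ x → f (γ , x)) (xs γ))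
    (foldrᴾ ((fᴾ ∘ᴾ (fstᴾ ,ᴾ fst-of sndᴾ)) +ᴾ snd-of sndᴾ) (constᴾ 0) xsᴾ (growth fᴾ)
      (λ γ x s → ≤-trans (size-+ (f (γ , x)) s) (+-monoʳ-≤ ∥ s ∥ (size-bound fᴾ (γ , x)))))
    where
    fold-sum : ∀ (g : A → ℕ) ys → foldr (λ x s → g x + s) 0 ys ≡ sum (map g ys)
    fold-sum g []       = refl
    fold-sum g (y ∷ ys) = cong (g y +_) (fold-sum g ys)

  infixl 7 _*ᴾ_
  _*ᴾ_ : {f g : Γ → ℕ} → Poly f → Poly g → Poly (λ γ → f γ * g γ)
  _*ᴾ_ {f} {g} fᴾ gᴾ = extensional (λ γ → sum-replicate (f γ) (g γ)) (sumᴾ (gᴾ ∘ᴾ fstᴾ) (asListᴾ fᴾ))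
    where
    sum-replicate : ∀ m n → sum (map (λ _ → n) (List.replicate m tt)) ≡ m * n
    sum-replicate zero    n = refl
    sum-replicate (suc m) n = cong (n +_) (sum-replicate m n)

  isZeroᴾ : {f : Γ → ℕ} → Poly f → Poly (λ γ → isZero (f γ))
  isZeroᴾ {f} fᴾ = caseℕᴾ fᴾ (constᴾ true) (constᴾ false)
    (λ γ k eq → cong isZero (sym eq)) (λ γ eq → cong isZero (sym eq))

  leqᴾ : {f g : Γ → ℕ} → Poly f → Poly g → Poly (λ γ → leq (f γ) (g γ))
  leqᴾ fᴾ gᴾ = isZeroᴾ (fᴾ ∸ᴾ gᴾ)

  notᴾ : {f : Γ → Bool} → Poly f → Poly (λ γ → not (f γ))
  notᴾ {f} fᴾ = extensional (λ γ → table (f γ)) (ifᴾ fᴾ (constᴾ false) (constᴾ true))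
    where
    table : ∀ b → (if b then false else true) ≡ not b
    table true  = refl
    table false = refl

  infixr 6 _∧ᴾ_
  _∧ᴾ_ : {f g : Γ → Bool} → Poly f → Poly g → Poly (λ γ → f γ ∧ g γ)
  _∧ᴾ_ {f} {g} fᴾ gᴾ = extensional (λ γ → table (f γ) (g γ)) (ifᴾ fᴾ gᴾ (constᴾ false))
    where
    table : ∀ a b → (if a then b else false) ≡ a ∧ b
    table true  b = refl
    table false b = refl

module _ {Γ : Set} {{_ : Coding Γ}} where

  allᴾ : ∀ {A} {{_ : Coding A}} {f : Γ × A → Bool} {xs : Γ → List A} → Poly f → Poly xs →
         Poly (λ γ → all (λ x → f (γ , x)) (xs γ))
  allᴾ {A} {f} {xs} fᴾ xsᴾ = extensional (λ γ → fold-all (λ x → f (γ , x)) (xs γ))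
    (foldrᴾ ((fᴾ ∘ᴾ (fstᴾ ,ᴾ fst-of sndᴾ)) ∧ᴾ snd-of sndᴾ) (constᴾ true) xsᴾ (constant 3)
      (λ γ x s → ≤-trans (size-Bool (f (γ , x) ∧ s)) (m≤n+m 3 ∥ s ∥)))
    where
    fold-all : ∀ (g : A → Bool) ys → foldr (λ x s → g x ∧ s) true ys ≡ all g ys
    fold-all g []       = refl
    fold-all g (y ∷ ys) = cong (g y ∧_) (fold-all g ys)

size-++ : ∀ {A} {{_ : Coding A}} (xs ys : List A) → ∥ xs ++ ys ∥ ≤ ∥ ys ∥ + ∥ xs ∥
size-++ []       ys = m≤m+n _ 1
size-++ (x ∷ xs) ys = begin
  ∥ x ∷ xs ++ ys ∥             ≡⟨⟩
  suc (∥ x ∥ + ∥ xs ++ ys ∥)    ≤⟨ s≤s (+-monoʳ-≤ ∥ x ∥ (size-++ xs ys)) ⟩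
  suc (∥ x ∥ + (∥ ys ∥ + ∥ xs ∥)) ≡⟨ rearrange (∥ x ∥) (∥ ys ∥) (∥ xs ∥) ⟩
  ∥ ys ∥ + ∥ x ∷ xs ∥           ∎
  where
  open ≤-Reasoning
  rearrange : ∀ a b c → suc (a + (b + c)) ≡ b + suc (a + c)
  rearrange = solve-∀

module _ {Γ A : Set} {{_ : Coding Γ}} {{_ : Coding A}} where

  infixr 5 _++ᴾ_
  _++ᴾ_ : {xs ys : Γ → List A} → Poly xs → Poly ys → Poly (λ γ → xs γ ++ ys γ)
  _++ᴾ_ {xs} {ys} xsᴾ ysᴾ = extensional (λ γ → sym (List.++-is-foldr (xs γ) (ys γ)))
    (foldrᴾ (fst-of sndᴾ ∷ᴾ snd-of sndᴾ) ysᴾ xsᴾ (constant 1 ⊕ var) (λ γ x s → begin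
      ∥ x ∷ s ∥           ≡⟨⟩
      suc (∥ x ∥ + ∥ s ∥)  ≡⟨ cong suc (+-comm ∥ x ∥ ∥ s ∥) ⟩
      suc (∥ s ∥ + ∥ x ∥)  ≡⟨ +-suc ∥ s ∥ ∥ x ∥ ⟨
      ∥ s ∥ + suc ∥ x ∥    ≤⟨ +-monoʳ-≤ ∥ s ∥ (s≤s (size-right ⌜ γ ⌝ ⌜ x ⌝)) ⟩
      ∥ s ∥ + (1 + ∥ γ , x ∥) ∎))
    where open ≤-Reasoning

module _ {Γ A : Set} {{_ : Coding Γ}} {{_ : Coding A}} where

  concatMapᴾ : ∀ {B} {{_ : Coding B}} {f : Γ × B → List A} {xs : Γ → List B} → Poly f → Poly xs →
               Poly (λ γ → List.concatMap (λ x → f (γ , x)) (xs γ))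
  concatMapᴾ {B} {f} {xs} fᴾ xsᴾ = extensional (λ γ → fold-concatMap (λ x → f (γ , x)) (xs γ))
    (foldrᴾ ((fᴾ ∘ᴾ (fstᴾ ,ᴾ fst-of sndᴾ)) ++ᴾ snd-of sndᴾ) (constᴾ []) xsᴾ (growth fᴾ)
      (λ γ x s → ≤-trans (size-++ (f (γ , x)) s) (+-monoʳ-≤ ∥ s ∥ (size-bound fᴾ (γ , x)))))
    where
    fold-concatMap : ∀ (g : B → List A) ys → foldr (λ x s → g x ++ s) [] ys ≡ List.concatMap g ys
    fold-concatMap g []       = refl
    fold-concatMap g (y ∷ ys) = cong (g y ++_) (fold-concatMap g ys)

  tailᴾ : {xs : Γ → List A} → Poly xs → Poly (λ γ → tail (xs γ))
  tailᴾ {xs} xsᴾ = caseListᴾ xsᴾ (constᴾ []) (snd-of sndᴾ) (λ γ → view (xs γ))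
    where
    view : ∀ ys → maybe′ (λ lr → proj₂ lr) [] (uncons ys) ≡ tail ys
    view []      = refl
    view (_ ∷ _) = refl

  headᴾ : ∀ d {xs : Γ → List A} → Poly xs → Poly (λ γ → at d (xs γ) 0)
  headᴾ d {xs} xsᴾ = caseListᴾ xsᴾ (constᴾ d) (fst-of sndᴾ) (λ γ → view (xs γ))
    where
    view : ∀ ys → maybe′ (λ lr → proj₁ lr) d (uncons ys) ≡ at d ys 0
    view []      = refl
    view (_ ∷ _) = refl

module _ {Γ A : Set} {{_ : Coding Γ}} {{_ : Coding A}} where

  atᴾ : ∀ d {xs : Γ → List A} {n : Γ → ℕ} → Poly xs → Poly n → Poly (λ γ → at d (xs γ) (n γ))
  atᴾ d {xs} {n} xsᴾ nᴾ = extensional (λ γ → head-drop (n γ) (xs γ))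
    (headᴾ d (foldlᴾ (tailᴾ (snd-of sndᴾ)) xsᴾ (asListᴾ nᴾ) (constant 0)
      (λ _ _ ys → ≤-trans (size-tail ys) (m≤m+n _ 0))))
    where
    head-drop : ∀ k ys → at d (foldl (λ s _ → tail s) ys (List.replicate k tt)) 0 ≡ at d ys k
    head-drop zero    []       = refl
    head-drop zero    (_ ∷ _)  = refl
    head-drop (suc k) []       = head-drop k []
    head-drop (suc k) (_ ∷ ys) = head-drop k ys

-- Digit arithmetic

size-downFrom : ∀ j → ∥ List.downFrom j ∥ ≤ 1 + j * (2 + 2 * j)
size-downFrom zero    = ≤-refl
size-downFrom (suc j) = begin
  suc (∥ j ∥ + ∥ List.downFrom j ∥)              ≤⟨ s≤s (+-mono-≤ (≤-reflexive (size-ℕ j)) (size-downFrom j)) ⟩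
  suc (suc (2 * j) + (1 + j * (2 + 2 * j)))     ≤⟨ m≤m+n _ (2 + 2 * j) ⟩
  suc (suc (2 * j) + (1 + j * (2 + 2 * j))) + (2 + 2 * j) ≡⟨ expand j ⟩
  1 + suc j * (2 + 2 * suc j)                   ∎
  where
  open ≤-Reasoning
  expand : ∀ j → suc (suc (2 * j) + (1 + j * (2 + 2 * j))) + (2 + 2 * j) ≡ 1 + suc j * (2 + 2 * suc j)
  expand = solve-∀

m≤size : ∀ m → m ≤ ∥ m ∥
m≤size m = ≤-trans (≤-trans (m≤m+n m _) (n≤1+n _)) (≤-reflexive (sym (size-ℕ m)))

module _ {Γ : Set} {{_ : Coding Γ}} where

  private
    count-down : ℕ × List ℕ → ⊤ → ℕ × List ℕ
    count-down (k , ys) _ = suc k , k ∷ ys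

    counted : ∀ us k → foldl count-down (k , List.downFrom k) us ≡ (length us + k , List.downFrom (length us + k))
    counted []       k = refl
    counted (_ ∷ us) k = trans (counted us (suc k)) (cong (λ j → j , List.downFrom j) (+-suc (length us) k))

  -- A step adds an entry as large as the counter inside the state, so its growth is not bounded by
  -- context and element; the size of every prefix is bounded directly by a quadratic.
  upToᴾ : {n : Γ → ℕ} → Poly n → Poly (λ γ → upTo (n γ))
  upToᴾ {n} nᴾ = extensional (λ γ → trans (cong (List.reverse ∘ proj₂) (trans (counted (List.replicate (n γ) tt) 0)
      (cong (λ j → j , List.downFrom j) (trans (+-identityʳ _) (List.length-replicate (n γ))))))
      (List.reverse-downFrom (n γ)))
    (reverseᴾ (snd-of (foldl-boundedᴾ {step = λ (_ , x , s) → count-down s x}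
      (sucᴾ (fst-of (snd-of sndᴾ)) ,ᴾ (fst-of (snd-of sndᴾ) ∷ᴾ snd-of (snd-of sndᴾ)))
      (constᴾ (0 , [])) (asListᴾ nᴾ) B small)))
    where
    G = growth nᴾ
    B = constant 1 ⊕ (constant 1 ⊕ constant 2 ⊗ G ⊕ (constant 1 ⊕ G ⊗ (constant 2 ⊕ constant 2 ⊗ G)))
    small : ∀ γ ys zs → List.replicate (n γ) tt ≡ ys ++ zs →
            ∥ foldl count-down (0 , []) ys ∥ ≤ eval B ∥ γ ∥
    small γ ys zs eq = begin
      ∥ foldl count-down (0 , []) ys ∥ ≡⟨ cong (λ s → size ⌜ s ⌝) (trans (counted ys 0)
                                            (cong (λ j → j , List.downFrom j) (+-identityʳ _))) ⟩
      suc (∥ j ∥ + ∥ List.downFrom j ∥) ≤⟨ s≤s (+-mono-≤ (≤-trans (≤-reflexive (size-ℕ j)) (s≤s (*-monoʳ-≤ 2 j≤)))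
                                           (≤-trans (size-downFrom j) (s≤s (*-mono-≤ j≤ (+-monoʳ-≤ 2 (*-monoʳ-≤ 2 j≤)))))) ⟩
      eval B ∥ γ ∥                     ∎
      where
      open ≤-Reasoning
      j = length ys
      j≤ : j ≤ eval G ∥ γ ∥
      j≤ = begin
        length ys                      ≤⟨ m≤m+n _ (length zs) ⟩
        length ys + length zs          ≡⟨ List.length-++ ys ⟨
        length (ys ++ zs)              ≡⟨ cong length eq ⟨
        length (List.replicate (n γ) tt) ≡⟨ List.length-replicate (n γ) ⟩
        n γ                            ≤⟨ m≤size (n γ) ⟩
        ∥ n γ ∥                        ≤⟨ size-bound nᴾ γ ⟩
        eval G ∥ γ ∥                   ∎

  -- Increasing k turns the upper half of k into the lower half and the lower half plus one into the
  -- upper half, so that a fold over the pair computes both.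
  halvesᴾ : {n : Γ → ℕ} → Poly n → Poly (λ γ → ⌊ n γ /2⌋ , ⌈ n γ /2⌉)
  halvesᴾ {n} nᴾ = extensional (λ γ → trans (halves (n γ) 0) (cong (λ j → ⌊ j /2⌋ , ⌈ j /2⌉) (+-identityʳ (n γ))))
    (foldlᴾ {step = λ (_ , _ , f , c) → c , suc f} (snd-of (snd-of sndᴾ) ,ᴾ sucᴾ (fst-of (snd-of sndᴾ))) (constᴾ (0 , 0)) (asListᴾ nᴾ) (constant 2)
      (λ _ _ (f , c) → ≤-reflexive (rearrange (∥ f ∥) (∥ c ∥))))
    where
    halves : ∀ m k → foldl (λ (f , c) _ → c , suc f) (⌊ k /2⌋ , ⌈ k /2⌉) (List.replicate m tt) ≡ (⌊ m + k /2⌋ , ⌈ m + k /2⌉)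
    halves zero    k = refl
    halves (suc m) k = trans (halves m (suc k)) (cong (λ j → ⌊ j /2⌋ , ⌈ j /2⌉) (+-suc m k))
    rearrange : ∀ a b → suc (b + suc (suc a)) ≡ suc (a + b) + 2
    rearrange = solve-∀

leq-true : ∀ {m n} → m ≤ n → leq m n ≡ true
leq-true m≤n = cong isZero (m≤n⇒m∸n≡0 m≤n)

leq-sound : ∀ m n → leq m n ≡ true → m ≤ n
leq-sound m n eq with m ∸ n in e
... | zero = m∸n≡0⇒m≤n e

leq-cong : ∀ {m n k l} → (m ≤ n → k ≤ l) → (k ≤ l → m ≤ n) → leq m n ≡ leq k l
leq-cong {m} {n} {k} {l} f g with leq m n in e | leq k l in e′
... | true  | true  = refl
... | false | false = refl
... | true  | false = trans (sym (leq-true (f (leq-sound m n e)))) e′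
... | false | true  = trans (sym e) (leq-true (g (leq-sound k l e′)))

-- A natural number is given by base-2 digits, least significant first,
-- each digit being an arbitrary number: arithmetic needs no carries.
value : List ℕ → ℕ
value []       = 0
value (d ∷ ds) = d + 2 * value ds

scale : ℕ → List ℕ → List ℕ
scale k = map (k *_)

-- The sum of the two lengths is long enough for both lists. Positions beyond the end are read as
-- the digit 0, which leaves the value unchanged.
align : List ℕ → List ℕ → List (ℕ × ℕ)
align xs ys = map (λ i → at 0 xs i , at 0 ys i) (upTo (length xs + length ys))

opaque

  addD : List ℕ → List ℕ → List ℕ
  addD xs ys = map (λ (x , y) → x + y) (align xs ys)

  addD-unfold : ∀ xs ys → addD xs ys ≡ map (λ (x , y) → x + y) (align xs ys)
  addD-unfold xs ys = refl

opaque

  mulD : List ℕ → List ℕ → List ℕ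
  mulD xs ys = foldr (λ x acc → addD (scale x ys) (0 ∷ acc)) [] xs

  mulD-unfold : ∀ xs ys → mulD xs ys ≡ foldr (λ x acc → addD (scale x ys) (0 ∷ acc)) [] xs
  mulD-unfold xs ys = refl

-- The two components are the carries of a comparison from the least
-- significant digit on; at most one of them is nonzero.
carry : ℕ × ℕ → ℕ × ℕ → ℕ × ℕ
carry (x , y) (c , e) = ⌈ (x + c) ∸ (y + e) /2⌉ , ⌊ (y + e) ∸ (x + c) /2⌋

opaque

  leD : List ℕ → List ℕ → Bool
  leD xs ys = let s = foldl (λ s p → carry p s) (0 , 0) (align xs ys) in leq (proj₁ s) (proj₂ s)

  leD-unfold : ∀ xs ys → leD xs ys ≡ leq (proj₁ (foldl (λ s p → carry p s) (0 , 0) (align xs ys)))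
                                         (proj₂ (foldl (λ s p → carry p s) (0 , 0) (align xs ys)))
  leD-unfold xs ys = refl

module _ {Γ : Set} {{_ : Coding Γ}} where

  alignᴾ : {f g : Γ → List ℕ} → Poly f → Poly g → Poly (λ γ → align (f γ) (g γ))
  alignᴾ fᴾ gᴾ = mapᴾ (atᴾ 0 (fᴾ ∘ᴾ fstᴾ) sndᴾ ,ᴾ atᴾ 0 (gᴾ ∘ᴾ fstᴾ) sndᴾ) (upToᴾ (lengthᴾ fᴾ +ᴾ lengthᴾ gᴾ))

  scaleᴾ : {k : Γ → ℕ} {f : Γ → List ℕ} → Poly k → Poly f → Poly (λ γ → scale (k γ) (f γ))
  scaleᴾ kᴾ fᴾ = mapᴾ ((kᴾ ∘ᴾ fstᴾ) *ᴾ sndᴾ) fᴾ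

  addDᴾ : {f g : Γ → List ℕ} → Poly f → Poly g → Poly (λ γ → addD (f γ) (g γ))
  addDᴾ {f} {g} fᴾ gᴾ = extensional (λ γ → sym (addD-unfold (f γ) (g γ))) (mapᴾ (fst-of sndᴾ +ᴾ snd-of sndᴾ) (alignᴾ fᴾ gᴾ))

align-applyUpTo : ∀ {A : Set} (h : ℕ × ℕ → A) xs ys → map h (align xs ys) ≡
                  List.applyUpTo (λ i → h (at 0 xs i , at 0 ys i)) (length xs + length ys)
align-applyUpTo h xs ys = trans (sym (List.map-∘ (upTo (length xs + length ys)))) (List.map-upTo _ _)

size-at : ∀ xs n → length xs ≤ n → ∥ List.applyUpTo (at 0 xs) n ∥ + 2 * length xs ≤ ∥ xs ∥ + 2 * n
size-at [] zero _ = ≤-refl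
size-at [] (suc n) _ = ≤-trans (+-monoʳ-≤ 2 (size-at [] n z≤n)) (≤-reflexive (rearrange n))
  where
  rearrange : ∀ n → 2 + (1 + 2 * n) ≡ 1 + 2 * suc n
  rearrange = solve-∀
size-at (x ∷ xs) (suc n) (s≤s l≤) = begin
  suc (∥ x ∥ + S) + 2 * suc (length xs)   ≡⟨ left (∥ x ∥) S (length xs) ⟩
  3 + ∥ x ∥ + (S + 2 * length xs)         ≤⟨ +-monoʳ-≤ (3 + ∥ x ∥) (size-at xs n l≤) ⟩
  3 + ∥ x ∥ + (∥ xs ∥ + 2 * n)            ≡⟨ right (∥ x ∥) (∥ xs ∥) n ⟩
  suc (∥ x ∥ + ∥ xs ∥) + 2 * suc n        ∎
  where
  open ≤-Reasoning
  S = ∥ List.applyUpTo (at 0 xs) n ∥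
  left : ∀ a b c → suc (a + b) + 2 * suc c ≡ 3 + a + (b + 2 * c)
  left = solve-∀
  right : ∀ a b c → 3 + a + (b + 2 * c) ≡ suc (a + b) + 2 * suc c
  right = solve-∀

size-zip-+ : ∀ f g n → ∥ List.applyUpTo (λ i → f i + g i) n ∥ + (1 + 2 * n) ≡
                       ∥ List.applyUpTo f n ∥ + ∥ List.applyUpTo g n ∥
size-zip-+ f g zero    = refl
size-zip-+ f g (suc n) = begin
  suc (∥ f 0 + g 0 ∥ + S) + (1 + 2 * suc n)    ≡⟨ cong (λ k → suc (k + S) + (1 + 2 * suc n)) (size-ℕ (f 0 + g 0)) ⟩
  suc (suc (2 * (f 0 + g 0)) + S) + (1 + 2 * suc n) ≡⟨ left (f 0) (g 0) S n ⟩
  4 + 2 * f 0 + 2 * g 0 + (S + (1 + 2 * n))    ≡⟨ cong (4 + 2 * f 0 + 2 * g 0 +_) (size-zip-+ (f ∘ suc) (g ∘ suc) n) ⟩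
  4 + 2 * f 0 + 2 * g 0 + (F + G)              ≡⟨ right (f 0) (g 0) F G ⟩
  suc (suc (2 * f 0) + F) + suc (suc (2 * g 0) + G)
    ≡⟨ cong₂ (λ a b → suc (a + F) + suc (b + G)) (size-ℕ (f 0)) (size-ℕ (g 0)) ⟨
  suc (∥ f 0 ∥ + F) + suc (∥ g 0 ∥ + G)        ∎
  where
  open ≡-Reasoning
  S = ∥ List.applyUpTo (λ i → f (suc i) + g (suc i)) n ∥
  F = ∥ List.applyUpTo (f ∘ suc) n ∥
  G = ∥ List.applyUpTo (g ∘ suc) n ∥
  left : ∀ a b s n → suc (suc (2 * (a + b)) + s) + (1 + 2 * suc n) ≡ 4 + 2 * a + 2 * b + (s + (1 + 2 * n))
  left = solve-∀
  right : ∀ a b c d → 4 + 2 * a + 2 * b + (c + d) ≡ suc (suc (2 * a) + c) + suc (suc (2 * b) + d)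
  right = solve-∀

-- The coefficient 1 is essential: multiplication sends its accumulator through `addD` once per
-- digit, and a larger factor would compound to an exponential. The zeros that pad the summands to a
-- common length are paid for by the digits merged at each position.
size-addD : ∀ xs ys → ∥ addD xs ys ∥ ≤ ∥ xs ∥ + ∥ ys ∥
size-addD xs ys = +-cancelʳ-≤ (4 * n) _ _ (begin
  ∥ addD xs ys ∥ + 4 * n           ≡⟨ cong (λ zs → size ⌜ zs ⌝ + 4 * n) (trans (addD-unfold xs ys) (align-applyUpTo _ xs ys)) ⟩
  S + 4 * n                        ≤⟨ n≤1+n _ ⟩
  suc (S + 4 * n)                  ≡⟨ left S (length xs) (length ys) ⟩
  S + (1 + 2 * n) + (2 * length xs + 2 * length ys)
    ≡⟨ cong (_+ (2 * length xs + 2 * length ys)) (size-zip-+ (at 0 xs) (at 0 ys) n) ⟩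
  X + Y + (2 * length xs + 2 * length ys)  ≡⟨ exchange X Y (2 * length xs) (2 * length ys) ⟩
  X + 2 * length xs + (Y + 2 * length ys)
    ≤⟨ +-mono-≤ (size-at xs n (m≤m+n _ _)) (size-at ys n (m≤n+m _ _)) ⟩
  ∥ xs ∥ + 2 * n + (∥ ys ∥ + 2 * n)        ≡⟨ right (∥ xs ∥) (∥ ys ∥) n ⟩
  ∥ xs ∥ + ∥ ys ∥ + 4 * n                  ∎)
  where
  open ≤-Reasoning
  n = length xs + length ys
  S = ∥ List.applyUpTo (λ i → at 0 xs i + at 0 ys i) n ∥
  X = ∥ List.applyUpTo (at 0 xs) n ∥
  Y = ∥ List.applyUpTo (at 0 ys) n ∥
  left : ∀ s a b → suc (s + 4 * (a + b)) ≡ s + (1 + 2 * (a + b)) + (2 * a + 2 * b)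
  left = solve-∀
  exchange : ∀ a b c d → a + b + (c + d) ≡ a + c + (b + d)
  exchange = solve-∀
  right : ∀ a b n → a + 2 * n + (b + 2 * n) ≡ a + b + 4 * n
  right = solve-∀

value-at : ∀ xs n → length xs ≤ n → value (List.applyUpTo (at 0 xs) n) ≡ value xs
value-at []       zero    _        = refl
value-at []       (suc n) _        = cong (2 *_) (value-at [] n z≤n)
value-at (x ∷ xs) (suc n) (s≤s l≤) = cong (λ k → x + 2 * k) (value-at xs n l≤)

value-addD : ∀ xs ys → value (addD xs ys) ≡ value xs + value ys
value-addD xs ys = trans (cong value (trans (addD-unfold xs ys) (align-applyUpTo _ xs ys))) (trans (additive (at 0 xs) (at 0 ys) n)
  (cong₂ _+_ (value-at xs n (m≤m+n _ _)) (value-at ys n (m≤n+m _ _))))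
  where
  n = length xs + length ys
  additive : ∀ f g k → value (List.applyUpTo (λ i → f i + g i) k) ≡
             value (List.applyUpTo f k) + value (List.applyUpTo g k)
  additive f g zero    = refl
  additive f g (suc k) = trans (cong (λ v → f 0 + g 0 + 2 * v) (additive (f ∘ suc) (g ∘ suc) k))
    (rearrange (f 0) (g 0) (value (List.applyUpTo (f ∘ suc) k)) (value (List.applyUpTo (g ∘ suc) k)))
    where
    rearrange : ∀ a b c d → a + b + 2 * (c + d) ≡ a + 2 * c + (b + 2 * d)
    rearrange = solve-∀

value-scale : ∀ k xs → value (scale k xs) ≡ k * value xs
value-scale k []       = sym (*-zeroʳ k)
value-scale k (x ∷ xs) = trans (cong (λ v → k * x + 2 * v) (value-scale k xs)) (rearrange k x (value xs))
  where
  rearrange : ∀ k x v → k * x + 2 * (k * v) ≡ k * (x + 2 * v)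
  rearrange = solve-∀

value-mulD : ∀ xs ys → value (mulD xs ys) ≡ value xs * value ys
value-mulD xs ys = trans (cong value (mulD-unfold xs ys)) (go xs)
  where
  rearrange : ∀ x a b → x * b + 2 * (a * b) ≡ (x + 2 * a) * b
  rearrange = solve-∀
  go : ∀ xs → value (foldr (λ x acc → addD (scale x ys) (0 ∷ acc)) [] xs) ≡ value xs * value ys
  go []       = refl
  go (x ∷ xs) = trans (value-addD (scale x ys) _)
    (trans (cong₂ (λ a b → a + 2 * b) (value-scale x ys) (go xs)) (rearrange x (value xs) (value ys)))

⌈n/2⌉≤ : ∀ n k → n ≤ 2 * k → ⌈ n /2⌉ ≤ k
⌈n/2⌉≤ n k n≤ = ≤-trans (⌈n/2⌉-mono n≤) (≤-reflexive (sym (trans (n≡⌈n+n/2⌉ k) (cong (λ j → ⌈ k + j /2⌉) (sym (+-identityʳ k))))))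

≤⌊n/2⌋ : ∀ n k → 2 * k ≤ n → k ≤ ⌊ n /2⌋
≤⌊n/2⌋ n k ≤n = ≤-trans (≤-reflexive (trans (n≡⌊n+n/2⌋ k) (cong (λ j → ⌊ k + j /2⌋) (sym (+-identityʳ k))))) (⌊n/2⌋-mono ≤n)

≤2⌈n/2⌉ : ∀ n → n ≤ 2 * ⌈ n /2⌉
≤2⌈n/2⌉ n = ≤-trans (≤-reflexive (sym (⌊n/2⌋+⌈n/2⌉≡n n))) (≤-trans (+-monoˡ-≤ ⌈ n /2⌉ (⌊n/2⌋≤⌈n/2⌉ n))
  (≤-reflexive (cong (⌈ n /2⌉ +_) (sym (+-identityʳ _)))))

2⌊n/2⌋≤ : ∀ n → 2 * ⌊ n /2⌋ ≤ n
2⌊n/2⌋≤ n = ≤-trans (≤-reflexive (cong (⌊ n /2⌋ +_) (+-identityʳ _))) (≤-trans (+-monoʳ-≤ ⌊ n /2⌋ (⌊n/2⌋≤⌈n/2⌉ n))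
  (≤-reflexive (⌊n/2⌋+⌈n/2⌉≡n n)))

-- For whole numbers, k + 2 X ≤ 2 Y holds exactly if X plus half of k rounded up is at most Y, and 2
-- X ≤ k + 2 Y exactly if X is at most Y plus half of k rounded down. Hence the carry on the left is
-- rounded up and the one on the right is rounded down.
carry-step : ∀ x y c e X Y → let c₁ , e₁ = carry (x , y) (c , e) in
  leq ((x + 2 * X) + c) ((y + 2 * Y) + e) ≡ leq (X + c₁) (Y + e₁)
carry-step x y c e X Y with ≤-total (x + c) (y + e)
... | inj₁ below = leq-cong to from
  where
  k = (y + e) ∸ (x + c)
  c₁≡0 : ⌈ (x + c) ∸ (y + e) /2⌉ ≡ 0
  c₁≡0 = cong ⌈_/2⌉ (m≤n⇒m∸n≡0 below)
  drop-c : X + ⌈ (x + c) ∸ (y + e) /2⌉ ≡ X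
  drop-c = trans (cong (X +_) c₁≡0) (+-identityʳ X)
  left : ∀ x X c → (x + 2 * X) + c ≡ x + c + 2 * X
  left = solve-∀
  right : (y + 2 * Y) + e ≡ x + c + (k + 2 * Y)
  right = trans (left y Y e) (trans (cong (_+ 2 * Y) (sym (m+[n∸m]≡n below))) (+-assoc (x + c) k _))
  to : (x + 2 * X) + c ≤ (y + 2 * Y) + e → X + ⌈ (x + c) ∸ (y + e) /2⌉ ≤ Y + ⌊ k /2⌋
  to h = begin
    X + ⌈ (x + c) ∸ (y + e) /2⌉ ≡⟨ drop-c ⟩
    X                    ≤⟨ m≤n+m∸n X Y ⟩
    Y + (X ∸ Y)          ≤⟨ +-monoʳ-≤ Y (≤⌊n/2⌋ k (X ∸ Y) (begin
      2 * (X ∸ Y)        ≡⟨ *-distribˡ-∸ 2 X Y ⟩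
      2 * X ∸ 2 * Y      ≤⟨ m≤n+o⇒m∸n≤o (2 * X) (2 * Y) (+-cancelˡ-≤ (x + c) _ _
                              (≤-trans (≤-reflexive (sym (left x X c))) (≤-trans h (≤-reflexive
                                (trans right (cong (x + c +_) (+-comm k _))))))) ⟩
      k                  ∎)) ⟩
    Y + ⌊ k /2⌋          ∎
    where
    open ≤-Reasoning
  from : X + ⌈ (x + c) ∸ (y + e) /2⌉ ≤ Y + ⌊ k /2⌋ → (x + 2 * X) + c ≤ (y + 2 * Y) + e
  from h = begin
    (x + 2 * X) + c             ≡⟨ left x X c ⟩
    x + c + 2 * X               ≤⟨ +-monoʳ-≤ (x + c) (*-monoʳ-≤ 2 (≤-trans (≤-reflexive (sym drop-c)) h)) ⟩
    x + c + 2 * (Y + ⌊ k /2⌋)   ≡⟨ cong (x + c +_) (*-distribˡ-+ 2 Y _) ⟩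
    x + c + (2 * Y + 2 * ⌊ k /2⌋) ≤⟨ +-monoʳ-≤ (x + c) (+-monoʳ-≤ (2 * Y) (2⌊n/2⌋≤ k)) ⟩
    x + c + (2 * Y + k)         ≡⟨ cong (x + c +_) (+-comm (2 * Y) k) ⟩
    x + c + (k + 2 * Y)         ≡⟨ right ⟨
    (y + 2 * Y) + e             ∎
    where open ≤-Reasoning
... | inj₂ above = leq-cong to from
  where
  k = (x + c) ∸ (y + e)
  e₁≡0 : ⌊ (y + e) ∸ (x + c) /2⌋ ≡ 0
  e₁≡0 = cong ⌊_/2⌋ (m≤n⇒m∸n≡0 above)
  drop-e : Y + ⌊ (y + e) ∸ (x + c) /2⌋ ≡ Y
  drop-e = trans (cong (Y +_) e₁≡0) (+-identityʳ Y)
  right : ∀ y Y e → (y + 2 * Y) + e ≡ y + e + 2 * Y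
  right = solve-∀
  left : (x + 2 * X) + c ≡ y + e + (k + 2 * X)
  left = trans (right x X c) (trans (cong (_+ 2 * X) (sym (m+[n∸m]≡n above))) (+-assoc (y + e) k _))
  to : (x + 2 * X) + c ≤ (y + 2 * Y) + e → X + ⌈ k /2⌉ ≤ Y + ⌊ (y + e) ∸ (x + c) /2⌋
  to h = begin
    X + ⌈ k /2⌉        ≤⟨ +-monoʳ-≤ X (⌈n/2⌉≤ k (Y ∸ X) (begin
      k                ≤⟨ m+n≤o⇒m≤o∸n k bounded ⟩
      2 * Y ∸ 2 * X    ≡⟨ *-distribˡ-∸ 2 Y X ⟨
      2 * (Y ∸ X)      ∎)) ⟩
    X + (Y ∸ X)        ≡⟨ m+[n∸m]≡n {X} (*-cancelˡ-≤ {X} {Y} 2 (≤-trans (m≤n+m (2 * X) k) bounded)) ⟩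
    Y                  ≡⟨ drop-e ⟨
    Y + ⌊ (y + e) ∸ (x + c) /2⌋ ∎
    where
    open ≤-Reasoning
    bounded : k + 2 * X ≤ 2 * Y
    bounded = +-cancelˡ-≤ (y + e) _ _ (≤-trans (≤-reflexive (sym left)) (≤-trans h (≤-reflexive (right y Y e))))
  from : X + ⌈ k /2⌉ ≤ Y + ⌊ (y + e) ∸ (x + c) /2⌋ → (x + 2 * X) + c ≤ (y + 2 * Y) + e
  from h = begin
    (x + 2 * X) + c              ≡⟨ left ⟩
    y + e + (k + 2 * X)          ≤⟨ +-monoʳ-≤ (y + e) (+-monoˡ-≤ (2 * X) (≤2⌈n/2⌉ k)) ⟩
    y + e + (2 * ⌈ k /2⌉ + 2 * X) ≡⟨ cong (y + e +_) (trans (+-comm (2 * ⌈ k /2⌉) _) (sym (*-distribˡ-+ 2 X _))) ⟩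
    y + e + 2 * (X + ⌈ k /2⌉)    ≤⟨ +-monoʳ-≤ (y + e) (*-monoʳ-≤ 2 (≤-trans h (≤-reflexive drop-e))) ⟩
    y + e + 2 * Y                ≡⟨ right y Y e ⟨
    (y + 2 * Y) + e              ∎
    where open ≤-Reasoning

leD-value : ∀ xs ys → leD xs ys ≡ leq (value xs) (value ys)
leD-value xs ys = trans (leD-unfold xs ys) (trans (sym (invariant (align xs ys) 0 0))
  (cong₂ leq (trans (+-identityʳ _) (trans (cong value (align-applyUpTo proj₁ xs ys)) (value-at xs _ (m≤m+n _ _))))
             (trans (+-identityʳ _) (trans (cong value (align-applyUpTo proj₂ xs ys)) (value-at ys (length xs + length ys) (m≤n+m _ _))))))
  where
  invariant : ∀ ps c e → leq (value (map proj₁ ps) + c) (value (map proj₂ ps) + e) ≡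
    leq (proj₁ (foldl (λ s p → carry p s) (c , e) ps)) (proj₂ (foldl (λ s p → carry p s) (c , e) ps))
  invariant []             c e = refl
  invariant ((x , y) ∷ ps) c e = trans (carry-step x y c e (value (map proj₁ ps)) (value (map proj₂ ps))) (invariant ps _ _)

module _ {Γ : Set} {{_ : Coding Γ}} where

  mulDᴾ : {f g : Γ → List ℕ} → Poly f → Poly g → Poly (λ γ → mulD (f γ) (g γ))
  mulDᴾ {f} {g} fᴾ gᴾ = extensional (λ γ → sym (mulD-unfold (f γ) (g γ)))
    (foldrᴾ (addDᴾ (scaleᴾ (fst-of sndᴾ) (gᴾ ∘ᴾ fstᴾ)) (constᴾ 0 ∷ᴾ snd-of sndᴾ)) (constᴾ []) fᴾ
    (growth scaled ⊕ constant 2) (λ γ x s → begin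
      ∥ addD (scale x (g γ)) (0 ∷ s) ∥      ≤⟨ size-addD (scale x (g γ)) (0 ∷ s) ⟩
      ∥ scale x (g γ) ∥ + (2 + ∥ s ∥)        ≤⟨ +-monoˡ-≤ (2 + ∥ s ∥) (size-bound scaled (γ , x)) ⟩
      eval (growth scaled) ∥ γ , x ∥ + (2 + ∥ s ∥) ≡⟨ rearrange (eval (growth scaled) ∥ γ , x ∥) (∥ s ∥) ⟩
      ∥ s ∥ + (eval (growth scaled) ∥ γ , x ∥ + 2) ∎))
    where
    open ≤-Reasoning
    scaled : Poly (λ (γ , x) → scale x (g γ))
    scaled = scaleᴾ sndᴾ (gᴾ ∘ᴾ fstᴾ)
    rearrange : ∀ a b → a + (2 + b) ≡ b + (a + 2)
    rearrange = solve-∀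

  leDᴾ : {f g : Γ → List ℕ} → Poly f → Poly g → Poly (λ γ → leD (f γ) (g γ))
  leDᴾ {f} {g} fᴾ gᴾ = extensional (λ γ → sym (leD-unfold (f γ) (g γ))) (leqᴾ (fst-of carries) (snd-of carries))
    where
    sums : Poly {Γ × (ℕ × ℕ) × (ℕ × ℕ)} (λ (_ , (x , y) , (c , e)) → (x + c) , (y + e))
    sums = (fst-of (fst-of sndᴾ) +ᴾ fst-of (snd-of sndᴾ)) ,ᴾ (snd-of (fst-of sndᴾ) +ᴾ snd-of (snd-of sndᴾ))
    carryᴾ : Poly {Γ × (ℕ × ℕ) × (ℕ × ℕ)} (λ (_ , p , s) → carry p s)
    carryᴾ = snd-of (halvesᴾ (fst-of sums ∸ᴾ snd-of sums)) ,ᴾ fst-of (halvesᴾ (snd-of sums ∸ᴾ fst-of sums))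
    carries : Poly (λ γ → foldl (λ s p → carry p s) (0 , 0) (align (f γ) (g γ)))
    carries = foldlᴾ carryᴾ (constᴾ (0 , 0)) (alignᴾ fᴾ gᴾ) var (λ γ (x , y) (c , e) → begin
      suc (∥ ⌈ (x + c) ∸ (y + e) /2⌉ ∥ + ∥ ⌊ (y + e) ∸ (x + c) /2⌋ ∥)
        ≡⟨ cong₂ (λ a b → suc (a + b)) (size-ℕ ⌈ (x + c) ∸ (y + e) /2⌉) (size-ℕ ⌊ (y + e) ∸ (x + c) /2⌋) ⟩
      suc (suc (2 * ⌈ (x + c) ∸ (y + e) /2⌉) + suc (2 * ⌊ (y + e) ∸ (x + c) /2⌋))
        ≤⟨ s≤s (+-mono-≤ (s≤s (*-monoʳ-≤ 2 (≤-trans (⌈n/2⌉≤n _) (m∸n≤m (x + c) (y + e)))))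
                         (s≤s (*-monoʳ-≤ 2 (≤-trans (⌊n/2⌋≤n _) (m∸n≤m (y + e) (x + c)))))) ⟩
      suc (suc (2 * (x + c)) + suc (2 * (y + e)))
        ≤⟨ m≤m+n _ (3 + (1 + ∥ γ ∥)) ⟩
      suc (suc (2 * (x + c)) + suc (2 * (y + e))) + (3 + (1 + ∥ γ ∥))
        ≡⟨ rearrange x y c e (∥ γ ∥) ⟩
      suc (suc (2 * c) + suc (2 * e)) + suc (∥ γ ∥ + suc (suc (2 * x) + suc (2 * y)))
        ≡⟨ cong₂ _+_ (cong₂ (λ a b → suc (a + b)) (size-ℕ c) (size-ℕ e))
             (cong (λ k → suc (∥ γ ∥ + suc k)) (cong₂ _+_ (size-ℕ x) (size-ℕ y))) ⟨
      ∥ c , e ∥ + ∥ γ , x , y ∥ ∎)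
      where
      open ≤-Reasoning
      rearrange : ∀ x y c e g → suc (suc (2 * (x + c)) + suc (2 * (y + e))) + (3 + (1 + g)) ≡
                  suc (suc (2 * c) + suc (2 * e)) + suc (g + suc (suc (2 * x) + suc (2 * y)))
      rearrange = solve-∀

-- Encodings

-- A rational is held as its sign bit and the digits that its encoding
-- spells out: for a negative numerator these are those of ∣ ↥ q ∣ ∸ 1.
Rat : Set
Rat = (Bool × List ℕ) × List ℕ

digit : Bool → ℕ
digit b = if b then 1 else 2

readDigit : List ℕ × List Bool → List ℕ × List Bool
readDigit (acc , true ∷ b ∷ bs) = digit b ∷ acc , bs
readDigit s                     = s

-- The bits serve twice, as data and as a supply of rounds that is certainly long enough; once the
-- terminating false is reached, `readDigit` changes nothing.
readDigits : List Bool → List ℕ × List Bool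
readDigits bits = foldl (λ s _ → readDigit s) ([] , bits) bits

readℕ : List Bool → List ℕ × List Bool
readℕ bits = List.reverse (proj₁ (readDigits bits)) , tail (proj₂ (readDigits bits))

readRat : List Bool → Rat × List Bool
readRat bits =
  ((at false bits 0 , proj₁ (readℕ (tail bits))) , proj₁ (readℕ (proj₂ (readℕ (tail bits)))))
  , proj₂ (readℕ (proj₂ (readℕ (tail bits))))

skipRats : ℕ → List Bool → List Bool
skipRats = iter (proj₂ ∘ readRat)

-- Each entry is found by skipping its predecessors from the start. This takes quadratic work, but
-- the state of the skipping loop is merely the remaining bits, whose size never grows.
readRats : ℕ → List Bool → List Rat
readRats n bits = map (λ i → proj₁ (readRat (skipRats i bits))) (upTo n)

-- Numbers are read into unary only up to a limit.
clip : ℕ → List ℕ → ℕ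
clip limit ds = foldr (λ d acc → limit ∸ (limit ∸ (d + (acc + acc)))) 0 ds

-- Truncation at every digit agrees with truncation at the end, because an accumulator that has
-- reached the limit stays there. The double subtraction in `clip` is the minimum.
clip-value : ∀ limit ds → clip limit ds ≡ limit ⊓ value ds
clip-value limit []       = sym (⊓-zeroʳ limit)
clip-value limit (d ∷ ds) = trans (sym (m⊓n≡m∸[m∸n] limit (d + (clip limit ds + clip limit ds)))) (same (clip-value limit ds))
  where
  m⊓n≡m∸[m∸n] : ∀ m n → m ⊓ n ≡ m ∸ (m ∸ n)
  m⊓n≡m∸[m∸n] m n with ≤-total n m
  ... | inj₁ n≤m = trans (m≥n⇒m⊓n≡n n≤m) (sym (m∸[m∸n]≡n n≤m))
  ... | inj₂ m≤n = trans (m≤n⇒m⊓n≡m m≤n) (cong (m ∸_) (sym (m≤n⇒m∸n≡0 m≤n)))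
  same : ∀ {c} → c ≡ limit ⊓ value ds → limit ⊓ (d + (c + c)) ≡ limit ⊓ (d + 2 * value ds)
  same refl with ≤-total (value ds) limit
  ... | inj₁ v≤l rewrite m≥n⇒m⊓n≡n v≤l = cong (λ k → limit ⊓ (d + (value ds + k))) (sym (+-identityʳ _))
  ... | inj₂ l≤v rewrite m≤n⇒m⊓n≡m l≤v =
    trans (m≤n⇒m⊓n≡m (≤-trans (m≤m+n limit limit) (m≤n+m _ d)))
          (sym (m≤n⇒m⊓n≡m (≤-trans l≤v (≤-trans (m≤m+n (value ds) _) (m≤n+m _ d)))))

writeDigits : List ℕ → List Bool
writeDigits ds = List.concatMap (λ d → true ∷ isZero (d ∸ 1) ∷ []) ds ++ false ∷ []

writeRat : Rat → List Bool
writeRat ((s , num) , den) = s ∷ writeDigits num ++ writeDigits den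

digitsᵇ : ℕᵇ → List ℕ
digitsᵇ zero     = []
digitsᵇ 2[1+ n ] = 2 ∷ digitsᵇ n
digitsᵇ 1+[2 n ] = 1 ∷ digitsᵇ n

value-digitsᵇ : ∀ n → value (digitsᵇ n) ≡ toℕ n
value-digitsᵇ zero     = refl
value-digitsᵇ 2[1+ n ] = trans (cong (λ k → 2 + 2 * k) (value-digitsᵇ n)) (sym (*-suc 2 (toℕ n)))
value-digitsᵇ 1+[2 n ] = cong (λ k → 1 + 2 * k) (value-digitsᵇ n)

writeDigits-digitsᵇ : ∀ n → writeDigits (digitsᵇ n) ≡ encodeℕᵇ n
writeDigits-digitsᵇ zero     = refl
writeDigits-digitsᵇ 2[1+ n ] = cong (λ bs → true ∷ false ∷ bs) (writeDigits-digitsᵇ n)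
writeDigits-digitsᵇ 1+[2 n ] = cong (λ bs → true ∷ true ∷ bs) (writeDigits-digitsᵇ n)

digits : ℕ → List ℕ
digits n = digitsᵇ (fromℕ n)

value-digits : ∀ n → value (digits n) ≡ n
value-digits n = trans (value-digitsᵇ (fromℕ n)) (ℕᵇ.toℕ-fromℕ n)

signDigits : ℤ → Bool × List ℕ
signDigits (ℤ.+ n)    = false , digits n
signDigits ℤ.-[1+ n ] = true , digits n

ratData : ℚ → Rat
ratData q = signDigits (↥ q) , digits (↧ₙ q)

writeRat-ratData : ∀ q → writeRat (ratData q) ≡ encodeℚ q
writeRat-ratData q = trans (cong (λ bs → proj₁ (signDigits (↥ q)) ∷ writeDigits (proj₂ (signDigits (↥ q))) ++ bs)
    (writeDigits-digitsᵇ (fromℕ (↧ₙ q)))) (cong (_++ encodeℕ (↧ₙ q)) (numerator (↥ q)))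
  where
  numerator : ∀ z → proj₁ (signDigits z) ∷ writeDigits (proj₂ (signDigits z)) ≡ encodeℤ z
  numerator (ℤ.+ n)    = cong (false ∷_) (writeDigits-digitsᵇ (fromℕ n))
  numerator ℤ.-[1+ n ] = cong (true ∷_) (writeDigits-digitsᵇ (fromℕ n))

readDigits-encodeℕᵇ : ∀ us n acc rest → length (digitsᵇ n) ≤ length us →
  foldl (λ s (_ : Bool) → readDigit s) (acc , encodeℕᵇ n ++ rest) us ≡ (digitsᵇ n ʳ++ acc , false ∷ rest)
readDigits-encodeℕᵇ []       zero     acc rest _        = refl
readDigits-encodeℕᵇ (u ∷ us) zero     acc rest _        = readDigits-encodeℕᵇ us zero acc rest z≤n
readDigits-encodeℕᵇ (u ∷ us) 2[1+ n ] acc rest (s≤s l≤) = readDigits-encodeℕᵇ us n (2 ∷ acc) rest l≤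
readDigits-encodeℕᵇ (u ∷ us) 1+[2 n ] acc rest (s≤s l≤) = readDigits-encodeℕᵇ us n (1 ∷ acc) rest l≤

length-encodeℕᵇ : ∀ n → length (encodeℕᵇ n) ≡ suc (2 * length (digitsᵇ n))
length-encodeℕᵇ zero     = refl
length-encodeℕᵇ 2[1+ n ] = trans (cong (2 +_) (length-encodeℕᵇ n)) (cong suc (sym (*-suc 2 _)))
length-encodeℕᵇ 1+[2 n ] = trans (cong (2 +_) (length-encodeℕᵇ n)) (cong suc (sym (*-suc 2 _)))

readℕ-encodeℕ : ∀ n rest → readℕ (encodeℕ n ++ rest) ≡ (digits n , rest)
readℕ-encodeℕ n rest = trans
  (cong (λ (ds , bs) → List.reverse ds , tail bs) (readDigits-encodeℕᵇ (encodeℕ n ++ rest) (fromℕ n) [] rest enough))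
  (cong (_, rest) (trans (List.ʳ++-ʳ++ (digits n)) (List.++-identityʳ (digits n))))
  where
  enough : length (digits n) ≤ length (encodeℕ n ++ rest)
  enough = ≤-trans (≤-trans (≤-trans (m≤m+n _ _) (n≤1+n _)) (≤-reflexive (sym (length-encodeℕᵇ (fromℕ n)))))
    (≤-trans (m≤m+n _ (length rest)) (≤-reflexive (sym (List.length-++ (encodeℕ n)))))

readRat-encodeℚ : ∀ q rest → readRat (encodeℚ q ++ rest) ≡ (ratData q , rest)
readRat-encodeℚ q rest = trans (cong readRat (List.++-assoc (encodeℤ (↥ q)) (encodeℕ (↧ₙ q)) rest)) (go (↥ q))
  where
  unsigned : ∀ b n d → readRat (b ∷ encodeℕ n ++ encodeℕ d ++ rest) ≡ (((b , digits n) , digits d) , rest)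
  unsigned b n d = trans
    (cong (λ r → ((b , proj₁ r) , proj₁ (readℕ (proj₂ r))) , proj₂ (readℕ (proj₂ r))) (readℕ-encodeℕ n (encodeℕ d ++ rest)))
    (cong (λ r → ((b , digits n) , proj₁ r) , proj₂ r) (readℕ-encodeℕ d rest))
  go : ∀ z → readRat (encodeℤ z ++ encodeℕ (↧ₙ q) ++ rest) ≡ ((signDigits z , digits (↧ₙ q)) , rest)
  go (ℤ.+ n)    = unsigned false n (↧ₙ q)
  go ℤ.-[1+ n ] = unsigned true n (↧ₙ q)

skipRats-encode : ∀ qs rest → skipRats (length qs) (List.concatMap encodeℚ qs ++ rest) ≡ rest
skipRats-encode []       rest = refl
skipRats-encode (q ∷ qs) rest = trans (cong (skipRats (length qs)) (trans
  (cong (proj₂ ∘ readRat) (List.++-assoc (encodeℚ q) (List.concatMap encodeℚ qs) rest))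
  (cong proj₂ (readRat-encodeℚ q (List.concatMap encodeℚ qs ++ rest))))) (skipRats-encode qs rest)

readRats-encode : ∀ qs rest → readRats (length qs) (List.concatMap encodeℚ qs ++ rest) ≡ map ratData qs
readRats-encode qs rest = trans (List.map-upTo _ (length qs)) (go qs)
  where
  go : ∀ qs → List.applyUpTo (λ i → proj₁ (readRat (skipRats i (List.concatMap encodeℚ qs ++ rest)))) (length qs) ≡ map ratData qs
  go []       = refl
  go (q ∷ qs) = cong₂ _∷_ (cong proj₁ first)
    (trans (cong (λ bs → List.applyUpTo (λ i → proj₁ (readRat (skipRats i bs))) (length qs)) (cong proj₂ first)) (go qs))
    where
    first : readRat ((encodeℚ q ++ List.concatMap encodeℚ qs) ++ rest) ≡ (ratData q , List.concatMap encodeℚ qs ++ rest)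
    first = trans (cong readRat (List.++-assoc (encodeℚ q) (List.concatMap encodeℚ qs) rest))
                  (readRat-encodeℚ q (List.concatMap encodeℚ qs ++ rest))

readDigit-shrinks : ∀ s → ∥ proj₂ (readDigit s) ∥ ≤ ∥ proj₂ s ∥
readDigit-shrinks (acc , [])               = ≤-refl
readDigit-shrinks (acc , false ∷ bs)       = ≤-refl
readDigit-shrinks (acc , true ∷ [])        = ≤-refl
readDigit-shrinks (acc , true ∷ b ∷ bs)    = ≤-trans (size-right ⌜ b ⌝ ⌜ bs ⌝) (size-right ⌜ true ⌝ ⌜ b ∷ bs ⌝)

size-readDigit : ∀ s → ∥ readDigit s ∥ ≤ ∥ s ∥ + 6
size-readDigit (acc , [])            = m≤m+n _ 6
size-readDigit (acc , false ∷ bs)    = m≤m+n _ 6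
size-readDigit (acc , true ∷ [])     = m≤m+n _ 6
size-readDigit (acc , true ∷ b ∷ bs) = begin
  suc (suc (∥ digit b ∥ + ∥ acc ∥) + ∥ bs ∥)      ≤⟨ s≤s (+-monoˡ-≤ ∥ bs ∥ (s≤s (+-monoˡ-≤ ∥ acc ∥ (digit-size b)))) ⟩
  suc (suc (5 + ∥ acc ∥) + ∥ bs ∥)                ≤⟨ m≤n+m _ (5 + ∥ b ∥) ⟩
  5 + ∥ b ∥ + suc (suc (5 + ∥ acc ∥) + ∥ bs ∥)    ≡⟨ rearrange (∥ acc ∥) (∥ b ∥) (∥ bs ∥) ⟩
  suc (∥ acc ∥ + suc (3 + suc (∥ b ∥ + ∥ bs ∥))) + 6 ∎
  where
  open ≤-Reasoning
  digit-size : ∀ b → ∥ digit b ∥ ≤ 5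
  digit-size true  = s≤s (s≤s (s≤s z≤n))
  digit-size false = ≤-refl
  rearrange : ∀ a b c → 5 + b + suc (suc (5 + a) + c) ≡ suc (a + suc (3 + suc (b + c))) + 6
  rearrange = solve-∀

readℕ-shrinks : ∀ bits → ∥ proj₂ (readℕ bits) ∥ ≤ ∥ bits ∥
readℕ-shrinks bits = ≤-trans (size-tail (proj₂ (readDigits bits))) (go bits ([] , bits))
  where
  go : ∀ (us : List Bool) s → ∥ proj₂ (foldl (λ s _ → readDigit s) s us) ∥ ≤ ∥ proj₂ s ∥
  go []       s = ≤-refl
  go (u ∷ us) s = ≤-trans (go us (readDigit s)) (readDigit-shrinks s)

readRat-shrinks : ∀ bits → ∥ proj₂ (readRat bits) ∥ ≤ ∥ bits ∥
readRat-shrinks bits = ≤-trans (readℕ-shrinks _) (≤-trans (readℕ-shrinks (tail bits)) (size-tail bits))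

readDigitᴾ : Poly readDigit
readDigitᴾ = extensional view (maybeᴾ (unconsᴾ sndᴾ) idᴾ (ifᴾ (fst-of sndᴾ)
  (maybeᴾ (unconsᴾ (snd-of sndᴾ)) fstᴾ
    ((ifᴾ (fst-of sndᴾ) (constᴾ 1) (constᴾ 2) ∷ᴾ fst-of (fst-of fstᴾ)) ,ᴾ snd-of sndᴾ))
  fstᴾ))
  where
  view : ∀ s → maybe′ (λ (b , bs) → if b then maybe′ (λ (c , cs) → digit c ∷ proj₁ s , cs) s (uncons bs) else s)
                      s (uncons (proj₂ s)) ≡ readDigit s
  view (acc , [])            = refl
  view (acc , false ∷ bs)    = refl
  view (acc , true ∷ [])     = refl
  view (acc , true ∷ b ∷ bs) = refl

module _ {Γ : Set} {{_ : Coding Γ}} where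

  readℕᴾ : {f : Γ → List Bool} → Poly f → Poly (λ γ → readℕ (f γ))
  readℕᴾ {f} fᴾ = reverseᴾ (fst-of read) ,ᴾ tailᴾ (snd-of read)
    where
    read : Poly (λ γ → readDigits (f γ))
    read = foldlᴾ {step = λ (_ , _ , s) → readDigit s} (readDigitᴾ ∘ᴾ snd-of sndᴾ) (constᴾ [] ,ᴾ fᴾ) fᴾ (constant 6)
             (λ _ _ s → size-readDigit s)

  clipᴾ : {limit : Γ → ℕ} {ds : Γ → List ℕ} → Poly limit → Poly ds → Poly (λ γ → clip (limit γ) (ds γ))
  clipᴾ {limit} limitᴾ dsᴾ = foldrᴾ {step = step} ((limitᴾ ∘ᴾ fstᴾ) ∸ᴾ ((limitᴾ ∘ᴾ fstᴾ) ∸ᴾ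
      (fst-of sndᴾ +ᴾ (snd-of sndᴾ +ᴾ snd-of sndᴾ)))) (constᴾ 0) dsᴾ (growth (limitᴾ ∘ᴾ fstᴾ)) small
    where
    step : Γ × ℕ × ℕ → ℕ
    step (γ , d , acc) = limit γ ∸ (limit γ ∸ (d + (acc + acc)))
    small : ∀ γ d acc → ∥ step (γ , d , acc) ∥ ≤ ∥ acc ∥ + eval (growth (limitᴾ ∘ᴾ fstᴾ)) ∥ γ , d ∥
    small γ d acc = begin
      ∥ step (γ , d , acc) ∥                       ≡⟨ size-ℕ (step (γ , d , acc)) ⟩
      suc (2 * step (γ , d , acc))                 ≤⟨ s≤s (*-monoʳ-≤ 2 (m∸n≤m (limit γ) (limit γ ∸ (d + (acc + acc))))) ⟩
      suc (2 * limit γ)                            ≡⟨ size-ℕ (limit γ) ⟨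
      ∥ limit γ ∥                                  ≤⟨ size-bound (limitᴾ ∘ᴾ fstᴾ) (γ , d) ⟩
      eval (growth (limitᴾ ∘ᴾ fstᴾ)) ∥ γ , d ∥     ≤⟨ m≤n+m _ ∥ acc ∥ ⟩
      ∥ acc ∥ + eval (growth (limitᴾ ∘ᴾ fstᴾ)) ∥ γ , d ∥ ∎
      where open ≤-Reasoning

  writeDigitsᴾ : {f : Γ → List ℕ} → Poly f → Poly (λ γ → writeDigits (f γ))
  writeDigitsᴾ fᴾ = concatMapᴾ (constᴾ true ∷ᴾ isZeroᴾ (sndᴾ ∸ᴾ constᴾ 1) ∷ᴾ constᴾ []) fᴾ ++ᴾ constᴾ (false ∷ [])

module _ {Γ : Set} {{_ : Coding Γ}} where

  readRatᴾ : {f : Γ → List Bool} → Poly f → Poly (λ γ → readRat (f γ))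
  readRatᴾ fᴾ = ((headᴾ false fᴾ ,ᴾ fst-of (readℕᴾ (tailᴾ fᴾ))) ,ᴾ fst-of second) ,ᴾ snd-of second
    where second = readℕᴾ (snd-of (readℕᴾ (tailᴾ fᴾ)))

  writeRatᴾ : {f : Γ → Rat} → Poly f → Poly (λ γ → writeRat (f γ))
  writeRatᴾ fᴾ = fst-of (fst-of fᴾ) ∷ᴾ (writeDigitsᴾ (snd-of (fst-of fᴾ)) ++ᴾ writeDigitsᴾ (snd-of fᴾ))

module _ {Γ : Set} {{_ : Coding Γ}} where

  skipRatsᴾ : {n : Γ → ℕ} {f : Γ → List Bool} → Poly n → Poly f → Poly (λ γ → skipRats (n γ) (f γ))
  skipRatsᴾ {n} {f} nᴾ fᴾ = extensional (λ γ → fold-iter (n γ) (f γ))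
    (foldlᴾ {step = λ (_ , _ , s) → proj₂ (readRat s)} (snd-of (readRatᴾ (snd-of sndᴾ))) fᴾ (asListᴾ nᴾ) (constant 0)
      (λ _ _ bits → ≤-trans (readRat-shrinks bits) (m≤m+n _ 0)))
    where
    fold-iter : ∀ k s → foldl (λ s _ → proj₂ (readRat s)) s (List.replicate k tt) ≡ skipRats k s
    fold-iter zero    s = refl
    fold-iter (suc k) s = fold-iter k (proj₂ (readRat s))

module _ {Γ : Set} {{_ : Coding Γ}} where

  readRatsᴾ : {n : Γ → ℕ} {f : Γ → List Bool} → Poly n → Poly f → Poly (λ γ → readRats (n γ) (f γ))
  readRatsᴾ nᴾ fᴾ = mapᴾ (fst-of (readRatᴾ (skipRatsᴾ sndᴾ (fᴾ ∘ᴾ fstᴾ)))) (upToᴾ nᴾ)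

-- The relaxation and its approximate solution

-- Order, demand, adjacency matrix and weights.
Graphᴸ : Set
Graphᴸ = ℕ × ℕ × List (List Bool) × List Rat

-- (0 , v , _), (1 , v , u) and (2 , v , u) index the constraints
--   Σ_{u ∈ N(v)} z v u + m x v ≥ m,   x u ≥ z v u,   1 ≥ z v u + x v,
-- and (v , 0) and (v , suc u) index the variables x v and z v u.
Row Var : Set
Row = ℕ × ℕ × ℕ
Var = ℕ × ℕ

Assignment : Set
Assignment = List (List Bool)

bit : Bool → ℕ
bit b = if b then 1 else 0

eqℕ : ℕ → ℕ → Bool
eqℕ a b = isZero ((a ∸ b) + (b ∸ a))

byKind : {A : Set} → ℕ → A → A → A → A
byKind k a b c = if isZero k then a else (if isZero (k ∸ 1) then b else c)

zeroRat : Rat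
zeroRat = (false , []) , 1 ∷ []

num den : Rat → List ℕ
num r = proj₂ (proj₁ r)
den r = proj₂ r

-- Signs are ignored: the comparison is meant for weights, which are nonnegative, and for these
-- `num` holds the numerator itself.
leRat : Rat → Rat → Bool
leRat r s = leD (mulD (num r) (den s)) (mulD (num s) (den r))

adjacent : List (List Bool) → ℕ → ℕ → Bool
adjacent adj v u = at false (at [] adj v) u

rowsOf : ℕ → List Row
rowsOf n = List.concatMap (λ k → List.concatMap (λ v → map (λ u → k , v , u) (upTo n)) (upTo n)) (upTo 3)

varsOf : ℕ → List Var
varsOf n = List.concatMap (λ v → map (λ j → v , j) (upTo (suc n))) (upTo n)

holds : Assignment → Var → Bool
holds X (v , j) = at false (at [] X v) j

-- Each constraint takes the form usage ≤ supply with natural coefficients on both sides, so that no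
-- negative number occurs in the method.
supplyConst usageConst : Graphᴸ → Row → ℕ
supplyConst (n , m , adj , ws) (k , v , u) = byKind k 0 0 1
usageConst  (n , m , adj , ws) (k , v , u) = byKind k m 0 0

supplyCoef usageCoef : Graphᴸ → Row → Var → ℕ
supplyCoef (n , m , adj , ws) (k , v , u) (w , j) = byKind k
  (if eqℕ w v then (if isZero j then m else bit (adjacent adj v (j ∸ 1))) else 0)
  (bit (eqℕ w u ∧ isZero j))
  0
usageCoef (n , m , adj , ws) (k , v , u) (w , j) = byKind k
  0
  (bit (eqℕ w v ∧ eqℕ j (suc u)))
  (bit (eqℕ w v ∧ (isZero j ∨ eqℕ j (suc u))))

supply usage : Graphᴸ → Row → Assignment → ℕ
supply g row X = supplyConst g row + sum (map (λ x → if holds X x then supplyCoef g row x else 0) (varsOf (proj₁ g)))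
usage  g row X = usageConst g row + sum (map (λ x → if holds X x then usageCoef g row x else 0) (varsOf (proj₁ g)))

-- The positive part of the accumulated violation. Divided by the number of rounds it is the
-- violation by the average of the assignments, so small debts mean an almost feasible average.
debt : Graphᴸ → List Assignment → Row → ℕ
debt g H row = sum (map (λ X → usage g row X) H) ∸ sum (map (λ X → supply g row X) H)

-- The debts act as Lagrange multipliers. In the Lagrangian a variable contributes its cost plus
-- `loss` minus `gain`, so the best 0/1 assignment is found variable by variable.
gain loss : Graphᴸ → List Assignment → Var → ℕ
gain g H x = sum (map (λ row → debt g H row * supplyCoef g row x) (rowsOf (proj₁ g)))
loss g H x = sum (map (λ row → debt g H row * usageCoef g row x) (rowsOf (proj₁ g)))

opaque

  -- The increase of the sum of squared debts that one round may cause beyond the drift: there are 3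
  -- n² rows, and the supply and the usage of each are at most 2 n + 1.
  penalty : ℕ → ℕ
  penalty n = 3 * (n * n) * (suc (2 * n) * suc (2 * n))

  -- With T rounds the squared debts turn out to be at most P T (8 n + 1), P being the penalty. The
  -- value of T is chosen so that 16 n times a debt is then at most T. No weight enters.
  rounds : ℕ → ℕ
  rounds n = penalty n * suc (8 * n) * ((16 * n) * (16 * n))

  penalty-unfold : ∀ n → penalty n ≡ 3 * (n * n) * (suc (2 * n) * suc (2 * n))
  penalty-unfold n = refl

  rounds-unfold : ∀ n → rounds n ≡ penalty n * suc (8 * n) * ((16 * n) * (16 * n))
  rounds-unfold n = refl

weightAt : Graphᴸ → ℕ → Rat
weightAt (n , m , adj , ws) v = at zeroRat ws v

-- The test in `worthwhile` is multiplied by the guess and would be vacuous for a variable without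
-- cost if the guess is 0. Such variables are decided by their debts alone.
isFree : Graphᴸ → Var → Bool
isFree g (v , j) = if isZero j then leD (num (weightAt g v)) [] else true

-- The inequality K w + l B ≤ h B with its denominators cleared. Measuring weights in units of the
-- guess B keeps the number of rounds independent of their magnitude.
worthwhile : ℕ → Rat → Rat → ℕ → ℕ → Bool
worthwhile K w B l h = leD (addD (scale K (mulD (num w) (den B))) (scale l (mulD (num B) (den w))))
                           (scale h (mulD (num B) (den w)))

-- The factor 4 `penalty` on the costs makes the additive error of the average cost an eighth of the
-- guess, which is where the factor 9/8 comes from.
select : Graphᴸ → Rat → List Assignment → Var → Bool
select g B H x = if isFree g x then leq (loss g H x) (gain g H x)
  else worthwhile (4 * penalty (proj₁ g)) (weightAt g (proj₁ x)) B (loss g H x) (gain g H x)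

round : Graphᴸ → Rat → List Assignment → Assignment
round g B H = map (λ v → map (λ j → select g B H (v , j)) (upTo (suc (proj₁ g)))) (upTo (proj₁ g))

history : Graphᴸ → Rat → List Assignment
history g B = foldr (λ _ H → round g B H ∷ H) [] (List.replicate (rounds (proj₁ g)) tt)

opaque
  -- A guess is judged by its outcome, as the optimum is unknown: the average must violate no
  -- constraint by more than 1 / (16 n). At most n constraints are added up later, for a total error
  -- of 1/16.
  succeeds : Graphᴸ → Rat → Bool
  succeeds g B = all (λ row → leq (16 * proj₁ g * debt g (history g B) row) (rounds (proj₁ g))) (rowsOf (proj₁ g))

  succeeds-unfold : ∀ g B →
    succeeds g B ≡ all (λ row → leq (16 * proj₁ g * debt g (history g B) row) (rounds (proj₁ g))) (rowsOf (proj₁ g))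
  succeeds-unfold g B = refl

-- Holds at most one entry, a smallest successful candidate. The cost bound needs only a guess that
-- succeeds and is at most the optimum, so the smallest success is as good as the intended guess.
-- The candidate 0 is there for an optimum of 0; the default `B` lets the first success pass the
-- comparison.
successful : Graphᴸ → List Rat
successful g = foldr (λ B best → if succeeds g B ∧ leRat B (at B best 0) then B ∷ [] else best) []
                     (zeroRat ∷ proj₂ (proj₂ (proj₂ g)))

guess : Graphᴸ → Rat
guess g = at zeroRat (successful g) 0

heavyIn : ℕ → List Assignment → ℕ → Bool
heavyIn n H v = leq (3 * rounds n) (8 * sum (map (λ X → bit (holds X (v , 0))) H))

heavy : Graphᴸ → ℕ → Bool
heavy g v = heavyIn (proj₁ g) (history g (guess g)) v

heavies : Graphᴸ → List Bool
heavies g = map (heavy g) (upTo (proj₁ g))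

byKindᴾ : ∀ {Γ A} {{_ : Coding Γ}} {{_ : Coding A}} {k : Γ → ℕ} {a b c : Γ → A} →
  Poly k → Poly a → Poly b → Poly c → Poly (λ γ → byKind (k γ) (a γ) (b γ) (c γ))
byKindᴾ kᴾ aᴾ bᴾ cᴾ = ifᴾ (isZeroᴾ kᴾ) aᴾ (ifᴾ (isZeroᴾ (kᴾ ∸ᴾ constᴾ 1)) bᴾ cᴾ)

module _ {Γ : Set} {{_ : Coding Γ}} where

  bitᴾ : {b : Γ → Bool} → Poly b → Poly (λ γ → bit (b γ))
  bitᴾ bᴾ = ifᴾ bᴾ (constᴾ 1) (constᴾ 0)

  infixr 5 _∨ᴾ_
  _∨ᴾ_ : {a b : Γ → Bool} → Poly a → Poly b → Poly (λ γ → a γ ∨ b γ)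
  _∨ᴾ_ {a} {b} aᴾ bᴾ = extensional (λ γ → table (a γ) (b γ)) (ifᴾ aᴾ (constᴾ true) bᴾ)
    where
    table : ∀ x y → (if x then true else y) ≡ x ∨ y
    table true  y = refl
    table false y = refl

  eqℕᴾ : {a b : Γ → ℕ} → Poly a → Poly b → Poly (λ γ → eqℕ (a γ) (b γ))
  eqℕᴾ aᴾ bᴾ = isZeroᴾ ((aᴾ ∸ᴾ bᴾ) +ᴾ (bᴾ ∸ᴾ aᴾ))

  numᴾ : {r : Γ → Rat} → Poly r → Poly (λ γ → num (r γ))
  numᴾ rᴾ = snd-of (fst-of rᴾ)

  denᴾ : {r : Γ → Rat} → Poly r → Poly (λ γ → den (r γ))
  denᴾ rᴾ = snd-of rᴾ

  leRatᴾ : {r s : Γ → Rat} → Poly r → Poly s → Poly (λ γ → leRat (r γ) (s γ))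
  leRatᴾ rᴾ sᴾ = leDᴾ (mulDᴾ (snd-of (fst-of rᴾ)) (snd-of sᴾ)) (mulDᴾ (snd-of (fst-of sᴾ)) (snd-of rᴾ))

  adjacentᴾ : {adj : Γ → List (List Bool)} {v u : Γ → ℕ} → Poly adj → Poly v → Poly u →
              Poly (λ γ → adjacent (adj γ) (v γ) (u γ))
  adjacentᴾ aᴾ vᴾ uᴾ = atᴾ false (atᴾ [] aᴾ vᴾ) uᴾ

rowsOfᴾ : Poly rowsOf
rowsOfᴾ = concatMapᴾ (concatMapᴾ (mapᴾ (snd-of (fst-of fstᴾ) ,ᴾ snd-of fstᴾ ,ᴾ sndᴾ) (upToᴾ (fst-of fstᴾ))) (upToᴾ fstᴾ)) (constᴾ (upTo 3))

varsOfᴾ : Poly varsOf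
varsOfᴾ = concatMapᴾ (mapᴾ (snd-of fstᴾ ,ᴾ sndᴾ) (upToᴾ (sucᴾ fstᴾ))) (upToᴾ idᴾ)

penaltyᴾ : Poly penalty
penaltyᴾ = extensional (sym ∘ penalty-unfold) (constᴾ 3 *ᴾ (idᴾ *ᴾ idᴾ) *ᴾ (sucᴾ (constᴾ 2 *ᴾ idᴾ) *ᴾ sucᴾ (constᴾ 2 *ᴾ idᴾ)))

roundsᴾ : Poly rounds
roundsᴾ = extensional (sym ∘ rounds-unfold) (penaltyᴾ *ᴾ sucᴾ (constᴾ 8 *ᴾ idᴾ) *ᴾ ((constᴾ 16 *ᴾ idᴾ) *ᴾ (constᴾ 16 *ᴾ idᴾ)))

size-map : ∀ {A B : Set} {{_ : Coding B}} (f : A → B) c → (∀ x → ∥ f x ∥ ≤ c) → ∀ xs → ∥ map f xs ∥ ≤ 1 + length xs * (1 + c)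
size-map f c f≤ []       = ≤-refl
size-map f c f≤ (x ∷ xs) = ≤-trans (s≤s (+-mono-≤ (f≤ x) (size-map f c f≤ xs))) (≤-reflexive (cong suc (+-suc c _)))

module _ {Γ : Set} {{_ : Coding Γ}} where

  orderᴾ : {g : Γ → Graphᴸ} → Poly g → Poly (λ γ → proj₁ (g γ))
  orderᴾ gᴾ = fst-of gᴾ

  requirementᴾ : {g : Γ → Graphᴸ} → Poly g → Poly (λ γ → proj₁ (proj₂ (g γ)))
  requirementᴾ gᴾ = fst-of (snd-of gᴾ)

  adjacencyᴾ : {g : Γ → Graphᴸ} → Poly g → Poly (λ γ → proj₁ (proj₂ (proj₂ (g γ))))
  adjacencyᴾ gᴾ = fst-of (snd-of (snd-of gᴾ))

  weightsᴾ : {g : Γ → Graphᴸ} → Poly g → Poly (λ γ → proj₂ (proj₂ (proj₂ (g γ))))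
  weightsᴾ gᴾ = snd-of (snd-of (snd-of gᴾ))

  weakenGraph : ∀ {A : Set} {{_ : Coding A}} {g : Γ → Graphᴸ} → Poly g → Poly {Γ × A} (λ (γ , _) → g γ)
  weakenGraph gᴾ = weaken gᴾ

  weakenRounds : ∀ {A : Set} {{_ : Coding A}} {H : Γ → List Assignment} → Poly H → Poly {Γ × A} (λ (γ , _) → H γ)
  weakenRounds Hᴾ = weaken Hᴾ

module _ {Γ : Set} {{_ : Coding Γ}} where

  rowsᴾ : {g : Γ → Graphᴸ} → Poly g → Poly (λ γ → rowsOf (proj₁ (g γ)))
  rowsᴾ gᴾ = rowsOfᴾ ∘ᴾ orderᴾ gᴾ

  varsᴾ : {g : Γ → Graphᴸ} → Poly g → Poly (λ γ → varsOf (proj₁ (g γ)))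
  varsᴾ gᴾ = varsOfᴾ ∘ᴾ orderᴾ gᴾ

  holdsᴾ : {X : Γ → Assignment} {x : Γ → Var} → Poly X → Poly x → Poly (λ γ → holds (X γ) (x γ))
  holdsᴾ Xᴾ xᴾ = atᴾ false (atᴾ [] Xᴾ (fst-of xᴾ)) (snd-of xᴾ)

  supplyConstᴾ : {g : Γ → Graphᴸ} {row : Γ → Row} → Poly g → Poly row → Poly (λ γ → supplyConst (g γ) (row γ))
  supplyConstᴾ gᴾ rowᴾ = byKindᴾ (fst-of rowᴾ) (constᴾ 0) (constᴾ 0) (constᴾ 1)

  usageConstᴾ : {g : Γ → Graphᴸ} {row : Γ → Row} → Poly g → Poly row → Poly (λ γ → usageConst (g γ) (row γ))
  usageConstᴾ gᴾ rowᴾ = byKindᴾ (fst-of rowᴾ) (requirementᴾ gᴾ) (constᴾ 0) (constᴾ 0)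

  module _ {g : Γ → Graphᴸ} {row : Γ → Row} {x : Γ → Var} (gᴾ : Poly g) (rowᴾ : Poly row) (xᴾ : Poly x) where

    private
      k : Poly (λ γ → proj₁ (row γ))
      k = fst-of rowᴾ
      v : Poly (λ γ → proj₁ (proj₂ (row γ)))
      v = fst-of (snd-of rowᴾ)
      u : Poly (λ γ → proj₂ (proj₂ (row γ)))
      u = snd-of (snd-of rowᴾ)
      w : Poly (λ γ → proj₁ (x γ))
      w = fst-of xᴾ
      j : Poly (λ γ → proj₂ (x γ))
      j = snd-of xᴾ

    supplyCoefᴾ : Poly (λ γ → supplyCoef (g γ) (row γ) (x γ))
    supplyCoefᴾ = byKindᴾ k
      (ifᴾ (eqℕᴾ w v) (ifᴾ (isZeroᴾ j) (requirementᴾ gᴾ) (bitᴾ (adjacentᴾ (adjacencyᴾ gᴾ) v (j ∸ᴾ constᴾ 1)))) (constᴾ 0))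
      (bitᴾ (eqℕᴾ w u ∧ᴾ isZeroᴾ j)) (constᴾ 0)

    usageCoefᴾ : Poly (λ γ → usageCoef (g γ) (row γ) (x γ))
    usageCoefᴾ = byKindᴾ k (constᴾ 0) (bitᴾ (eqℕᴾ w v ∧ᴾ eqℕᴾ j (sucᴾ u)))
      (bitᴾ (eqℕᴾ w v ∧ᴾ (isZeroᴾ j ∨ᴾ eqℕᴾ j (sucᴾ u))))

module _ {Γ : Set} {{_ : Coding Γ}} where

  supplyᴾ : {g : Γ → Graphᴸ} {row : Γ → Row} {X : Γ → Assignment} → Poly g → Poly row → Poly X → Poly (λ γ → supply (g γ) (row γ) (X γ))
  supplyᴾ gᴾ rowᴾ Xᴾ = supplyConstᴾ gᴾ rowᴾ +ᴾ
    sumᴾ (ifᴾ (holdsᴾ (weaken Xᴾ) sndᴾ) (supplyCoefᴾ (weakenGraph gᴾ) (weaken rowᴾ) sndᴾ) (constᴾ 0)) (varsᴾ gᴾ)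

  usageᴾ : {g : Γ → Graphᴸ} {row : Γ → Row} {X : Γ → Assignment} → Poly g → Poly row → Poly X → Poly (λ γ → usage (g γ) (row γ) (X γ))
  usageᴾ gᴾ rowᴾ Xᴾ = usageConstᴾ gᴾ rowᴾ +ᴾ
    sumᴾ (ifᴾ (holdsᴾ (weaken Xᴾ) sndᴾ) (usageCoefᴾ (weakenGraph gᴾ) (weaken rowᴾ) sndᴾ) (constᴾ 0)) (varsᴾ gᴾ)

module _ {Γ : Set} {{_ : Coding Γ}} where

  debtᴾ : {g : Γ → Graphᴸ} {H : Γ → List Assignment} {row : Γ → Row} → Poly g → Poly H → Poly row → Poly (λ γ → debt (g γ) (H γ) (row γ))
  debtᴾ gᴾ Hᴾ rowᴾ = sumᴾ (usageᴾ (weakenGraph gᴾ) (weaken rowᴾ) sndᴾ) Hᴾ ∸ᴾ sumᴾ (supplyᴾ (weakenGraph gᴾ) (weaken rowᴾ) sndᴾ) Hᴾ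

module _ {Γ : Set} {{_ : Coding Γ}} {g : Γ → Graphᴸ} (gᴾ : Poly g) where

  gainᴾ : {H : Γ → List Assignment} {x : Γ → Var} → Poly H → Poly x → Poly (λ γ → gain (g γ) (H γ) (x γ))
  gainᴾ Hᴾ xᴾ = sumᴾ (debtᴾ (weakenGraph gᴾ) (weakenRounds Hᴾ) sndᴾ *ᴾ supplyCoefᴾ (weakenGraph gᴾ) sndᴾ (weaken xᴾ)) (rowsᴾ gᴾ)

  lossᴾ : {H : Γ → List Assignment} {x : Γ → Var} → Poly H → Poly x → Poly (λ γ → loss (g γ) (H γ) (x γ))
  lossᴾ Hᴾ xᴾ = sumᴾ (debtᴾ (weakenGraph gᴾ) (weakenRounds Hᴾ) sndᴾ *ᴾ usageCoefᴾ (weakenGraph gᴾ) sndᴾ (weaken xᴾ)) (rowsᴾ gᴾ)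

  weightAtᴾ : {v : Γ → ℕ} → Poly v → Poly (λ γ → weightAt (g γ) (v γ))
  weightAtᴾ vᴾ = atᴾ zeroRat (weightsᴾ gᴾ) vᴾ

  isFreeᴾ : {x : Γ → Var} → Poly x → Poly (λ γ → isFree (g γ) (x γ))
  isFreeᴾ xᴾ = ifᴾ (isZeroᴾ (snd-of xᴾ)) (leDᴾ (numᴾ (weightAtᴾ (fst-of xᴾ))) (constᴾ [])) (constᴾ true)

module _ {Γ : Set} {{_ : Coding Γ}} where

  worthwhileᴾ : {K l h : Γ → ℕ} {w B : Γ → Rat} → Poly K → Poly w → Poly B → Poly l → Poly h →
                Poly (λ γ → worthwhile (K γ) (w γ) (B γ) (l γ) (h γ))
  worthwhileᴾ Kᴾ wᴾ Bᴾ lᴾ hᴾ = leDᴾ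
    (addDᴾ (scaleᴾ Kᴾ (mulDᴾ (snd-of (fst-of wᴾ)) (snd-of Bᴾ))) (scaleᴾ lᴾ (mulDᴾ (snd-of (fst-of Bᴾ)) (snd-of wᴾ))))
    (scaleᴾ hᴾ (mulDᴾ (snd-of (fst-of Bᴾ)) (snd-of wᴾ)))

  selectᴾ : {g : Γ → Graphᴸ} {B : Γ → Rat} {H : Γ → List Assignment} {x : Γ → Var} →
    Poly g → Poly B → Poly H → Poly x → Poly (λ γ → select (g γ) (B γ) (H γ) (x γ))
  selectᴾ gᴾ Bᴾ Hᴾ xᴾ = ifᴾ (isFreeᴾ gᴾ xᴾ) (leqᴾ (lossᴾ gᴾ Hᴾ xᴾ) (gainᴾ gᴾ Hᴾ xᴾ))
    (worthwhileᴾ (constᴾ 4 *ᴾ (penaltyᴾ ∘ᴾ orderᴾ gᴾ)) (weightAtᴾ gᴾ (fst-of xᴾ)) Bᴾ (lossᴾ gᴾ Hᴾ xᴾ) (gainᴾ gᴾ Hᴾ xᴾ))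

module _ {Γ : Set} {{_ : Coding Γ}} {g : Γ → Graphᴸ} {B : Γ → Rat} {H : Γ → List Assignment} where

  roundᴾ : Poly g → Poly B → Poly H → Poly (λ γ → round (g γ) (B γ) (H γ))
  roundᴾ gᴾ Bᴾ Hᴾ = mapᴾ (mapᴾ chosen (upToᴾ (sucᴾ (orderᴾ (weakenGraph gᴾ))))) (upToᴾ (orderᴾ gᴾ))
    where
    chosen : Poly {(Γ × ℕ) × ℕ} (λ ((γ , v) , j) → select (g γ) (B γ) (H γ) (v , j))
    chosen = selectᴾ (weakenGraph (weakenGraph gᴾ)) (weaken (weaken Bᴾ)) (weakenRounds (weakenRounds Hᴾ)) (snd-of fstᴾ ,ᴾ sndᴾ)

module _ {Γ : Set} {{_ : Coding Γ}} {g : Γ → Graphᴸ} {B : Γ → Rat} (gᴾ : Poly g) (Bᴾ : Poly B) where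

  -- A round adds a table of Booleans whose size depends on n alone, whatever the debts are, so the
  -- history grows additively.
  historyᴾ : Poly (λ γ → history (g γ) (B γ))
  historyᴾ = foldrᴾ {step = λ (γ , _ , H) → round (g γ) (B γ) H ∷ H}
    (roundᴾ (weakenGraph gᴾ) (weaken Bᴾ) (snd-of sndᴾ) ∷ᴾ snd-of sndᴾ) (constᴾ []) (asListᴾ (roundsᴾ ∘ᴾ orderᴾ gᴾ)) q small
    where
    N q : Polynomial
    N = growth (orderᴾ gᴾ)
    q = constant 2 ⊕ N ⊗ (constant 2 ⊕ (constant 4 ⊕ constant 4 ⊗ N))
    small : ∀ (γ : Γ) (x : ⊤) (H : List Assignment) → ∥ round (g γ) (B γ) H ∷ H ∥ ≤ ∥ H ∥ + eval q ∥ γ , x ∥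
    small γ x H = begin
      suc (∥ round (g γ) (B γ) H ∥ + ∥ H ∥)            ≤⟨ s≤s (+-monoˡ-≤ ∥ H ∥ table) ⟩
      suc (1 + n * (2 + (suc n) * 4) + ∥ H ∥)          ≡⟨ rearrange (∥ H ∥) n ⟩
      ∥ H ∥ + (2 + n * (2 + (4 + 4 * n)))              ≤⟨ +-monoʳ-≤ ∥ H ∥ (+-monoʳ-≤ 2 (*-mono-≤ n≤ (+-monoʳ-≤ 2 (+-monoʳ-≤ 4 (*-monoʳ-≤ 4 n≤))))) ⟩
      ∥ H ∥ + eval q ∥ γ , x ∥                          ∎
      where
      open ≤-Reasoning
      n : ℕ
      n = proj₁ (g γ)
      n≤ : n ≤ eval N ∥ γ , x ∥
      n≤ = ≤-trans (m≤size n) (≤-trans (size-bound (orderᴾ gᴾ) γ) (eval-mono N (size-left ⌜ γ ⌝ leaf)))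
      row≤ : ∀ v → ∥ map (λ j → select (g γ) (B γ) H (v , j)) (upTo (suc n)) ∥ ≤ 1 + suc n * 4
      row≤ v = ≤-trans (size-map _ 3 (λ j → size-Bool (select (g γ) (B γ) H (v , j))) (upTo (suc n)))
                       (≤-reflexive (cong (λ l → 1 + l * 4) (List.length-upTo (suc n))))
      table : ∥ round (g γ) (B γ) H ∥ ≤ 1 + n * (2 + suc n * 4)
      table = ≤-trans (size-map _ (1 + suc n * 4) row≤ (upTo n))
                      (≤-reflexive (cong (λ l → 1 + l * (2 + suc n * 4)) (List.length-upTo n)))
      rearrange : ∀ h n → suc (1 + n * (2 + suc n * 4) + h) ≡ h + (2 + n * (2 + (4 + 4 * n)))
      rearrange = solve-∀

  succeedsᴾ : Poly (λ γ → succeeds (g γ) (B γ))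
  succeedsᴾ = extensional (λ γ → sym (succeeds-unfold (g γ) (B γ)))
    (allᴾ (leqᴾ (constᴾ 16 *ᴾ orderᴾ (weakenGraph gᴾ) *ᴾ debtᴾ (weakenGraph gᴾ) (weakenRounds historyᴾ) sndᴾ)
                (roundsᴾ ∘ᴾ orderᴾ (weakenGraph gᴾ))) (rowsᴾ gᴾ))

module _ {Γ : Set} {{_ : Coding Γ}} {g : Γ → Graphᴸ} (gᴾ : Poly g) where

  successfulᴾ : Poly (λ γ → successful (g γ))
  successfulᴾ = foldrᴾ {step = step}
    (ifᴾ (succeedsᴾ (weakenGraph gᴾ) candidate ∧ᴾ leRatᴾ candidate firstᴾ) (candidate ∷ᴾ constᴾ []) best)
    (constᴾ []) (constᴾ zeroRat ∷ᴾ weightsᴾ gᴾ) (constant 2 ⊕ var)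
    (λ γ B best → small γ B best (succeeds (g γ) B ∧ leRat B (at B best 0)))
    where
    step : Γ × Rat × List Rat → List Rat
    step (γ , B , best) = if succeeds (g γ) B ∧ leRat B (at B best 0) then B ∷ [] else best
    at-cases : ∀ (B : Rat) best → maybe′ (λ lr → proj₁ lr) B (uncons best) ≡ at B best 0
    at-cases B []      = refl
    at-cases B (_ ∷ _) = refl
    candidate : Poly {Γ × Rat × List Rat} (λ (_ , B , _) → B)
    candidate = fst-of sndᴾ
    best : Poly {Γ × Rat × List Rat} (λ (_ , _ , best) → best)
    best = snd-of sndᴾ
    firstᴾ : Poly {Γ × Rat × List Rat} (λ (_ , B , best) → at B best 0)
    firstᴾ = caseListᴾ best candidate (fst-of sndᴾ) (λ (_ , B , best) → at-cases B best)
    small : ∀ γ B best b → ∥ (if b then B ∷ [] else best) ∥ ≤ ∥ best ∥ + (2 + ∥ γ , B ∥)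
    small γ B best true  = ≤-trans (s≤s (≤-trans (≤-reflexive (+-comm ∥ B ∥ 1)) (s≤s (size-right ⌜ γ ⌝ ⌜ B ⌝)))) (m≤n+m _ ∥ best ∥)
    small γ B best false = m≤m+n _ _

  heaviesᴾ : Poly (λ γ → heavies (g γ))
  heaviesᴾ = mapᴾ (leqᴾ (constᴾ 3 *ᴾ (roundsᴾ ∘ᴾ orderᴾ (weakenGraph gᴾ))) (constᴾ 8 *ᴾ count)) (upToᴾ (orderᴾ gᴾ))
    where
    played : Poly (λ γ → history (g γ) (guess (g γ)))
    played = historyᴾ gᴾ (headᴾ zeroRat successfulᴾ)
    count : Poly {Γ × ℕ} (λ (γ , v) → sum (map (λ X → bit (holds X (v , 0))) (history (g γ) (guess (g γ)))))
    count = sumᴾ (bitᴾ (holdsᴾ sndᴾ (snd-of fstᴾ ,ᴾ constᴾ 0))) (weakenRounds played)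

-- The reduction as a function on bit strings

magnitude : Rat → List ℕ
magnitude ((s , ds) , _) = if s then addD (1 ∷ []) ds else ds

sign : Rat → Bool
sign r = proj₁ (proj₁ r)

sameSign : Bool → Bool → Bool
sameSign s t = if s then t else not t

-- (r - s)² = (plus r s - minus r s) / over r s
cross plus minus over : Rat → Rat → List ℕ
cross r s = scale 2 (mulD (mulD (magnitude r) (den s)) (mulD (magnitude s) (den r)))
plus  r s = addD (addD (mulD (mulD (magnitude r) (den s)) (mulD (magnitude r) (den s)))
                       (mulD (mulD (magnitude s) (den r)) (mulD (magnitude s) (den r))))
                 (if sameSign (sign r) (sign s) then [] else cross r s)
minus r s = if sameSign (sign r) (sign s) then cross r s else []
over  r s = mulD (mulD (den r) (den s)) (mulD (den r) (den s))

-- The condition that the squared difference is at most 0; its positive denominator can be left out.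
equalRat : Rat → Rat → Bool
equalRat r s = leD (plus r s) (minus r s)

near : Rat × Rat → Rat × Rat → Bool
near (a , b) (c , d) = leD
  (addD (mulD (plus a c) (over b d)) (mulD (plus b d) (over a c)))
  (addD (mulD (over a c) (over b d)) (addD (mulD (minus a c) (over b d)) (mulD (minus b d) (over a c))))

-- The digits of the order, those of m, the order, the coordinates and
-- the weights.
Parsed : Set
Parsed = List ℕ × List ℕ × ℕ × List Rat × List Rat

parse : List Bool → Parsed
parse bits = proj₁ (readℕ bits) , proj₁ (readℕ rest) , n , readRats (n + n) (proj₂ (readℕ bits))
           , readRats n (proj₂ (readℕ (proj₂ (readℕ rest))))
  where
  -- Each vertex has a weight in the input, so on an encoded instance the limit changes nothing; on
  -- other strings it keeps the running time polynomial.
  n = clip (length bits) (proj₁ (readℕ bits))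
  rest = skipRats (n + n) (proj₂ (readℕ bits))

orderOf : Parsed → ℕ
orderOf P = proj₁ (proj₂ (proj₂ P))

positionAt : Parsed → ℕ → Rat × Rat
positionAt P v = at zeroRat (proj₁ (proj₂ (proj₂ (proj₂ P)))) (v + v)
               , at zeroRat (proj₁ (proj₂ (proj₂ (proj₂ P)))) (suc (v + v))

nearAt : Parsed → ℕ → ℕ → Bool
nearAt P v u = not (eqℕ v u) ∧ near (positionAt P v) (positionAt P u)

graphOf : Parsed → Graphᴸ
-- The demand is given in binary and may be exponential, but the relaxation counts with it in unary.
-- A solution for m also serves the smaller demand, and the two demands turn out to agree as soon as
-- there is a light vertex.
graphOf P = orderOf P , clip (orderOf P) (proj₁ (proj₂ P))
          , map (λ v → map (λ u → nearAt P v u) (upTo (orderOf P))) (upTo (orderOf P))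
          , proj₂ (proj₂ (proj₂ (proj₂ P)))

coincide : Parsed → ℕ → ℕ → Bool
coincide P v u = equalRat (proj₁ (positionAt P v)) (proj₁ (positionAt P u))
               ∧ equalRat (proj₂ (positionAt P v)) (proj₂ (positionAt P u))

-- Among coincident light vertices only the first one is to be covered.
mustCover : Parsed → List Bool → ℕ → Bool
mustCover P L v = not (at false L v) ∧ all (λ u → leq v u ∨ (at false L u ∨ not (coincide P v u))) (upTo (orderOf P))

writePoint : Rat × Rat → List Bool
writePoint (a , b) = writeRat a ++ writeRat b

-- The encoding of 2 ^ suc k / (2 ^ suc k - 1).
writeRatio : ℕ → List Bool
writeRatio k = false ∷ writeDigits (2 ∷ List.replicate k 1) ++ writeDigits (1 ∷ List.replicate k 1)

-- The exponent of the first radius, the parsed input and the heavy vertices.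
Emission : Set
Emission = ℕ × Parsed × List Bool

-- An index that need not be covered still gets a point, with both coordinates equal to its radius
-- and with demand 0. All sections then have n entries, and the answer is a set of vertices without
-- renumbering. Heavy vertices keep their disks at weight 0.
pointBits demandBits diskBits weightBits : Emission → ℕ → List Bool
pointBits (base , P , L) v = if mustCover P L v then writePoint (positionAt P v)
                             else writeRatio (base + v) ++ writeRatio (base + v)
demandBits (base , P , L) v = if mustCover P L v then false ∷ writeDigits (proj₁ (proj₂ P)) else false ∷ writeDigits []
diskBits (base , P , L) v = writePoint (positionAt P v) ++ writeRatio (base + v)
weightBits (base , P , L) v = if at false L v then writeRat zeroRat
                              else writeRat (at zeroRat (proj₂ (proj₂ (proj₂ (proj₂ P)))) v)

section : (Emission → ℕ → List Bool) → Emission → List Bool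
section f e = writeDigits (proj₁ (proj₁ (proj₂ e))) ++ List.concatMap (f e) (upTo (orderOf (proj₁ (proj₂ e))))

emit : Emission → List Bool
emit e = section pointBits e ++ section demandBits e ++ section diskBits e ++ section weightBits e

heavySet : Parsed → List Bool
heavySet P = heavies (graphOf P)

baseFor : List Bool → ℕ
baseFor bits = suc (8 * length bits)

emission : List Bool → Emission
emission bits = baseFor bits , parse bits , heavySet (parse bits)

emitWithSet : Emission → List Bool × List Bool
emitWithSet e = emit e , proj₂ (proj₂ e)

reduce : List Bool → List Bool × List Bool
reduce bits = emitWithSet (emission bits)

module _ {Γ : Set} {{_ : Coding Γ}} where

  magnitudeᴾ : {r : Γ → Rat} → Poly r → Poly (λ γ → magnitude (r γ))
  magnitudeᴾ rᴾ = ifᴾ (fst-of (fst-of rᴾ)) (addDᴾ (constᴾ (1 ∷ [])) (snd-of (fst-of rᴾ))) (snd-of (fst-of rᴾ))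

  sameSignᴾ : {s t : Γ → Bool} → Poly s → Poly t → Poly (λ γ → sameSign (s γ) (t γ))
  sameSignᴾ sᴾ tᴾ = ifᴾ sᴾ tᴾ (notᴾ tᴾ)

module _ {Γ : Set} {{_ : Coding Γ}} {r s : Γ → Rat} (rᴾ : Poly r) (sᴾ : Poly s) where

  private
    left : Poly (λ γ → mulD (magnitude (r γ)) (den (s γ)))
    left = mulDᴾ (magnitudeᴾ rᴾ) (denᴾ sᴾ)
    right : Poly (λ γ → mulD (magnitude (s γ)) (den (r γ)))
    right = mulDᴾ (magnitudeᴾ sᴾ) (denᴾ rᴾ)
    same : Poly (λ γ → sameSign (sign (r γ)) (sign (s γ)))
    same = sameSignᴾ (fst-of (fst-of rᴾ)) (fst-of (fst-of sᴾ))

  crossᴾ : Poly (λ γ → cross (r γ) (s γ))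
  crossᴾ = scaleᴾ (constᴾ 2) (mulDᴾ left right)

  plusᴾ : Poly (λ γ → plus (r γ) (s γ))
  plusᴾ = addDᴾ (addDᴾ (mulDᴾ left left) (mulDᴾ right right)) (ifᴾ same (constᴾ []) crossᴾ)

  minusᴾ : Poly (λ γ → minus (r γ) (s γ))
  minusᴾ = ifᴾ same crossᴾ (constᴾ [])

  overᴾ : Poly (λ γ → over (r γ) (s γ))
  overᴾ = mulDᴾ (mulDᴾ (denᴾ rᴾ) (denᴾ sᴾ)) (mulDᴾ (denᴾ rᴾ) (denᴾ sᴾ))

  equalRatᴾ : Poly (λ γ → equalRat (r γ) (s γ))
  equalRatᴾ = leDᴾ plusᴾ minusᴾ

module _ {Γ : Set} {{_ : Coding Γ}} where

  nearᴾ : {a b c d : Γ → Rat} → Poly a → Poly b → Poly c → Poly d → Poly (λ γ → near (a γ , b γ) (c γ , d γ))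
  nearᴾ aᴾ bᴾ cᴾ dᴾ = leDᴾ
    (addDᴾ (mulDᴾ (plusᴾ aᴾ cᴾ) (overᴾ bᴾ dᴾ)) (mulDᴾ (plusᴾ bᴾ dᴾ) (overᴾ aᴾ cᴾ)))
    (addDᴾ (mulDᴾ (overᴾ aᴾ cᴾ) (overᴾ bᴾ dᴾ))
           (addDᴾ (mulDᴾ (minusᴾ aᴾ cᴾ) (overᴾ bᴾ dᴾ)) (mulDᴾ (minusᴾ bᴾ dᴾ) (overᴾ aᴾ cᴾ))))

module _ {Γ : Set} {{_ : Coding Γ}} {P : Γ → Parsed} (Pᴾ : Poly P) where

  orderOfᴾ : Poly (λ γ → orderOf (P γ))
  orderOfᴾ = fst-of (snd-of (snd-of Pᴾ))

  demandDigitsᴾ : Poly (λ γ → proj₁ (proj₂ (P γ)))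
  demandDigitsᴾ = fst-of (snd-of Pᴾ)

  weightListᴾ : Poly (λ γ → proj₂ (proj₂ (proj₂ (proj₂ (P γ)))))
  weightListᴾ = snd-of (snd-of (snd-of (snd-of Pᴾ)))

  private
    coordinates : Poly (λ γ → proj₁ (proj₂ (proj₂ (proj₂ (P γ)))))
    coordinates = fst-of (snd-of (snd-of (snd-of Pᴾ)))

  abscissaᴾ : {v : Γ → ℕ} → Poly v → Poly (λ γ → proj₁ (positionAt (P γ) (v γ)))
  abscissaᴾ vᴾ = atᴾ zeroRat coordinates (vᴾ +ᴾ vᴾ)

  ordinateᴾ : {v : Γ → ℕ} → Poly v → Poly (λ γ → proj₂ (positionAt (P γ) (v γ)))
  ordinateᴾ vᴾ = atᴾ zeroRat coordinates (sucᴾ (vᴾ +ᴾ vᴾ))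

  weakenParsed : ∀ {A : Set} {{_ : Coding A}} → Poly {Γ × A} (λ (γ , _) → P γ)
  weakenParsed = weaken Pᴾ

module _ {Γ : Set} {{_ : Coding Γ}} {P : Γ → Parsed} (Pᴾ : Poly P) where

  nearAtᴾ : {v u : Γ → ℕ} → Poly v → Poly u → Poly (λ γ → nearAt (P γ) (v γ) (u γ))
  nearAtᴾ vᴾ uᴾ = notᴾ (eqℕᴾ vᴾ uᴾ) ∧ᴾ nearᴾ (abscissaᴾ Pᴾ vᴾ) (ordinateᴾ Pᴾ vᴾ) (abscissaᴾ Pᴾ uᴾ) (ordinateᴾ Pᴾ uᴾ)

  coincideᴾ : {v u : Γ → ℕ} → Poly v → Poly u → Poly (λ γ → coincide (P γ) (v γ) (u γ))
  coincideᴾ vᴾ uᴾ = equalRatᴾ (abscissaᴾ Pᴾ vᴾ) (abscissaᴾ Pᴾ uᴾ) ∧ᴾ equalRatᴾ (ordinateᴾ Pᴾ vᴾ) (ordinateᴾ Pᴾ uᴾ)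

module _ {Γ : Set} {{_ : Coding Γ}} {P : Γ → Parsed} (Pᴾ : Poly P) where

  graphOfᴾ : Poly (λ γ → graphOf (P γ))
  graphOfᴾ = orderOfᴾ Pᴾ ,ᴾ clipᴾ (orderOfᴾ Pᴾ) (demandDigitsᴾ Pᴾ) ,ᴾ matrix ,ᴾ weightListᴾ Pᴾ
    where
    matrix : Poly (λ γ → map (λ v → map (λ u → nearAt (P γ) v u) (upTo (orderOf (P γ)))) (upTo (orderOf (P γ))))
    matrix = mapᴾ (mapᴾ (nearAtᴾ (weakenParsed (weakenParsed Pᴾ)) (snd-of fstᴾ) sndᴾ) (upToᴾ (orderOfᴾ (weakenParsed Pᴾ)))) (upToᴾ (orderOfᴾ Pᴾ))

  mustCoverᴾ : {L : Γ → List Bool} {v : Γ → ℕ} → Poly L → Poly v → Poly (λ γ → mustCover (P γ) (L γ) (v γ))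
  mustCoverᴾ Lᴾ vᴾ = notᴾ (atᴾ false Lᴾ vᴾ) ∧ᴾ allᴾ
    (leqᴾ (weaken vᴾ) sndᴾ ∨ᴾ (atᴾ false (weaken Lᴾ) sndᴾ ∨ᴾ notᴾ (coincideᴾ (weakenParsed Pᴾ) (weaken vᴾ) sndᴾ))) (upToᴾ (orderOfᴾ Pᴾ))

parseᴾ : Poly parse
parseᴾ = fst-of first ,ᴾ fst-of (readℕᴾ rest) ,ᴾ n ,ᴾ readRatsᴾ (n +ᴾ n) (snd-of first)
     ,ᴾ readRatsᴾ n (snd-of (readℕᴾ (snd-of (readℕᴾ rest))))
  where
  first = readℕᴾ (idᴾ {A = List Bool})
  n = clipᴾ (lengthᴾ (idᴾ {A = List Bool})) (fst-of first)
  rest = skipRatsᴾ (n +ᴾ n) (snd-of first)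

module _ {Γ : Set} {{_ : Coding Γ}} where

  writeRatioᴾ : {k : Γ → ℕ} → Poly k → Poly (λ γ → writeRatio (k γ))
  writeRatioᴾ {k} kᴾ = constᴾ false ∷ᴾ (writeDigitsᴾ (constᴾ 2 ∷ᴾ ones) ++ᴾ writeDigitsᴾ (constᴾ 1 ∷ᴾ ones))
    where
    map-const : ∀ k → map (λ _ → 1) (List.replicate k tt) ≡ List.replicate k 1
    map-const zero    = refl
    map-const (suc k) = cong (1 ∷_) (map-const k)
    ones : Poly (λ γ → List.replicate (k γ) 1)
    ones = extensional (λ γ → map-const (k γ)) (mapᴾ (constᴾ 1) (asListᴾ kᴾ))

  module _ {base : Γ → ℕ} {P : Γ → Parsed} {L : Γ → List Bool} (baseᴾ : Poly base) (Pᴾ : Poly P) (Lᴾ : Poly L)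
           {v : Γ → ℕ} (vᴾ : Poly v) where

    private
      covered : Poly (λ γ → mustCover (P γ) (L γ) (v γ))
      covered = mustCoverᴾ Pᴾ Lᴾ vᴾ
      position : Poly (λ γ → writePoint (positionAt (P γ) (v γ)))
      position = writeRatᴾ (abscissaᴾ Pᴾ vᴾ) ++ᴾ writeRatᴾ (ordinateᴾ Pᴾ vᴾ)
      ratio : Poly (λ γ → writeRatio (base γ + v γ))
      ratio = writeRatioᴾ (baseᴾ +ᴾ vᴾ)

    pointBitsᴾ : Poly (λ γ → pointBits (base γ , P γ , L γ) (v γ))
    pointBitsᴾ = ifᴾ covered position (ratio ++ᴾ ratio)

    demandBitsᴾ : Poly (λ γ → demandBits (base γ , P γ , L γ) (v γ))
    demandBitsᴾ = ifᴾ covered (constᴾ false ∷ᴾ writeDigitsᴾ (demandDigitsᴾ Pᴾ)) (constᴾ (false ∷ writeDigits []))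

    diskBitsᴾ : Poly (λ γ → diskBits (base γ , P γ , L γ) (v γ))
    diskBitsᴾ = position ++ᴾ ratio

    weightBitsᴾ : Poly (λ γ → weightBits (base γ , P γ , L γ) (v γ))
    weightBitsᴾ = ifᴾ (atᴾ false Lᴾ vᴾ) (constᴾ (writeRat zeroRat)) (writeRatᴾ (atᴾ zeroRat (weightListᴾ Pᴾ) vᴾ))

module _ {Γ : Set} {{_ : Coding Γ}} {base : Γ → ℕ} {P : Γ → Parsed} {L : Γ → List Bool} (baseᴾ : Poly base) (Pᴾ : Poly P) (Lᴾ : Poly L) where

  private
    sectionᴾ : (f : Emission → ℕ → List Bool) → Poly {Γ × ℕ} (λ (γ , v) → f (base γ , P γ , L γ) v) → Poly (λ γ → section f (base γ , P γ , L γ))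
    sectionᴾ f fᴾ = writeDigitsᴾ (fst-of Pᴾ) ++ᴾ concatMapᴾ {f = λ (γ , v) → f (base γ , P γ , L γ) v} fᴾ (upToᴾ (orderOfᴾ Pᴾ))

  emitᴾ : Poly (λ γ → emit (base γ , P γ , L γ))
  emitᴾ = sectionᴾ pointBits (pointBitsᴾ base′ P′ L′ sndᴾ) ++ᴾ (sectionᴾ demandBits (demandBitsᴾ base′ P′ L′ sndᴾ)
    ++ᴾ (sectionᴾ diskBits (diskBitsᴾ base′ P′ L′ sndᴾ) ++ᴾ sectionᴾ weightBits (weightBitsᴾ base′ P′ L′ sndᴾ)))
    where
    base′ : Poly {Γ × ℕ} (λ (γ , _) → base γ)
    base′ = weaken baseᴾ
    P′ : Poly {Γ × ℕ} (λ (γ , _) → P γ)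
    P′ = weakenParsed Pᴾ
    L′ : Poly {Γ × ℕ} (λ (γ , _) → L γ)
    L′ = weaken Lᴾ

heavySetᴾ : Poly (λ bits → heavySet (parse bits))
heavySetᴾ = heaviesᴾ {g = λ bits → graphOf (parse bits)} (graphOfᴾ {P = parse} parseᴾ)

reduceᴾ : Poly reduce
reduceᴾ = emitᴾ {base = baseFor} {P = parse} {L = λ bits → heavySet (parse bits)} (sucᴾ (constᴾ 8 *ᴾ lengthᴾ idᴾ)) parseᴾ heavySetᴾ ,ᴾ heavySetᴾ

-- From functions to search algorithms

prefixed : ∀ {m} (S : Store m) {k} → Frame {k} (m Fin.↑ʳ_)
prefixed []      = record { plug = id ; lookup-plug = λ _ _ → refl ; update-plug = λ _ _ _ → refl }
prefixed (x ∷ S) = record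
  { plug        = λ s → x ∷ plug (prefixed S) s
  ; lookup-plug = λ s i → lookup-plug (prefixed S) s i
  ; update-plug = λ s i v → cong (x ∷_) (update-plug (prefixed S) s i v) }

suffixed : ∀ {k m} (S : Store m) → Frame {k} (Fin._↑ˡ m)
suffixed S = record
  { plug        = λ s → s Vec.++ S
  ; lookup-plug = λ s i → Vec.lookup-++ˡ s S i
  ; update-plug = λ s i v → Vec.[]≔-++-↑ˡ s S i }

-- The input and output stack together with the data stack and its
-- scratch stacks, within the stacks of a subroutine and of a Poly program.
outer : ∀ {k} d → Fin 5 → Fin (suc k + (d + 4))
outer     d zero    = zero
outer {k} d (suc i) = suc k Fin.↑ʳ (d Fin.↑ʳ i)

outer-frame : ∀ {k} d (S : Store k) → Frame (outer {k} d)
outer-frame {k} d S = record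
  { plug        = λ { (x ∷ s) → x ∷ plug (prefixed S) (plug (beneath d) s) }
  ; lookup-plug = λ { (x ∷ s) zero → refl ; (x ∷ s) (suc i) →
      trans (lookup-plug (prefixed S) (plug (beneath d) s) (d Fin.↑ʳ i)) (lookup-plug (beneath d) s i) }
  ; update-plug = λ { (x ∷ s) zero v → refl ; (x ∷ s) (suc i) v →
      cong (x ∷_) (trans (update-plug (prefixed S) (plug (beneath d) s) (d Fin.↑ʳ i) v)
                         (cong (plug (prefixed S)) (update-plug (beneath d) s i v))) } }

pattern #i = zero
pattern #0 = suc zero
pattern #1 = suc (suc zero)
pattern #2 = suc (suc (suc zero))
pattern #3 = suc (suc (suc (suc zero)))

choose₂ : Fin 5 → Fin 5 → Fin 2 → Fin 5
choose₂ i j zero = i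
choose₂ i j #0   = j

i⇒b : ∀ a c d → Frame (choose₂ #i #1)
i⇒b a c d = record
  { plug = λ { (x ∷ y ∷ []) → x ∷ a ∷ y ∷ c ∷ d ∷ [] }
  ; lookup-plug = λ { (_ ∷ _ ∷ []) zero → refl ; (_ ∷ _ ∷ []) #0 → refl }
  ; update-plug = λ { (_ ∷ _ ∷ []) zero _ → refl ; (_ ∷ _ ∷ []) #0 _ → refl } }

b⇒i : ∀ a c d → Frame (choose₂ #1 #i)
b⇒i a c d = record
  { plug = λ { (x ∷ y ∷ []) → y ∷ a ∷ x ∷ c ∷ d ∷ [] }
  ; lookup-plug = λ { (_ ∷ _ ∷ []) zero → refl ; (_ ∷ _ ∷ []) #0 → refl }
  ; update-plug = λ { (_ ∷ _ ∷ []) zero _ → refl ; (_ ∷ _ ∷ []) #0 _ → refl } }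

b⇒c : ∀ i a d → Frame (choose₂ #1 #2)
b⇒c i a d = record
  { plug = λ { (x ∷ y ∷ []) → i ∷ a ∷ x ∷ y ∷ d ∷ [] }
  ; lookup-plug = λ { (_ ∷ _ ∷ []) zero → refl ; (_ ∷ _ ∷ []) #0 → refl }
  ; update-plug = λ { (_ ∷ _ ∷ []) zero _ → refl ; (_ ∷ _ ∷ []) #0 _ → refl } }

reverse-reverse : ∀ (xs : List Bool) → (xs ʳ++ []) ʳ++ [] ≡ xs
reverse-reverse xs = trans (List.ʳ++-ʳ++ xs) (List.++-identityʳ xs)

length-reverse : ∀ (xs : List Bool) → length (xs ʳ++ []) ≡ length xs
length-reverse xs = trans (List.length-ʳ++ xs) (+-identityʳ _)

-- Translates a raw bit string, the format of inputs and outputs, into the code of a list of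
-- Booleans; `unload` goes the other way.
load-loop load : Program 5
load-loop = while #1 (case #1 skip
  (pop #1 ⨟ push #0 false ⨟ push #0 true)
  (pop #1 ⨟ push #0 false ⨟ push #0 false ⨟ push #0 true ⨟ push #0 true))
load = rename (choose₂ #i #1) move ⨟ push #0 false ⨟ load-loop

load-loop-runs : ∀ i xs ys c d → Runs load-loop (i ∷ code ⌜ ys ⌝ ∷ xs ∷ c ∷ d ∷ []) (7 * length xs + 1)
                                               (i ∷ code ⌜ xs ʳ++ ys ⌝ ∷ [] ∷ c ∷ d ∷ [])
load-loop-runs i [] ys c d = exactly (while-stop⇓ refl)
load-loop-runs i (false ∷ xs) ys c d = within (≤-trans (m≤n+m _ 2) (≤-reflexive (per-item (length xs))))
  (iterate-once refl (on-false refl (exactly pop⇓ then exactly push⇓ then exactly push⇓))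
    (load-loop-runs i xs (false ∷ ys) c d))
  where
  per-item : ∀ n → 2 + suc (suc (1 + (1 + 1)) + (7 * n + 1)) ≡ 7 * suc n + 1
  per-item = solve-∀
load-loop-runs i (true ∷ xs) ys c d = within (≤-reflexive (per-item (length xs)))
  (iterate-once refl (on-true refl (exactly pop⇓ then exactly push⇓ then exactly push⇓ then exactly push⇓ then exactly push⇓))
    (load-loop-runs i xs (true ∷ ys) c d))
  where
  per-item : ∀ n → suc (suc (1 + (1 + (1 + (1 + 1)))) + (7 * n + 1)) ≡ 7 * suc n + 1
  per-item = solve-∀

load-runs : ∀ xs → Runs load (xs ∷ [] ∷ [] ∷ [] ∷ [] ∷ []) (3 + 11 * length xs)
                             ([] ∷ code ⌜ xs ⌝ ∷ [] ∷ [] ∷ [] ∷ [])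
load-runs xs = replace-target (cong (λ ys → [] ∷ code ⌜ ys ⌝ ∷ [] ∷ [] ∷ [] ∷ []) (reverse-reverse xs))
  (trans (cong (λ n → 1 + 4 * length xs + (1 + (7 * n + 1))) (length-reverse xs)) (total (length xs)))
  (rename-runs (i⇒b [] [] []) (move-runs xs []) then exactly push⇓ then load-loop-runs [] (xs ʳ++ []) [] [] [])
  where
  total : ∀ n → 1 + 4 * n + (1 + (7 * n + 1)) ≡ 3 + 11 * n
  total = solve-∀

unload : Program 5
unload = push #3 true ⨟ while #3 (case #0 skip
  (pop #0 ⨟ pop #3)
  (pop #0 ⨟ case #0 skip (pop #0 ⨟ push #1 false) (pop #0 ⨟ pop #0 ⨟ pop #0 ⨟ push #1 true)))

unload-runs : ∀ i xs rest ys c → Runs unload (i ∷ (code ⌜ xs ⌝ ++ rest) ∷ ys ∷ c ∷ [] ∷ []) (6 + 8 * length xs)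
                                             (i ∷ rest ∷ (xs ʳ++ ys) ∷ c ∷ [] ∷ [])
unload-runs i xs rest ys c = within (≤-reflexive (cong suc (+-comm (8 * length xs) 5))) (exactly push⇓ then loop xs ys)
  where
  loop : ∀ xs ys → Runs _ (i ∷ (code ⌜ xs ⌝ ++ rest) ∷ ys ∷ c ∷ (true ∷ []) ∷ []) (8 * length xs + 5)
                          (i ∷ rest ∷ (xs ʳ++ ys) ∷ c ∷ [] ∷ [])
  loop [] ys = iterate-once refl (on-false refl (exactly pop⇓ then exactly pop⇓)) (exactly (while-stop⇓ refl))
  loop (false ∷ xs) ys = within (≤-trans (m≤n+m _ 2) (≤-reflexive (per-item (length xs))))
    (iterate-once refl (on-true refl (exactly pop⇓ then on-false refl (exactly pop⇓ then exactly push⇓))) (loop xs (false ∷ ys)))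
    where
    per-item : ∀ n → 2 + suc (suc (1 + suc (1 + 1)) + (8 * n + 5)) ≡ 8 * suc n + 5
    per-item = solve-∀
  loop (true ∷ xs) ys = within (≤-reflexive (per-item (length xs)))
    (iterate-once refl (on-true refl (exactly pop⇓ then on-true refl
      (exactly pop⇓ then exactly pop⇓ then exactly pop⇓ then exactly push⇓))) (loop xs (true ∷ ys)))
    where
    per-item : ∀ n → suc (suc (1 + suc (1 + (1 + (1 + 1)))) + (8 * n + 5)) ≡ 8 * suc n + 5
    per-item = solve-∀

merge : List Bool → List Bool → List Bool
merge []       ys = []
merge (x ∷ xs) ys = (x ∨ at false ys 0) ∷ merge xs (List.drop 1 ys)

merge-program : Program 5
merge-program = while #i (case #i skip
  (pop #i ⨟ case #2 (push #1 false) (push #1 false) (push #1 true) ⨟ pop #2)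
  (pop #i ⨟ push #1 true ⨟ pop #2))

leftover : List Bool → List Bool → List Bool
leftover []       ys = ys
leftover (_ ∷ xs) ys = leftover xs (List.drop 1 ys)

merge-runs : ∀ a xs ys zs → Runs merge-program (xs ∷ a ∷ zs ∷ ys ∷ [] ∷ []) (6 * length xs + 1)
               ([] ∷ a ∷ (merge xs ys ʳ++ zs) ∷ leftover xs ys ∷ [] ∷ [])
merge-runs a [] ys zs = exactly (while-stop⇓ refl)
merge-runs a (true ∷ xs) ys zs = within (≤-trans (n≤1+n _) (≤-reflexive (per-item (length xs))))
  (iterate-once refl (on-true refl (exactly pop⇓ then exactly push⇓ then exactly pop⇓))
    (merge-runs a xs (List.drop 1 ys) (true ∷ zs)))
  where
  per-item : ∀ n → suc (suc (suc (1 + (1 + 1)) + (6 * n + 1))) ≡ 6 * suc n + 1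
  per-item = solve-∀
merge-runs a (false ∷ xs) ys zs = within (≤-reflexive (per-item (length xs)))
  (iterate-once refl (on-false refl (exactly pop⇓ then test ys then exactly pop⇓))
    (merge-runs a xs (List.drop 1 ys) (at false ys 0 ∷ zs)))
  where
  per-item : ∀ n → suc (suc (1 + (2 + 1)) + (6 * n + 1)) ≡ 6 * suc n + 1
  per-item = solve-∀
  test : ∀ ys → Runs (case #2 (push #1 false) (push #1 false) (push #1 true)) (xs ∷ a ∷ zs ∷ ys ∷ [] ∷ []) 2
                     (xs ∷ a ∷ (at false ys 0 ∷ zs) ∷ ys ∷ [] ∷ [])
  test []           = ran ≤-refl (case-empty⇓ refl push⇓)
  test (false ∷ ys) = on-false refl (exactly push⇓)
  test (true ∷ ys)  = on-true refl (exactly push⇓)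

length-merge : ∀ xs ys → length (merge xs ys) ≡ length xs
length-merge []       ys = refl
length-merge (x ∷ xs) ys = cong suc (length-merge xs (List.drop 1 ys))

replicate-++ : ∀ m {n} {A : Set} (x : A) → Vec.replicate (m + n) x ≡ Vec.replicate m x Vec.++ Vec.replicate n x
replicate-++ zero    x = refl
replicate-++ (suc m) x = cong (x ∷_) (replicate-++ m x)

plug-prefixed : ∀ {m} (S : Store m) {k} (s : Store k) → plug (prefixed S) s ≡ S Vec.++ s
plug-prefixed []      s = refl
plug-prefixed (x ∷ S) s = cong (x ∷_) (plug-prefixed S s)

-- Runs P on the first output of f applied to the input and merges its
-- output with the second output of f.
module _ {f : List Bool → List Bool × List Bool} (fᴾ : Poly f) {k : ℕ} (P : Program (suc k)) where

  private
    d = depth fᴾ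

    inner : Program 5 → Program (suc k + (d + 4))
    inner = rename (outer {k} d)

    store : List Bool → Store k → List Bool → List Bool → List Bool → List Bool → Store (suc k + (d + 4))
    store i S a b c e = plug (outer-frame d S) (i ∷ a ∷ b ∷ c ∷ e ∷ [])

    outer-runs : ∀ S {Q i a b c e T i′ a′ b′ c′ e′} →
      Runs Q (i ∷ a ∷ b ∷ c ∷ e ∷ []) T (i′ ∷ a′ ∷ b′ ∷ c′ ∷ e′ ∷ []) →
      Runs (inner Q) (store i S a b c e) T (store i′ S a′ b′ c′ e′)
    outer-runs S = rename-runs (outer-frame d S)

  through : Program (suc (k + (d + 4)))
  through = inner load
    ⨟ rename (suc k Fin.↑ʳ_) (program fᴾ)
    ⨟ inner (pop #0 ⨟ unload ⨟ rename (choose₂ #1 #i) move ⨟ unload ⨟ rename (choose₂ #1 #2) move)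
    ⨟ rename (Fin._↑ˡ (d + 4)) P
    ⨟ inner (merge-program ⨟ rename (choose₂ #1 #i) move)

  through-runs : ∀ input {T S out} → Runs P (proj₁ (f input) ∷ Vec.replicate k []) T (out ∷ S) →
    ∃[ s ] Vec.head s ≡ merge out (proj₂ (f input)) ×
      Runs through (input ∷ Vec.replicate (k + (d + 4)) [])
        (3 + 11 * length input + (eval (bound fᴾ) ∥ input ∥
          + ((1 + ((6 + 8 * length (proj₁ (f input))) + ((1 + 4 * length (proj₁ (f input)))
              + ((6 + 8 * length (proj₂ (f input))) + (1 + 4 * length (proj₂ (f input)))))))
          + (T + ((6 * length out + 1) + (1 + 4 * length out)))))) s
  through-runs input {T} {S} {out} run = _ , refl ,
    (subst (λ s → Runs (inner load) s (3 + 11 * length input) (store [] scratch (code ⌜ input ⌝) [] [] [])) start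
        (outer-runs scratch (load-runs input))
     then subst (λ x → Runs (rename (suc k Fin.↑ʳ_) (program fᴾ)) (store [] scratch x [] [] []) (eval (bound fᴾ) ∥ input ∥)
                         (store [] scratch (code ⌜ f input ⌝ ++ []) [] [] [])) (List.++-identityʳ _)
            (rename-runs (prefixed ([] ∷ scratch)) (runs fᴾ input []))
     then outer-runs scratch (exactly (pop⇓ {i = #0})
       then subst (λ x → Runs unload ([] ∷ x ∷ [] ∷ [] ∷ [] ∷ []) (6 + 8 * length X)
                         ([] ∷ (code ⌜ Y ⌝ ++ []) ∷ (X ʳ++ []) ∷ [] ∷ [] ∷ []))
                  (sym (List.++-assoc (code ⌜ X ⌝) (code ⌜ Y ⌝) []))
                  (unload-runs [] X (code ⌜ Y ⌝ ++ []) [] [])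
       then replace-target (cong (λ x → x ∷ (code ⌜ Y ⌝ ++ []) ∷ [] ∷ [] ∷ [] ∷ []) (reverse-reverse X))
              (cong (λ n → 1 + 4 * n) (length-reverse X)) (rename-runs (b⇒i _ [] []) (move-runs (X ʳ++ []) []))
       then unload-runs X Y [] [] []
       then replace-target (cong (λ y → X ∷ [] ∷ [] ∷ y ∷ [] ∷ []) (reverse-reverse Y))
              (cong (λ n → 1 + 4 * n) (length-reverse Y)) (rename-runs (b⇒c X [] []) (move-runs (Y ʳ++ []) [])))
     then subst₂ (λ s s′ → Runs (rename (Fin._↑ˡ (d + 4)) P) s T s′) (sym (outer-++ X scratch Y)) (sym (outer-++ out S Y))
            (rename-runs (suffixed (plug (beneath d) ([] ∷ [] ∷ Y ∷ [] ∷ []))) run)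
     then outer-runs S (merge-runs [] out Y []
       then replace-target (cong (λ x → x ∷ [] ∷ [] ∷ leftover out Y ∷ [] ∷ []) (reverse-reverse (merge out Y)))
              (cong (λ n → 1 + 4 * n) (trans (length-reverse (merge out Y)) (length-merge out Y)))
              (rename-runs (b⇒i [] (leftover out Y) []) (move-runs (merge out Y ʳ++ []) []))))
    where
    X = proj₁ (f input)
    Y = proj₂ (f input)
    scratch : Store k
    scratch = Vec.replicate k []
    outer-++ : ∀ x (S : Store k) y → store x S [] [] y [] ≡ (x ∷ S) Vec.++ plug (beneath d) ([] ∷ [] ∷ y ∷ [] ∷ [])
    outer-++ x S y = cong (x ∷_) (plug-prefixed S _)
    empties : ∀ d → plug (beneath d) ([] ∷ [] ∷ [] ∷ [] ∷ []) ≡ Vec.replicate (d + 4) []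
    empties zero    = refl
    empties (suc d) = cong ([] ∷_) (empties d)
    start : store input scratch [] [] [] [] ≡ input ∷ Vec.replicate (k + (d + 4)) []
    start = trans (outer-++ input scratch []) (cong (input ∷_)
      (trans (cong (scratch Vec.++_) (empties d)) (sym (replicate-++ k []))))

-- Sums over lists and the drift-plus-penalty method

total : {A : Set} → (A → ℕ) → List A → ℕ
total f xs = sum (map f xs)

module _ {A : Set} where

  total-cong : ∀ {f g : A → ℕ} xs → (∀ {x} → x ∈ xs → f x ≡ g x) → total f xs ≡ total g xs
  total-cong []       eq = refl
  total-cong (x ∷ xs) eq = cong₂ _+_ (eq (here refl)) (total-cong xs (eq ∘ there))

  total-mono : ∀ {f g : A → ℕ} xs → (∀ {x} → x ∈ xs → f x ≤ g x) → total f xs ≤ total g xs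
  total-mono []       le = z≤n
  total-mono (x ∷ xs) le = +-mono-≤ (le (here refl)) (total-mono xs (le ∘ there))

  total-+ : ∀ (f g : A → ℕ) xs → total (λ x → f x + g x) xs ≡ total f xs + total g xs
  total-+ f g []       = refl
  total-+ f g (x ∷ xs) = trans (cong (f x + g x +_) (total-+ f g xs)) (exchange (f x) (g x) (total f xs) (total g xs))
    where
    exchange : ∀ a b c d → a + b + (c + d) ≡ a + c + (b + d)
    exchange = solve-∀

  total-* : ∀ c (f : A → ℕ) xs → total (λ x → c * f x) xs ≡ c * total f xs
  total-* c f []       = sym (*-zeroʳ c)
  total-* c f (x ∷ xs) = trans (cong (c * f x +_) (total-* c f xs)) (sym (*-distribˡ-+ c (f x) _))

  total-const : ∀ c (xs : List A) → total (λ _ → c) xs ≡ length xs * c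
  total-const c []       = refl
  total-const c (x ∷ xs) = cong (c +_) (total-const c xs)

  term≤total : ∀ (f : A → ℕ) {x xs} → x ∈ xs → f x ≤ total f xs
  term≤total f (here refl) = m≤m+n _ _
  term≤total f {xs = y ∷ ys} (there x∈) = ≤-trans (term≤total f x∈) (m≤n+m _ (f y))

module _ {A B : Set} where

  total-swap : ∀ (f : A → B → ℕ) xs ys →
    total (λ x → total (f x) ys) xs ≡ total (λ y → total (λ x → f x y) xs) ys
  total-swap f []       ys = sym (trans (total-const 0 ys) (*-zeroʳ (length ys)))
  total-swap f (x ∷ xs) ys = trans (cong (total (f x) ys +_) (total-swap f xs ys))
    (sym (total-+ (f x) (λ y → total (λ x → f x y) xs) ys))

-- y′ = (U + a) ∸ (S + p) is the positive part of a number at most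
-- y + a - p, hence y′² ≤ (y + a - p)².
energy-step : ∀ U S a p R → a ≤ R → p ≤ R → let y = U ∸ S; y′ = (a + U) ∸ (p + S) in
  y′ * y′ + 2 * (y * p) ≤ y * y + 2 * (y * a) + R * R
energy-step U S a p R a≤R p≤R with ≤-total ((U ∸ S) + a) p
-- Here y′ vanishes, and 2 y p ≤ y² + p² is enough.
... | inj₁ small = begin
  y′ * y′ + 2 * (y * p)       ≡⟨ cong (λ k → k * k + 2 * (y * p)) y′≡0 ⟩
  2 * (y * p)                 ≡⟨ cong (λ k → 2 * (y * k)) (sym (m+[n∸m]≡n small)) ⟩
  2 * (y * (y + a + δ))       ≤⟨ m≤m+n _ (δ * δ + a * a + 2 * (a * δ)) ⟩
  2 * (y * (y + a + δ)) + (δ * δ + a * a + 2 * (a * δ)) ≡⟨ square y a δ ⟩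
  y * y + (y + a + δ) * (y + a + δ) ≡⟨ cong (λ k → y * y + k * k) (m+[n∸m]≡n small) ⟩
  y * y + p * p               ≤⟨ +-mono-≤ (m≤m+n (y * y) (2 * (y * a))) (*-mono-≤ p≤R p≤R) ⟩
  y * y + 2 * (y * a) + R * R ∎
  where
  open ≤-Reasoning
  y = U ∸ S
  y′ = (a + U) ∸ (p + S)
  δ = p ∸ (y + a)
  square : ∀ y a d → 2 * (y * (y + a + d)) + (d * d + a * a + 2 * (a * d)) ≡ y * y + (y + a + d) * (y + a + d)
  square = solve-∀
  y′≡0 : y′ ≡ 0
  y′≡0 = m≤n⇒m∸n≡0 (begin
    a + U             ≤⟨ +-monoʳ-≤ a (m≤n+m∸n U S) ⟩
    a + (S + y)       ≡⟨ rotate a S y ⟩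
    y + a + S         ≤⟨ +-monoˡ-≤ S small ⟩
    p + S             ∎)
    where
    rotate : ∀ a s y → a + (s + y) ≡ y + a + s
    rotate = solve-∀
... | inj₂ large with ≤-total p a
-- The debt rises by at most `δ` = a - p, and squaring y + `δ` gives the claim.
... | inj₁ p≤a = begin
  y′ * y′ + 2 * (y * p)                          ≤⟨ +-monoˡ-≤ (2 * (y * p)) (*-mono-≤ y′≤ y′≤) ⟩
  (y + δ) * (y + δ) + 2 * (y * p)                ≡⟨ square y δ p ⟩
  y * y + 2 * (y * (p + δ)) + δ * δ              ≡⟨ cong (λ k → y * y + 2 * (y * k) + δ * δ) (m+[n∸m]≡n p≤a) ⟩
  y * y + 2 * (y * a) + δ * δ                    ≤⟨ +-monoʳ-≤ (y * y + 2 * (y * a)) (*-mono-≤ δ≤ δ≤) ⟩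
  y * y + 2 * (y * a) + R * R                    ∎
  where
  open ≤-Reasoning
  y = U ∸ S
  y′ = (a + U) ∸ (p + S)
  δ = a ∸ p
  δ≤ : δ ≤ R
  δ≤ = ≤-trans (m∸n≤m a p) a≤R
  square : ∀ y d p → (y + d) * (y + d) + 2 * (y * p) ≡ y * y + 2 * (y * (p + d)) + d * d
  square = solve-∀
  y′≤ : y′ ≤ y + δ
  y′≤ = m≤n+o⇒m∸n≤o (a + U) (p + S) (begin
    a + U                 ≤⟨ +-monoʳ-≤ a (m≤n+m∸n U S) ⟩
    a + (S + y)           ≡⟨ cong (_+ (S + y)) (sym (m+[n∸m]≡n p≤a)) ⟩
    p + δ + (S + y)       ≡⟨ rotate p δ S y ⟩
    p + S + (y + δ)       ∎)
    where
    rotate : ∀ p d s y → p + d + (s + y) ≡ p + s + (y + d)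
    rotate = solve-∀
-- The debt falls by at least `δ` = p - a. Naming the remaining gap `ε` expresses y through y′ by
-- additions alone, after which the inequality is an identity with nonnegative terms left out.
... | inj₂ a≤p = begin
  y′ * y′ + 2 * (y * p)                          ≡⟨ cong₂ (λ j k → y′ * y′ + 2 * (j * k)) y≡ (sym (m+[n∸m]≡n a≤p)) ⟩
  y′ * y′ + 2 * ((y′ + δ + ε) * (a + δ))         ≤⟨ m≤m+n _ (ε * ε + 2 * (y′ * ε)) ⟩
  y′ * y′ + 2 * ((y′ + δ + ε) * (a + δ)) + (ε * ε + 2 * (y′ * ε)) ≡⟨ square y′ δ ε a ⟩
  (y′ + δ + ε) * (y′ + δ + ε) + 2 * ((y′ + δ + ε) * a) + δ * δ
    ≡⟨ cong (λ k → k * k + 2 * (k * a) + δ * δ) y≡ ⟨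
  y * y + 2 * (y * a) + δ * δ                    ≤⟨ +-monoʳ-≤ (y * y + 2 * (y * a)) (*-mono-≤ δ≤ δ≤) ⟩
  y * y + 2 * (y * a) + R * R                    ∎
  where
  open ≤-Reasoning
  y = U ∸ S
  y′ = (a + U) ∸ (p + S)
  δ = p ∸ a
  ε = y ∸ (y′ + δ)
  δ≤ : δ ≤ R
  δ≤ = ≤-trans (m∸n≤m p a) p≤R
  δ≤y : δ ≤ y
  δ≤y = m≤n+o⇒m∸n≤o p a (≤-trans large (≤-reflexive (+-comm y a)))
  y′≤ : y′ ≤ y ∸ δ
  y′≤ = m≤n+o⇒m∸n≤o (a + U) (p + S) (begin
    a + U                       ≤⟨ +-monoʳ-≤ a (m≤n+m∸n U S) ⟩
    a + (S + y)                 ≡⟨ cong (λ k → a + (S + k)) (sym (m+[n∸m]≡n δ≤y)) ⟩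
    a + (S + (δ + (y ∸ δ)))     ≡⟨ rotate a S δ (y ∸ δ) ⟩
    a + δ + S + (y ∸ δ)         ≡⟨ cong (λ k → k + S + (y ∸ δ)) (m+[n∸m]≡n a≤p) ⟩
    p + S + (y ∸ δ)             ∎)
    where
    rotate : ∀ a s d z → a + (s + (d + z)) ≡ a + d + s + z
    rotate = solve-∀
  y≡ : y ≡ y′ + δ + ε
  y≡ = sym (m+[n∸m]≡n (≤-trans (+-monoˡ-≤ δ y′≤) (≤-reflexive (m∸n+n≡m δ≤y))))
  square : ∀ y d e a → y * y + 2 * ((y + d + e) * (a + d)) + (e * e + 2 * (y * e)) ≡
                       (y + d + e) * (y + d + e) + 2 * ((y + d + e) * a) + d * d
  square = solve-∀

-- Drift plus penalty: a 0/1 assignment is chosen in every round so as to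
-- minimise K cost + B Σ debt (usage - supply), and the sum of the
-- squared debts serves as potential function.
module DriftPlusPenalty {Row Var Assignment : Set} (rows : List Row) (vars : List Var)
  (holds : Assignment → Var → Bool) (supplyConst usageConst : Row → ℕ) (supplyCoef usageCoef : Row → Var → ℕ) where

  pays : (Var → Bool) → (Var → ℕ) → Var → ℕ
  pays X f x = if X x then f x else 0

  supplied used : Row → (Var → Bool) → ℕ
  supplied row X = supplyConst row + total (pays X (supplyCoef row)) vars
  used     row X = usageConst row + total (pays X (usageCoef row)) vars

  debts : List Assignment → Row → ℕ
  debts H row = total (λ X → used row (holds X)) H ∸ total (λ X → supplied row (holds X)) H

  gains losses : List Assignment → Var → ℕ
  gains  H x = total (λ row → debts H row * supplyCoef row x) rows
  losses H x = total (λ row → debts H row * usageCoef row x) rows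

  module _ (R : ℕ) (supplied≤ : ∀ {row} → row ∈ rows → ∀ X → supplied row (holds X) ≤ R)
           (used≤ : ∀ {row} → row ∈ rows → ∀ X → used row (holds X) ≤ R)
           (X⋆ : Var → Bool) (feasible : ∀ {row} → row ∈ rows → used row X⋆ ≤ supplied row X⋆)
           (K B : ℕ) (cost : Var → ℕ) (next : List Assignment → Assignment)
           (greedy : ∀ H {x} → x ∈ vars →
             K * pays (holds (next H)) cost x + B * pays (holds (next H)) (losses H) x + B * pays X⋆ (gains H) x
               ≤ K * pays X⋆ cost x + B * pays X⋆ (losses H) x + B * pays (holds (next H)) (gains H) x)
    where

    private
      costOf : (Var → Bool) → ℕ
      costOf X = total (pays X cost) vars

      energy : List Assignment → ℕ
      energy H = total (λ row → debts H row * debts H row) rows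

      drift : (H : List Assignment) (f : Row → ℕ) → ℕ
      drift H f = total (λ row → debts H row * f row) rows

      -- Exchanging the order of summation turns a sum over rows, weighted by debts, into a sum over
      -- variables. This is what reduces the minimisation to separate decisions about single
      -- variables.
      drift-split : ∀ H (c : Row → ℕ) (coef : Row → Var → ℕ) X →
        drift H (λ row → c row + total (pays X (coef row)) vars) ≡
        drift H c + total (pays X (λ x → total (λ row → debts H row * coef row x) rows)) vars
      drift-split H c coef X = trans
        (trans (total-cong rows (λ {row} _ → *-distribˡ-+ (debts H row) (c row) _)) (total-+ _ _ rows))
        (cong (drift H c +_) (trans (total-cong rows (λ {row} _ → sym (total-* (debts H row) _ vars)))
          (trans (total-swap _ rows vars) (total-cong vars (λ {x} _ → factor x (X x))))))
        where
        factor : ∀ x b → total (λ row → debts H row * (if b then coef row x else 0)) rows ≡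
                         (if b then total (λ row → debts H row * coef row x) rows else 0)
        factor x true  = refl
        factor x false = trans (total-cong rows (λ {row} _ → *-zeroʳ (debts H row)))
                               (trans (total-const 0 rows) (*-zeroʳ (length rows)))

      -- The greedy choice is at least as good as `X⋆` in K cost + B Σ debt (usage - supply), and
      -- for `X⋆` the second part is at most 0, since it is feasible and debts are nonnegative.
      round-bound : ∀ H → K * costOf (holds (next H)) + B * drift H (λ row → used row (holds (next H)))
                          ≤ K * costOf X⋆ + B * drift H (λ row → supplied row (holds (next H)))
      round-bound H = +-cancelʳ-≤ (B * G⋆ + B * L⋆) _ _ (begin
        K * costOf X + B * drift H (λ row → used row X) + (B * G⋆ + B * L⋆)
          ≡⟨ cong (λ k → K * costOf X + B * k + (B * G⋆ + B * L⋆)) (drift-split H usageConst usageCoef X) ⟩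
        K * costOf X + B * (U + L) + (B * G⋆ + B * L⋆)        ≡⟨ left K (costOf X) B U L G⋆ L⋆ ⟩
        (K * costOf X + B * L + B * G⋆) + B * (U + L⋆)        ≤⟨ +-mono-≤ pointwise (*-monoʳ-≤ B feasible-drift) ⟩
        (K * costOf X⋆ + B * L⋆ + B * G) + B * (S + G⋆)       ≡⟨ right K (costOf X⋆) B L⋆ G S G⋆ ⟩
        K * costOf X⋆ + B * (S + G) + (B * G⋆ + B * L⋆)
          ≡⟨ cong (λ k → K * costOf X⋆ + B * k + (B * G⋆ + B * L⋆)) (drift-split H supplyConst supplyCoef X) ⟨
        K * costOf X⋆ + B * drift H (λ row → supplied row X) + (B * G⋆ + B * L⋆) ∎)
        where
        open ≤-Reasoning
        X = holds (next H)
        U = drift H usageConst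
        S = drift H supplyConst
        L = total (pays X (losses H)) vars
        G = total (pays X (gains H)) vars
        L⋆ = total (pays X⋆ (losses H)) vars
        G⋆ = total (pays X⋆ (gains H)) vars
        combine : ∀ (f g h : Var → ℕ) → total (λ x → K * f x + B * g x + B * h x) vars ≡
                  K * total f vars + B * total g vars + B * total h vars
        combine f g h = trans (total-+ _ _ vars) (cong₂ _+_
          (trans (total-+ _ _ vars) (cong₂ _+_ (total-* K f vars) (total-* B g vars))) (total-* B h vars))
        pointwise : K * costOf X + B * L + B * G⋆ ≤ K * costOf X⋆ + B * L⋆ + B * G
        pointwise = ≤-trans (≤-reflexive (sym (combine _ _ _)))
          (≤-trans (total-mono vars (greedy H)) (≤-reflexive (combine _ _ _)))
        feasible-drift : U + L⋆ ≤ S + G⋆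
        feasible-drift = ≤-trans (≤-reflexive (sym (drift-split H usageConst usageCoef X⋆)))
          (≤-trans (total-mono rows (λ {row} row∈ → *-monoʳ-≤ (debts H row) (feasible row∈)))
                   (≤-reflexive (drift-split H supplyConst supplyCoef X⋆)))
        left : ∀ k c b u l g m → k * c + b * (u + l) + (b * g + b * m) ≡ (k * c + b * l + b * g) + b * (u + m)
        left = solve-∀
        right : ∀ k c b m g s h → (k * c + b * m + b * g) + b * (s + h) ≡ k * c + b * (s + g) + (b * h + b * m)
        right = solve-∀

      energy-bound : ∀ H → energy (next H ∷ H) + 2 * drift H (λ row → supplied row (holds (next H)))
        ≤ energy H + 2 * drift H (λ row → used row (holds (next H))) + length rows * (R * R)
      energy-bound H = begin
        energy (next H ∷ H) + 2 * drift H s          ≡⟨ cong (energy (next H ∷ H) +_) (total-* 2 _ rows) ⟨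
        energy (next H ∷ H) + total (λ row → 2 * (debts H row * s row)) rows ≡⟨ total-+ _ _ rows ⟨
        total (λ row → debts (next H ∷ H) row * debts (next H ∷ H) row + 2 * (debts H row * s row)) rows
          ≤⟨ total-mono rows (λ row∈ → energy-step _ _ _ _ R (used≤ row∈ (next H)) (supplied≤ row∈ (next H))) ⟩
        total (λ row → debts H row * debts H row + 2 * (debts H row * u row) + R * R) rows
          ≡⟨ trans (total-+ _ _ rows) (cong₂ _+_ (trans (total-+ _ _ rows) (cong (energy H +_) (total-* 2 _ rows)))
               (total-const (R * R) rows)) ⟩
        energy H + 2 * drift H u + length rows * (R * R) ∎
        where
        open ≤-Reasoning
        s u : Row → ℕ
        s row = supplied row (holds (next H))
        u row = used row (holds (next H))

    run : ℕ → List Assignment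
    run zero    = []
    run (suc t) = next (run t) ∷ run t

    -- Add the bounds on cost and energy over all rounds: the drifts cancel and the energy
    -- telescopes from 0. Leaving out either of the two terms on the left yields a bound on the
    -- debts or on the costs.
    potential-bound : ∀ t → B * total (λ row → debts (run t) row * debts (run t) row) rows
      + 2 * (K * total (λ X → total (pays (holds X) cost) vars) (run t))
      ≤ 2 * (t * (K * total (pays X⋆ cost) vars)) + t * (B * (length rows * (R * R)))
    potential-bound zero = ≤-reflexive (trans (cong₂ (λ j k → B * j + 2 * k)
      (trans (total-const 0 rows) (*-zeroʳ (length rows))) (*-zeroʳ K)) (cong (_+ 0) (*-zeroʳ B)))
    potential-bound (suc t) = +-cancelʳ-≤ (2 * (B * s)) _ _ (begin
      B * energy (next H ∷ H) + 2 * (K * (c + costs)) + 2 * (B * s)  ≡⟨ left B (energy (next H ∷ H)) K c costs s ⟩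
      B * (energy (next H ∷ H) + 2 * s) + 2 * (K * costs) + 2 * (K * c)
        ≤⟨ +-monoˡ-≤ (2 * (K * c)) (+-monoˡ-≤ (2 * (K * costs)) (*-monoʳ-≤ B (energy-bound H))) ⟩
      B * (energy H + 2 * u + r) + 2 * (K * costs) + 2 * (K * c)     ≡⟨ middle B (energy H) u r K costs c ⟩
      (B * energy H + 2 * (K * costs)) + 2 * (K * c + B * u) + B * r
        ≤⟨ +-monoˡ-≤ (B * r) (+-mono-≤ (potential-bound t) (*-monoʳ-≤ 2 (round-bound H))) ⟩
      (2 * (t * (K * c⋆)) + t * (B * r)) + 2 * (K * c⋆ + B * s) + B * r ≡⟨ right t K c⋆ B r s ⟩
      2 * (suc t * (K * c⋆)) + suc t * (B * r) + 2 * (B * s)          ∎)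
      where
      open ≤-Reasoning
      H = run t
      s = drift H (λ row → supplied row (holds (next H)))
      u = drift H (λ row → used row (holds (next H)))
      c = costOf (holds (next H))
      c⋆ = costOf X⋆
      costs = total (λ X → costOf (holds X)) H
      r = length rows * (R * R)
      left : ∀ b e k c d s → b * e + 2 * (k * (c + d)) + 2 * (b * s) ≡ b * (e + 2 * s) + 2 * (k * d) + 2 * (k * c)
      left = solve-∀
      middle : ∀ b e u r k d c → b * (e + 2 * u + r) + 2 * (k * d) + 2 * (k * c) ≡
                                 (b * e + 2 * (k * d)) + 2 * (k * c + b * u) + b * r
      middle = solve-∀
      right : ∀ t k c b r s → (2 * (t * (k * c)) + t * (b * r)) + 2 * (k * c + b * s) + b * r ≡
                              2 * (suc t * (k * c)) + suc t * (b * r) + 2 * (b * s)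
      right = solve-∀

-- The constraints written out

module _ {A B : Set} where

  total-map : ∀ (f : B → ℕ) (g : A → B) xs → total f (map g xs) ≡ total (f ∘ g) xs
  total-map f g xs = cong sum (sym (List.map-∘ xs))

  total-concatMap : ∀ (f : B → ℕ) (g : A → List B) xs → total f (List.concatMap g xs) ≡ total (λ x → total f (g x)) xs
  total-concatMap f g []       = refl
  total-concatMap f g (x ∷ xs) = trans (cong sum (List.map-++ f (g x) (List.concatMap g xs)))
    (trans (sum-++ (map f (g x)) _) (cong (total f (g x) +_) (total-concatMap f g xs)))

total-upTo-suc : ∀ (f : ℕ → ℕ) n → total f (upTo (suc n)) ≡ f 0 + total (f ∘ suc) (upTo n)
total-upTo-suc f n = cong (λ xs → f 0 + sum xs) (trans (List.map-applyUpTo suc f n) (sym (List.map-upTo (f ∘ suc) n)))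

eqℕ-true : ∀ a b → eqℕ a b ≡ true → a ≡ b
eqℕ-true a b eq with (a ∸ b) + (b ∸ a) in e
... | zero = ≤-antisym (m∸n≡0⇒m≤n (m+n≡0⇒m≡0 _ e)) (m∸n≡0⇒m≤n (m+n≡0⇒n≡0 (a ∸ b) e))

eqℕ-refl : ∀ a → eqℕ a a ≡ true
eqℕ-refl a rewrite n∸n≡0 a = refl

if-true : ∀ {A : Set} {b} {x y : A} → b ≡ true → (if b then x else y) ≡ x
if-true refl = refl

total-zero : ∀ {A : Set} (xs : List A) → total (λ _ → 0) xs ≡ 0
total-zero xs = trans (total-const 0 xs) (*-zeroʳ (length xs))

total-pick : ∀ (f : ℕ → ℕ) {v n} → v < n → total (λ w → if eqℕ w v then f w else 0) (upTo n) ≡ f v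
total-pick f {zero}  {suc n} _ = trans (total-upTo-suc _ n) (trans (cong (f 0 +_) (total-zero (upTo n))) (+-identityʳ _))
total-pick f {suc v} {suc n} (s≤s v<n) = trans (total-upTo-suc (λ w → if eqℕ w (suc v) then f w else 0) n) (total-pick (f ∘ suc) v<n)

at-applyUpTo : ∀ {A : Set} (d : A) f {n i} → i < n → at d (List.applyUpTo f n) i ≡ f i
at-applyUpTo d f {suc n} {zero}  _         = refl
at-applyUpTo d f {suc n} {suc i} (s≤s i<n) = at-applyUpTo d (f ∘ suc) i<n

at-map-upTo : ∀ {A : Set} (d : A) f {n i} → i < n → at d (map f (upTo n)) i ≡ f i
at-map-upTo d f {n} i<n = trans (cong (λ xs → at d xs _) (List.map-upTo f n)) (at-applyUpTo d f i<n)

infix 4 _∈Row_ _∈Var_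
_∈Row_ : Row → ℕ → Set
(k , v , u) ∈Row n = k < 3 × v < n × u < n

_∈Var_ : Var → ℕ → Set
(v , j) ∈Var n = v < n × j < suc n

∈-rowsOf⁻ : ∀ n {row} → row ∈ rowsOf n → row ∈Row n
∈-rowsOf⁻ n row∈ with find (∈.∈-concatMap⁻ (λ k → List.concatMap (λ v → map (λ u → k , v , u) (upTo n)) (upTo n)) {xs = upTo 3} row∈)
... | k , k∈ , row∈₁ with find (∈.∈-concatMap⁻ (λ v → map (λ u → k , v , u) (upTo n)) {xs = upTo n} row∈₁)
... | v , v∈ , row∈₂ with ∈.∈-map⁻ (λ u → k , v , u) row∈₂
... | u , u∈ , refl = ∈.∈-upTo⁻ k∈ , ∈.∈-upTo⁻ v∈ , ∈.∈-upTo⁻ u∈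

∈-rowsOf⁺ : ∀ n {row} → row ∈Row n → row ∈ rowsOf n
∈-rowsOf⁺ n {k , v , u} (k< , v< , u<) =
  ∈.∈-concatMap⁺ (λ k → List.concatMap (λ v → map (λ u → k , v , u) (upTo n)) (upTo n)) (lose (∈.∈-upTo⁺ k<)
    (∈.∈-concatMap⁺ (λ v → map (λ u → k , v , u) (upTo n)) (lose (∈.∈-upTo⁺ v<) (∈.∈-map⁺ (λ u → k , v , u) (∈.∈-upTo⁺ u<)))))

∈-varsOf⁻ : ∀ n {x} → x ∈ varsOf n → x ∈Var n
∈-varsOf⁻ n x∈ with find (∈.∈-concatMap⁻ (λ v → map (λ j → v , j) (upTo (suc n))) {xs = upTo n} x∈)
... | v , v∈ , x∈₁ with ∈.∈-map⁻ (λ j → v , j) x∈₁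
... | j , j∈ , refl = ∈.∈-upTo⁻ v∈ , ∈.∈-upTo⁻ j∈

all-sound : ∀ {A : Set} (p : A → Bool) {x} xs → all p xs ≡ true → x ∈ xs → p x ≡ true
all-sound p (x ∷ xs) eq x∈ with p x in e
all-sound p (x ∷ xs) eq (here refl) | true = e
all-sound p (x ∷ xs) eq (there x∈)  | true = all-sound p xs eq x∈

all-complete : ∀ {A : Set} (p : A → Bool) xs → (∀ {x} → x ∈ xs → p x ≡ true) → all p xs ≡ true
all-complete p []       px = refl
all-complete p (x ∷ xs) px rewrite px (here refl) = all-complete p xs (px ∘ there)

length-rowsOf : ∀ n → length (rowsOf n) ≡ 3 * (n * n)
length-rowsOf n = trans (List.length-++ (table 0)) (cong₂ _+_ (block 0)
  (trans (List.length-++ (table 1)) (cong₂ _+_ (block 1) (trans (List.length-++ (table 2)) (cong (_+ 0) (block 2))))))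
  where
  table : ℕ → List Row
  table k = List.concatMap (λ v → map (λ u → k , v , u) (upTo n)) (upTo n)
  block : ∀ k → length (table k) ≡ n * n
  block k = trans (length-total (upTo n)) (cong (_* n) (List.length-upTo n))
    where
    length-total : ∀ xs → length (List.concatMap (λ v → map (λ u → k , v , u) (upTo n)) xs) ≡ length xs * n
    length-total []       = refl
    length-total (v ∷ xs) = trans (List.length-++ (map (λ u → k , v , u) (upTo n)))
      (cong₂ _+_ (trans (List.length-map _ (upTo n)) (List.length-upTo n)) (length-total xs))

module _ (X : Var → Bool) (n : ℕ) where

  private
    pays : (Var → ℕ) → Var → ℕ
    pays f x = if X x then f x else 0

    pays-if : ∀ b c v j → (if X (v , j) then (if b then c else 0) else 0) ≡ (if b then (if X (v , j) then c else 0) else 0)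
    pays-if true  c v j = refl
    pays-if false c v j with X (v , j)
    ... | true  = refl
    ... | false = refl

  -- Either side of any row involves the variables of a single vertex only, so the double sum over
  -- all variables collapses to that vertex.
  total-vars : ∀ (coef : Var → ℕ) (f : ℕ → ℕ) {v} → v < n →
    (∀ w j → coef (w , j) ≡ (if eqℕ w v then f j else 0)) →
    total (pays coef) (varsOf n) ≡ (if X (v , 0) then f 0 else 0) + total (λ u → if X (v , suc u) then f (suc u) else 0) (upTo n)
  total-vars coef f {v} v<n eq = begin
    total (pays coef) (varsOf n)                       ≡⟨ total-concatMap (pays coef) _ (upTo n) ⟩
    total (λ w → total (pays coef) (map (w ,_) (upTo (suc n)))) (upTo n)
      ≡⟨ total-cong (upTo n) (λ {w} _ → trans (total-map (pays coef) (w ,_) (upTo (suc n)))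
           (total-cong (upTo (suc n)) (λ {j} _ → trans (cong (λ c → if X (w , j) then c else 0) (eq w j)) (pays-if (eqℕ w v) (f j) w j)))) ⟩
    total (λ w → total (λ j → if eqℕ w v then (if X (w , j) then f j else 0) else 0) (upTo (suc n))) (upTo n)
      ≡⟨ total-cong (upTo n) (λ {w} _ → pull-if (eqℕ w v) w) ⟩
    total (λ w → if eqℕ w v then total (λ j → if X (w , j) then f j else 0) (upTo (suc n)) else 0) (upTo n)
      ≡⟨ total-pick _ v<n ⟩
    total (λ j → if X (v , j) then f j else 0) (upTo (suc n)) ≡⟨ total-upTo-suc _ n ⟩
    (if X (v , 0) then f 0 else 0) + total (λ u → if X (v , suc u) then f (suc u) else 0) (upTo n) ∎
    where
    open ≡-Reasoning
    pull-if : ∀ b w → total (λ j → if b then (if X (w , j) then f j else 0) else 0) (upTo (suc n)) ≡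
                      (if b then total (λ j → if X (w , j) then f j else 0) (upTo (suc n)) else 0)
    pull-if true  w = refl
    pull-if false w = total-zero (upTo (suc n))

module _ (n m : ℕ) (adj : List (List Bool)) (ws : List Rat) (X : Var → Bool) where

  private
    g : Graphᴸ
    g = n , m , adj , ws

    supplied used : Row → ℕ
    supplied row = supplyConst g row + total (λ x → if X x then supplyCoef g row x else 0) (varsOf n)
    used     row = usageConst g row + total (λ x → if X x then usageCoef g row x else 0) (varsOf n)

    bit-∧ : ∀ a b → bit (a ∧ b) ≡ (if a then bit b else 0)
    bit-∧ true  b = refl
    bit-∧ false b = refl

    if-zero : ∀ b → (if b then 0 else 0) ≡ 0
    if-zero true  = refl
    if-zero false = refl

    none : total (λ x → if X x then 0 else 0) (varsOf n) ≡ 0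
    none = trans (total-cong (varsOf n) (λ {x} _ → if-zero (X x))) (total-zero (varsOf n))

    exchange : ∀ a b → (if a then bit b else 0) ≡ (if b then bit a else 0)
    exchange true  true  = refl
    exchange true  false = refl
    exchange false true  = refl
    exchange false false = refl

    picked-z : ∀ v {u} → u < n → total (λ w → if X (v , suc w) then bit (eqℕ w u) else 0) (upTo n) ≡ bit (X (v , suc u))
    picked-z v {u} u<n = trans (total-cong (upTo n) (λ {w} _ → exchange (X (v , suc w)) (eqℕ w u)))
                               (total-pick (λ w → bit (X (v , suc w))) u<n)

  used₀ : ∀ v u → used (0 , v , u) ≡ m
  used₀ v u = trans (cong (m +_) none) (+-identityʳ m)

  supplied₀ : ∀ {v} u → v < n → supplied (0 , v , u) ≡
    (if X (v , 0) then m else 0) + total (λ u → if X (v , suc u) then bit (adjacent adj v u) else 0) (upTo n)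
  supplied₀ {v} u v<n = total-vars X n (supplyCoef g (0 , v , u)) (λ j → if isZero j then m else bit (adjacent adj v (j ∸ 1))) v<n (λ _ _ → refl)

  supplied₁ : ∀ v {u} → u < n → supplied (1 , v , u) ≡ bit (X (u , 0))
  supplied₁ v {u} u<n = trans (total-vars X n (supplyCoef g (1 , v , u)) (λ j → bit (isZero j)) u<n (λ w j → bit-∧ (eqℕ w u) (isZero j)))
    (trans (cong (bit (X (u , 0)) +_) (trans (total-cong (upTo n) (λ {x} _ → if-zero (X (u , suc x)))) (total-zero (upTo n)))) (+-identityʳ _))

  used₁ : ∀ {v u} → v < n → u < n → used (1 , v , u) ≡ bit (X (v , suc u))
  used₁ {v} {u} v<n u<n = trans (total-vars X n (usageCoef g (1 , v , u)) (λ j → bit (eqℕ j (suc u))) v<n (λ w j → bit-∧ (eqℕ w v) _))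
    (trans (cong (_+ total (λ w → if X (v , suc w) then bit (eqℕ (suc w) (suc u)) else 0) (upTo n)) (if-zero (X (v , 0)))) (picked-z v u<n))

  supplied₂ : ∀ v u → supplied (2 , v , u) ≡ 1
  supplied₂ v u = cong suc none

  used₂ : ∀ {v u} → v < n → u < n → used (2 , v , u) ≡ bit (X (v , 0)) + bit (X (v , suc u))
  used₂ {v} {u} v<n u<n = trans (total-vars X n (usageCoef g (2 , v , u)) (λ j → bit (isZero j ∨ eqℕ j (suc u))) v<n (λ w j → bit-∧ (eqℕ w v) _))
    (cong (bit (X (v , 0)) +_) (picked-z v u<n))

-- The rational is k / Q. A common denominator Q of all weights makes them comparable as natural
-- numbers; it occurs in the proof only and is never computed by the program.
record Scaled (Q : ℕ) (r : Rat) (k : ℕ) : Set where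
  constructor scaled
  field
    value-eq : value (num r) * Q ≡ k * value (den r)
    den-pos  : 0 < value (den r)

open Scaled public

scaled-zero : ∀ Q → Scaled Q zeroRat 0
scaled-zero Q = scaled refl (s≤s z≤n)

leq-false : ∀ m n → leq m n ≡ false → n ≤ m
leq-false m n eq with ≤-total m n
... | inj₂ n≤m = n≤m
... | inj₁ m≤n with trans (sym eq) (leq-true m≤n)
... | ()

pos⇒nonZero : ∀ {n} → 0 < n → NonZero n
pos⇒nonZero (s≤s _) = _

module _ {Q : ℕ} (Q>0 : 0 < Q) where

  private
    instance
      Q≢0 : NonZero Q
      Q≢0 = pos⇒nonZero Q>0

  leRat-scaled : ∀ {r s k l} → Scaled Q r k → Scaled Q s l → leRat r s ≡ leq k l
  leRat-scaled {r} {s} {k} {l} R S = trans (leD-value (mulD (num r) (den s)) (mulD (num s) (den r)))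
    (trans (cong₂ leq (value-mulD (num r) (den s)) (value-mulD (num s) (den r)))
      (leq-cong {nr * ds} {ns * dr} {k} {l}
        (λ h → *-cancelʳ-≤ k l (dr * ds) {{m*n≢0 dr ds}} (≤-trans (≤-reflexive (sym left)) (≤-trans (*-monoˡ-≤ Q h) (≤-reflexive right))))
        (λ h → *-cancelʳ-≤ (nr * ds) (ns * dr) Q (≤-trans (≤-reflexive left) (≤-trans (*-monoˡ-≤ (dr * ds) h) (≤-reflexive (sym right)))))))
    where
    nr = value (num r)
    dr = value (den r)
    ns = value (num s)
    ds = value (den s)
    instance
      dr≢0 : NonZero dr
      dr≢0 = pos⇒nonZero (den-pos R)
      ds≢0 : NonZero ds
      ds≢0 = pos⇒nonZero (den-pos S)
    swap-last : ∀ a b c → a * b * c ≡ a * c * b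
    swap-last = solve-∀
    left : nr * ds * Q ≡ k * (dr * ds)
    left = trans (swap-last nr ds Q) (trans (cong (_* ds) (value-eq R)) (*-assoc k dr ds))
    right : ns * dr * Q ≡ l * (dr * ds)
    right = trans (swap-last ns dr Q) (trans (cong (_* dr) (value-eq S)) (trans (*-assoc l ds dr) (cong (l *_) (*-comm ds dr))))

  worthwhile-scaled : ∀ {w B W b} → Scaled Q w W → Scaled Q B b → ∀ K l h →
    worthwhile K w B l h ≡ leq (K * W + l * b) (h * b)
  worthwhile-scaled {w} {B} {W} {b} V S K l h = trans (leD-value (addD (scale K (mulD (num w) (den B))) (scale l (mulD (num B) (den w)))) (scale h (mulD (num B) (den w))))
    (trans (cong₂ leq value-left value-right)
      (leq-cong {K * (nw * dB) + l * (nB * dw)} {h * (nB * dw)} {K * W + l * b} {h * b}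
        (λ le → *-cancelʳ-≤ (K * W + l * b) (h * b) (dw * dB) {{m*n≢0 dw dB}} (≤-trans (≤-reflexive (sym left)) (≤-trans (*-monoˡ-≤ Q le) (≤-reflexive right))))
        (λ le → *-cancelʳ-≤ (K * (nw * dB) + l * (nB * dw)) (h * (nB * dw)) Q (≤-trans (≤-reflexive left) (≤-trans (*-monoˡ-≤ (dw * dB) le) (≤-reflexive (sym right)))))))
    where
    nw = value (num w)
    dw = value (den w)
    nB = value (num B)
    dB = value (den B)
    instance
      dw≢0 : NonZero dw
      dw≢0 = pos⇒nonZero (den-pos V)
      dB≢0 : NonZero dB
      dB≢0 = pos⇒nonZero (den-pos S)
    product : ∀ k x y → value (scale k (mulD x y)) ≡ k * (value x * value y)
    product k x y = trans (value-scale k (mulD x y)) (cong (k *_) (value-mulD x y))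
    value-left : value (addD (scale K (mulD (num w) (den B))) (scale l (mulD (num B) (den w)))) ≡ K * (nw * dB) + l * (nB * dw)
    value-left = trans (value-addD (scale K (mulD (num w) (den B))) (scale l (mulD (num B) (den w))))
      (cong₂ _+_ (product K (num w) (den B)) (product l (num B) (den w)))
    value-right : value (scale h (mulD (num B) (den w))) ≡ h * (nB * dw)
    value-right = product h (num B) (den w)
    left : (K * (nw * dB) + l * (nB * dw)) * Q ≡ (K * W + l * b) * (dw * dB)
    left = trans (collect K nw dB l nB dw Q) (trans (cong₂ (λ x y → K * (x * dB) + l * (y * dw)) (value-eq V) (value-eq S)) (spread K W dw dB l b))
      where
      collect : ∀ K a e l c d q → (K * (a * e) + l * (c * d)) * q ≡ K * ((a * q) * e) + l * ((c * q) * d)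
      collect = solve-∀
      spread : ∀ K W d e l b → K * ((W * d) * e) + l * ((b * e) * d) ≡ (K * W + l * b) * (d * e)
      spread = solve-∀
    right : h * (nB * dw) * Q ≡ h * b * (dw * dB)
    right = trans (collect h nB dw Q) (trans (cong (λ x → h * (x * dw)) (value-eq S)) (spread h b dB dw))
      where
      collect : ∀ h c d q → h * (c * d) * q ≡ h * ((c * q) * d)
      collect = solve-∀
      spread : ∀ h b e d → h * ((b * e) * d) ≡ h * b * (d * e)
      spread = solve-∀

  isZero-scaled : ∀ {w W} → Scaled Q w W → leD (num w) [] ≡ leq W 0
  isZero-scaled {w} {W} V = trans (leD-value (num w) []) (leq-cong {value (num w)} {0} {W} {0}
    (λ n≤0 → *-cancelʳ-≤ W 0 (value (den w)) {{pos⇒nonZero (den-pos V)}} (≤-reflexive (trans (sym (value-eq V)) (cong (_* Q) (n≤0⇒n≡0 n≤0)))))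
    (λ W≤0 → *-cancelʳ-≤ (value (num w)) 0 Q (≤-reflexive (trans (value-eq V) (cong (_* value (den w)) (n≤0⇒n≡0 W≤0))))))

module _ (n : ℕ) (W : ℕ → ℕ) where

  cost : Var → ℕ
  cost (v , zero)  = W v
  cost (v , suc _) = 0

  chosenWeight : (ℕ → Bool) → ℕ
  chosenWeight s = total (λ v → if s v then W v else 0) (upTo n)

  total-cost : ∀ (X : Var → Bool) → total (λ x → if X x then cost x else 0) (varsOf n) ≡ chosenWeight (λ v → X (v , 0))
  total-cost X = trans (total-concatMap (λ x → if X x then cost x else 0) (λ v → map (v ,_) (upTo (suc n))) (upTo n)) (total-cong (upTo n) (λ {v} _ →
    trans (total-map (λ x → if X x then cost x else 0) (v ,_) (upTo (suc n))) (trans (total-upTo-suc (λ j → if X (v , j) then cost (v , j) else 0) n)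
      (trans (cong ((if X (v , 0) then W v else 0) +_) (trans (total-cong (upTo n) (λ {j} _ → if-zero (X (v , suc j)))) (total-zero (upTo n))))
        (+-identityʳ _)))))
    where
    if-zero : ∀ b → (if b then 0 else 0) ≡ 0
    if-zero true  = refl
    if-zero false = refl

module Solve (n m : ℕ) (adj : List (List Bool)) (ws : List Rat) (m≤n : m ≤ n)
  {Q : ℕ} (Q>0 : 0 < Q) (W : ℕ → ℕ) (weights : ∀ {v} → v < n → Scaled Q (at zeroRat ws v) (W v))
  (s : ℕ → Bool)
  (dominating : ∀ {v} → v < n → s v ≡ false →
    m ≤ total (λ u → if s u then bit (adjacent adj v u) else 0) (upTo n)) where

  private
    g : Graphᴸ
    g = n , m , adj , ws

    optimum : ℕ
    optimum = chosenWeight n W s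

    -- The integral solution behind a dominating set sets z v u = x u (1 - x v). A vertex in the set
    -- needs no help from its neighbours, so the cap on z excludes no dominating set.
    X⋆ : Var → Bool
    X⋆ (v , zero)  = s v
    X⋆ (v , suc u) = s u ∧ not (s v)

  open DriftPlusPenalty (rowsOf n) (varsOf n) holds (supplyConst g) (usageConst g) (supplyCoef g) (usageCoef g)

  private
    bit≤1 : ∀ b → bit b ≤ 1
    bit≤1 true  = ≤-refl
    bit≤1 false = z≤n

    feasible : ∀ {row} → row ∈ rowsOf n → used row X⋆ ≤ supplied row X⋆
    feasible {k , v , u} row∈ with ∈-rowsOf⁻ n row∈
    feasible {0 , v , u} row∈ | _ , v<n , u<n = subst₂ _≤_ (sym (used₀ n m adj ws X⋆ v u)) (sym (supplied₀ n m adj ws X⋆ u v<n)) (row₀ (s v) refl)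
      where
      row₀ : ∀ b → s v ≡ b → m ≤ (if s v then m else 0) + total (λ u → if s u ∧ not (s v) then bit (adjacent adj v u) else 0) (upTo n)
      row₀ true  e rewrite e = m≤m+n m _
      row₀ false e = subst (λ b → m ≤ (if b then m else 0) + total (λ u → if s u ∧ not b then bit (adjacent adj v u) else 0) (upTo n)) (sym e)
        (≤-trans (dominating v<n e) (≤-reflexive (total-cong (upTo n) (λ {u} _ → cong (λ b → if b then bit (adjacent adj v u) else 0) (sym (∧-true (s u)))))))
        where
        ∧-true : ∀ b → b ∧ true ≡ b
        ∧-true true  = refl
        ∧-true false = refl
    feasible {1 , v , u} row∈ | _ , v<n , u<n = subst₂ _≤_ (sym (used₁ n m adj ws X⋆ v<n u<n)) (sym (supplied₁ n m adj ws X⋆ v u<n)) (row₁ (s u) (s v))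
      where
      row₁ : ∀ a b → bit (a ∧ not b) ≤ bit a
      row₁ true  b = bit≤1 (not b)
      row₁ false b = z≤n
    feasible {2 , v , u} row∈ | _ , v<n , u<n = subst₂ _≤_ (sym (used₂ n m adj ws X⋆ v<n u<n)) (sym (supplied₂ n m adj ws X⋆ v u)) (row₂ (s u) (s v))
      where
      row₂ : ∀ a b → bit b + bit (a ∧ not b) ≤ 1
      row₂ true  true  = ≤-refl
      row₂ true  false = ≤-refl
      row₂ false true  = ≤-refl
      row₂ false false = z≤n
    feasible {suc (suc (suc k)) , v , u} row∈ | s≤s (s≤s (s≤s ())) , _

    -- The term m x v supplies at most n because the demand has been clipped to n, and the
    -- neighbours supply at most n more. An unclipped demand would make the number of rounds depend
    -- on m.
    R : ℕ
    R = suc (2 * n)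

    supplied≤ : ∀ {row} → row ∈ rowsOf n → ∀ X → supplied row (holds X) ≤ R
    supplied≤ {k , v , u} row∈ X with ∈-rowsOf⁻ n row∈
    supplied≤ {0 , v , u} row∈ X | _ , v<n , u<n = ≤-trans (≤-reflexive (supplied₀ n m adj ws (holds X) u v<n))
      (≤-trans (+-mono-≤ (first (holds X (v , 0))) (≤-trans (total-mono (upTo n) (λ {u} _ → term (holds X (v , suc u)) (adjacent adj v u)))
        (≤-reflexive (trans (total-const 1 (upTo n)) (trans (*-identityʳ _) (List.length-upTo n))))))
        (≤-trans (≤-reflexive (cong (n +_) (sym (+-identityʳ n)))) (n≤1+n _)))
      where
      first : ∀ b → (if b then m else 0) ≤ n
      first true  = m≤n
      first false = z≤n
      term : ∀ a b → (if a then bit b else 0) ≤ 1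
      term true  b = bit≤1 b
      term false b = z≤n
    supplied≤ {1 , v , u} row∈ X | _ , v<n , u<n = ≤-trans (≤-reflexive (supplied₁ n m adj ws (holds X) v u<n)) (≤-trans (bit≤1 _) (s≤s z≤n))
    supplied≤ {2 , v , u} row∈ X | _ , v<n , u<n = ≤-trans (≤-reflexive (supplied₂ n m adj ws (holds X) v u)) (s≤s z≤n)
    supplied≤ {suc (suc (suc k)) , v , u} row∈ X | s≤s (s≤s (s≤s ())) , _

    used≤ : ∀ {row} → row ∈ rowsOf n → ∀ X → used row (holds X) ≤ R
    used≤ {k , v , u} row∈ X with ∈-rowsOf⁻ n row∈
    used≤ {0 , v , u} row∈ X | _ , v<n , u<n = ≤-trans (≤-reflexive (used₀ n m adj ws (holds X) v u)) (≤-trans m≤n (≤-trans (m≤m+n n _) (n≤1+n _)))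
    used≤ {1 , v , u} row∈ X | _ , v<n , u<n = ≤-trans (≤-reflexive (used₁ n m adj ws (holds X) v<n u<n)) (≤-trans (bit≤1 _) (s≤s z≤n))
    used≤ {2 , v , u} row∈ X | _ , v<n , u<n = ≤-trans (≤-reflexive (used₂ n m adj ws (holds X) v<n u<n))
      (≤-trans (+-mono-≤ (bit≤1 (holds X (v , 0))) (bit≤1 (holds X (v , suc u)))) (s≤s (≤-trans (≤-trans (s≤s z≤n) v<n) (m≤m+n n _))))
    used≤ {suc (suc (suc k)) , v , u} row∈ X | s≤s (s≤s (s≤s ())) , _

    holds-round : ∀ B H {v j} → (v , j) ∈Var n → holds (round g B H) (v , j) ≡ select g B H (v , j)
    holds-round B H {v} {j} (v<n , j≤n) = trans (cong (λ row → at false row j) (at-map-upTo [] _ v<n)) (at-map-upTo false _ j≤n)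

    selected : ∀ {B b} → Scaled Q B b → ∀ H {v} → v < n → select g B H (v , 0) ≡
      (if leq (W v) 0 then leq (loss g H (v , 0)) (gain g H (v , 0))
       else leq (4 * penalty n * W v + loss g H (v , 0) * b) (gain g H (v , 0) * b))
    selected {B} {b} S H {v} v<n = cong₂ (λ c d → if c then leq (loss g H (v , 0)) (gain g H (v , 0)) else d)
      (isZero-scaled Q>0 {w = weightAt g v} (weights v<n))
      (worthwhile-scaled Q>0 {w = weightAt g v} {B} (weights v<n) S (4 * penalty n) (loss g H (v , 0)) (gain g H (v , 0)))

    exchange-step : ∀ K B c l h b b⋆ → (b ≡ true → K * c + B * l ≤ B * h) → (b ≡ false → B * h ≤ K * c + B * l) →
      K * (if b then c else 0) + B * (if b then l else 0) + B * (if b⋆ then h else 0) ≤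
      K * (if b⋆ then c else 0) + B * (if b⋆ then l else 0) + B * (if b then h else 0)
    exchange-step K B c l h true  true  _ _ = ≤-refl
    exchange-step K B c l h false false _ _ = ≤-refl
    exchange-step K B c l h true  false take _ = subst₂ _≤_
      (trans (sym (+-identityʳ _)) (cong (K * c + B * l +_) (sym (*-zeroʳ B))))
      (cong₂ (λ x y → x + y + B * h) (sym (*-zeroʳ K)) (sym (*-zeroʳ B))) (take refl)
    exchange-step K B c l h false true  _ leave = subst₂ _≤_
      (cong₂ (λ x y → x + y + B * h) (sym (*-zeroʳ K)) (sym (*-zeroʳ B)))
      (trans (sym (+-identityʳ _)) (cong (K * c + B * l +_) (sym (*-zeroʳ B)))) (leave refl)

  module _ {B : Rat} {b : ℕ} (S : Scaled Q B b) where

    private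
      H : List Assignment
      H = history g B

      -- Two choices of the coefficients occur. For the costs, and for a positive guess b, they are
      -- 4 P and b. If b = 0, these say nothing about the debts, whose energy is multiplied by b,
      -- and the coefficients 0 and 1 are used.
      Greedy : ℕ → ℕ → Set
      Greedy K c = ∀ H {x} → x ∈ varsOf n →
        K * pays (holds (round g B H)) (cost n W) x + c * pays (holds (round g B H)) (losses H) x + c * pays X⋆ (gains H) x
          ≤ K * pays X⋆ (cost n W) x + c * pays X⋆ (losses H) x + c * pays (holds (round g B H)) (gains H) x

      free : ∀ K c H x b⋆ → cost n W x ≡ 0 → holds (round g B H) x ≡ leq (loss g H x) (gain g H x) →
        K * pays (holds (round g B H)) (cost n W) x + c * pays (holds (round g B H)) (losses H) x + c * (if b⋆ then gains H x else 0)
          ≤ K * (if b⋆ then cost n W x else 0) + c * (if b⋆ then losses H x else 0) + c * pays (holds (round g B H)) (gains H) x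
      free K c H x b⋆ c≡0 eq = exchange-step K c (cost n W x) (losses H x) (gains H x) (holds (round g B H) x) b⋆
        (λ e → ≤-trans (≤-reflexive (cong (_+ c * losses H x) no-cost)) (*-monoʳ-≤ c (leq-sound (loss g H x) (gain g H x) (trans (sym eq) e))))
        (λ e → ≤-trans (*-monoʳ-≤ c (leq-false (loss g H x) (gain g H x) (trans (sym eq) e))) (≤-reflexive (cong (_+ c * losses H x) (sym no-cost))))
        where
        no-cost : K * cost n W x ≡ 0
        no-cost = trans (cong (K *_) c≡0) (*-zeroʳ K)

      greedy-positive : Greedy (4 * penalty n) b
      greedy-positive H {v , suc j} x∈ = free (4 * penalty n) b H (v , suc j) (X⋆ (v , suc j)) refl (holds-round B H (∈-varsOf⁻ n x∈))
      greedy-positive H {v , zero}  x∈ with leq (W v) 0 in e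
      ... | true  = free (4 * penalty n) b H (v , 0) (s v) (n≤0⇒n≡0 (leq-sound (W v) 0 e)) (trans (holds-round B H (∈-varsOf⁻ n x∈))
        (trans (selected S H (proj₁ (∈-varsOf⁻ n x∈))) (if-true e)))
      ... | false = exchange-step (4 * penalty n) b (W v) (losses H (v , 0)) (gains H (v , 0)) (holds (round g B H) (v , 0)) (s v)
        (λ e′ → subst₂ (λ x y → 4 * penalty n * W v + x ≤ y) (*-comm _ b) (*-comm _ b) (leq-sound (4 * penalty n * W v + loss g H (v , 0) * b) _ (trans (sym chosen) e′)))
        (λ e′ → subst₂ (λ x y → y ≤ 4 * penalty n * W v + x) (*-comm _ b) (*-comm _ b) (leq-false (4 * penalty n * W v + loss g H (v , 0) * b) _ (trans (sym chosen) e′)))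
        where
        chosen : holds (round g B H) (v , 0) ≡ leq (4 * penalty n * W v + loss g H (v , 0) * b) (gain g H (v , 0) * b)
        chosen = trans (holds-round B H (∈-varsOf⁻ n x∈)) (trans (selected S H (proj₁ (∈-varsOf⁻ n x∈)))
          (cong (λ c → if c then leq (loss g H (v , 0)) (gain g H (v , 0)) else leq (4 * penalty n * W v + loss g H (v , 0) * b) (gain g H (v , 0) * b)) e))

      history-run : ∀ K c (gr : Greedy K c) → H ≡ run R supplied≤ used≤ X⋆ feasible K c (cost n W) (round g B) gr (rounds n)
      history-run K c gr = go (rounds n)
        where
        go : ∀ t → foldr (λ _ H → round g B H ∷ H) [] (List.replicate t tt) ≡ run R supplied≤ used≤ X⋆ feasible K c (cost n W) (round g B) gr t
        go zero    = refl
        go (suc t) = cong (λ H → round g B H ∷ H) (go t)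

      potential : ∀ K c → Greedy K c → c * total (λ row → debts H row * debts H row) (rowsOf n)
        + 2 * (K * total (λ X → chosenWeight n W (λ v → holds X (v , 0))) H) ≤ 2 * (rounds n * (K * optimum)) + rounds n * (c * penalty n)
      potential K c gr = subst₂ _≤_
        (cong₂ (λ H C → c * total (λ row → debts H row * debts H row) (rowsOf n) + 2 * (K * C)) (sym (history-run K c gr))
          (trans (cong (total (λ X → total (pays (holds X) (cost n W)) (varsOf n))) (sym (history-run K c gr)))
                 (total-cong H (λ {X} _ → total-cost n W (holds X)))))
        (cong₂ (λ o l → 2 * (rounds n * (K * o)) + rounds n * (c * l)) (total-cost n W X⋆)
          (trans (cong (_* (R * R)) (length-rowsOf n)) (sym (penalty-unfold n))))
        (potential-bound R supplied≤ used≤ X⋆ feasible K c (cost n W) (round g B) gr (rounds n))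

      P = penalty n
      T = rounds n
      spent = total (λ X → chosenWeight n W (λ v → holds X (v , 0))) H

      spent-empty : n ≡ 0 → spent ≡ 0
      spent-empty n≡0 = trans (total-cong H (λ {X} _ → cong (λ k → chosenWeight k W (λ v → holds X (v , 0))) n≡0)) (total-zero H)

      penalty-pos : ∀ {k} → n ≡ suc k → 0 < P
      penalty-pos {k} n≡ = subst (λ j → 0 < penalty j) (sym n≡) (≤-trans (s≤s z≤n) (≤-reflexive (sym (penalty-unfold (suc k)))))

    -- Leave out the energy in the potential bound. With costs weighted by 4 P the remaining error T
    -- b P becomes T b / 8 after division by 8 P.
    cost-bound : 8 * spent ≤ T * (8 * optimum + b)
    cost-bound = by-order n refl
      where
      by-order : ∀ k → n ≡ k → 8 * spent ≤ T * (8 * optimum + b)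
      -- Without vertices the penalty is 0 and could not be cancelled.
      by-order zero    n≡ = ≤-trans (≤-reflexive (cong (8 *_) (spent-empty n≡))) z≤n
      by-order (suc k) n≡ = *-cancelˡ-≤ P {{pos⇒nonZero (penalty-pos n≡)}} (begin
        P * (8 * spent)                               ≡⟨ left P spent ⟩
        2 * (4 * P * spent)                           ≤⟨ m≤n+m _ (b * total (λ row → debts H row * debts H row) (rowsOf n)) ⟩
        b * total (λ row → debts H row * debts H row) (rowsOf n) + 2 * (4 * P * spent) ≤⟨ potential (4 * P) b greedy-positive ⟩
        2 * (T * (4 * P * optimum)) + T * (b * P)     ≡⟨ right P T optimum b ⟩
        P * (T * (8 * optimum + b))                   ∎)
        where
        open ≤-Reasoning
        left : ∀ p c → p * (8 * c) ≡ 2 * (4 * p * c)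
        left = solve-∀
        right : ∀ p t o b → 2 * (t * (4 * p * o)) + t * (b * p) ≡ p * (t * (8 * o + b))
        right = solve-∀

    private
      square-cancel : ∀ x y → x * x ≤ y * y → x ≤ y
      square-cancel x y le with ≤-<-connex x y
      ... | inj₁ x≤y = x≤y
      ... | inj₂ y<x = contradiction le (<⇒≱ (*-mono-< y<x y<x))

      small-debts : (∀ {row} → row ∈ rowsOf n → debts H row * debts H row ≤ P * T * suc (8 * n)) → succeeds g B ≡ true
      small-debts small = trans (succeeds-unfold g B) (all-complete (λ row → leq (16 * n * debts H row) T) (rowsOf n) (λ {row} row∈ → leq-true (square-cancel (16 * n * debts H row) T (begin
        16 * n * debts H row * (16 * n * debts H row) ≡⟨ left (16 * n) (debts H row) ⟩
        16 * n * (16 * n) * (debts H row * debts H row) ≤⟨ *-monoʳ-≤ (16 * n * (16 * n)) (small row∈) ⟩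
        16 * n * (16 * n) * (P * T * suc (8 * n))     ≡⟨ right (16 * n * (16 * n)) P T (suc (8 * n)) ⟩
        T * (P * suc (8 * n) * (16 * n * (16 * n)))   ≡⟨ cong (T *_) (rounds-unfold n) ⟨
        T * T                                         ∎))))
        where
        open ≤-Reasoning
        left : ∀ e y → e * y * (e * y) ≡ e * e * (y * y)
        left = solve-∀
        right : ∀ e p t c → e * (p * t * c) ≡ t * (p * c * e)
        right = solve-∀

      square-term : ∀ {row} → row ∈ rowsOf n → debts H row * debts H row ≤ total (λ row → debts H row * debts H row) (rowsOf n)
      square-term row∈ = term≤total (λ row → debts H row * debts H row) row∈

    -- Leave out the costs in the potential bound. Since the optimum is at most n b, the guess
    -- cancels and every squared debt is at most P T (8 n + 1), for which `rounds` was chosen.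
    success : 0 < b → optimum ≤ n * b → succeeds g B ≡ true
    success b>0 optimum≤ = small-debts (λ {row} row∈ → *-cancelˡ-≤ b {{pos⇒nonZero b>0}} (begin
      b * (debts H row * debts H row)               ≤⟨ *-monoʳ-≤ b (square-term row∈) ⟩
      b * total (λ row → debts H row * debts H row) (rowsOf n) ≤⟨ m≤m+n _ _ ⟩
      b * total (λ row → debts H row * debts H row) (rowsOf n) + 2 * (4 * P * spent) ≤⟨ potential (4 * P) b greedy-positive ⟩
      2 * (T * (4 * P * optimum)) + T * (b * P)     ≤⟨ +-monoˡ-≤ (T * (b * P)) (*-monoʳ-≤ 2 (*-monoʳ-≤ T (*-monoʳ-≤ (4 * P) optimum≤))) ⟩
      2 * (T * (4 * P * (n * b))) + T * (b * P)     ≡⟨ collect P T n b ⟩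
      b * (P * T * suc (8 * n))                     ∎))
      where
      open ≤-Reasoning
      collect : ∀ p t n b → 2 * (t * (4 * p * (n * b))) + t * (b * p) ≡ b * (p * t * suc (8 * n))
      collect = solve-∀

    private
      weightless : b ≡ 0 → ∀ H {v} → v < n → holds (round g B H) (v , 0) ≡ true → W v ≡ 0
      weightless b≡0 H {v} v<n e with leq (W v) 0 in e₀
      ... | true  = n≤0⇒n≡0 (leq-sound (W v) 0 e₀)
      ... | false = contradiction (begin
          1                                               ≤⟨ *-mono-≤ (*-mono-≤ {1} {4} (s≤s z≤n) (pos v<n)) (W>0 (W v) e₀) ⟩
          4 * P * W v                                     ≤⟨ m≤m+n _ _ ⟩
          4 * P * W v + loss g H (v , 0) * b              ≤⟨ leq-sound (4 * P * W v + loss g H (v , 0) * b) _ chosen ⟩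
          gain g H (v , 0) * b                            ≡⟨ trans (cong (gain g H (v , 0) *_) b≡0) (*-zeroʳ (gain g H (v , 0))) ⟩
          0                                               ∎) (λ ())
        where
        open ≤-Reasoning
        chosen : leq (4 * P * W v + loss g H (v , 0) * b) (gain g H (v , 0) * b) ≡ true
        chosen = trans (sym (trans (selected S H v<n) (cong (λ c → if c then leq (loss g H (v , 0)) (gain g H (v , 0))
          else leq (4 * P * W v + loss g H (v , 0) * b) (gain g H (v , 0) * b)) e₀))) (trans (sym (holds-round B H (v<n , s≤s z≤n))) e)
        W>0 : ∀ w → leq w 0 ≡ false → 0 < w
        W>0 (suc w) _ = s≤s z≤n
        pos : ∀ {k} → v < k → 0 < penalty k
        pos {suc k} _ = ≤-trans (s≤s z≤n) (≤-reflexive (sym (penalty-unfold (suc k))))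

    -- With the guess 0 no vertex of positive weight is ever selected, and a solution of weight 0
    -- contains none either. On the remaining variables the selection follows the debts alone, so it
    -- is greedy with costs ignored.
    success-zero : b ≡ 0 → optimum ≡ 0 → succeeds g B ≡ true
    success-zero b≡0 optimum≡0 = small-debts (λ {row} row∈ → begin
      debts H row * debts H row               ≤⟨ square-term row∈ ⟩
      total (λ row → debts H row * debts H row) (rowsOf n) ≤⟨ ≤-trans (m≤m+n _ 0) (m≤m+n _ _) ⟩
      1 * total (λ row → debts H row * debts H row) (rowsOf n) + 2 * (0 * spent) ≤⟨ potential 0 1 greedy-zero ⟩
      2 * (T * (0 * optimum)) + T * (1 * P)   ≡⟨ collect T P ⟩
      P * T * 1                               ≤⟨ *-monoʳ-≤ (P * T) (s≤s (z≤n {8 * n})) ⟩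
      P * T * suc (8 * n)                     ∎)
      where
      open ≤-Reasoning
      collect : ∀ t p → 2 * (t * 0) + t * (1 * p) ≡ p * t * 1
      collect = solve-∀
      neither : ∀ K B c l h {a a⋆} → a ≡ false → a⋆ ≡ false →
        K * (if a then c else 0) + B * (if a then l else 0) + B * (if a⋆ then h else 0) ≤
        K * (if a⋆ then c else 0) + B * (if a⋆ then l else 0) + B * (if a then h else 0)
      neither K B c l h refl refl = ≤-refl
      unless : ∀ {a w} → (a ≡ true → w ≡ 0) → leq w 0 ≡ false → a ≡ false
      unless {false} _ _ = refl
      unless {true} to0 e with trans (sym e) (cong (λ w → leq w 0) (to0 refl))
      ... | ()
      greedy-zero : Greedy 0 1
      greedy-zero H {v , suc j} x∈ = free 0 1 H (v , suc j) (X⋆ (v , suc j)) refl (holds-round B H (∈-varsOf⁻ n x∈))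
      greedy-zero H {v , zero}  x∈ with leq (W v) 0 in e
      ... | true  = free 0 1 H (v , 0) (s v) (n≤0⇒n≡0 (leq-sound (W v) 0 e)) (trans (holds-round B H (∈-varsOf⁻ n x∈))
        (trans (selected S H (proj₁ (∈-varsOf⁻ n x∈))) (if-true e)))
      ... | false = neither 0 1 (W v) (losses H (v , 0)) (gains H (v , 0))
        (unless (weightless b≡0 H (proj₁ (∈-varsOf⁻ n x∈))) e)
        (unless (λ sv → n≤0⇒n≡0 (≤-trans (≤-reflexive (sym (if-true sv))) (≤-trans
          (term≤total (λ v → if s v then W v else 0) (∈.∈-upTo⁺ (proj₁ (∈-varsOf⁻ n x∈)))) (≤-reflexive optimum≡0)))) e)

at-∈ : ∀ {A : Set} (d : A) xs {i} → i < length xs → at d xs i ∈ xs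
at-∈ d (x ∷ xs) {zero}  _         = here refl
at-∈ d (x ∷ xs) {suc i} (s≤s i<) = there (at-∈ d xs i<)

module _ (test : Rat → Bool) {Q : ℕ} (Q>0 : 0 < Q) where

  private
    improve : Rat → List Rat → List Rat
    improve B best = if test B ∧ leRat B (at B best 0) then B ∷ [] else best

    scale-unique : ∀ {B b b′} → Scaled Q B b → Scaled Q B b′ → b ≤ b′
    scale-unique {B} {b} {b′} S S′ = leq-sound b b′ (trans (sym (leRat-scaled Q>0 {B} {B} S S′))
      (trans (leRat-scaled Q>0 {B} {B} S S) (leq-true (≤-refl {b}))))

    absurd : ∀ {A : Set} {b} → b ≡ true → b ≡ false → A
    absurd refl ()

  Least : List Rat → List Rat → Set
  Least Bs best = (best ≡ [] × (∀ {B} → B ∈ Bs → test B ≡ false)) ⊎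
    (∃[ B ] ∃[ b ] best ≡ B ∷ [] × test B ≡ true × Scaled Q B b ×
      (∀ {C c} → C ∈ Bs → test C ≡ true → Scaled Q C c → b ≤ c))

  private
    improve-least : ∀ {B b Bs best} → Scaled Q B b → ∀ t → test B ≡ t → Least Bs best →
                    Least (B ∷ Bs) (if t ∧ leRat B (at B best 0) then B ∷ [] else best)
    improve-least S false eB (inj₁ (best≡ , none)) = inj₁ (best≡ , λ { (here refl) → eB ; (there C∈) → none C∈ })
    improve-least {B} {b} S true eB (inj₁ (refl , none)) = inj₂ (B , b
      , cong (λ c → if c then B ∷ [] else []) (trans (leRat-scaled Q>0 {B} {B} S S) (leq-true (≤-refl {b}))) , eB , S
      , λ { (here refl) _ S′ → scale-unique S S′ ; (there C∈) tC _ → absurd tC (none C∈) })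
    improve-least S false eB (inj₂ (C , c , best≡ , tC , S′ , min)) = inj₂ (C , c , best≡ , tC , S′
      , λ { (here refl) tB _ → absurd tB eB ; (there D∈) → min D∈ })
    improve-least {B} {b} S true eB (inj₂ (C , c , refl , tC , S′ , min)) with leRat B C in eBC
    ... | true  = inj₂ (B , b , refl , eB , S , λ
      { (here refl) _ S″ → scale-unique S S″
      ; (there D∈) tD S″ → ≤-trans (leq-sound b c (trans (sym (leRat-scaled Q>0 {B} {C} S S′)) eBC)) (min D∈ tD S″) })
    ... | false = inj₂ (C , c , refl , tC , S′ , λ
      { (here refl) _ S″ → ≤-trans (leq-false b c (trans (sym (leRat-scaled Q>0 {B} {C} S S′)) eBC)) (scale-unique S S″)
      ; (there D∈) tD S″ → min D∈ tD S″ })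

  least : ∀ Bs → (∀ {B} → B ∈ Bs → ∃[ b ] Scaled Q B b) → Least Bs (foldr improve [] Bs)
  least []       _     = inj₁ (refl , λ ())
  least (B ∷ Bs) known = improve-least (proj₂ (known (here refl))) (test B) refl (least Bs (known ∘ there))

  first-least : ∀ {Bs best} → Least Bs best → ∀ {C c} → C ∈ Bs → test C ≡ true → Scaled Q C c →
    ∃[ b ] test (at zeroRat best 0) ≡ true × Scaled Q (at zeroRat best 0) b × b ≤ c
  first-least (inj₁ (_ , none)) C∈ tC S = absurd tC (none C∈)
  first-least (inj₂ (B , b , refl , tB , S′ , min)) C∈ tC S = b , tB , S′ , min C∈ tC S

guess-least : ∀ (g : Graphᴸ) {Q} → 0 < Q → (∀ {B} → B ∈ zeroRat ∷ proj₂ (proj₂ (proj₂ g)) → ∃[ b ] Scaled Q B b) →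
  ∀ {C c} → C ∈ zeroRat ∷ proj₂ (proj₂ (proj₂ g)) → succeeds g C ≡ true → Scaled Q C c →
  ∃[ b ] succeeds g (guess g) ≡ true × Scaled Q (guess g) b × b ≤ c
guess-least g Q>0 known = first-least (succeeds g) Q>0 (least (succeeds g) Q>0 (zeroRat ∷ proj₂ (proj₂ (proj₂ g))) known)

-- Light vertices in the averaged assignment

total-bits< : ∀ (f : ℕ → Bool) {v n} → v < n → f v ≡ false → suc (total (bit ∘ f) (upTo n)) ≤ n
total-bits< f {v} {n} v<n fv = begin
  suc (total (bit ∘ f) (upTo n))                          ≡⟨ +-comm 1 _ ⟩
  total (bit ∘ f) (upTo n) + 1                            ≡⟨ cong (total (bit ∘ f) (upTo n) +_) (total-pick (λ _ → 1) v<n) ⟨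
  total (bit ∘ f) (upTo n) + total (λ u → bit (eqℕ u v)) (upTo n) ≡⟨ total-+ (bit ∘ f) _ (upTo n) ⟨
  total (λ u → bit (f u) + bit (eqℕ u v)) (upTo n)        ≤⟨ total-mono (upTo n) (λ {u} _ → one u) ⟩
  total (λ _ → 1) (upTo n)                                ≡⟨ trans (total-const 1 (upTo n)) (trans (*-identityʳ _) (List.length-upTo n)) ⟩
  n                                                       ∎
  where
  open ≤-Reasoning
  one : ∀ u → bit (f u) + bit (eqℕ u v) ≤ 1
  one u with eqℕ u v in e | f u in fu
  ... | false | true  = ≤-refl
  ... | false | false = z≤n
  ... | true  | false = ≤-refl
  ... | true  | true with trans (sym fu) (trans (cong f (eqℕ-true u v e)) fv)
  ...   | ()

module Rounding (n m : ℕ) (adj : List (List Bool)) (ws : List Rat) (H : List Assignment)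
  (length-H : length H ≡ rounds n)
  (settled : ∀ {row} → row ∈Row n → 16 * n * debt (n , m , adj , ws) H row ≤ rounds n) where

  private
    T E : ℕ
    T = rounds n
    E = 16 * n
    g : Graphᴸ
    g = n , m , adj , ws

  -- These counts are T times the averaged values of the relaxation; keeping the factor T avoids
  -- fractions.
  xs : ℕ → ℕ
  xs v = total (λ X → bit (holds X (v , 0))) H

  zs : ℕ → ℕ → ℕ
  zs v u = total (λ X → bit (holds X (v , suc u))) H

  private
    row-bound : ∀ {row} → row ∈Row n → ∀ {a b} → total (usage g row) H ≡ a → total (supply g row) H ≡ b → E * a ≤ E * b + T
    row-bound {row} row∈ refl refl = begin
      E * total (usage g row) H                     ≤⟨ *-monoʳ-≤ E (m≤n+m∸n _ (total (supply g row) H)) ⟩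
      E * (total (supply g row) H + debt g H row)   ≡⟨ *-distribˡ-+ E (total (supply g row) H) _ ⟩
      E * total (supply g row) H + E * debt g H row ≤⟨ +-monoʳ-≤ _ (settled row∈) ⟩
      E * total (supply g row) H + T                ∎
      where open ≤-Reasoning

    scaled-bit : ∀ c b → (if b then c else 0) ≡ c * bit b
    scaled-bit c true  = sym (*-identityʳ c)
    scaled-bit c false = sym (*-zeroʳ c)

  cover-row : ∀ {v} → v < n → E * (T * m) ≤ E * (m * xs v + total (λ u → if adjacent adj v u then zs v u else 0) (upTo n)) + T
  cover-row {v} v<n = row-bound {0 , v , v} (s≤s z≤n , v<n , v<n)
    (trans (total-cong H (λ {X} _ → used₀ n m adj ws (holds X) v v)) (trans (total-const m H) (cong (_* m) length-H)))
    (trans (total-cong H (λ {X} _ → supplied₀ n m adj ws (holds X) v v<n))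
      (trans (total-+ (λ X → if holds X (v , 0) then m else 0) _ H) (cong₂ _+_
        (trans (total-cong H (λ {X} _ → scaled-bit m (holds X (v , 0)))) (total-* m _ H))
        (trans (total-swap (λ X u → if holds X (v , suc u) then bit (adjacent adj v u) else 0) H (upTo n))
          (total-cong (upTo n) (λ {u} _ → column u (adjacent adj v u)))))))
    where
    column : ∀ u b → total (λ X → if holds X (v , suc u) then bit b else 0) H ≡ (if b then zs v u else 0)
    column u true  = refl
    column u false = trans (total-cong H (λ {X} _ → if-zero (holds X (v , suc u)))) (total-zero H)
      where
      if-zero : ∀ b → (if b then 0 else 0) ≡ 0
      if-zero true  = refl
      if-zero false = refl

  help-row : ∀ {v u} → v < n → u < n → E * zs v u ≤ E * xs u + T
  help-row {v} {u} v<n u<n = row-bound {1 , v , u} (s≤s (s≤s z≤n) , v<n , u<n)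
    (total-cong H (λ {X} _ → used₁ n m adj ws (holds X) v<n u<n)) (total-cong H (λ {X} _ → supplied₁ n m adj ws (holds X) v u<n))

  choice-row : ∀ {v u} → v < n → u < n → E * (xs v + zs v u) ≤ E * T + T
  choice-row {v} {u} v<n u<n = row-bound {2 , v , u} (s≤s (s≤s (s≤s z≤n)) , v<n , u<n)
    (trans (total-cong H (λ {X} _ → used₂ n m adj ws (holds X) v<n u<n)) (total-+ (λ X → bit (holds X (v , 0))) _ H))
    (trans (total-cong H (λ {X} _ → supplied₂ n m adj ws (holds X) v u)) (trans (total-const 1 H) (trans (*-identityʳ _) length-H)))

  -- For a light vertex v the constraints give
  --   E T m ≤ E m xs v + Σ_{heavy} (E T + T - E xs v) + Σ_{light} (E xs u + T) + T
  -- over the neighbours of v, and 8 xs v < 3 T leaves 9/16 of what the heavy ones miss.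
  module _ (isHeavy : ℕ → Bool) {v : ℕ} (v<n : v < n) (light : 8 * xs v ≤ 3 * T) (loopless : adjacent adj v v ≡ false) where

    private
      A Y c : ℕ
      A = total (λ u → bit (adjacent adj v u ∧ isHeavy u)) (upTo n)
      Y = total (λ u → if adjacent adj v u ∧ not (isHeavy u) then xs u else 0) (upTo n)
      c = total (λ u → bit (adjacent adj v u ∧ not (isHeavy u))) (upTo n)
      Z = total (λ u → if adjacent adj v u then zs v u else 0) (upTo n)

      -- One constraint per neighbour and one for the vertex itself are going to be added, at most n
      -- in all as there is no loop. Their errors T then sum to at most n T, which is E T / 16.
      A+c<n : suc (A + c) ≤ n
      A+c<n = ≤-trans (s≤s (≤-reflexive (trans (sym (total-+ _ _ (upTo n))) (total-cong (upTo n) (λ {u} _ → split (adjacent adj v u) (isHeavy u))))))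
                      (total-bits< (adjacent adj v) v<n loopless)
        where
        split : ∀ a b → bit (a ∧ b) + bit (a ∧ not b) ≡ bit a
        split true  true  = refl
        split true  false = refl
        split false b     = refl

      neighbours-bound : E * Z + A * (E * xs v) ≤ A * (E * T + T) + (E * Y + c * T)
      neighbours-bound = begin
        E * Z + A * (E * xs v)
          ≡⟨ cong₂ _+_ (sym (total-* E _ (upTo n))) (trans (*-comm A _) (sym (total-* (E * xs v) _ (upTo n)))) ⟩
        total (λ u → E * (if adjacent adj v u then zs v u else 0)) (upTo n) + total (λ u → E * xs v * bit (adjacent adj v u ∧ isHeavy u)) (upTo n)
          ≡⟨ total-+ _ _ (upTo n) ⟨
        total (λ u → E * (if adjacent adj v u then zs v u else 0) + E * xs v * bit (adjacent adj v u ∧ isHeavy u)) (upTo n)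
          ≤⟨ total-mono (upTo n) (λ {u} u∈ → term u (∈.∈-upTo⁻ u∈) (adjacent adj v u) (isHeavy u)) ⟩
        total (λ u → (E * T + T) * bit (adjacent adj v u ∧ isHeavy u) + (E * (if adjacent adj v u ∧ not (isHeavy u) then xs u else 0)
                     + T * bit (adjacent adj v u ∧ not (isHeavy u)))) (upTo n)
          ≡⟨ trans (total-+ _ _ (upTo n)) (cong₂ _+_ (trans (total-* (E * T + T) _ (upTo n)) (*-comm (E * T + T) A))
               (trans (total-+ _ _ (upTo n)) (cong₂ _+_ (total-* E _ (upTo n)) (trans (total-* T _ (upTo n)) (*-comm T c))))) ⟩
        A * (E * T + T) + (E * Y + c * T) ∎
        where
        open ≤-Reasoning
        term : ∀ u → u < n → ∀ a b → E * (if a then zs v u else 0) + E * xs v * bit (a ∧ b) ≤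
          (E * T + T) * bit (a ∧ b) + (E * (if a ∧ not b then xs u else 0) + T * bit (a ∧ not b))
        term u u<n false b rewrite *-zeroʳ E | *-zeroʳ (E * xs v) = z≤n
        term u u<n true true = begin
          E * zs v u + E * xs v * 1     ≡⟨ heavy-left E (zs v u) (xs v) ⟩
          E * (xs v + zs v u)           ≤⟨ choice-row v<n u<n ⟩
          E * T + T                     ≡⟨ heavy-right E T ⟩
          (E * T + T) * 1 + (E * 0 + T * 0) ∎
          where
          heavy-left : ∀ e z x → e * z + e * x * 1 ≡ e * (x + z)
          heavy-left = solve-∀
          heavy-right : ∀ e t → e * t + t ≡ (e * t + t) * 1 + (e * 0 + t * 0)
          heavy-right = solve-∀
        term u u<n true false = begin
          E * zs v u + E * xs v * 0     ≡⟨ light-left E (zs v u) (xs v) ⟩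
          E * zs v u                    ≤⟨ help-row v<n u<n ⟩
          E * xs u + T                  ≡⟨ light-right E T (xs u) ⟩
          (E * T + T) * 0 + (E * xs u + T * 1) ∎
          where
          light-left : ∀ e z x → e * z + e * x * 0 ≡ e * z
          light-left = solve-∀
          light-right : ∀ e t x → e * x + t ≡ (e * t + t) * 0 + (e * x + t * 1)
          light-right = solve-∀

    light-cover : 9 * (T * m) ≤ 16 * Y + 9 * (T * A)
    light-cover with ≤-<-connex m A
    ... | inj₁ m≤A = ≤-trans (*-monoʳ-≤ 9 (*-monoʳ-≤ T m≤A)) (m≤n+m _ (16 * Y))
    ... | inj₂ A<m = subst (λ k → 9 * (T * k) ≤ 16 * Y + 9 * (T * A)) (m+[n∸m]≡n (<⇒≤ A<m)) (begin
        9 * (T * (A + d))            ≡⟨ split T A d ⟩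
        9 * (T * d) + 9 * (T * A)    ≤⟨ +-monoˡ-≤ (9 * (T * A)) missing ⟩
        16 * Y + 9 * (T * A)         ∎)
      where
      open ≤-Reasoning
      d : ℕ
      d = m ∸ A
      d>0 : 0 < d
      d>0 = m<n⇒0<n∸m A<m
      split : ∀ t a d → 9 * (t * (a + d)) ≡ 9 * (t * d) + 9 * (t * a)
      split = solve-∀
      -- Adding the row of the vertex to those of its neighbours, the terms A xs v supplied by the
      -- caps of the heavy neighbours cancel against part of m xs v. Only d = m - A copies remain,
      -- so that everything becomes proportional to the residual demand d.
      residual : E * (T * d) ≤ E * (d * xs v) + E * Y + n * T
      residual = +-cancelʳ-≤ (E * (T * A) + A * (E * xs v) + E * Z) _ _ (begin
        E * (T * d) + (E * (T * A) + A * (E * xs v) + E * Z)  ≡⟨ s₁ E T d A (xs v) Z ⟩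
        E * (T * (A + d)) + (E * Z + A * (E * xs v))          ≡⟨ cong (λ k → E * (T * k) + (E * Z + A * (E * xs v))) (m+[n∸m]≡n (<⇒≤ A<m)) ⟩
        E * (T * m) + (E * Z + A * (E * xs v))                ≤⟨ +-mono-≤ (cover-row v<n) neighbours-bound ⟩
        E * (m * xs v + Z) + T + (A * (E * T + T) + (E * Y + c * T)) ≡⟨ cong (λ k → E * (k * xs v + Z) + T + (A * (E * T + T) + (E * Y + c * T))) (m+[n∸m]≡n (<⇒≤ A<m)) ⟨
        E * ((A + d) * xs v + Z) + T + (A * (E * T + T) + (E * Y + c * T)) ≡⟨ s₂ E T d A (xs v) Z Y c ⟩
        E * (d * xs v) + E * Y + suc (A + c) * T + (E * (T * A) + A * (E * xs v) + E * Z)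
          ≤⟨ +-monoˡ-≤ _ (+-monoʳ-≤ (E * (d * xs v) + E * Y) (*-monoˡ-≤ T A+c<n)) ⟩
        E * (d * xs v) + E * Y + n * T + (E * (T * A) + A * (E * xs v) + E * Z) ∎)
        where
        s₁ : ∀ e t d a x z → e * (t * d) + (e * (t * a) + a * (e * x) + e * z) ≡ e * (t * (a + d)) + (e * z + a * (e * x))
        s₁ = solve-∀
        s₂ : ∀ e t d a x z y c → e * ((a + d) * x + z) + t + (a * (e * t + t) + (e * y + c * t)) ≡
             e * (d * x) + e * y + suc (a + c) * t + (e * (t * a) + a * (e * x) + e * z)
        s₂ = solve-∀
      n≢0 : NonZero n
      n≢0 = pos⇒nonZero (≤-trans (s≤s z≤n) v<n)
      -- Divide the residual inequality by E T. Lightness gives d ≤ 3/8 d + Y / T + 1/16, and d ≥ 1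
      -- absorbs the error into d / 16, which leaves (5/8 - 1/16) d = 9/16 d.
      missing : 9 * (T * d) ≤ 16 * Y
      missing = +-cancelʳ-≤ (T * d) _ _ (*-cancelˡ-≤ (8 * n) {{m*n≢0 8 n {{_}} {{n≢0}}}} (+-cancelʳ-≤ (3 * (E * (d * T))) _ _ (begin
        8 * n * (9 * (T * d) + T * d) + 3 * (E * (d * T))   ≡⟨ s₃ n T d ⟩
        8 * (E * (T * d))                                   ≤⟨ *-monoʳ-≤ 8 residual ⟩
        8 * (E * (d * xs v) + E * Y + n * T)                ≡⟨ s₄ E d (xs v) Y n T ⟩
        E * d * (8 * xs v) + 8 * (E * Y) + 8 * n * T        ≤⟨ +-mono-≤ (+-monoˡ-≤ (8 * (E * Y)) (*-monoʳ-≤ (E * d) light)) (*-monoʳ-≤ (8 * n) (m≤m*n T d {{pos⇒nonZero d>0}})) ⟩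
        E * d * (3 * T) + 8 * (E * Y) + 8 * n * (T * d)     ≡⟨ s₅ n d T Y ⟩
        8 * n * (16 * Y + T * d) + 3 * (E * (d * T))        ∎)))
        where
        s₃ : ∀ n t d → 8 * n * (9 * (t * d) + t * d) + 3 * (16 * n * (d * t)) ≡ 8 * (16 * n * (t * d))
        s₃ = solve-∀
        s₄ : ∀ e d x y n t → 8 * (e * (d * x) + e * y + n * t) ≡ e * d * (8 * x) + 8 * (e * y) + 8 * n * t
        s₄ = solve-∀
        s₅ : ∀ n d t y → 16 * n * d * (3 * t) + 8 * (16 * n * y) + 8 * n * (t * d) ≡ 8 * n * (16 * y + t * d) + 3 * (16 * n * (d * t))
        s₅ = solve-∀

-- Natural numbers as rationals

opaque
  ιℤ : ℤ → ℚ
  ιℤ z = z ℚ./ 1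

  ιℤ-unfold : ∀ z → ιℤ z ≡ z ℚ./ 1
  ιℤ-unfold z = refl

ι : ℕ → ℚ
ι n = ιℤ (ℤ.+ n)

toℚᵘ-ιℤ : ∀ z → ℚ.toℚᵘ (ιℤ z) ℚᵘ.≃ ℚᵘ.mkℚᵘ z 0
toℚᵘ-ιℤ z = ℚᵘ.≃-trans (ℚᵘ.≃-reflexive (cong ℚ.toℚᵘ (ιℤ-unfold z))) (ℚ.toℚᵘ-fromℚᵘ (ℚᵘ.mkℚᵘ z 0))

ι-0 : ι 0 ≡ 0ℚ
ι-0 = ιℤ-unfold (ℤ.+ 0)

ι-1 : ι 1 ≡ 1ℚ
ι-1 = ιℤ-unfold (ℤ.+ 1)

ι-neg : ∀ n → ιℤ ℤ.-[1+ n ] ≡ ℚ.- ι (suc n)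
ι-neg n = ℚ.toℚᵘ-injective (ℚᵘ.≃-trans (toℚᵘ-ιℤ ℤ.-[1+ n ]) (ℚᵘ.≃-trans (ℚᵘ.*≡* refl)
  (ℚᵘ.≃-sym (ℚᵘ.≃-trans (ℚ.toℚᵘ-homo‿- (ι (suc n))) (ℚᵘ.-‿cong (toℚᵘ-ιℤ (ℤ.+ suc n)))))))

ιℤ-+ : ∀ a b → ιℤ (a ℤ.+ b) ≡ ιℤ a ℚ.+ ιℤ b
ιℤ-+ a b = ℚ.toℚᵘ-injective (ℚᵘ.≃-trans (toℚᵘ-ιℤ (a ℤ.+ b)) (ℚᵘ.≃-trans
  (ℚᵘ.*≡* (cong (ℤ._* ℤ.+ 1) (cong₂ ℤ._+_ (sym (ℤ.*-identityʳ a)) (sym (ℤ.*-identityʳ b)))))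
  (ℚᵘ.≃-sym (ℚᵘ.≃-trans (ℚ.toℚᵘ-homo-+ (ιℤ a) (ιℤ b)) (ℚᵘ.+-cong (toℚᵘ-ιℤ a) (toℚᵘ-ιℤ b))))))

ιℤ-* : ∀ a b → ιℤ (a ℤ.* b) ≡ ιℤ a ℚ.* ιℤ b
ιℤ-* a b = ℚ.toℚᵘ-injective (ℚᵘ.≃-trans (toℚᵘ-ιℤ (a ℤ.* b)) (ℚᵘ.≃-trans (ℚᵘ.*≡* refl)
  (ℚᵘ.≃-sym (ℚᵘ.≃-trans (ℚ.toℚᵘ-homo-* (ιℤ a) (ιℤ b)) (ℚᵘ.*-cong (toℚᵘ-ιℤ a) (toℚᵘ-ιℤ b))))))

ι-+ : ∀ a b → ι (a + b) ≡ ι a ℚ.+ ι b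
ι-+ a b = ιℤ-+ (ℤ.+ a) (ℤ.+ b)

ι-* : ∀ a b → ι (a * b) ≡ ι a ℚ.* ι b
ι-* a b = trans (cong ιℤ (ℤ.pos-* a b)) (ιℤ-* (ℤ.+ a) (ℤ.+ b))

ιℤ-mono : ∀ {a b} → a ℤ.≤ b → ιℤ a ℚ.≤ ιℤ b
ιℤ-mono {a} {b} a≤b = ℚ.toℚᵘ-cancel-≤ (ℚᵘ.≤-respˡ-≃ (ℚᵘ.≃-sym (toℚᵘ-ιℤ a)) (ℚᵘ.≤-respʳ-≃ (ℚᵘ.≃-sym (toℚᵘ-ιℤ b))
  (ℚᵘ.*≤* (ℤ.*-monoʳ-≤-nonNeg (ℤ.+ 1) a≤b))))

ι-mono : ∀ {a b} → a ≤ b → ι a ℚ.≤ ι b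
ι-mono a≤b = ιℤ-mono (ℤ.+≤+ a≤b)

ι-cancel : ∀ {a b} → ι a ℚ.≤ ι b → a ≤ b
ι-cancel {a} {b} le with ℚᵘ.≤-respˡ-≃ (toℚᵘ-ιℤ (ℤ.+ a)) (ℚᵘ.≤-respʳ-≃ (toℚᵘ-ιℤ (ℤ.+ b)) (ℚ.toℚᵘ-mono-≤ le))
... | ℚᵘ.*≤* h = ℤ.drop‿+≤+ (subst₂ ℤ._≤_ (ℤ.*-identityʳ (ℤ.+ a)) (ℤ.*-identityʳ (ℤ.+ b)) h)

ι-nonNeg : ∀ n → 0ℚ ℚ.≤ ι n
ι-nonNeg n = subst (ℚ._≤ ι n) ι-0 (ι-mono {0} z≤n)

ι-pos : ∀ {n} → 0 < n → ℚ.Positive (ι n)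
ι-pos {suc n} _ = ℚ.positive (ℚ.<-≤-trans {0ℚ} {1ℚ} (ℚ.positive⁻¹ 1ℚ) (subst (ℚ._≤ ι (suc n)) ι-1 (ι-mono {1} (s≤s z≤n))))

numerator-eq : ∀ r → r ℚ.* ι (↧ₙ r) ≡ ιℤ (↥ r)
numerator-eq r@(ℚ.mkℚ n d-1 _) = ℚ.toℚᵘ-injective (ℚᵘ.≃-trans (ℚ.toℚᵘ-homo-* r (ι (suc d-1)))
  (ℚᵘ.≃-trans (ℚᵘ.*-cong {ℚ.toℚᵘ r} ℚᵘ.≃-refl (toℚᵘ-ιℤ (ℤ.+ suc d-1))) (ℚᵘ.≃-trans (ℚᵘ.*≡* (trans (ℤ.*-assoc n (ℤ.+ suc d-1) (ℤ.+ 1)) refl)) (ℚᵘ.≃-sym (toℚᵘ-ιℤ n)))))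

value-den : ∀ q → value (den (ratData q)) ≡ ↧ₙ q
value-den q = value-digits (↧ₙ q)

value-magnitude : ∀ q → value (magnitude (ratData q)) ≡ ℤ.∣ ↥ q ∣
value-magnitude q = go (↥ q)
  where
  go : ∀ z → value (if proj₁ (signDigits z) then addD (1 ∷ []) (proj₂ (signDigits z)) else proj₂ (signDigits z)) ≡ ℤ.∣ z ∣
  go (ℤ.+ n)    = value-digits n
  go ℤ.-[1+ n ] = trans (value-addD (1 ∷ []) (digits n)) (cong suc (value-digits n))

value-over : ∀ r s → value (over (ratData r) (ratData s)) ≡ (↧ₙ r * ↧ₙ s) * (↧ₙ r * ↧ₙ s)
value-over r s = trans (value-mulD D D) (cong₂ _*_ product product)
  where
  D = mulD (den (ratData r)) (den (ratData s))
  product : value D ≡ ↧ₙ r * ↧ₙ s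
  product = trans (value-mulD (den (ratData r)) (den (ratData s))) (cong₂ _*_ (value-den r) (value-den s))

sq : ℚ → ℚ
sq q = q ℚ.* q

signed : Bool → ℕ → ℚ
signed true  n = ℚ.- ι n
signed false n = ι n

ιℤ-signed : ∀ z → ιℤ z ≡ signed (proj₁ (signDigits z)) ℤ.∣ z ∣
ιℤ-signed (ℤ.+ n)    = refl
ιℤ-signed ℤ.-[1+ n ] = ι-neg n

module _ (r s : ℚ) where
  private
    a b e d : ℕ
    a = ℤ.∣ ↥ r ∣
    b = ℤ.∣ ↥ s ∣
    d = ↧ₙ r
    e = ↧ₙ s
    σ τ : Bool
    σ = sign (ratData r)
    τ = sign (ratData s)

    ae bd : List ℕ
    ae = mulD (magnitude (ratData r)) (den (ratData s))
    bd = mulD (magnitude (ratData s)) (den (ratData r))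

    value-ae : value ae ≡ a * e
    value-ae = trans (value-mulD (magnitude (ratData r)) (den (ratData s))) (cong₂ _*_ (value-magnitude r) (value-den s))

    value-bd : value bd ≡ b * d
    value-bd = trans (value-mulD (magnitude (ratData s)) (den (ratData r))) (cong₂ _*_ (value-magnitude s) (value-den r))

    value-cross : value (cross (ratData r) (ratData s)) ≡ 2 * ((a * e) * (b * d))
    value-cross = trans (value-scale 2 (mulD ae bd)) (cong (2 *_) (trans (value-mulD ae bd) (cong₂ _*_ value-ae value-bd)))

    value-squares : value (addD (mulD ae ae) (mulD bd bd)) ≡ (a * e) * (a * e) + (b * d) * (b * d)
    value-squares = trans (value-addD (mulD ae ae) (mulD bd bd)) (cong₂ _+_
      (trans (value-mulD ae ae) (cong₂ _*_ value-ae value-ae)) (trans (value-mulD bd bd) (cong₂ _*_ value-bd value-bd)))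

    value-plus : value (plus (ratData r) (ratData s)) ≡
      (a * e) * (a * e) + (b * d) * (b * d) + (if sameSign σ τ then 0 else 2 * ((a * e) * (b * d)))
    value-plus = trans (value-addD (addD (mulD ae ae) (mulD bd bd)) (if sameSign σ τ then [] else cross (ratData r) (ratData s)))
      (cong₂ _+_ value-squares (by (sameSign σ τ)))
      where
      by : ∀ t → value (if t then [] else cross (ratData r) (ratData s)) ≡ (if t then 0 else 2 * ((a * e) * (b * d)))
      by true  = refl
      by false = value-cross

    value-minus : value (minus (ratData r) (ratData s)) ≡ (if sameSign σ τ then 2 * ((a * e) * (b * d)) else 0)
    value-minus = by (sameSign σ τ)
      where
      by : ∀ t → value (if t then cross (ratData r) (ratData s) else []) ≡ (if t then 2 * ((a * e) * (b * d)) else 0)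
      by true  = value-cross
      by false = refl

    difference : ∀ σ τ → r ℚ.* ι d ≡ signed σ a → s ℚ.* ι e ≡ signed τ b →
      sq (r ℚ.- s) ℚ.* ι ((d * e) * (d * e)) ℚ.+ ι (if sameSign σ τ then 2 * ((a * e) * (b * d)) else 0)
      ≡ ι ((a * e) * (a * e) + (b * d) * (b * d) + (if sameSign σ τ then 0 else 2 * ((a * e) * (b * d))))
    difference σ τ rd se = trans (cong₂ ℚ._+_ (trans (cong (sq (r ℚ.- s) ℚ.*_) over-ι) (expand r s (ι d) (ι e)))
        (by σ τ)) (trans (cong₂ (λ x y → sq (x ℚ.* ι e ℚ.- y ℚ.* ι d) ℚ.+ minus-ℚ σ τ) rd se) (trans (signs σ τ) (sym (plus-ι σ τ))))
      where
      open ℚ-Solver.+-*-Solver renaming (solve to ring)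
      A = ι a ℚ.* ι e
      B = ι b ℚ.* ι d
      cross-ℚ = A ℚ.* B ℚ.+ A ℚ.* B
      minus-ℚ plus-ℚ : Bool → Bool → ℚ
      minus-ℚ σ τ = if sameSign σ τ then cross-ℚ else 0ℚ
      plus-ℚ σ τ = A ℚ.* A ℚ.+ B ℚ.* B ℚ.+ (if sameSign σ τ then 0ℚ else cross-ℚ)
      over-ι : ι ((d * e) * (d * e)) ≡ (ι d ℚ.* ι e) ℚ.* (ι d ℚ.* ι e)
      over-ι = trans (ι-* (d * e) (d * e)) (cong₂ ℚ._*_ (ι-* d e) (ι-* d e))
      expand : ∀ r s d e → sq (r ℚ.- s) ℚ.* ((d ℚ.* e) ℚ.* (d ℚ.* e)) ≡ sq ((r ℚ.* d) ℚ.* e ℚ.- (s ℚ.* e) ℚ.* d)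
      expand = ring 4 (λ r s d e → ((r :- s) :* (r :- s)) :* ((d :* e) :* (d :* e)) :=
        ((((r :* d) :* e) :- ((s :* e) :* d)) :* (((r :* d) :* e) :- ((s :* e) :* d)))) refl
      cross-ι : ι (2 * ((a * e) * (b * d))) ≡ cross-ℚ
      cross-ι = trans (trans (cong ι (cong ((a * e) * (b * d) +_) (+-identityʳ _))) (ι-+ ((a * e) * (b * d)) ((a * e) * (b * d))))
        (cong₂ ℚ._+_ product product)
        where
        product : ι ((a * e) * (b * d)) ≡ A ℚ.* B
        product = trans (ι-* (a * e) (b * d)) (cong₂ ℚ._*_ (ι-* a e) (ι-* b d))
      by : ∀ σ τ → ι (if sameSign σ τ then 2 * ((a * e) * (b * d)) else 0) ≡ minus-ℚ σ τ
      by σ τ with sameSign σ τ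
      ... | true  = cross-ι
      ... | false = ι-0
      plus-ι : ∀ σ τ → ι ((a * e) * (a * e) + (b * d) * (b * d) + (if sameSign σ τ then 0 else 2 * ((a * e) * (b * d)))) ≡ plus-ℚ σ τ
      plus-ι σ τ = trans (ι-+ ((a * e) * (a * e) + (b * d) * (b * d)) _) (cong₂ ℚ._+_
        (trans (ι-+ ((a * e) * (a * e)) _) (cong₂ ℚ._+_ (trans (ι-* (a * e) (a * e)) (cong₂ ℚ._*_ (ι-* a e) (ι-* a e)))
          (trans (ι-* (b * d) (b * d)) (cong₂ ℚ._*_ (ι-* b d) (ι-* b d))))) (last (sameSign σ τ)))
        where
        last : ∀ t → ι (if t then 0 else 2 * ((a * e) * (b * d))) ≡ (if t then 0ℚ else cross-ℚ)
        last true  = ι-0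
        last false = cross-ι
      same : ∀ a b d e → sq (a ℚ.* e ℚ.- b ℚ.* d) ℚ.+ ((a ℚ.* e) ℚ.* (b ℚ.* d) ℚ.+ (a ℚ.* e) ℚ.* (b ℚ.* d)) ≡
                         (a ℚ.* e) ℚ.* (a ℚ.* e) ℚ.+ (b ℚ.* d) ℚ.* (b ℚ.* d) ℚ.+ 0ℚ
      same = ring 4 (λ a b d e → ((a :* e :- b :* d) :* (a :* e :- b :* d)) :+ ((a :* e) :* (b :* d) :+ (a :* e) :* (b :* d)) :=
        ((a :* e) :* (a :* e) :+ (b :* d) :* (b :* d)) :+ con 0ℚ) refl
      same′ : ∀ a b d e → sq ((ℚ.- a) ℚ.* e ℚ.- (ℚ.- b) ℚ.* d) ℚ.+ ((a ℚ.* e) ℚ.* (b ℚ.* d) ℚ.+ (a ℚ.* e) ℚ.* (b ℚ.* d)) ≡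
                         (a ℚ.* e) ℚ.* (a ℚ.* e) ℚ.+ (b ℚ.* d) ℚ.* (b ℚ.* d) ℚ.+ 0ℚ
      same′ = ring 4 (λ a b d e → (((:- a) :* e :- (:- b) :* d) :* ((:- a) :* e :- (:- b) :* d)) :+ ((a :* e) :* (b :* d) :+ (a :* e) :* (b :* d)) :=
        ((a :* e) :* (a :* e) :+ (b :* d) :* (b :* d)) :+ con 0ℚ) refl
      other : ∀ a b d e → sq (a ℚ.* e ℚ.- (ℚ.- b) ℚ.* d) ℚ.+ 0ℚ ≡
                         (a ℚ.* e) ℚ.* (a ℚ.* e) ℚ.+ (b ℚ.* d) ℚ.* (b ℚ.* d) ℚ.+ ((a ℚ.* e) ℚ.* (b ℚ.* d) ℚ.+ (a ℚ.* e) ℚ.* (b ℚ.* d))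
      other = ring 4 (λ a b d e → ((a :* e :- (:- b) :* d) :* (a :* e :- (:- b) :* d)) :+ con 0ℚ :=
        ((a :* e) :* (a :* e) :+ (b :* d) :* (b :* d)) :+ ((a :* e) :* (b :* d) :+ (a :* e) :* (b :* d))) refl
      other′ : ∀ a b d e → sq ((ℚ.- a) ℚ.* e ℚ.- b ℚ.* d) ℚ.+ 0ℚ ≡
                         (a ℚ.* e) ℚ.* (a ℚ.* e) ℚ.+ (b ℚ.* d) ℚ.* (b ℚ.* d) ℚ.+ ((a ℚ.* e) ℚ.* (b ℚ.* d) ℚ.+ (a ℚ.* e) ℚ.* (b ℚ.* d))
      other′ = ring 4 (λ a b d e → (((:- a) :* e :- b :* d) :* ((:- a) :* e :- b :* d)) :+ con 0ℚ :=
        ((a :* e) :* (a :* e) :+ (b :* d) :* (b :* d)) :+ ((a :* e) :* (b :* d) :+ (a :* e) :* (b :* d))) refl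
      signs : ∀ σ τ → sq (signed σ a ℚ.* ι e ℚ.- signed τ b ℚ.* ι d) ℚ.+ minus-ℚ σ τ ≡ plus-ℚ σ τ
      signs false false = same (ι a) (ι b) (ι d) (ι e)
      signs true  true  = same′ (ι a) (ι b) (ι d) (ι e)
      signs false true  = other (ι a) (ι b) (ι d) (ι e)
      signs true  false = other′ (ι a) (ι b) (ι d) (ι e)

  square-difference : sq (r ℚ.- s) ℚ.* ι (value (over (ratData r) (ratData s))) ℚ.+ ι (value (minus (ratData r) (ratData s)))
                      ≡ ι (value (plus (ratData r) (ratData s)))
  square-difference = trans (cong₂ (λ x y → sq (r ℚ.- s) ℚ.* ι x ℚ.+ ι y) (value-over r s) value-minus)
    (trans (difference σ τ (trans (numerator-eq r) (ιℤ-signed (↥ r))) (trans (numerator-eq s) (ιℤ-signed (↥ s))))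
           (cong ι (sym value-plus)))

over-pos : ∀ r s → 0 < value (over (ratData r) (ratData s))
over-pos r s = ≤-trans (*-mono-≤ positive positive) (≤-reflexive (sym (value-over r s)))
  where
  positive : 1 ≤ ↧ₙ r * ↧ₙ s
  positive = *-mono-≤ {1} {↧ₙ r} {1} (s≤s z≤n) (s≤s z≤n)

+-cancelʳ-≤ℚ : ∀ r {p q} → p ℚ.+ r ℚ.≤ q ℚ.+ r → p ℚ.≤ q
+-cancelʳ-≤ℚ r {p} {q} le with p ℚ.≤? q
... | yes p≤q = p≤q
... | no p≰q = contradiction (ℚ.<-≤-trans (ℚ.+-monoˡ-< r (ℚ.≰⇒> p≰q)) le) (ℚ.<-irrefl refl)

sq-pos : ∀ q → q ≢ 0ℚ → 0ℚ ℚ.< sq q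
sq-pos q q≢0 with ℚ.<-cmp q 0ℚ
... | tri< q<0 _ _ = subst (ℚ._< sq q) (ℚ.*-zeroʳ q) (ℚ.*-monoʳ-<-neg q {{ℚ.negative q<0}} q<0)
... | tri≈ _ q≡0 _ = contradiction q≡0 q≢0
... | tri> _ _ 0<q = subst (ℚ._< sq q) (ℚ.*-zeroʳ q) (ℚ.*-monoʳ-<-pos q {{ℚ.positive 0<q}} 0<q)

-- A description of t = (P - M) / O with the subtraction moved to the other side, so that
-- comparisons with t become comparisons of natural numbers.
module Fraction (t : ℚ) (P M O : ℕ) (O>0 : 0 < O) (t≡ : t ℚ.* ι O ℚ.+ ι M ≡ ι P) where

  private
    instance
      ιO-pos : ℚ.Positive (ι O)
      ιO-pos = ι-pos O>0

    left : ∀ b → ι (P * b) ≡ ι O ℚ.* (t ℚ.* ι b) ℚ.+ ι (M * b)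
    left b = trans (ι-* P b) (trans (cong (ℚ._* ι b) (sym t≡)) (trans (distribute t (ι O) (ι M) (ι b))
      (cong (ι O ℚ.* (t ℚ.* ι b) ℚ.+_) (sym (ι-* M b)))))
      where
      open ℚ-Solver.+-*-Solver renaming (solve to ring)
      distribute : ∀ t o m b → (t ℚ.* o ℚ.+ m) ℚ.* b ≡ o ℚ.* (t ℚ.* b) ℚ.+ m ℚ.* b
      distribute = ring 4 (λ t o m b → (t :* o :+ m) :* b := o :* (t :* b) :+ m :* b) refl

    right : ∀ a b → ι (O * a + M * b) ≡ ι O ℚ.* ι a ℚ.+ ι (M * b)
    right a b = trans (ι-+ (O * a) (M * b)) (cong (ℚ._+ ι (M * b)) (ι-* O a))

  ≤-fraction : ∀ a b → t ℚ.* ι b ℚ.≤ ι a → P * b ≤ O * a + M * b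
  ≤-fraction a b le = ι-cancel (subst₂ ℚ._≤_ (sym (left b)) (sym (right a b))
    (ℚ.+-monoˡ-≤ (ι (M * b)) (ℚ.*-monoˡ-≤-nonNeg (ι O) {{ℚ.pos⇒nonNeg (ι O)}} le)))

  fraction-≤ : ∀ a b → P * b ≤ O * a + M * b → t ℚ.* ι b ℚ.≤ ι a
  fraction-≤ a b le = ℚ.*-cancelˡ-≤-pos (ι O) (+-cancelʳ-≤ℚ (ι (M * b)) (subst₂ ℚ._≤_ (left b) (right a b) (ι-mono le)))

  ≤1⇔ : (t ℚ.≤ 1ℚ → P ≤ O + M) × (P ≤ O + M → t ℚ.≤ 1ℚ)
  ≤1⇔ = (λ t≤1 → subst₂ _≤_ (*-identityʳ P) O+M (≤-fraction 1 1 (subst₂ ℚ._≤_ t*1 (sym ι-1) t≤1)))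
      , (λ P≤ → subst₂ ℚ._≤_ (sym t*1) ι-1 (fraction-≤ 1 1 (subst₂ _≤_ (sym (*-identityʳ P)) (sym O+M) P≤)))
    where
    O+M : O * 1 + M * 1 ≡ O + M
    O+M = cong₂ _+_ (*-identityʳ O) (*-identityʳ M)
    t*1 : t ≡ t ℚ.* ι 1
    t*1 = sym (trans (cong (t ℚ.*_) ι-1) (ℚ.*-identityʳ t))

  -- A radius N⁺ / N this close to 1 contains no further fractions with denominator O.
  module _ (r : ℚ) (N : ℕ) (N>1 : 1 < N) (3O≤N : 3 * O ≤ N) (r≡ : r ℚ.* ι N ≡ ι (suc N)) where

    private
      r²≡ : sq r ℚ.* ι (N * N) ≡ ι (suc N * suc N)
      r²≡ = trans (cong (sq r ℚ.*_) (ι-* N N)) (trans (exchange r (ι N)) (trans (cong₂ ℚ._*_ r≡ r≡) (sym (ι-* (suc N) (suc N)))))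
        where
        open ℚ-Solver.+-*-Solver renaming (solve to ring)
        exchange : ∀ r n → sq r ℚ.* (n ℚ.* n) ≡ (r ℚ.* n) ℚ.* (r ℚ.* n)
        exchange = ring 2 (λ r n → (r :* r) :* (n :* n) := (r :* n) :* (r :* n)) refl
      N²-pos : ℚ.Positive (ι (N * N))
      N²-pos = ι-pos (*-mono-≤ (<⇒≤ N>1) (<⇒≤ N>1))

    ≤1⇒≤r² : t ℚ.≤ 1ℚ → t ℚ.≤ sq r
    ≤1⇒≤r² t≤1 = ℚ.*-cancelʳ-≤-pos (ι (N * N)) {{N²-pos}} (subst (t ℚ.* ι (N * N) ℚ.≤_) (sym r²≡)
      (fraction-≤ (suc N * suc N) (N * N) (begin
        P * (N * N)                       ≤⟨ *-monoˡ-≤ (N * N) (proj₁ ≤1⇔ t≤1) ⟩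
        (O + M) * (N * N)                 ≡⟨ *-distribʳ-+ (N * N) O M ⟩
        O * (N * N) + M * (N * N)         ≤⟨ +-monoˡ-≤ (M * (N * N)) (*-monoʳ-≤ O (*-mono-≤ (n≤1+n N) (n≤1+n N))) ⟩
        O * (suc N * suc N) + M * (N * N) ∎)))
      where open ≤-Reasoning

    -- If t exceeds 1, then it is at least 1 + 1 / O. But r² = 1 + (2 N + 1) / N², which is less
    -- than 1 + 3 / N because N > 1, and hence less than 1 + 1 / O.
    ≤r²⇒≤1 : t ℚ.≤ sq r → t ℚ.≤ 1ℚ
    ≤r²⇒≤1 t≤r² with ≤-<-connex P (O + M)
    ... | inj₁ P≤ = proj₂ ≤1⇔ P≤
    ... | inj₂ P> = contradiction gap (<⇒≱ small)
      where
      open ≤-Reasoning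
      N² : ℕ
      N² = N * N
      scaled-≤ : P * N² ≤ O * (suc N * suc N) + M * N²
      scaled-≤ = ≤-fraction (suc N * suc N) N² (subst (t ℚ.* ι N² ℚ.≤_) r²≡ (ℚ.*-monoʳ-≤-nonNeg (ι N²) {{ℚ.pos⇒nonNeg (ι N²) {{N²-pos}}}} t≤r²))
      gap : N² ≤ O * suc (2 * N)
      gap = +-cancelʳ-≤ (O * N² + M * N²) _ _ (begin
        N² + (O * N² + M * N²)                 ≡⟨ collect O M N² ⟩
        suc (O + M) * N²                       ≤⟨ *-monoˡ-≤ N² P> ⟩
        P * N²                                 ≤⟨ scaled-≤ ⟩
        O * (suc N * suc N) + M * N²           ≡⟨ expand O N (M * N²) ⟩
        O * suc (2 * N) + (O * N² + M * N²)    ∎)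
        where
        collect : ∀ o m n → n + (o * n + m * n) ≡ suc (o + m) * n
        collect = solve-∀
        expand : ∀ o n x → o * (suc n * suc n) + x ≡ o * suc (2 * n) + (o * (n * n) + x)
        expand = solve-∀
      small : O * suc (2 * N) < N²
      small = *-cancelˡ-< 3 _ _ (begin-strict
        3 * (O * suc (2 * N))   ≡⟨ *-assoc 3 O _ ⟨
        3 * O * suc (2 * N)     ≤⟨ *-monoˡ-≤ (suc (2 * N)) 3O≤N ⟩
        N * suc (2 * N)         <⟨ *-monoʳ-< N {{pos⇒nonZero (<⇒≤ N>1)}} (+-monoˡ-≤ (2 * N) N>1) ⟩
        N * (3 * N)             ≡⟨ rotate N ⟩
        3 * N²                  ∎)
        where
        rotate : ∀ n → n * (3 * n) ≡ 3 * (n * n)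
        rotate = solve-∀

module Distance (p q : Point) where

  private
    a = ratData (Point.x p)
    c = ratData (Point.x q)
    b = ratData (Point.y p)
    d = ratData (Point.y q)

  distance-over distance-plus distance-minus : ℕ
  distance-over  = value (over a c) * value (over b d)
  distance-plus  = value (plus a c) * value (over b d) + value (plus b d) * value (over a c)
  distance-minus = value (minus a c) * value (over b d) + value (minus b d) * value (over a c)

  distance-over-pos : 0 < distance-over
  distance-over-pos = *-mono-≤ (over-pos (Point.x p) (Point.x q)) (over-pos (Point.y p) (Point.y q))

  distance-fraction : dist² p q ℚ.* ι distance-over ℚ.+ ι distance-minus ≡ ι distance-plus
  distance-fraction = trans
    (cong₂ (λ x y → dist² p q ℚ.* x ℚ.+ y) (ι-* _ _) (trans (ι-+ _ _) (cong₂ ℚ._+_ (ι-* _ _) (ι-* _ _))))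
    (trans (regroup (sq (Point.x p ℚ.- Point.x q)) (sq (Point.y p ℚ.- Point.y q)) (ι (value (over a c))) (ι (value (over b d))) (ι (value (minus a c))) (ι (value (minus b d))))
      (trans (cong₂ (λ x y → x ℚ.* ι (value (over b d)) ℚ.+ y ℚ.* ι (value (over a c))) (square-difference (Point.x p) (Point.x q)) (square-difference (Point.y p) (Point.y q)))
        (sym (trans (ι-+ _ _) (cong₂ ℚ._+_ (ι-* _ _) (ι-* _ _))))))
    where
    open ℚ-Solver.+-*-Solver renaming (solve to ring)
    regroup : ∀ s t o u m n → (s ℚ.+ t) ℚ.* (o ℚ.* u) ℚ.+ (m ℚ.* u ℚ.+ n ℚ.* o) ≡ (s ℚ.* o ℚ.+ m) ℚ.* u ℚ.+ (t ℚ.* u ℚ.+ n) ℚ.* o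
    regroup = ring 6 (λ s t o u m n → (s :+ t) :* (o :* u) :+ (m :* u :+ n :* o) := (s :* o :+ m) :* u :+ (t :* u :+ n) :* o) refl

  open Fraction (dist² p q) distance-plus distance-minus distance-over distance-over-pos distance-fraction public

  near-dist : near (a , b) (c , d) ≡ does (dist² p q ℚ.≤? 1ℚ)
  near-dist = trans (leD-value (addD (mulD (plus a c) (over b d)) (mulD (plus b d) (over a c))) (addD (mulD (over a c) (over b d)) (addD (mulD (minus a c) (over b d)) (mulD (minus b d) (over a c)))))
    (trans (cong₂ leq value-left value-right) (agree (dist² p q ℚ.≤? 1ℚ)))
    where
    product : ∀ x y → value (mulD x y) ≡ value x * value y
    product = value-mulD
    value-left : value (addD (mulD (plus a c) (over b d)) (mulD (plus b d) (over a c))) ≡ distance-plus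
    value-left = trans (value-addD (mulD (plus a c) (over b d)) (mulD (plus b d) (over a c))) (cong₂ _+_ (product (plus a c) (over b d)) (product (plus b d) (over a c)))
    value-right : value (addD (mulD (over a c) (over b d)) (addD (mulD (minus a c) (over b d)) (mulD (minus b d) (over a c)))) ≡ distance-over + distance-minus
    value-right = trans (value-addD (mulD (over a c) (over b d)) (addD (mulD (minus a c) (over b d)) (mulD (minus b d) (over a c))))
      (cong₂ _+_ (product (over a c) (over b d)) (trans (value-addD (mulD (minus a c) (over b d)) (mulD (minus b d) (over a c)))
        (cong₂ _+_ (product (minus a c) (over b d)) (product (minus b d) (over a c)))))
    agree : ∀ (dec : Dec (dist² p q ℚ.≤ 1ℚ)) → leq distance-plus (distance-over + distance-minus) ≡ does dec
    agree (yes t≤1) = leq-true (proj₁ ≤1⇔ t≤1)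
    agree (no t≰1)  with leq distance-plus (distance-over + distance-minus) in e
    ... | false = refl
    ... | true  = contradiction (proj₂ ≤1⇔ (leq-sound distance-plus _ e)) t≰1

module _ (r s : ℚ) where

  private
    P M O : ℕ
    P = value (plus (ratData r) (ratData s))
    M = value (minus (ratData r) (ratData s))
    O = value (over (ratData r) (ratData s))

    open Fraction (sq (r ℚ.- s)) P M O (over-pos r s) (square-difference r s)

    equalRat-leq : equalRat (ratData r) (ratData s) ≡ leq P M
    equalRat-leq = leD-value (plus (ratData r) (ratData s)) (minus (ratData r) (ratData s))

    O*0+M*1 : O * 0 + M * 1 ≡ M
    O*0+M*1 = cong₂ _+_ (*-zeroʳ O) (*-identityʳ M)

  equalRat-sound : equalRat (ratData r) (ratData s) ≡ true → r ≡ s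
  equalRat-sound eq with (r ℚ.- s) ℚ.≟ 0ℚ
  ... | no r-s≢0 = contradiction (ℚ.<-≤-trans (sq-pos (r ℚ.- s) r-s≢0) sq≤0) (ℚ.<-irrefl refl)
    where
    sq≤0 : sq (r ℚ.- s) ℚ.≤ 0ℚ
    sq≤0 = subst₂ ℚ._≤_ (trans (cong (sq (r ℚ.- s) ℚ.*_) ι-1) (ℚ.*-identityʳ _)) ι-0
      (fraction-≤ 0 1 (subst₂ _≤_ (sym (*-identityʳ P)) (sym O*0+M*1) (leq-sound P M (trans (sym equalRat-leq) eq))))
  ... | yes r-s≡0 = trans (sym (ℚ.+-identityʳ r)) (trans (cong (r ℚ.+_) (sym (ℚ.+-inverseˡ s)))
    (trans (sym (ℚ.+-assoc r (ℚ.- s) s)) (trans (cong (ℚ._+ s) r-s≡0) (ℚ.+-identityˡ s))))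

  equalRat-complete : r ≡ s → equalRat (ratData r) (ratData s) ≡ true
  equalRat-complete r≡s = trans equalRat-leq (leq-true (subst₂ _≤_ (*-identityʳ P) O*0+M*1
    (≤-fraction 0 1 (ℚ.≤-reflexive (trans (cong (λ x → sq x ℚ.* ι 1) (trans (cong (ℚ._- s) r≡s) (ℚ.+-inverseʳ s)))
      (trans (ℚ.*-zeroˡ (ι 1)) (sym ι-0)))))))

-- Distinct radii close to 1

allOnes : ℕ → ℕᵇ
allOnes zero    = zero
allOnes (suc k) = 1+[2 allOnes k ]

toℕ-allOnes : ∀ k → suc (toℕ (allOnes k)) ≡ 2 ^ k
toℕ-allOnes zero    = refl
toℕ-allOnes (suc k) = trans (sym (*-suc 2 (toℕ (allOnes k)))) (cong (2 *_) (toℕ-allOnes k))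

digitsᵇ-allOnes : ∀ k → digitsᵇ (allOnes k) ≡ List.replicate k 1
digitsᵇ-allOnes zero    = refl
digitsᵇ-allOnes (suc k) = cong (1 ∷_) (digitsᵇ-allOnes k)

opaque

  -- The fraction (N + 1) / N with N + 1 a power of 2. Consecutive numbers are coprime, so it is in
  -- lowest terms as it stands. In bijective base 2 its two parts consist of the digit 1 apart from
  -- a single 2, which makes the encoding easy to write.
  ratio : ℕ → ℚ
  ratio k = ℚ.mkℚ (ℤ.+ suc (suc (2 * toℕ (allOnes k)))) (2 * toℕ (allOnes k)) coprime
    where
    coprime : Coprime (suc (suc (2 * toℕ (allOnes k)))) (suc (2 * toℕ (allOnes k)))
    coprime = subst (λ j → Coprime j (suc (2 * toℕ (allOnes k)))) (+-comm (suc (2 * toℕ (allOnes k))) 1)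
      (Coprime.coprime-+ {1} {suc (2 * toℕ (allOnes k))} (Coprime.1-coprimeTo (suc (2 * toℕ (allOnes k)))))

  ↥-ratio : ∀ k → ↥ (ratio k) ≡ ℤ.+ suc (suc (2 * toℕ (allOnes k)))
  ↥-ratio k = refl

  ↧-ratio : ∀ k → ↧ₙ (ratio k) ≡ suc (2 * toℕ (allOnes k))
  ↧-ratio k = refl

  ratio-pos : ∀ k → ℚ.Positive (ratio k)
  ratio-pos k = _

den-ratio : ∀ k → suc (↧ₙ (ratio k)) ≡ 2 ^ suc k
den-ratio k = trans (cong suc (↧-ratio k)) (toℕ-allOnes (suc k))

ratio-eq : ∀ k → ratio k ℚ.* ι (↧ₙ (ratio k)) ≡ ι (suc (↧ₙ (ratio k)))
ratio-eq k = trans (numerator-eq (ratio k)) (cong ιℤ (trans (↥-ratio k) (cong (λ d → ℤ.+ suc d) (sym (↧-ratio k)))))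

ratio-injective : ∀ {j k} → ratio j ≡ ratio k → j ≡ k
ratio-injective {j} {k} eq with <-cmp j k
... | tri< j<k _ _ = contradiction same (<⇒≢ (^-monoʳ-< 2 ≤-refl (s≤s j<k)))
  where
  same : 2 ^ suc j ≡ 2 ^ suc k
  same = trans (sym (den-ratio j)) (trans (cong (λ q → suc (↧ₙ q)) eq) (den-ratio k))
... | tri≈ _ j≡k _ = j≡k
... | tri> _ _ k<j = contradiction same (<⇒≢ (^-monoʳ-< 2 ≤-refl (s≤s k<j)))
  where
  same : 2 ^ suc k ≡ 2 ^ suc j
  same = trans (sym (den-ratio k)) (trans (cong (λ q → suc (↧ₙ q)) (sym eq)) (den-ratio j))

writeRatio-ratio : ∀ k → writeRatio k ≡ encodeℚ (ratio k)
writeRatio-ratio k = trans (cong (false ∷_) (cong₂ _++_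
  (trans (cong (λ ds → writeDigits (2 ∷ ds)) (sym (digitsᵇ-allOnes k)))
    (trans (writeDigits-digitsᵇ 2[1+ allOnes k ]) (cong encodeℕᵇ (trans (sym (ℕᵇ.fromℕ-toℕ 2[1+ allOnes k ])) (cong fromℕ (*-suc 2 (toℕ (allOnes k))))))))
  (trans (cong (λ ds → writeDigits (1 ∷ ds)) (sym (digitsᵇ-allOnes k)))
    (trans (writeDigits-digitsᵇ 1+[2 allOnes k ]) (cong encodeℕᵇ (sym (ℕᵇ.fromℕ-toℕ 1+[2 allOnes k ])))))))
  (cong₂ (λ z d → encodeℤ z ++ encodeℕ d) (sym (↥-ratio k)) (sym (↧-ratio k)))

toℕ<2^ : ∀ n → 2 + toℕ n ≤ 2 ^ suc (length (digitsᵇ n))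
toℕ<2^ zero     = ≤-refl
toℕ<2^ 2[1+ n ] = ≤-trans (≤-reflexive (double (toℕ n))) (*-monoʳ-≤ 2 (toℕ<2^ n))
  where
  double : ∀ t → 2 + 2 * suc t ≡ 2 * (2 + t)
  double = solve-∀
toℕ<2^ 1+[2 n ] = ≤-trans (n≤1+n _) (≤-trans (≤-reflexive (double (toℕ n))) (*-monoʳ-≤ 2 (toℕ<2^ n)))
  where
  double : ∀ t → suc (2 + suc (2 * t)) ≡ 2 * (2 + t)
  double = solve-∀

-- The length of the input thus bounds every denominator in it, so an exponent computed from this
-- length alone makes the radii close enough to 1.
den<2^ : ∀ q → ↧ₙ q < 2 ^ length (encodeℚ q)
den<2^ q = begin
  suc (↧ₙ q)                              ≡⟨ cong suc (ℕᵇ.toℕ-fromℕ (↧ₙ q)) ⟨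
  suc (toℕ (fromℕ (↧ₙ q)))                ≤⟨ n≤1+n _ ⟩
  2 + toℕ (fromℕ (↧ₙ q))                  ≤⟨ toℕ<2^ (fromℕ (↧ₙ q)) ⟩
  2 ^ suc (length (digits (↧ₙ q)))        ≤⟨ ^-monoʳ-≤ 2 (s≤s (m≤m+n (length (digits (↧ₙ q))) (length (digits (↧ₙ q)) + 0))) ⟩
  2 ^ suc (2 * length (digits (↧ₙ q)))    ≡⟨ cong (2 ^_) (length-encodeℕᵇ (fromℕ (↧ₙ q))) ⟨
  2 ^ length (encodeℕ (↧ₙ q))             ≤⟨ ^-monoʳ-≤ 2 (≤-trans (m≤n+m _ (length (encodeℤ (↥ q)))) (≤-reflexive (sym (List.length-++ (encodeℤ (↥ q)))))) ⟩
  2 ^ length (encodeℚ q)                  ∎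
  where open ≤-Reasoning

-- Reading an encoded instance

parse-by : ∀ bits {nd r₀ k r₁ md r₂ x r₃ cs ws} → readℕ bits ≡ (nd , r₀) → clip (length bits) nd ≡ k →
  skipRats (k + k) r₀ ≡ r₁ → readℕ r₁ ≡ (md , r₂) → readℕ r₂ ≡ (x , r₃) → readRats (k + k) r₀ ≡ cs → readRats k r₃ ≡ ws →
  parse bits ≡ (nd , md , k , cs , ws)
parse-by bits refl refl refl refl refl refl refl = refl

coordinatesOf : Point → List ℚ
coordinatesOf p = Point.x p ∷ Point.y p ∷ []

concatMap-encodePoint : ∀ ps → List.concatMap encodePoint ps ≡ List.concatMap encodeℚ (List.concatMap coordinatesOf ps)
concatMap-encodePoint []       = refl
concatMap-encodePoint (p ∷ ps) = trans (List.++-assoc (encodeℚ (Point.x p)) (encodeℚ (Point.y p)) _)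
  (cong (λ bs → encodeℚ (Point.x p) ++ encodeℚ (Point.y p) ++ bs) (concatMap-encodePoint ps))

length-coordinates : ∀ ps → length (List.concatMap coordinatesOf ps) ≡ length ps + length ps
length-coordinates []       = refl
length-coordinates (p ∷ ps) = cong suc (trans (cong suc (length-coordinates ps)) (sym (+-suc (length ps) (length ps))))

at-tabulate : ∀ {A : Set} (d : A) {n} (f : Fin n → A) i → at d (List.tabulate f) (Fin.toℕ i) ≡ f i
at-tabulate d f zero    = refl
at-tabulate d f (suc i) = at-tabulate d (f ∘ suc) i

at-coordinates : ∀ {n} (f : Fin n → Point) i → let cs = map ratData (List.concatMap coordinatesOf (List.tabulate f)) in
  at zeroRat cs (Fin.toℕ i + Fin.toℕ i) ≡ ratData (Point.x (f i)) × at zeroRat cs (suc (Fin.toℕ i + Fin.toℕ i)) ≡ ratData (Point.y (f i))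
at-coordinates f zero    = refl , refl
at-coordinates {suc n} f (suc i) =
  trans (cong (at zeroRat (map ratData (List.concatMap coordinatesOf (List.tabulate f)))) (cong suc (+-suc (Fin.toℕ i) (Fin.toℕ i)))) (proj₁ rest) ,
  trans (cong (at zeroRat (map ratData (List.concatMap coordinatesOf (List.tabulate f)))) (cong (λ k → suc (suc k)) (+-suc (Fin.toℕ i) (Fin.toℕ i)))) (proj₂ rest)
  where
  rest = at-coordinates (f ∘ suc) i

eqℕ-toℕ : ∀ {n} (i j : Fin n) → eqℕ (Fin.toℕ i) (Fin.toℕ j) ≡ does (i Fin.≟ j)
eqℕ-toℕ i j with i Fin.≟ j
... | yes refl = eqℕ-refl (Fin.toℕ i)
... | no i≢j with eqℕ (Fin.toℕ i) (Fin.toℕ j) in e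
...   | false = refl
...   | true  = contradiction (Fin.toℕ-injective (eqℕ-true _ _ e)) i≢j

length≤concatMap : ∀ {A : Set} (f : A → List Bool) → (∀ x → 1 ≤ length (f x)) → ∀ xs → length xs ≤ length (List.concatMap f xs)
length≤concatMap f pos []       = z≤n
length≤concatMap f pos (x ∷ xs) = ≤-trans (+-mono-≤ (pos x) (length≤concatMap f pos xs)) (≤-reflexive (sym (List.length-++ (f x))))

length-encodeℚ : ∀ q → 1 ≤ length (encodeℚ q)
length-encodeℚ q = ≤-trans (go (↥ q)) (≤-trans (m≤m+n _ _) (≤-reflexive (sym (List.length-++ (encodeℤ (↥ q))))))
  where
  go : ∀ z → 1 ≤ length (encodeℤ z)
  go (ℤ.+ n)    = s≤s z≤n
  go ℤ.-[1+ n ] = s≤s z≤n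

module Input (J : UnitDiskDomination) where

  module J = UnitDiskDomination J

  n : ℕ
  n = J.#V

  bits : List Bool
  bits = J.encode

  parsed : Parsed
  parsed = digits n , digits J.m , n , map ratData (List.concatMap coordinatesOf (List.tabulate J.position)) , map ratData (List.tabulate J.weight)

  private
    cs ws : List ℚ
    cs = List.concatMap coordinatesOf (List.tabulate J.position)
    ws = List.tabulate J.weight

    r₀ r₁ : List Bool
    r₁ = encodeℕ J.m ++ (encodeℕ n ++ List.concatMap encodeℚ ws)
    r₀ = List.concatMap encodeℚ cs ++ r₁

    bits≡ : bits ≡ encodeℕ n ++ r₀
    bits≡ = trans (List.++-assoc (encodeℕ n) _ r₁) (cong (λ bs → encodeℕ n ++ bs ++ r₁) (concatMap-encodePoint (List.tabulate J.position)))

    length-cs : length cs ≡ n + n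
    length-cs = trans (length-coordinates (List.tabulate J.position)) (cong₂ _+_ (List.length-tabulate J.position) (List.length-tabulate J.position))

  weights-within : length (List.concatMap encodeℚ ws) ≤ length bits
  weights-within = begin
    length (List.concatMap encodeℚ ws)                               ≤⟨ m≤n+m _ (length (encodeℕ n)) ⟩
    length (encodeℕ n) + length (List.concatMap encodeℚ ws)          ≡⟨ List.length-++ (encodeℕ n) ⟨
    length (encodeℕ n ++ List.concatMap encodeℚ ws)                  ≤⟨ m≤n+m _ (length (encodeℕ J.m)) ⟩
    length (encodeℕ J.m) + length (encodeℕ n ++ List.concatMap encodeℚ ws) ≡⟨ List.length-++ (encodeℕ J.m) ⟨
    length r₁                                                        ≤⟨ m≤n+m _ (length (encodeVector encodePoint J.position)) ⟩
    length (encodeVector encodePoint J.position) + length r₁         ≡⟨ List.length-++ (encodeVector encodePoint J.position) ⟨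
    length bits                                                      ∎
    where open ≤-Reasoning

  n≤bits : n ≤ length bits
  n≤bits = begin
    n                                   ≡⟨ List.length-tabulate J.weight ⟨
    length ws                           ≤⟨ length≤concatMap encodeℚ length-encodeℚ ws ⟩
    length (List.concatMap encodeℚ ws)  ≤⟨ weights-within ⟩
    length bits                         ∎
    where open ≤-Reasoning

  parse-bits : parse bits ≡ parsed
  parse-bits = parse-by bits (trans (cong readℕ bits≡) (readℕ-encodeℕ n r₀))
    (trans (clip-value (length bits) (digits n)) (trans (cong (length bits ⊓_) (value-digits n)) (m≥n⇒m⊓n≡n n≤bits)))
    (subst (λ k → skipRats k r₀ ≡ r₁) length-cs (skipRats-encode cs r₁))
    (readℕ-encodeℕ J.m _) (readℕ-encodeℕ n _)
    (subst (λ k → readRats k r₀ ≡ map ratData cs) length-cs (readRats-encode cs r₁))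
    (subst₂ (λ k bs → readRats k bs ≡ map ratData ws) (List.length-tabulate J.weight) (List.++-identityʳ _) (readRats-encode ws []))

  position-at : ∀ v → positionAt parsed (Fin.toℕ v) ≡ (ratData (Point.x (J.position v)) , ratData (Point.y (J.position v)))
  position-at v = cong₂ _,_ (proj₁ (at-coordinates J.position v)) (proj₂ (at-coordinates J.position v))

  weight-at : ∀ v → at zeroRat (map ratData ws) (Fin.toℕ v) ≡ ratData (J.weight v)
  weight-at v = trans (cong (λ xs → at zeroRat xs (Fin.toℕ v)) (List.map-tabulate J.weight ratData)) (at-tabulate zeroRat (ratData ∘ J.weight) v)

  adjacency : List (List Bool)
  adjacency = proj₁ (proj₂ (proj₂ (graphOf parsed)))

  adjacent-graph : ∀ v u → adjacent adjacency (Fin.toℕ v) (Fin.toℕ u) ≡ does (Graph._~?_ J.graph v u)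
  adjacent-graph v u = trans (cong (λ row → at false row (Fin.toℕ u)) (at-map-upTo [] _ (Fin.toℕ<n v)))
    (trans (at-map-upTo false _ (Fin.toℕ<n u)) (cong₂ (λ a b → not a ∧ b) (eqℕ-toℕ v u)
      (trans (cong₂ near (position-at v) (position-at u)) (Distance.near-dist (J.position v) (J.position u)))))

  loopless : ∀ v → adjacent adjacency (Fin.toℕ v) (Fin.toℕ v) ≡ false
  loopless v = trans (adjacent-graph v v) (irreflexive (Graph._~?_ J.graph v v))
    where
    irreflexive : (d : Dec (Graph._~_ J.graph v v)) → does d ≡ false
    irreflexive (yes v~v) = contradiction v~v (Graph.~-irrefl J.graph refl)
    irreflexive (no _)    = refl

  coincide-iff : ∀ v u → (coincide parsed (Fin.toℕ v) (Fin.toℕ u) ≡ true → J.position v ≡ J.position u) ×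
                         (J.position v ≡ J.position u → coincide parsed (Fin.toℕ v) (Fin.toℕ u) ≡ true)
  coincide-iff v u = sound , complete
    where
    p = J.position v
    q = J.position u
    same : coincide parsed (Fin.toℕ v) (Fin.toℕ u) ≡ equalRat (ratData (Point.x p)) (ratData (Point.x q)) ∧ equalRat (ratData (Point.y p)) (ratData (Point.y q))
    same = cong₂ (λ a b → equalRat (proj₁ a) (proj₁ b) ∧ equalRat (proj₂ a) (proj₂ b)) (position-at v) (position-at u)
    both : ∀ a b → a ∧ b ≡ true → a ≡ true × b ≡ true
    both true true _ = refl , refl
    sound : coincide parsed (Fin.toℕ v) (Fin.toℕ u) ≡ true → p ≡ q
    sound eq with both _ _ (trans (sym same) eq)
    ... | ex , ey = cong₂ point (equalRat-sound (Point.x p) (Point.x q) ex) (equalRat-sound (Point.y p) (Point.y q) ey)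
    complete : p ≡ q → coincide parsed (Fin.toℕ v) (Fin.toℕ u) ≡ true
    complete eq = trans same (cong₂ _∧_ (equalRat-complete _ _ (cong Point.x eq)) (equalRat-complete _ _ (cong Point.y eq)))

common-multiple : ∀ {n} (f : Fin n → ℕ) → (∀ i → 0 < f i) → ∃[ Q ] 0 < Q × (∀ i → ∃[ k ] Q ≡ k * f i)
common-multiple {zero}  f pos = 1 , s≤s z≤n , λ ()
common-multiple {suc n} f pos with common-multiple (f ∘ suc) (pos ∘ suc)
... | Q , Q>0 , multiple = f zero * Q , *-mono-≤ (pos zero) Q>0 ,
  λ { zero → Q , *-comm (f zero) Q ; (suc i) → let k , eq = multiple i in f zero * k , trans (cong (f zero *_) eq) (sym (*-assoc (f zero) k _)) }

nonNeg-numerator : ∀ q → 0ℚ ℚ.≤ q → ∃[ p ] ↥ q ≡ ℤ.+ p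
nonNeg-numerator (ℚ.mkℚ (ℤ.+ p)    d c) 0≤q = p , refl
nonNeg-numerator (ℚ.mkℚ ℤ.-[1+ p ] d c) 0≤q with ℚ.drop-*≤* 0≤q
... | ()

cardinality : ∀ {n} (p : Subset n) (f : ℕ → ℕ) → (∀ i → f (Fin.toℕ i) ≡ bit (lookup p i)) → ∣ p ∣ ≡ total f (upTo n)
cardinality []          f eq = refl
cardinality {suc n} (b ∷ p) f eq = trans (by b (cardinality p (f ∘ suc) (eq ∘ suc))) (trans (cong (_+ total (f ∘ suc) (upTo n)) (sym (eq zero))) (sym (total-upTo-suc f n)))
  where
  by : ∀ b {k} → ∣ p ∣ ≡ k → ∣ b ∷ p ∣ ≡ bit b + k
  by true  refl = refl
  by false refl = refl

bits-of : ∀ {n} → Subset n → ℕ → Bool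
bits-of p v = at false (Vec.toList p) v

bits-of-toℕ : ∀ {n} (p : Subset n) i → bits-of p (Fin.toℕ i) ≡ lookup p i
bits-of-toℕ (b ∷ p) zero    = refl
bits-of-toℕ (b ∷ p) (suc i) = bits-of-toℕ p i

∉-lookup : ∀ {n} {p : Subset n} {i} → lookup p i ≡ false → i Subset.∉ p
∉-lookup {p = p} {i} eq i∈p with trans (sym eq) (Vec.[]=⇒lookup i∈p)
... | ()

lookup-∉ : ∀ {n} {p : Subset n} {i} → i Subset.∉ p → lookup p i ≡ false
lookup-∉ {p = p} {i} i∉p with lookup p i in eq
... | false = refl
... | true  = contradiction (Vec.lookup⇒[]= i p eq) i∉p

module Weights (J : UnitDiskDomination) where

  open Input J

  private
    multiple = common-multiple (λ v → ↧ₙ (J.weight v)) (λ v → s≤s z≤n)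

  Q : ℕ
  Q = proj₁ multiple

  Q>0 : 0 < Q
  Q>0 = proj₁ (proj₂ multiple)

  private
    numerator : ∀ v → ∃[ p ] ↥ (J.weight v) ≡ ℤ.+ p
    numerator v = nonNeg-numerator (J.weight v) (J.weight-nonneg v)

    W-fin : Fin n → ℕ
    W-fin v = proj₁ (numerator v) * proj₁ (proj₂ (proj₂ multiple) v)

  W : ℕ → ℕ
  W = at 0 (List.tabulate W-fin)

  private
    W-toℕ : ∀ v → W (Fin.toℕ v) ≡ W-fin v
    W-toℕ v = at-tabulate 0 W-fin v

  weight-scaled : ∀ v → Scaled Q (ratData (J.weight v)) (W (Fin.toℕ v))
  weight-scaled v = scaled
    (trans (cong₂ _*_ (trans (cong (value ∘ proj₂ ∘ signDigits) (proj₂ (numerator v))) (value-digits p)) (proj₂ (proj₂ (proj₂ multiple) v)))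
      (trans (sym (*-assoc p k (↧ₙ (J.weight v)))) (cong₂ _*_ (sym (W-toℕ v)) (sym (value-den (J.weight v))))))
    (≤-trans (s≤s z≤n) (≤-reflexive (sym (value-den (J.weight v)))))
    where
    p = proj₁ (numerator v)
    k = proj₁ (proj₂ (proj₂ multiple) v)

  weight-ι : ∀ v → J.weight v ℚ.* ι Q ≡ ι (W (Fin.toℕ v))
  weight-ι v = begin
    w ℚ.* ι Q                         ≡⟨ cong (λ q → w ℚ.* ι q) (trans (proj₂ (proj₂ (proj₂ multiple) v)) (*-comm k (↧ₙ w))) ⟩
    w ℚ.* ι (↧ₙ w * k)                ≡⟨ cong (w ℚ.*_) (ι-* (↧ₙ w) k) ⟩
    w ℚ.* (ι (↧ₙ w) ℚ.* ι k)          ≡⟨ ℚ.*-assoc w (ι (↧ₙ w)) (ι k) ⟨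
    w ℚ.* ι (↧ₙ w) ℚ.* ι k            ≡⟨ cong (ℚ._* ι k) (trans (numerator-eq w) (cong ιℤ (proj₂ (numerator v)))) ⟩
    ι p ℚ.* ι k                       ≡⟨ ι-* p k ⟨
    ι (p * k)                         ≡⟨ cong ι (W-toℕ v) ⟨
    ι (W (Fin.toℕ v))                 ∎
    where
    open ≡-Reasoning
    w = J.weight v
    p = proj₁ (numerator v)
    k = proj₁ (proj₂ (proj₂ multiple) v)

known-weight : ∀ {n Q} (w : Fin n → ℚ) (W : Fin n → ℕ) → (∀ v → Scaled Q (ratData (w v)) (W v)) →
  ∀ {B} → B ∈ zeroRat ∷ map ratData (List.tabulate w) → ∃[ b ] Scaled Q B b
known-weight {Q = Q} w W scaled-w (here refl) = 0 , scaled-zero Q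
known-weight w W scaled-w (there B∈) with ∈.∈-map⁻ ratData B∈
... | q , q∈ , refl with ∈.∈-tabulate⁻ {f = w} q∈
...   | v , refl = W v , scaled-w v

-- A largest term. For the weights in an optimal solution it is the intended guess b, with b at most
-- the optimum and the optimum at most n b.
dominating-term : ∀ {A : Set} (f : A → ℕ) xs → total f xs ≡ 0 ⊎ (∃[ x ] x ∈ xs × 0 < f x × total f xs ≤ length xs * f x)
dominating-term f []       = inj₁ refl
dominating-term f (x ∷ xs) with dominating-term f xs | f x in e
... | inj₁ rest≡0 | zero  = inj₁ rest≡0
... | inj₁ rest≡0 | suc k = inj₂ (x , here refl , ≤-trans (s≤s z≤n) (≤-reflexive (sym e)) ,
  ≤-trans (≤-reflexive (trans (cong (suc k +_) rest≡0) (trans (+-identityʳ _) (sym e)))) (m≤m+n (f x) _))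
... | inj₂ (y , y∈ , y>0 , rest≤) | k with ≤-total (f x) (f y)
...   | inj₁ x≤y = inj₂ (y , there y∈ , y>0 , +-mono-≤ (≤-trans (≤-reflexive (sym e)) x≤y) rest≤)
...   | inj₂ y≤x = inj₂ (x , here refl , ≤-trans y>0 y≤x ,
  +-mono-≤ (≤-reflexive (sym e)) (≤-trans rest≤ (*-monoʳ-≤ (length xs) y≤x)))

-- Comparison with an optimal solution

module Approximate (n m : ℕ) (adj : List (List Bool)) (ws : List Rat) (m≤n : m ≤ n) (length-ws : length ws ≡ n)
  {Q : ℕ} (Q>0 : 0 < Q) (W : ℕ → ℕ) (weights : ∀ {v} → v < n → Scaled Q (at zeroRat ws v) (W v))
  (known : ∀ {B} → B ∈ zeroRat ∷ ws → ∃[ b ] Scaled Q B b) (s : ℕ → Bool)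
  (dominating : ∀ {v} → v < n → s v ≡ false → m ≤ total (λ u → if s u then bit (adjacent adj v u) else 0) (upTo n)) where

  private
    module Solved = Solve n m adj ws m≤n Q>0 W weights s dominating

    G : Graphᴸ
    G = n , m , adj , ws

  optimum : ℕ
  optimum = chosenWeight n W s

  private
    Guessed : Set
    Guessed = ∃[ b ] succeeds G (guess G) ≡ true × Scaled Q (guess G) b × b ≤ optimum

    -- The largest weight in the comparison solution is a candidate that succeeds, or the candidate
    -- 0 does if the solution has weight 0. The guess actually used is the smallest success, so it
    -- is no larger and hence at most the optimum.
    good-guess : Guessed
    good-guess = by (dominating-term (λ v → if s v then W v else 0) (upTo n))
      where
      lower : ∀ {b} → b ≤ 0 → b ≤ optimum
      lower b≤ = ≤-trans b≤ z≤n
      by : total (λ v → if s v then W v else 0) (upTo n) ≡ 0 ⊎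
           (∃[ v ] v ∈ upTo n × 0 < (if s v then W v else 0) × optimum ≤ length (upTo n) * (if s v then W v else 0)) → Guessed
      by (inj₁ opt≡0) = let b , ok , S , b≤ = guess-least G Q>0 known {zeroRat} {0} (here refl) (Solved.success-zero {zeroRat} {0} (scaled-zero Q) refl opt≡0) (scaled-zero Q)
                        in b , ok , S , lower b≤
      by (inj₂ (v , v∈ , pos , opt≤)) = let b , ok , S , b≤ = guess-least G Q>0 known {at zeroRat ws v} {W v} (there weight∈) (Solved.success {at zeroRat ws v} {W v} (weights v<n) W>0 opt≤′) (weights v<n)
                                        in b , ok , S , ≤-trans b≤ (subst (_≤ optimum) term≡ (term≤total (λ v → if s v then W v else 0) v∈))
        where
        v<n : v < n
        v<n = ∈.∈-upTo⁻ v∈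
        chosen : ∀ b → 0 < (if b then W v else 0) → (if b then W v else 0) ≡ W v
        chosen true _ = refl
        term≡ : (if s v then W v else 0) ≡ W v
        term≡ = chosen (s v) pos
        W>0 : 0 < W v
        W>0 = subst (0 <_) term≡ pos
        opt≤′ : optimum ≤ n * W v
        opt≤′ = ≤-trans opt≤ (≤-reflexive (cong₂ _*_ (List.length-upTo n) term≡))
        weight∈ : at zeroRat ws v ∈ ws
        weight∈ = at-∈ zeroRat ws (subst (v <_) (sym length-ws) v<n)

  H : List Assignment
  H = history G (guess G)

  T : ℕ
  T = rounds n

  private
    length-history : ∀ t → length (foldr (λ _ H → round G (guess G) H ∷ H) [] (List.replicate t tt)) ≡ t
    length-history zero    = refl
    length-history (suc t) = cong suc (length-history t)

    settled : ∀ {row} → row ∈Row n → 16 * n * debt G H row ≤ T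
    settled {row} row∈ = leq-sound (16 * n * debt G H row) T
      (all-sound (λ row → leq (16 * n * debt G H row) T) (rowsOf n) (trans (sym (succeeds-unfold G (guess G))) (proj₁ (proj₂ good-guess))) (∈-rowsOf⁺ n row∈))

  open Rounding n m adj ws H (length-history T) settled public

  isHeavy : ℕ → Bool
  isHeavy v = leq (3 * T) (8 * xs v)

  heavies-isHeavy : heavies G ≡ map isHeavy (upTo n)
  heavies-isHeavy = refl

  spent : 8 * total (λ v → W v * xs v) (upTo n) ≤ 9 * (T * optimum)
  spent = begin
    8 * total (λ v → W v * xs v) (upTo n)                          ≡⟨ cong (8 *_) swap ⟨
    8 * total (λ X → chosenWeight n W (λ v → holds X (v , 0))) H   ≤⟨ Solved.cost-bound {guess G} {b} (proj₁ (proj₂ (proj₂ good-guess))) ⟩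
    T * (8 * optimum + b)                                          ≤⟨ *-monoʳ-≤ T (+-monoʳ-≤ (8 * optimum) (proj₂ (proj₂ (proj₂ good-guess)))) ⟩
    T * (8 * optimum + optimum)                                    ≡⟨ nine T optimum ⟩
    9 * (T * optimum)                                              ∎
    where
    open ≤-Reasoning
    b = proj₁ good-guess
    nine : ∀ t o → t * (8 * o + o) ≡ 9 * (t * o)
    nine = solve-∀
    if-* : ∀ b w → (if b then w else 0) ≡ w * bit b
    if-* true  w = sym (*-identityʳ w)
    if-* false w = sym (*-zeroʳ w)
    swap : total (λ X → chosenWeight n W (λ v → holds X (v , 0))) H ≡ total (λ v → W v * xs v) (upTo n)
    swap = trans (total-swap (λ X v → if holds X (v , 0) then W v else 0) H (upTo n)) (total-cong (upTo n) (λ {v} _ →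
      trans (total-cong H (λ {X} _ → if-* (holds X (v , 0)) (W v))) (total-* (W v) (λ X → bit (holds X (v , 0))) H)))

module Relaxation (J : UnitDiskDomination) (S : Subset (UnitDiskDomination.#V J)) (S-dominating : UnitDiskDomination.IsMDominating J S) where

  open Input J
  open Weights J

  s : ℕ → Bool
  s = bits-of S

  m′ : ℕ
  m′ = n ⊓ J.m

  private
    ws : List Rat
    ws = map ratData (List.tabulate J.weight)

    g : Graphᴸ
    g = graphOf parsed

    weights : ∀ {v} → v < n → Scaled Q (at zeroRat ws v) (W v)
    weights {v} v<n = subst (λ k → Scaled Q (at zeroRat ws k) (W k)) (Fin.toℕ-fromℕ< v<n)
      (subst (λ r → Scaled Q r (W (Fin.toℕ i))) (sym (weight-at i)) (weight-scaled i))
      where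
      i = Fin.fromℕ< v<n

    covered : ∀ {v} → v < n → s v ≡ false → m′ ≤ total (λ u → if s u then bit (adjacent adjacency v u) else 0) (upTo n)
    covered {v} v<n sv = subst (λ k → m′ ≤ total (λ u → if s u then bit (adjacent adjacency k u) else 0) (upTo n)) (Fin.toℕ-fromℕ< v<n)
      (≤-trans (m⊓n≤n n J.m) (≤-trans (S-dominating i (∉-lookup (trans (sym (bits-of-toℕ S i)) (trans (cong s (Fin.toℕ-fromℕ< v<n)) sv))))
        (≤-reflexive (cardinality (S ∩ Graph.neighbours J.graph i) _ term))))
      where
      i : Fin n
      i = Fin.fromℕ< v<n
      bit-∧ : ∀ a b → (if a then bit b else 0) ≡ bit (a ∧ b)
      bit-∧ true  b = refl
      bit-∧ false b = refl
      term : ∀ u → (if s (Fin.toℕ u) then bit (adjacent adjacency (Fin.toℕ i) (Fin.toℕ u)) else 0) ≡ bit (lookup (S ∩ Graph.neighbours J.graph i) u)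
      term u = trans (bit-∧ (s (Fin.toℕ u)) _) (cong bit (trans (cong₂ _∧_ (bits-of-toℕ S u)
        (trans (adjacent-graph i u) (sym (Vec.lookup∘tabulate (λ u → does (Graph._~?_ J.graph i u)) u))))
        (sym (Vec.lookup-zipWith _∧_ u S (Graph.neighbours J.graph i)))))

    length-ws : length ws ≡ n
    length-ws = trans (List.length-map ratData (List.tabulate J.weight)) (List.length-tabulate J.weight)

    g≡ : g ≡ (n , m′ , adjacency , ws)
    g≡ = cong (λ k → n , k , adjacency , ws) (trans (clip-value n (digits J.m)) (cong (n ⊓_) (value-digits J.m)))

  open Approximate n m′ adjacency ws (m⊓n≤m n J.m) length-ws Q>0 W weights (known-weight J.weight (λ v → W (Fin.toℕ v)) weight-scaled) s covered public

  heavySet-isHeavy : heavySet parsed ≡ map isHeavy (upTo n)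
  heavySet-isHeavy = trans (cong heavies g≡) heavies-isHeavy

-- The multicover instance

concatMap-tabulate : ∀ {A : Set} {n} (enc : A → List Bool) (f : Fin n → A) (h : ℕ → List Bool) →
  (∀ i → enc (f i) ≡ h (Fin.toℕ i)) → List.concatMap enc (List.tabulate f) ≡ List.concatMap h (upTo n)
concatMap-tabulate {n = zero}  enc f h eq = refl
concatMap-tabulate {n = suc n} enc f h eq = cong₂ _++_ (eq zero) (trans (concatMap-tabulate enc (f ∘ suc) (h ∘ suc) (eq ∘ suc))
  (cong List.concat (trans (List.map-upTo (h ∘ suc) n) (sym (List.map-applyUpTo suc h n)))))

length-member : ∀ {A : Set} (enc : A → List Bool) {x xs} → x ∈ xs → length (enc x) ≤ length (List.concatMap enc xs)
length-member enc {xs = x ∷ xs} (here refl) = ≤-trans (m≤m+n _ _) (≤-reflexive (sym (List.length-++ (enc x))))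
length-member enc {xs = x ∷ xs} (there y∈) = ≤-trans (length-member enc y∈) (≤-trans (m≤n+m _ (length (enc x))) (≤-reflexive (sym (List.length-++ (enc x)))))

all-false : ∀ {A : Set} (p : A → Bool) xs → all p xs ≡ false → ∃[ x ] x ∈ xs × p x ≡ false
all-false p (x ∷ xs) eq with p x in e
... | false = x , here refl , e
... | true  = let y , y∈ , ey = all-false p xs eq in y , there y∈ , ey

∨-false : ∀ {a b} → a ∨ b ≡ false → a ≡ false × b ≡ false
∨-false {false} {false} _ = refl , refl

∧-true : ∀ {a b} → a ∧ b ≡ true → a ≡ true × b ≡ true
∧-true {true} {true} _ = refl , refl

not-false : ∀ {a} → not a ≡ false → a ≡ true
not-false {true} _ = refl

not-true : ∀ {a} → not a ≡ true → a ≡ false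
not-true {false} _ = refl

true≢false : ∀ {A : Set} {b} → b ≡ true → b ≡ false → A
true≢false refl ()

reduce-from : ∀ bits {e out} → emission bits ≡ e → emit e ≡ out → reduce bits ≡ (out , proj₂ (proj₂ e))
reduce-from bits refl refl = refl

module Output (J : UnitDiskDomination) (L : List Bool) where

  open Input J public

  heavyAt : Fin n → Bool
  heavyAt v = at false L (Fin.toℕ v)

  real : Fin n → Bool
  real v = mustCover parsed L (Fin.toℕ v)

  exponent : Fin n → ℕ
  exponent v = baseFor bits + Fin.toℕ v

  radius : Fin n → ℚ
  radius v = ratio (exponent v)

  disk : Fin n → Disk
  disk v = record { centre = J.position v ; radius = radius v ; radius-positive = ratio-pos (exponent v) }

  target : Fin n → Point
  target v = if real v then J.position v else point (radius v) (radius v)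

  demandOf : Fin n → ℤ
  demandOf v = if real v then ℤ.+ J.m else ℤ.+ 0

  price : Fin n → ℚ
  price v = if heavyAt v then 0ℚ else J.weight v

  private
    position-within : ∀ v → length (encodePoint (J.position v)) ≤ length bits
    position-within v = ≤-trans (length-member encodePoint (∈.∈-tabulate⁺ {f = J.position} v))
      (≤-trans (m≤n+m _ (length (encodeℕ n))) (≤-trans (≤-reflexive (sym (List.length-++ (encodeℕ n))))
        (≤-trans (m≤m+n _ _) (≤-reflexive (sym (List.length-++ (encodeVector encodePoint J.position)))))))

    D : ℕ
    D = 2 ^ length bits

    x-den : ∀ v → ↧ₙ (Point.x (J.position v)) < D
    x-den v = <-≤-trans (den<2^ x) (^-monoʳ-≤ 2 (≤-trans (m≤m+n (length (encodeℚ x)) (length (encodeℚ (Point.y (J.position v))))) (≤-trans (≤-reflexive (sym (List.length-++ (encodeℚ x)))) (position-within v))))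
      where x = Point.x (J.position v)

    y-den : ∀ v → ↧ₙ (Point.y (J.position v)) < D
    y-den v = <-≤-trans (den<2^ (Point.y (J.position v))) (^-monoʳ-≤ 2 (≤-trans (m≤n+m (length (encodeℚ (Point.y (J.position v)))) (length (encodeℚ x))) (≤-trans (≤-reflexive (sym (List.length-++ (encodeℚ x)))) (position-within v))))
      where x = Point.x (J.position v)

    den-radius : ∀ u → suc (↧ₙ (radius u)) ≡ 2 ^ suc (exponent u)
    den-radius u = den-ratio (exponent u)

    -- The exponent exceeds eight times the length of the input, and the
    -- square of a distance is a fraction over eight denominators.
    large : ∀ u → 4 * 2 ^ (8 * length bits) ≤ suc (↧ₙ (radius u))
    large u = begin
      4 * 2 ^ (8 * length bits)       ≡⟨ *-assoc 2 2 (2 ^ (8 * length bits)) ⟩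
      2 ^ (2 + 8 * length bits)       ≤⟨ ^-monoʳ-≤ 2 (s≤s (m≤m+n (baseFor bits) (Fin.toℕ u))) ⟩
      2 ^ suc (exponent u)            ≡⟨ den-radius u ⟨
      suc (↧ₙ (radius u))             ∎
      where open ≤-Reasoning

    over≤ : ∀ {r s} → ↧ₙ r ≤ D → ↧ₙ s ≤ D → value (over (ratData r) (ratData s)) ≤ (D * D) * (D * D)
    over≤ {r} {s} r≤ s≤ = ≤-trans (≤-reflexive (value-over r s)) (*-mono-≤ (*-mono-≤ r≤ s≤) (*-mono-≤ r≤ s≤))

    distance-over≤ : ∀ v u → Distance.distance-over (J.position v) (J.position u) ≤ 2 ^ (8 * length bits)
    distance-over≤ v u = ≤-trans (*-mono-≤ (over≤ {Point.x (J.position v)} {Point.x (J.position u)} (<⇒≤ (x-den v)) (<⇒≤ (x-den u)))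
        (over≤ {Point.y (J.position v)} {Point.y (J.position u)} (<⇒≤ (y-den v)) (<⇒≤ (y-den u))))
      (≤-reflexive (trans (eighth D) (trans (^-*-assoc 2 (length bits) 8) (cong (2 ^_) (*-comm (length bits) 8)))))
      where
      eighth : ∀ d → (d * d) * (d * d) * ((d * d) * (d * d)) ≡ d * (d * (d * (d * (d * (d * (d * (d * 1)))))))
      eighth = solve-∀

    D≤2^ : D ≤ 2 ^ (8 * length bits)
    D≤2^ = ^-monoʳ-≤ 2 (m≤n*m (length bits) 8)

    module Near (v u : Fin n) = Distance (J.position v) (J.position u)

    N>1 : ∀ u → 1 < ↧ₙ (radius u)
    N>1 u = s≤s⁻¹ (≤-trans (≤-trans (s≤s (s≤s (s≤s z≤n))) (*-monoʳ-≤ 4 (m^n>0 2 (8 * length bits)))) (large u))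

    3O≤N : ∀ v u → 3 * Distance.distance-over (J.position v) (J.position u) ≤ ↧ₙ (radius u)
    3O≤N v u = s≤s⁻¹ (≤-trans (≤-trans (s≤s (*-monoʳ-≤ 3 (distance-over≤ v u)))
      (+-monoˡ-≤ (3 * 2 ^ (8 * length bits)) (m^n>0 2 (8 * length bits)))) (large u))

  in-disk : ∀ v u → J.position v ∈ᵈ disk u → dist² (J.position v) (J.position u) ℚ.≤ 1ℚ
  in-disk v u = Near.≤r²⇒≤1 v u (radius u) (↧ₙ (radius u)) (N>1 u) (3O≤N v u) (ratio-eq (exponent u))

  into-disk : ∀ v u → dist² (J.position v) (J.position u) ℚ.≤ 1ℚ → J.position v ∈ᵈ disk u
  into-disk v u = Near.≤1⇒≤r² v u (radius u) (↧ₙ (radius u)) (N>1 u) (3O≤N v u) (ratio-eq (exponent u))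

  private
    -- The denominator of a radius exceeds 2 to the power of the input length, and no coordinate of
    -- the input has a denominator that large.
    dummy-far : ∀ v u → J.position v ≢ point (radius u) (radius u)
    dummy-far v u eq = <⇒≱ (x-den v) (begin
      D                               ≤⟨ D≤2^ ⟩
      2 ^ (8 * length bits)           ≤⟨ m≤m+n _ (2 * 2 ^ (8 * length bits)) ⟩
      3 * 2 ^ (8 * length bits)       ≤⟨ s≤s⁻¹ (≤-trans (+-monoˡ-≤ (3 * 2 ^ (8 * length bits)) (m^n>0 2 (8 * length bits))) (large u)) ⟩
      ↧ₙ (radius u)                   ≡⟨ cong (λ p → ↧ₙ (Point.x p)) eq ⟨
      ↧ₙ (Point.x (J.position v))     ∎)
      where open ≤-Reasoning

    radius-injective : ∀ {v u} → radius v ≡ radius u → v ≡ u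
    radius-injective eq = Fin.toℕ-injective (+-cancelˡ-≡ (baseFor bits) _ _ (ratio-injective eq))

    light-first : ∀ {v} → real v ≡ true → ∀ {u} → Fin.toℕ u < Fin.toℕ v → heavyAt u ≡ false → J.position v ≢ J.position u
    light-first {v} rv {u} u<v light-u same = true≢false (proj₂ (coincide-iff v u) same)
      (not-true (drop-false light-u (drop-false (leq-not u<v)
        (all-sound (λ u → leq (Fin.toℕ v) u ∨ (at false L u ∨ not (coincide parsed (Fin.toℕ v) u))) (upTo n) (proj₂ (∧-true rv)) (∈.∈-upTo⁺ (Fin.toℕ<n u))))))
      where
      drop-false : ∀ {a b} → a ≡ false → a ∨ b ≡ true → b ≡ true
      drop-false refl e = e
      leq-not : ∀ {i j} → i < j → leq j i ≡ false
      leq-not {i} {j} i<j with leq j i in e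
      ... | false = refl
      ... | true  = contradiction (leq-sound j i e) (<⇒≱ i<j)

    real-light : ∀ {v} → real v ≡ true → heavyAt v ≡ false
    real-light rv = not-true (proj₁ (∧-true rv))

    real-injective : ∀ v u → real v ≡ true → real u ≡ true → J.position v ≡ J.position u → v ≡ u
    real-injective v u rv ru same = by (<-cmp (Fin.toℕ v) (Fin.toℕ u))
      where
      by : Tri (Fin.toℕ v < Fin.toℕ u) (Fin.toℕ v ≡ Fin.toℕ u) (Fin.toℕ u < Fin.toℕ v) → v ≡ u
      by (tri< v<u _ _) = contradiction (sym same) (light-first ru v<u (real-light {v} rv))
      by (tri≈ _ v≡u _) = Fin.toℕ-injective v≡u
      by (tri> _ _ u<v) = contradiction same (light-first rv u<v (real-light {u} ru))

  target-real : ∀ {v} → real v ≡ true → target v ≡ J.position v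
  target-real {v} e = cong (λ b → if b then J.position v else point (radius v) (radius v)) e

  target-injective : ∀ {v u} → target v ≡ target u → v ≡ u
  target-injective {v} {u} eq = by (real v) (real u) refl refl
    where
    dummy : ∀ {v} → real v ≡ false → target v ≡ point (radius v) (radius v)
    dummy {v} e = cong (λ b → if b then J.position v else point (radius v) (radius v)) e
    by : ∀ a b → real v ≡ a → real u ≡ b → v ≡ u
    by true  true  ev eu = real-injective v u ev eu (trans (sym (target-real ev)) (trans eq (target-real eu)))
    by true  false ev eu = contradiction (trans (sym (target-real ev)) (trans eq (dummy {u} eu))) (dummy-far v u)
    by false true  ev eu = contradiction (trans (sym (target-real eu)) (trans (sym eq) (dummy {v} ev))) (dummy-far u v)
    by false false ev eu = radius-injective (cong Point.x (trans (sym (dummy {v} ev)) (trans eq (dummy {u} eu))))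

  instance′ : DiskMulticover
  instance′ = record
    { #P = n ; #D = n
    ; point = target
    ; points-distinct = target-injective
    ; demand = demandOf
    ; disk = disk
    ; disks-distinct = λ eq → radius-injective (cong Disk.radius eq)
    ; weight = price
    ; weight-nonneg = λ v → price-nonneg v (heavyAt v)
    }
    where
    price-nonneg : ∀ v b → 0ℚ ℚ.≤ (if b then 0ℚ else J.weight v)
    price-nonneg v true  = ℚ.≤-refl
    price-nonneg v false = J.weight-nonneg v

  module I′ = DiskMulticover instance′

  private
    section-encode : ∀ {A : Set} (enc : A → List Bool) (f : Fin n → A) (h : Emission → ℕ → List Bool) →
      (∀ v → enc (f v) ≡ h (baseFor bits , parsed , L) (Fin.toℕ v)) → section h (baseFor bits , parsed , L) ≡ encodeVector enc f
    section-encode enc f h eq = cong₂ _++_ (writeDigits-digitsᵇ (fromℕ n)) (sym (concatMap-tabulate enc f (h (baseFor bits , parsed , L)) eq))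

    write-position : ∀ v → encodePoint (J.position v) ≡ writePoint (positionAt parsed (Fin.toℕ v))
    write-position v = trans (sym (cong₂ _++_ (writeRat-ratData (Point.x (J.position v))) (writeRat-ratData (Point.y (J.position v)))))
      (sym (cong writePoint (position-at v)))

    point-bits : ∀ v → encodePoint (target v) ≡ pointBits (baseFor bits , parsed , L) (Fin.toℕ v)
    point-bits v = by (real v)
      where
      by : ∀ b → encodePoint (if b then J.position v else point (radius v) (radius v)) ≡
        (if b then writePoint (positionAt parsed (Fin.toℕ v)) else writeRatio (exponent v) ++ writeRatio (exponent v))
      by true  = write-position v
      by false = sym (cong₂ _++_ (writeRatio-ratio (exponent v)) (writeRatio-ratio (exponent v)))

    demand-bits : ∀ v → encodeℤ (demandOf v) ≡ demandBits (baseFor bits , parsed , L) (Fin.toℕ v)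
    demand-bits v = by (real v)
      where
      by : ∀ b → encodeℤ (if b then ℤ.+ J.m else ℤ.+ 0) ≡ (if b then false ∷ writeDigits (digits J.m) else false ∷ writeDigits [])
      by true  = cong (false ∷_) (sym (writeDigits-digitsᵇ (fromℕ J.m)))
      by false = refl

    disk-bits : ∀ v → encodeDisk (disk v) ≡ diskBits (baseFor bits , parsed , L) (Fin.toℕ v)
    disk-bits v = cong₂ _++_ (write-position v) (sym (writeRatio-ratio (exponent v)))

    weight-bits : ∀ v → encodeℚ (price v) ≡ weightBits (baseFor bits , parsed , L) (Fin.toℕ v)
    weight-bits v = by (heavyAt v)
      where
      by : ∀ b → encodeℚ (if b then 0ℚ else J.weight v) ≡
        (if b then writeRat zeroRat else writeRat (at zeroRat (map ratData (List.tabulate J.weight)) (Fin.toℕ v)))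
      by true  = refl
      by false = sym (trans (cong writeRat (weight-at v)) (writeRat-ratData (J.weight v)))

    emit-bits : emit (baseFor bits , parsed , L) ≡ I′.encode
    emit-bits = cong₂ _++_ (section-encode encodePoint target pointBits point-bits)
      (cong₂ _++_ (section-encode encodeℤ demandOf demandBits demand-bits)
        (cong₂ _++_ (section-encode encodeDisk disk diskBits disk-bits) (section-encode encodeℚ price weightBits weight-bits)))

    emission-bits : heavySet parsed ≡ L → emission bits ≡ (baseFor bits , parsed , L)
    emission-bits L≡ = begin
      emission bits                              ≡⟨ cong (λ P → baseFor bits , P , heavySet P) parse-bits ⟩
      (baseFor bits , parsed , heavySet parsed)  ≡⟨ cong (λ L → baseFor bits , parsed , L) L≡ ⟩
      (baseFor bits , parsed , L)                ∎
      where open ≡-Reasoning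

  reduce-bits : heavySet parsed ≡ L → reduce bits ≡ (I′.encode , L)
  reduce-bits L≡ = reduce-from bits (emission-bits L≡) emit-bits

light-at : ∀ (L : List Bool) {n} (D : Subset n) →
  Vec.toList (D ∪ Vec.tabulate (λ i → at false L (Fin.toℕ i))) ≡ merge (Vec.toList D) L
light-at L []      = refl
light-at L (b ∷ D) = cong₂ _∷_ refl (trans (cong (λ E → Vec.toList (D ∪ E)) (Vec.tabulate-cong (λ i → sym (at-drop L (Fin.toℕ i)))))
  (light-at (List.drop 1 L) D))
  where
  at-drop : ∀ L i → at false (List.drop 1 L) i ≡ at false L (suc i)
  at-drop []      i = refl
  at-drop (_ ∷ L) i = refl

lookup-∪ : ∀ {n} (p q : Subset n) i → lookup (p ∪ q) i ≡ lookup p i ∨ lookup q i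
lookup-∪ p q i = Vec.lookup-zipWith _∨_ i p q

lookup-∩ : ∀ {n} (p q : Subset n) i → lookup (p ∩ q) i ≡ lookup p i ∧ lookup q i
lookup-∩ p q i = Vec.lookup-zipWith _∧_ i p q

card-mono : ∀ {n} (p q : Subset n) → (∀ i → lookup p i ≡ true → lookup q i ≡ true) → ∣ p ∣ ≤ ∣ q ∣
card-mono p q le = Subset.p⊆q⇒∣p∣≤∣q∣ {p = p} {q} (λ {i} i∈p → Vec.lookup⇒[]= i q (le i (Vec.[]=⇒lookup i∈p)))

does-true : ∀ {P : Set} (d : Dec P) → does d ≡ true → P
does-true (yes p) _ = p

true-does : ∀ {P : Set} (d : Dec P) → P → does d ≡ true
true-does (yes _) _ = refl
true-does (no ¬p) p = contradiction p ¬p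

module Correctness (J : UnitDiskDomination) (L : List Bool) where

  open Output J L public

  heavySubset : Subset n
  heavySubset = Vec.tabulate heavyAt

  solution : Subset n → Subset n
  solution D = D ∪ heavySubset

  encode-solution : ∀ D → encodeSubset (solution D) ≡ merge (encodeSubset D) L
  encode-solution D = light-at L D

  private
    lookup-heavy : ∀ v → lookup heavySubset v ≡ heavyAt v
    lookup-heavy v = Vec.lookup∘tabulate heavyAt v

  lookup-solution : ∀ D v → lookup (solution D) v ≡ lookup D v ∨ heavyAt v
  lookup-solution D v = trans (lookup-∪ D heavySubset v) (cong (lookup D v ∨_) (lookup-heavy v))

  private
    -- A light vertex that is not to be covered coincides with an earlier light one. The bound k on
    -- the index makes the descent to the first of them terminate.
    representative : ∀ k v → Fin.toℕ v < k → heavyAt v ≡ false → ∃[ r ] real r ≡ true × J.position r ≡ J.position v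
    representative (suc k) v (s≤s v≤k) light with real v in rv
    ... | true  = v , rv , refl
    ... | false = earlier (all-false _ (upTo n) (fail light rv))
      where
      fail : ∀ {a b} → a ≡ false → not a ∧ b ≡ false → b ≡ false
      fail refl e = e
      earlier : ∃[ u ] u ∈ upTo n × leq (Fin.toℕ v) u ∨ (at false L u ∨ not (coincide parsed (Fin.toℕ v) u)) ≡ false →
                ∃[ r ] real r ≡ true × J.position r ≡ J.position v
      earlier (u , u∈ , e) = r , rr , trans pr same
        where
        u<n : u < n
        u<n = ∈.∈-upTo⁻ u∈
        i : Fin n
        i = Fin.fromℕ< u<n
        i≡ : Fin.toℕ i ≡ u
        i≡ = Fin.toℕ-fromℕ< u<n
        u<v : u < Fin.toℕ v
        u<v with ≤-<-connex (Fin.toℕ v) u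
        ... | inj₁ v≤u = true≢false (leq-true v≤u) (proj₁ (∨-false e))
        ... | inj₂ u<v = u<v
        light-i : heavyAt i ≡ false
        light-i = trans (cong (at false L) i≡) (proj₁ (∨-false (proj₂ (∨-false {leq (Fin.toℕ v) u} e))))
        same : J.position i ≡ J.position v
        same = sym (proj₁ (coincide-iff v i) (trans (cong (coincide parsed (Fin.toℕ v)) i≡)
          (not-false (proj₂ (∨-false {at false L u} (proj₂ (∨-false {leq (Fin.toℕ v) u} e)))))))
        rest = representative k i (<-≤-trans (subst (_< Fin.toℕ v) (sym i≡) u<v) v≤k) light-i
        r = proj₁ rest
        rr = proj₁ (proj₂ rest)
        pr = proj₂ (proj₂ rest)

  contains : Fin n → Fin n → Bool
  contains v u = does (target v ∈ᵈ? disk u)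

  contains-near : ∀ {v u} → real v ≡ true → contains v u ≡ true → dist² (J.position v) (J.position u) ℚ.≤ 1ℚ
  contains-near {v} {u} rv c = in-disk v u (subst (_∈ᵈ disk u) (target-real rv) (does-true (target v ∈ᵈ? disk u) c))

  near-contains : ∀ {v u} → real v ≡ true → dist² (J.position v) (J.position u) ℚ.≤ 1ℚ → contains v u ≡ true
  near-contains {v} {u} rv d = true-does (target v ∈ᵈ? disk u) (subst (_∈ᵈ disk u) (sym (target-real rv)) (into-disk v u d))

  -- A vertex v outside the solution is light, and its representative sits at the same place. The
  -- disks of `D` over that point belong to vertices at distance at most 1 from v. The disk of v
  -- itself contains the point as well, but it is not in `D`, so all of these vertices are proper
  -- neighbours.
  dominating : ∀ {D} → I′.IsMulticover D → J.IsMDominating (solution D)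
  dominating {D} cover v v∉ = ≤-trans demand≤ (card-mono (D ∩ I′.disksContaining r) (solution D ∩ Graph.neighbours J.graph v) inclusion)
    where
    outside : lookup D v ≡ false × heavyAt v ≡ false
    outside = ∨-false (trans (sym (lookup-solution D v)) (lookup-∉ v∉))
    rep = representative (suc (Fin.toℕ v)) v ≤-refl (proj₂ outside)
    r = proj₁ rep
    r-real : real r ≡ true
    r-real = proj₁ (proj₂ rep)
    demand≤ : J.m ≤ ∣ D ∩ I′.disksContaining r ∣
    demand≤ = ℤ.drop‿+≤+ (subst (ℤ._≤ ℤ.+ ∣ D ∩ I′.disksContaining r ∣) (cong (λ b → if b then ℤ.+ J.m else ℤ.+ 0) r-real) (cover r))
    inclusion : ∀ u → lookup (D ∩ I′.disksContaining r) u ≡ true → lookup (solution D ∩ Graph.neighbours J.graph v) u ≡ true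
    inclusion u e = trans (lookup-∩ (solution D) (Graph.neighbours J.graph v) u) (cong₂ _∧_ in-solution adjacent-u)
      where
      both : lookup D u ≡ true × contains r u ≡ true
      both = let d , c = ∧-true (trans (sym (lookup-∩ D (I′.disksContaining r) u)) e) in d , trans (sym (Vec.lookup∘tabulate (contains r) u)) c
      in-solution : lookup (solution D) u ≡ true
      in-solution = trans (lookup-solution D u) (cong (_∨ heavyAt u) (proj₁ both))
      v≢u : v ≢ u
      v≢u refl = true≢false (proj₁ both) (proj₁ outside)
      adjacent-u : lookup (Graph.neighbours J.graph v) u ≡ true
      adjacent-u = trans (Vec.lookup∘tabulate (λ u → does (Graph._~?_ J.graph v u)) u)
        (true-does (Graph._~?_ J.graph v u) (v≢u , subst (λ p → dist² p (J.position u) ℚ.≤ 1ℚ) (proj₂ (proj₂ rep)) (contains-near r-real (proj₂ both))))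

Σℚ-≥ : ∀ {n} (f : Fin n → ℚ) (F : ℕ → ℕ) c → (∀ i → ι (F (Fin.toℕ i)) ℚ.≤ f i ℚ.* c) → ι (total F (upTo n)) ℚ.≤ Σℚ f ℚ.* c
Σℚ-≥ {zero}  f F c le = ℚ.≤-reflexive (trans ι-0 (sym (ℚ.*-zeroˡ c)))
Σℚ-≥ {suc n} f F c le = subst₂ ℚ._≤_ (sym (trans (cong ι (total-upTo-suc F n)) (ι-+ (F 0) _))) (sym (ℚ.*-distribʳ-+ c (f zero) _))
  (ℚ.+-mono-≤ (le zero) (Σℚ-≥ (f ∘ suc) (F ∘ suc) c (le ∘ suc)))

Σℚ-≡ : ∀ {n} (f : Fin n → ℚ) (F : ℕ → ℕ) c → (∀ i → f i ℚ.* c ≡ ι (F (Fin.toℕ i))) → Σℚ f ℚ.* c ≡ ι (total F (upTo n))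
Σℚ-≡ {zero}  f F c eq = trans (ℚ.*-zeroˡ c) (sym ι-0)
Σℚ-≡ {suc n} f F c eq = trans (ℚ.*-distribʳ-+ c (f zero) _)
  (trans (cong₂ ℚ._+_ (eq zero) (Σℚ-≡ (f ∘ suc) (F ∘ suc) c (eq ∘ suc))) (sym (trans (cong ι (total-upTo-suc F n)) (ι-+ (F 0) _))))

Σℚ-nonNeg : ∀ {n} (f : Fin n → ℚ) → (∀ i → 0ℚ ℚ.≤ f i) → 0ℚ ℚ.≤ Σℚ f
Σℚ-nonNeg {zero}  f pos = ℚ.≤-refl
Σℚ-nonNeg {suc n} f pos = ℚ.+-mono-≤ {0ℚ} {f zero} {0ℚ} (pos zero) (Σℚ-nonNeg (f ∘ suc) (pos ∘ suc))

Σℚ-+ : ∀ {n} (f g h : Fin n → ℚ) → (∀ i → f i ≡ g i ℚ.+ h i) → Σℚ f ≡ Σℚ g ℚ.+ Σℚ h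
Σℚ-+ {zero}  f g h eq = refl
Σℚ-+ {suc n} f g h eq = trans (cong₂ ℚ._+_ (eq zero) (Σℚ-+ (f ∘ suc) (g ∘ suc) (h ∘ suc) (eq ∘ suc)))
  (exchange (g zero) (h zero) (Σℚ (g ∘ suc)) (Σℚ (h ∘ suc)))
  where
  open ℚ-Solver.+-*-Solver renaming (solve to ring)
  exchange : ∀ a b c d → (a ℚ.+ b) ℚ.+ (c ℚ.+ d) ≡ (a ℚ.+ c) ℚ.+ (b ℚ.+ d)
  exchange = ring 4 (λ a b c d → (a :+ b) :+ (c :+ d) := (a :+ c) :+ (b :+ d)) refl

-- The value at 0 is junk.
reciprocal : ℕ → ℚ
reciprocal zero    = 0ℚ
reciprocal (suc k) = ℚ.1/_ (ι (suc k)) {{ℚ.pos⇒nonZero (ι (suc k)) {{ι-pos (s≤s z≤n)}}}}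

reciprocal-* : ∀ {k} → 0 < k → reciprocal k ℚ.* ι k ≡ 1ℚ
reciprocal-* {suc k} _ = ℚ.*-inverseˡ (ι (suc k)) {{ℚ.pos⇒nonZero (ι (suc k)) {{ι-pos (s≤s z≤n)}}}}

LightCover : UnitDiskDomination → List Bool → ℕ → (ℕ → ℕ) → Set
LightCover J L T xs = ∀ v → at false L (Fin.toℕ v) ≡ false →
  9 * (T * (n ⊓ m)) ≤ 16 * total (λ u → if adj v u ∧ not (at false L u) then xs u else 0) (upTo n)
                      + 9 * (T * total (λ u → bit (adj v u ∧ at false L u)) (upTo n))
  where
  open UnitDiskDomination J using (m) renaming (#V to n)
  adj : Fin n → ℕ → Bool
  adj v = adjacent (Input.adjacency J) (Fin.toℕ v)

-- T copies of a fractional solution in which heavy vertices, those in L,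
-- count fully, and light ones 16 / 9 times.
module Fractional (J : UnitDiskDomination) (L : List Bool) (T : ℕ) (T>0 : Fin (UnitDiskDomination.#V J) → 0 < T) (xs : ℕ → ℕ)
  (light≤ : ∀ {v} → v < UnitDiskDomination.#V J → at false L v ≡ false → 8 * xs v ≤ 3 * T)
  (light-cover : LightCover J L T xs) where

  open Correctness J L public

  m′ : ℕ
  m′ = n ⊓ J.m

  isHeavy : ℕ → Bool
  isHeavy v = at false L v

  scale-y : ℕ
  scale-y = 9 * T

  scale-pos : Fin n → 0 < scale-y
  scale-pos v = *-mono-≤ {1} {9} (s≤s z≤n) (T>0 v)

  y-nat : ℕ → ℕ
  y-nat v = if isHeavy v then scale-y else 16 * xs v

  y : Fin n → ℚ
  y v = ι (y-nat (Fin.toℕ v)) ℚ.* reciprocal scale-y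

  y-scaled : ∀ v → y v ℚ.* ι scale-y ≡ ι (y-nat (Fin.toℕ v))
  y-scaled v = trans (ℚ.*-assoc (ι (y-nat (Fin.toℕ v))) _ _) (trans (cong (ι (y-nat (Fin.toℕ v)) ℚ.*_) (reciprocal-* (scale-pos v))) (ℚ.*-identityʳ _))

  private
    -- A light vertex gets at most 16/9 of 3/8, which is 2/3.
    y-nat≤ : ∀ {v} → v < n → y-nat v ≤ scale-y
    y-nat≤ {v} v<n = by (isHeavy v) refl
      where
      open ≤-Reasoning
      by : ∀ b → isHeavy v ≡ b → (if b then scale-y else 16 * xs v) ≤ scale-y
      by true  _ = ≤-refl
      by false e = begin
        16 * xs v        ≡⟨ *-assoc 2 8 (xs v) ⟩
        2 * (8 * xs v)   ≤⟨ *-monoʳ-≤ 2 (light≤ v<n e) ⟩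
        2 * (3 * T)      ≡⟨ *-assoc 2 3 T ⟨
        6 * T            ≤⟨ *-monoˡ-≤ T (m≤m+n 6 3) ⟩
        9 * T            ∎

    coverage : ℕ → ℕ → ℕ
    coverage v u = if adjacent adjacency v u then y-nat u else 0

    covered-enough : ∀ v → isHeavy (Fin.toℕ v) ≡ false →
      scale-y * m′ ≤ total (coverage (Fin.toℕ v)) (upTo n)
    covered-enough v e = begin
      9 * T * m′      ≡⟨ *-assoc 9 T m′ ⟩
      9 * (T * m′)    ≤⟨ light-cover v e ⟩
      16 * Y + 9 * (T * A) ≡⟨ trans (+-comm (16 * Y) _) (cong₂ _+_ (sym (trans (total-* (9 * T) _ (upTo n)) (*-assoc 9 T A))) (sym (total-* 16 _ (upTo n)))) ⟩
      total (λ u → 9 * T * bit (adj u ∧ isHeavy u)) (upTo n) + total (λ u → 16 * (if adj u ∧ not (isHeavy u) then xs u else 0)) (upTo n)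
        ≡⟨ total-+ _ _ (upTo n) ⟨
      total (λ u → 9 * T * bit (adj u ∧ isHeavy u) + 16 * (if adj u ∧ not (isHeavy u) then xs u else 0)) (upTo n)
        ≡⟨ total-cong (upTo n) (λ {u} _ → term u (adj u) (isHeavy u)) ⟩
      total (coverage (Fin.toℕ v)) (upTo n) ∎
      where
      open ≤-Reasoning
      adj : ℕ → Bool
      adj = adjacent adjacency (Fin.toℕ v)
      A Y : ℕ
      A = total (λ u → bit (adj u ∧ isHeavy u)) (upTo n)
      Y = total (λ u → if adj u ∧ not (isHeavy u) then xs u else 0) (upTo n)
      term : ∀ u a h → 9 * T * bit (a ∧ h) + 16 * (if a ∧ not h then xs u else 0) ≡ (if a then (if h then 9 * T else 16 * xs u) else 0)
      term u true  true  = trans (+-identityʳ _) (*-identityʳ (9 * T))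
      term u true  false = cong (_+ 16 * xs u) (*-zeroʳ (9 * T))
      term u false h     = trans (+-identityʳ _) (*-zeroʳ (9 * T))

    -- No fractional value exceeds 1, so a light vertex whose neighbours carry the total m′ has at
    -- least m′ neighbours. This gives the feasibility of the multicover instance, and it shows that
    -- the clipped demand is the true one.
    degree : ∀ v → isHeavy (Fin.toℕ v) ≡ false → m′ ≤ total (λ u → bit (adjacent adjacency (Fin.toℕ v) u)) (upTo n)
    degree v e = *-cancelˡ-≤ scale-y {{pos⇒nonZero (scale-pos v)}} (begin
      scale-y * m′                                       ≤⟨ covered-enough v e ⟩
      total (coverage (Fin.toℕ v)) (upTo n)              ≤⟨ total-mono (upTo n) (λ {u} u∈ → term u (∈.∈-upTo⁻ u∈) (adjacent adjacency (Fin.toℕ v) u)) ⟩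
      total (λ u → scale-y * bit (adjacent adjacency (Fin.toℕ v) u)) (upTo n) ≡⟨ total-* scale-y _ (upTo n) ⟩
      scale-y * total (λ u → bit (adjacent adjacency (Fin.toℕ v) u)) (upTo n) ∎)
      where
      open ≤-Reasoning
      term : ∀ u → u < n → ∀ a → (if a then y-nat u else 0) ≤ scale-y * bit a
      term u u<n true  = ≤-trans (y-nat≤ u<n) (≤-reflexive (sym (*-identityʳ scale-y)))
      term u u<n false = z≤n

    -- A light vertex has fewer than n neighbours, so the demand was not clipped.
    m′≡m : ∀ v → isHeavy (Fin.toℕ v) ≡ false → m′ ≡ J.m
    m′≡m v e = by (≤-total n J.m)
      where
      by : n ≤ J.m ⊎ J.m ≤ n → m′ ≡ J.m
      by (inj₂ m≤n) = m≥n⇒m⊓n≡n m≤n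
      by (inj₁ n≤m) = contradiction (≤-trans (s≤s (degree v e)) (total-bits< (adjacent adjacency (Fin.toℕ v)) (Fin.toℕ<n v) (loopless v)))
                        (<⇒≱ (s≤s (≤-reflexive (sym (m≤n⇒m⊓n≡m n≤m)))))

    real-light : ∀ v → real v ≡ true → isHeavy (Fin.toℕ v) ≡ false
    real-light v rv = not-true (proj₁ (∧-true rv))

    adjacent-contains : ∀ {v} u → real v ≡ true → adjacent adjacency (Fin.toℕ v) (Fin.toℕ u) ≡ true → contains v u ≡ true
    adjacent-contains {v} u rv a = near-contains rv (proj₂ (does-true (Graph._~?_ J.graph v u) (trans (sym (adjacent-graph v u)) a)))

    adjacents : Fin n → Subset n
    adjacents v = Vec.tabulate (λ u → adjacent adjacency (Fin.toℕ v) (Fin.toℕ u))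

    lookup-adjacents : ∀ v u → lookup (adjacents v) u ≡ adjacent adjacency (Fin.toℕ v) (Fin.toℕ u)
    lookup-adjacents v u = Vec.lookup∘tabulate (λ u → adjacent adjacency (Fin.toℕ v) (Fin.toℕ u)) u

    contribution : (Fin n → ℚ) → Fin n → Fin n → ℚ
    contribution x v u = if contains v u then x u else 0ℚ

  -- The given algorithm promises something for feasible instances only. All disks together are a
  -- multicover because light vertices have enough neighbours and the other demands are 0.
  multicover-feasible : I′.Feasible
  multicover-feasible = Subset.⊤ , cover
    where
    cover : I′.IsMulticover Subset.⊤
    cover v = by (real v) refl
      where
      by : ∀ b → real v ≡ b → (if b then ℤ.+ J.m else ℤ.+ 0) ℤ.≤ ℤ.+ ∣ Subset.⊤ ∩ I′.disksContaining v ∣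
      by false _  = ℤ.+≤+ z≤n
      by true  rv = ℤ.+≤+ (begin
        J.m                                                                  ≡⟨ m′≡m v (real-light v rv) ⟨
        m′                                                                   ≤⟨ degree v (real-light v rv) ⟩
        total (λ u → bit (adjacent adjacency (Fin.toℕ v) u)) (upTo n)        ≡⟨ cardinality (adjacents v) (λ u → bit (adjacent adjacency (Fin.toℕ v) u)) (λ u → cong bit (sym (lookup-adjacents v u))) ⟨
        ∣ adjacents v ∣ ≤⟨ card-mono (adjacents v) (Subset.⊤ ∩ I′.disksContaining v) inclusion ⟩
        ∣ Subset.⊤ ∩ I′.disksContaining v ∣                                  ∎)
        where
        open ≤-Reasoning
        inclusion : ∀ u → lookup (adjacents v) u ≡ true → lookup (Subset.⊤ ∩ I′.disksContaining v) u ≡ true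
        inclusion u a = trans (lookup-∩ Subset.⊤ (I′.disksContaining v) u) (cong₂ _∧_ (Vec.lookup-replicate u true)
          (trans (Vec.lookup∘tabulate (contains v) u) (adjacent-contains u rv (trans (sym (lookup-adjacents v u)) a))))

  y-feasible : I′.LPFeasible y
  y-feasible = (λ v → demand-met v (real v) refl) , (λ v → 0≤y v , y≤1 v)
    where
    0≤y : ∀ v → 0ℚ ℚ.≤ y v
    0≤y v = ℚ.*-cancelʳ-≤-pos (ι scale-y) {{ι-pos (scale-pos v)}} (subst₂ ℚ._≤_ (sym (ℚ.*-zeroˡ (ι scale-y))) (sym (y-scaled v)) (ι-nonNeg (y-nat (Fin.toℕ v))))
    y≤1 : ∀ v → y v ℚ.≤ 1ℚ
    y≤1 v = ℚ.*-cancelʳ-≤-pos (ι scale-y) {{ι-pos (scale-pos v)}} (subst₂ ℚ._≤_ (sym (y-scaled v)) (sym (ℚ.*-identityˡ (ι scale-y))) (ι-mono (y-nat≤ (Fin.toℕ<n v))))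
    demand-met : ∀ v b → real v ≡ b → (if b then ℤ.+ J.m else ℤ.+ 0) ℚ./ 1 ℚ.≤ Σℚ (contribution y v)
    demand-met v false _ = subst (ℚ._≤ Σℚ (contribution y v)) (trans (sym ι-0) (ιℤ-unfold (ℤ.+ 0))) (Σℚ-nonNeg (contribution y v) (λ u → nonneg u (contains v u)))
      where
      nonneg : ∀ u b → 0ℚ ℚ.≤ (if b then y u else 0ℚ)
      nonneg u true  = 0≤y u
      nonneg u false = ℚ.≤-refl
    demand-met v true rv = subst (ℚ._≤ Σℚ (contribution y v)) (ιℤ-unfold (ℤ.+ J.m)) (ℚ.*-cancelʳ-≤-pos (ι scale-y) {{ι-pos (scale-pos v)}}
      (subst (ℚ._≤ Σℚ (contribution y v) ℚ.* ι scale-y) (trans (ι-* scale-y J.m) (ℚ.*-comm (ι scale-y) (ι J.m)))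
        (ℚ.≤-trans (ι-mono (subst (λ k → scale-y * k ≤ total (coverage (Fin.toℕ v)) (upTo n)) (m′≡m v (real-light v rv)) (covered-enough v (real-light v rv))))
          (Σℚ-≥ (contribution y v) (coverage (Fin.toℕ v)) (ι scale-y) (λ u → term u (adjacent adjacency (Fin.toℕ v) (Fin.toℕ u)) (contains v u) (adjacent-contains u rv))))))
      where
      term : ∀ u a c → (a ≡ true → c ≡ true) → ι (if a then y-nat (Fin.toℕ u) else 0) ℚ.≤ (if c then y u else 0ℚ) ℚ.* ι scale-y
      term u true  true  _ = ℚ.≤-reflexive (sym (y-scaled u))
      term u true  false to = true≢false (to refl) refl
      term u false true  _ = subst₂ ℚ._≤_ (sym ι-0) (sym (y-scaled u)) (ι-nonNeg (y-nat (Fin.toℕ u)))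
      term u false false _ = ℚ.≤-reflexive (trans ι-0 (sym (ℚ.*-zeroˡ (ι scale-y))))

-- The integrality gap

subsets : ∀ n → List (Subset n)
subsets zero    = [] ∷ []
subsets (suc n) = map (true ∷_) (subsets n) ++ map (false ∷_) (subsets n)

∈-subsets : ∀ {n} (p : Subset n) → p ∈ subsets n
∈-subsets []              = here refl
∈-subsets {suc n} (true ∷ p)  = ∈.∈-++⁺ˡ (∈.∈-map⁺ (true ∷_) (∈-subsets p))
∈-subsets {suc n} (false ∷ p) = ∈.∈-++⁺ʳ (map (true ∷_) (subsets n)) (∈.∈-map⁺ (false ∷_) (∈-subsets p))

module _ {n : ℕ} (Feasible : Subset n → Set) (feasible? : ∀ p → Dec (Feasible p)) (cost : Subset n → ℚ) where

  private
    improve : ∀ ps {p} → Feasible p → ∃[ r ] Feasible r × cost r ℚ.≤ cost p × (∀ {q} → q ∈ ps → Feasible q → cost r ℚ.≤ cost q)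
    improve []       {p} ok = p , ok , ℚ.≤-refl , λ ()
    improve (q ∷ ps) {p} ok with feasible? q
    ... | no ¬ok = let r , fr , r≤p , min = improve ps ok in r , fr , r≤p , λ { (here refl) okq → contradiction okq ¬ok ; (there q∈) → min q∈ }
    ... | yes okq with ℚ.≤-total (cost p) (cost q)
    ...   | inj₁ p≤q = let r , fr , r≤p , min = improve ps ok in
                       r , fr , r≤p , λ { (here refl) _ → ℚ.≤-trans r≤p p≤q ; (there q∈) → min q∈ }
    ...   | inj₂ q≤p = let r , fr , r≤q , min = improve ps okq in
                       r , fr , ℚ.≤-trans r≤q q≤p , λ { (here refl) _ → r≤q ; (there q∈) → min q∈ }

  -- By exhaustive search over all subsets. It belongs to the proof and not to the algorithm: the
  -- guarantee is stated relative to a minimum that is attained.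
  minimizer : ∀ {p} → Feasible p → ∃ (IsMinimizer Feasible cost)
  minimizer ok = let r , fr , _ , min = improve (subsets n) ok in r , fr , λ q okq → min (∈-subsets q) okq

module _ (J : UnitDiskDomination) where

  private module J = UnitDiskDomination J

  dominating? : ∀ S → Dec (J.IsMDominating S)
  dominating? S = Fin.all? (λ v → ¬? (v Subset.∈? S) →-dec (J.m ≤? ∣ S ∩ Graph.neighbours J.graph v ∣))

  minimum-dominating : ∃ (IsMinimizer J.IsMDominating (weightOf J.weight))
  minimum-dominating = minimizer J.IsMDominating dominating? (weightOf J.weight) {Subset.⊤} (λ v v∉⊤ → contradiction Subset.∈⊤ v∉⊤)

-- Each of four disks contains three of four points: two disks are needed,
-- while a third of every disk suffices fractionally.
module Gap where

  corner : Fin 4 → Point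
  corner zero                   = point 1ℚ 0ℚ
  corner (suc zero)             = point 0ℚ 1ℚ
  corner (suc (suc zero))       = point (ℚ.- 1ℚ) 0ℚ
  corner (suc (suc (suc zero))) = point 0ℚ (ℚ.- 1ℚ)

  corner-injective : ∀ i j → corner i ≡ corner j → i ≡ j
  corner-injective zero zero _ = refl
  corner-injective (suc zero) (suc zero) _ = refl
  corner-injective (suc (suc zero)) (suc (suc zero)) _ = refl
  corner-injective (suc (suc (suc zero))) (suc (suc (suc zero))) _ = refl
  corner-injective zero (suc zero) ()
  corner-injective zero (suc (suc zero)) ()
  corner-injective zero (suc (suc (suc zero))) ()
  corner-injective (suc zero) zero ()
  corner-injective (suc zero) (suc (suc zero)) ()
  corner-injective (suc zero) (suc (suc (suc zero))) ()
  corner-injective (suc (suc zero)) zero ()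
  corner-injective (suc (suc zero)) (suc zero) ()
  corner-injective (suc (suc zero)) (suc (suc (suc zero))) ()
  corner-injective (suc (suc (suc zero))) zero ()
  corner-injective (suc (suc (suc zero))) (suc zero) ()
  corner-injective (suc (suc (suc zero))) (suc (suc zero)) ()

  gap : DiskMulticover
  gap = record
    { #P = 4 ; #D = 4
    ; point = corner
    ; points-distinct = corner-injective _ _
    ; demand = λ _ → ℤ.+ 1
    -- Adjacent corners have distance √2 and opposite ones 2. As 3/2 lies in between, a disk misses
    -- exactly the opposite corner.
    ; disk = λ i → record { centre = corner i ; radius = ℤ.+ 3 ℚ./ 2 }
    ; disks-distinct = λ eq → corner-injective _ _ (cong Disk.centre eq)
    ; weight = λ _ → 1ℚ
    ; weight-nonneg = λ _ → toWitness {a? = 0ℚ ℚ.≤? 1ℚ} _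
    }

  open DiskMulticover gap hiding (point; disk)

  third : Fin 4 → ℚ
  third _ = ℤ.+ 1 ℚ./ 3

  third-feasible : LPFeasible third
  third-feasible = (λ p → toWitness {a? = Fin.all? λ p → demand p ℚ./ 1 ℚ.≤? Σℚ λ i → if does (corner p ∈ᵈ? DiskMulticover.disk gap i) then third i else 0ℚ} _ p)
                 , (λ _ → toWitness {a? = 0ℚ ℚ.≤? ℤ.+ 1 ℚ./ 3} _ , toWitness {a? = ℤ.+ 1 ℚ./ 3 ℚ.≤? 1ℚ} _)

  feasible : Feasible
  feasible = Subset.⊤ , toWitness {a? = Fin.all? λ p → demand p ℤ.≤? ℤ.+ ∣ Subset.⊤ ∩ disksContaining p ∣} _

  two-needed : ∀ D → IsMulticover D → ι 2 ℚ.≤ weightOf weight D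
  two-needed D cover = subst (ℚ._≤ weightOf weight D) (sym (ιℤ-unfold (ℤ.+ 2)))
    (All.lookup (toWitness {a? = All.all? (λ D → Fin.all? (λ p → demand p ℤ.≤? ℤ.+ ∣ D ∩ disksContaining p ∣)
      →-dec (ℤ.+ 2 ℚ./ 1 ℚ.≤? weightOf weight D)) (subsets 4)} _) (∈-subsets D) cover)

module _ (α : ℝ) where

  open Gap
  open DiskMulticover gap using (weight; LPObjective)

  -- The multicover has weight at least 2, while the LP optimum is at most 4/3, so 2 ≤ 4/3 q.
  -- Replacing the optimum by 4/3 requires q ≥ 0; for q ≤ 0 the bound on the weight would be at most
  -- 0.
  upper≥3/2 : ∀ {D} → SearchProblem.Meets (LPRelativeDiskMulticover α) gap D → ∀ {q} → ℝ.Upper α q → ι 3 ℚ.≤ q ℚ.* ι 2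
  upper≥3/2 {D} (cover , x , ((x-feasible , minimal) , W≤)) {q} u = by (ℚ.≤-total q 0ℚ)
    where
    cost≥0 : 0ℚ ℚ.≤ LPObjective x
    cost≥0 = Σℚ-nonNeg (λ i → weight i ℚ.* x i) (λ i → subst (0ℚ ℚ.≤_) (sym (ℚ.*-identityˡ (x i))) (proj₁ (proj₂ x-feasible i)))
    2≰0 : ¬ ι 2 ℚ.≤ 0ℚ
    2≰0 2≤0 = contradiction (ι-cancel {2} {0} (subst (ι 2 ℚ.≤_) (sym ι-0) 2≤0)) λ ()
    nonpos : q ℚ.≤ 0ℚ → q ℚ.* LPObjective x ℚ.≤ 0ℚ
    nonpos q≤0 = subst (q ℚ.* LPObjective x ℚ.≤_) (ℚ.*-zeroˡ (LPObjective x)) (ℚ.*-monoʳ-≤-nonNeg (LPObjective x) {{ℚ.nonNegative cost≥0}} q≤0)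
    2≤cost : ι 2 ℚ.≤ q ℚ.* LPObjective x
    2≤cost = ℚ.≤-trans (two-needed D cover) (W≤ q u)
    bound-4/3 : 0ℚ ℚ.≤ q → ι 2 ℚ.≤ q ℚ.* LPObjective third
    bound-4/3 0≤q = ℚ.≤-trans 2≤cost (ℚ.*-monoˡ-≤-nonNeg q {{ℚ.nonNegative 0≤q}} (minimal third third-feasible))
    by : q ℚ.≤ 0ℚ ⊎ 0ℚ ℚ.≤ q → ι 3 ℚ.≤ q ℚ.* ι 2
    by (inj₁ q≤0) = contradiction (ℚ.≤-trans 2≤cost (nonpos q≤0)) 2≰0
    by (inj₂ 0≤q) = ℚ.*-cancelʳ-≤-pos (ι 2) {{ι-pos (s≤s z≤n)}} (begin
      ι 3 ℚ.* ι 2                       ≡⟨ ℚ.*-comm (ι 3) (ι 2) ⟩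
      ι 2 ℚ.* ι 3                       ≤⟨ ℚ.*-monoʳ-≤-nonNeg (ι 3) {{ℚ.nonNegative (ι-nonNeg 3)}} (bound-4/3 0≤q) ⟩
      q ℚ.* LPObjective third ℚ.* ι 3   ≡⟨ ℚ.*-assoc q (LPObjective third) (ι 3) ⟩
      q ℚ.* (LPObjective third ℚ.* ι 3) ≡⟨ cong (λ z → q ℚ.* (LPObjective third ℚ.* z)) (ιℤ-unfold (ℤ.+ 3)) ⟩
      q ℚ.* (ℤ.+ 4 ℚ./ 1)               ≡⟨ cong (q ℚ.*_) (trans (sym (ιℤ-unfold (ℤ.+ 4))) (ι-* 2 2)) ⟩
      q ℚ.* (ι 2 ℚ.* ι 2)               ≡⟨ ℚ.*-assoc q (ι 2) (ι 2) ⟨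
      q ℚ.* ι 2 ℚ.* ι 2                 ∎)
      where open ℚ.≤-Reasoning

rounds-pos : ∀ {n} → 0 < n → 0 < rounds n
rounds-pos {suc k} _ = subst (0 <_) (sym (rounds-unfold (suc k))) (*-mono-≤ {1} {penalty (suc k) * suc (8 * suc k)} {1}
  (*-mono-≤ {1} {penalty (suc k)} {1} (subst (0 <_) (sym (penalty-unfold (suc k))) (s≤s z≤n)) (s≤s z≤n)) (s≤s z≤n))

Σℚ-empty : ∀ {n} (f : Fin n → ℚ) → n ≡ 0 → Σℚ f ≡ 0ℚ
Σℚ-empty f refl = refl

weightOf-scaled : ∀ {n} (w : Fin n → ℚ) (W : ℕ → ℕ) c → (∀ v → w v ℚ.* c ≡ ι (W (Fin.toℕ v))) → (S : Subset n) →
  weightOf w S ℚ.* c ≡ ι (total (λ v → if bits-of S v then W v else 0) (upTo n))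
weightOf-scaled w W c eq S = Σℚ-≡ (λ v → if lookup S v then w v else 0ℚ) (λ v → if bits-of S v then W v else 0) c
  (λ v → by v (lookup S v) (bits-of-toℕ S v))
  where
  by : ∀ v b {b′} → b′ ≡ b → (if b then w v else 0ℚ) ℚ.* c ≡ ι (if b′ then W (Fin.toℕ v) else 0)
  by v true  refl = eq v
  by v false refl = trans (ℚ.*-zeroˡ c) (sym ι-0)

module Approximation (J : UnitDiskDomination) (L : List Bool) (T : ℕ) (T>0 : Fin (UnitDiskDomination.#V J) → 0 < T) (xs : ℕ → ℕ)
  (light≤ : ∀ {v} → v < UnitDiskDomination.#V J → at false L v ≡ false → 8 * xs v ≤ 3 * T)
  (heavy≥ : ∀ {v} → v < UnitDiskDomination.#V J → at false L v ≡ true → 3 * T ≤ 8 * xs v)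
  (light-cover : LightCover J L T xs)
  (Q : ℕ) (Q>0 : 0 < Q) (W : ℕ → ℕ) (weight-ι : ∀ v → UnitDiskDomination.weight J v ℚ.* ι Q ≡ ι (W (Fin.toℕ v)))
  (opt : ℕ) (spent : 8 * total (λ v → W v * xs v) (upTo (UnitDiskDomination.#V J)) ≤ 9 * (T * opt)) where

  open Fractional J L T T>0 xs light≤ light-cover public

  private
    heavyWeight : Fin n → ℚ
    heavyWeight v = if heavyAt v then J.weight v else 0ℚ

    wl cL cR : ℕ
    wl = total (λ v → if isHeavy v then W v else 0) (upTo n)
    cL = total (λ v → if isHeavy v then W v * xs v else 0) (upTo n)
    cR = total (λ v → if isHeavy v then 0 else W v * xs v) (upTo n)

    cL+cR : cL + cR ≡ total (λ v → W v * xs v) (upTo n)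
    cL+cR = trans (sym (total-+ _ _ (upTo n))) (total-cong (upTo n) (λ {v} _ → by (isHeavy v) (W v * xs v)))
      where
      by : ∀ b k → (if b then k else 0) + (if b then 0 else k) ≡ k
      by true  k = +-identityʳ k
      by false k = refl

    heavy-spent : 3 * T * wl ≤ 8 * cL
    heavy-spent = begin
      3 * T * wl                                                    ≡⟨ total-* (3 * T) _ (upTo n) ⟨
      total (λ v → 3 * T * (if isHeavy v then W v else 0)) (upTo n) ≤⟨ total-mono (upTo n) (λ {v} v∈ → by v (isHeavy v) (heavy≥ (∈.∈-upTo⁻ v∈))) ⟩
      total (λ v → 8 * (if isHeavy v then W v * xs v else 0)) (upTo n) ≡⟨ total-* 8 _ (upTo n) ⟩
      8 * cL                                                        ∎
      where
      open ≤-Reasoning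
      by : ∀ v b → (b ≡ true → 3 * T ≤ 8 * xs v) → 3 * T * (if b then W v else 0) ≤ 8 * (if b then W v * xs v else 0)
      by v true  le = ≤-trans (*-monoˡ-≤ (W v) (le refl)) (≤-reflexive (rotate (xs v) (W v)))
        where
        rotate : ∀ x w → 8 * x * w ≡ 8 * (w * x)
        rotate = solve-∀
      by v false le = ≤-reflexive (*-zeroʳ (3 * T))

    K : ℚ
    K = ι scale-y ℚ.* ι Q

    K-* : ∀ {a k} → a ℚ.* ι Q ≡ ι k → a ℚ.* K ≡ ι (scale-y * k)
    K-* {a} {k} eq = begin
      a ℚ.* (ι scale-y ℚ.* ι Q)   ≡⟨ cong (a ℚ.*_) (ℚ.*-comm (ι scale-y) (ι Q)) ⟩
      a ℚ.* (ι Q ℚ.* ι scale-y)   ≡⟨ ℚ.*-assoc a (ι Q) (ι scale-y) ⟨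
      a ℚ.* ι Q ℚ.* ι scale-y     ≡⟨ cong (ℚ._* ι scale-y) eq ⟩
      ι k ℚ.* ι scale-y           ≡⟨ ℚ.*-comm (ι k) (ι scale-y) ⟩
      ι scale-y ℚ.* ι k           ≡⟨ ι-* scale-y k ⟨
      ι (scale-y * k)             ∎
      where open ≡-Reasoning

    heavyWeight-scaled : Σℚ heavyWeight ℚ.* K ≡ ι (scale-y * wl)
    heavyWeight-scaled = K-* {Σℚ heavyWeight} {wl} (Σℚ-≡ heavyWeight (λ v → if isHeavy v then W v else 0) (ι Q) (λ v → by v (heavyAt v)))
      where
      by : ∀ v b → (if b then J.weight v else 0ℚ) ℚ.* ι Q ≡ ι (if b then W (Fin.toℕ v) else 0)
      by v true  = weight-ι v
      by v false = trans (ℚ.*-zeroˡ (ι Q)) (sym ι-0)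

    objective-y : I′.LPObjective y ℚ.* K ≡ ι (16 * cR)
    objective-y = trans (Σℚ-≡ (λ v → price v ℚ.* y v) (λ v → 16 * (if isHeavy v then 0 else W v * xs v)) K (λ v → by v (heavyAt v) refl))
      (cong ι (total-* 16 _ (upTo n)))
      where
      open ≡-Reasoning
      exchange : ∀ a b c d → (a ℚ.* b) ℚ.* (c ℚ.* d) ≡ (a ℚ.* d) ℚ.* (b ℚ.* c)
      exchange = ring 4 (λ a b c d → (a :* b) :* (c :* d) := (a :* d) :* (b :* c)) refl
        where open ℚ-Solver.+-*-Solver renaming (solve to ring)
      rotate : ∀ w x → w * (16 * x) ≡ 16 * (w * x)
      rotate = solve-∀
      by : ∀ v b → heavyAt v ≡ b → (if b then 0ℚ else J.weight v) ℚ.* y v ℚ.* K ≡ ι (16 * (if b then 0 else W (Fin.toℕ v) * xs (Fin.toℕ v)))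
      by v true  _ = trans (cong (ℚ._* K) (ℚ.*-zeroˡ (y v))) (trans (ℚ.*-zeroˡ K) (sym ι-0))
      by v false e = begin
        J.weight v ℚ.* y v ℚ.* (ι scale-y ℚ.* ι Q)        ≡⟨ exchange (J.weight v) (y v) (ι scale-y) (ι Q) ⟩
        (J.weight v ℚ.* ι Q) ℚ.* (y v ℚ.* ι scale-y)      ≡⟨ cong₂ ℚ._*_ (weight-ι v) (trans (y-scaled v) (cong (λ b → ι (if b then scale-y else 16 * xs (Fin.toℕ v))) e)) ⟩
        ι (W (Fin.toℕ v)) ℚ.* ι (16 * xs (Fin.toℕ v))     ≡⟨ ι-* (W (Fin.toℕ v)) (16 * xs (Fin.toℕ v)) ⟨
        ι (W (Fin.toℕ v) * (16 * xs (Fin.toℕ v)))         ≡⟨ cong ι (rotate (W (Fin.toℕ v)) (xs (Fin.toℕ v))) ⟩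
        ι (16 * (W (Fin.toℕ v) * xs (Fin.toℕ v)))         ∎

    weight-solution : ∀ D → weightOf J.weight (solution D) ≡ Σℚ heavyWeight ℚ.+ weightOf price D
    weight-solution D = Σℚ-+ (λ v → if lookup (solution D) v then J.weight v else 0ℚ) heavyWeight (λ v → if lookup D v then price v else 0ℚ)
      (λ v → by v (lookup D v) (heavyAt v) (lookup-solution D v))
      where
      by : ∀ v d h {b} → b ≡ d ∨ h → (if b then J.weight v else 0ℚ) ≡
        (if h then J.weight v else 0ℚ) ℚ.+ (if d then (if h then 0ℚ else J.weight v) else 0ℚ)
      by v true  true  refl = sym (ℚ.+-identityʳ (J.weight v))
      by v true  false refl = sym (ℚ.+-identityˡ (J.weight v))
      by v false true  refl = sym (ℚ.+-identityʳ (J.weight v))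
      by v false false refl = refl

  -- In units of 1 / `K`, both parts are charged to 2 q times 8 W v xs v. A heavy vertex costs 9 T W
  -- v ≤ 3 · 8 W v xs v, and 3 ≤ 2 q pays for it. The light part costs at most q times the LP
  -- objective 16 W v xs v, which is the same charge exactly. The sum of all charges is bounded by
  -- `spent`.
  weight-bound : ∀ {D q o} → ι 3 ℚ.≤ q ℚ.* ι 2 → weightOf price D ℚ.≤ q ℚ.* I′.LPObjective y →
    o ℚ.* ι Q ≡ ι opt → 0 < n → weightOf J.weight (solution D) ℚ.≤ q ℚ.* ι 2 ℚ.* o
  weight-bound {D} {q} {o} 3≤2q price≤ o-scaled n>0 = ℚ.*-cancelʳ-≤-pos K {{K-pos}} (begin
    weightOf J.weight (solution D) ℚ.* K                        ≡⟨ cong (ℚ._* K) (weight-solution D) ⟩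
    (Σℚ heavyWeight ℚ.+ weightOf price D) ℚ.* K                 ≡⟨ ℚ.*-distribʳ-+ K (Σℚ heavyWeight) (weightOf price D) ⟩
    Σℚ heavyWeight ℚ.* K ℚ.+ weightOf price D ℚ.* K             ≤⟨ ℚ.+-mono-≤ heavy-part light-part ⟩
    p ℚ.* ι (8 * cL) ℚ.+ p ℚ.* ι (8 * cR)                       ≡⟨ ℚ.*-distribˡ-+ p (ι (8 * cL)) (ι (8 * cR)) ⟨
    p ℚ.* (ι (8 * cL) ℚ.+ ι (8 * cR))                           ≡⟨ cong (p ℚ.*_) (ι-+ (8 * cL) (8 * cR)) ⟨
    p ℚ.* ι (8 * cL + 8 * cR)                                   ≤⟨ ℚ.*-monoˡ-≤-nonNeg p {{ℚ.nonNegative p≥0}} (ι-mono shares) ⟩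
    p ℚ.* ι (scale-y * opt)                                     ≡⟨ cong (p ℚ.*_) (K-* {o} {opt} o-scaled) ⟨
    p ℚ.* (o ℚ.* K)                                             ≡⟨ ℚ.*-assoc p o K ⟨
    p ℚ.* o ℚ.* K                                               ∎)
    where
    open ℚ.≤-Reasoning
    p : ℚ
    p = q ℚ.* ι 2
    p≥0 : 0ℚ ℚ.≤ p
    p≥0 = ℚ.≤-trans (ι-nonNeg 3) 3≤2q
    K≡ : K ≡ ι (scale-y * Q)
    K≡ = sym (ι-* scale-y Q)
    K>0 : 0 < scale-y * Q
    K>0 = *-mono-≤ {1} {scale-y} {1} (scale-pos (Fin.fromℕ< n>0)) Q>0
    K-pos : ℚ.Positive K
    K-pos = subst ℚ.Positive (sym K≡) (ι-pos K>0)
    K-nonNeg : ℚ.NonNegative K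
    K-nonNeg = ℚ.nonNegative (subst (0ℚ ℚ.≤_) (sym K≡) (ι-nonNeg (scale-y * Q)))
    shares : 8 * cL + 8 * cR ≤ scale-y * opt
    shares = ≤-trans (≤-reflexive (trans (sym (*-distribˡ-+ 8 cL cR)) (cong (8 *_) cL+cR))) (≤-trans spent (≤-reflexive (sym (*-assoc 9 T opt))))
    heavy-part : Σℚ heavyWeight ℚ.* K ℚ.≤ p ℚ.* ι (8 * cL)
    heavy-part = begin
      Σℚ heavyWeight ℚ.* K     ≡⟨ heavyWeight-scaled ⟩
      ι (scale-y * wl)         ≡⟨ cong ι (thrice T wl) ⟩
      ι (3 * (3 * T * wl))     ≤⟨ ι-mono (*-monoʳ-≤ 3 heavy-spent) ⟩
      ι (3 * (8 * cL))         ≡⟨ ι-* 3 (8 * cL) ⟩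
      ι 3 ℚ.* ι (8 * cL)       ≤⟨ ℚ.*-monoʳ-≤-nonNeg (ι (8 * cL)) {{ℚ.nonNegative (ι-nonNeg (8 * cL))}} 3≤2q ⟩
      p ℚ.* ι (8 * cL)         ∎
      where
      thrice : ∀ t w → 9 * t * w ≡ 3 * (3 * t * w)
      thrice = solve-∀
    light-part : weightOf price D ℚ.* K ℚ.≤ p ℚ.* ι (8 * cR)
    light-part = begin
      weightOf price D ℚ.* K                 ≤⟨ ℚ.*-monoʳ-≤-nonNeg K {{K-nonNeg}} price≤ ⟩
      q ℚ.* I′.LPObjective y ℚ.* K           ≡⟨ ℚ.*-assoc q (I′.LPObjective y) K ⟩
      q ℚ.* (I′.LPObjective y ℚ.* K)         ≡⟨ cong (q ℚ.*_) objective-y ⟩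
      q ℚ.* ι (16 * cR)                      ≡⟨ cong (λ k → q ℚ.* ι k) (*-assoc 2 8 cR) ⟩
      q ℚ.* ι (2 * (8 * cR))                 ≡⟨ cong (q ℚ.*_) (ι-* 2 (8 * cR)) ⟩
      q ℚ.* (ι 2 ℚ.* ι (8 * cR))             ≡⟨ ℚ.*-assoc q (ι 2) (ι (8 * cR)) ⟨
      p ℚ.* ι (8 * cR)                       ∎

  meets : ∀ {α D S⋆} → IsMinimizer J.IsMDominating (weightOf J.weight) S⋆ → weightOf J.weight S⋆ ℚ.* ι Q ≡ ι opt →
    (∀ {q} → ℝ.Upper α q → ι 3 ℚ.≤ q ℚ.* ι 2) → SearchProblem.Meets (LPRelativeDiskMulticover α) instance′ D →
    SearchProblem.Meets (ApproximateUnitDiskDomination (twice α)) J (solution D)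
  meets {α} {D} {S⋆} S⋆-minimum S⋆-scaled upper (cover , x , ((x-feasible , minimal) , W≤)) = dominating {D} cover , S⋆ , S⋆-minimum , within-twice
    where
    within-twice : ∀ q′ → ℝ.Upper α (ℚ.½ ℚ.* q′) → weightOf J.weight (solution D) ℚ.≤ q′ ℚ.* weightOf J.weight S⋆
    within-twice q′ u = by (n ≟ 0)
      where
      q : ℚ
      q = ℚ.½ ℚ.* q′
      q*2 : q ℚ.* ι 2 ≡ q′
      q*2 = begin
        ℚ.½ ℚ.* q′ ℚ.* ι 2           ≡⟨ cong (ℚ.½ ℚ.* q′ ℚ.*_) (ιℤ-unfold (ℤ.+ 2)) ⟩
        ℚ.½ ℚ.* q′ ℚ.* 2ℚ            ≡⟨ cong (ℚ._* 2ℚ) (ℚ.*-comm ℚ.½ q′) ⟩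
        q′ ℚ.* ℚ.½ ℚ.* 2ℚ            ≡⟨ ℚ.*-assoc q′ ℚ.½ 2ℚ ⟩
        q′ ℚ.* 1ℚ                    ≡⟨ ℚ.*-identityʳ q′ ⟩
        q′                           ∎
        where open ≡-Reasoning
      q≥0 : 0ℚ ℚ.≤ q
      q≥0 = ℚ.*-cancelʳ-≤-pos (ι 2) {{ι-pos (s≤s z≤n)}} (subst (ℚ._≤ q ℚ.* ι 2) (sym (ℚ.*-zeroˡ (ι 2))) (ℚ.≤-trans (ι-nonNeg 3) (upper {q} u)))
      by : Dec (n ≡ 0) → weightOf J.weight (solution D) ℚ.≤ q′ ℚ.* weightOf J.weight S⋆
      -- Without vertices there are no rounds, and the scaling factor would be 0.
      by (yes n≡0) = ℚ.≤-reflexive (trans (Σℚ-empty (λ v → if lookup (solution D) v then J.weight v else 0ℚ) n≡0)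
        (sym (trans (cong (q′ ℚ.*_) (Σℚ-empty (λ v → if lookup S⋆ v then J.weight v else 0ℚ) n≡0)) (ℚ.*-zeroʳ q′))))
      by (no n≢0)  = subst (λ p → weightOf J.weight (solution D) ℚ.≤ p ℚ.* weightOf J.weight S⋆) q*2
        (weight-bound {D} {q} {weightOf J.weight S⋆} (upper {q} u)
          (ℚ.≤-trans (W≤ q u) (ℚ.*-monoˡ-≤-nonNeg q {{ℚ.nonNegative q≥0}} (minimal y y-feasible)))
          S⋆-scaled (n≢0⇒n>0 n≢0))

module Reduction (J : UnitDiskDomination) (L : List Bool) (L≡ : heavySet (Input.parsed J) ≡ L)
  {S⋆ : Subset (UnitDiskDomination.#V J)} (S⋆-minimum : IsMinimizer (UnitDiskDomination.IsMDominating J) (weightOf (UnitDiskDomination.weight J)) S⋆) where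

  private
    N = UnitDiskDomination.#V J
    module R = Relaxation J S⋆ (proj₁ S⋆-minimum)
    module V = Weights J

    heavy-at : ∀ {v} → v < N → at false L v ≡ R.isHeavy v
    heavy-at {v} v<n = trans (cong (λ L → at false L v) (trans (sym L≡) R.heavySet-isHeavy)) (at-map-upTo false R.isHeavy v<n)

    light≤ : ∀ {v} → v < N → at false L v ≡ false → 8 * R.xs v ≤ 3 * R.T
    light≤ {v} v<n e = leq-false (3 * R.T) (8 * R.xs v) (trans (sym (heavy-at v<n)) e)

    heavy≥ : ∀ {v} → v < N → at false L v ≡ true → 3 * R.T ≤ 8 * R.xs v
    heavy≥ {v} v<n e = leq-sound (3 * R.T) (8 * R.xs v) (trans (sym (heavy-at v<n)) e)

    light-cover : LightCover J L R.T R.xs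
    light-cover v e = subst₂ (λ a b → 9 * (R.T * R.m′) ≤ 16 * a + 9 * (R.T * b))
      (total-cong (upTo N) (λ {u} u∈ → cong (λ h → if adj u ∧ not h then R.xs u else 0) (sym (heavy-at (∈.∈-upTo⁻ u∈)))))
      (total-cong (upTo N) (λ {u} u∈ → cong (λ h → bit (adj u ∧ h)) (sym (heavy-at (∈.∈-upTo⁻ u∈)))))
      (R.light-cover R.isHeavy {Fin.toℕ v} (Fin.toℕ<n v) (light≤ (Fin.toℕ<n v) e) (Input.loopless J v))
      where
      adj = adjacent (Input.adjacency J) (Fin.toℕ v)

  open Approximation J L R.T (λ v → rounds-pos (≤-trans (s≤s z≤n) (Fin.toℕ<n v))) R.xs light≤ heavy≥ light-cover V.Q V.Q>0 V.W V.weight-ι R.optimum R.spent public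

  minimum-scaled : weightOf J.weight S⋆ ℚ.* ι V.Q ≡ ι R.optimum
  minimum-scaled = weightOf-scaled J.weight V.W (ι V.Q) V.weight-ι S⋆

-- Running time and the final assembly

pow : Polynomial → ℕ → Polynomial
pow p zero    = constant 1
pow p (suc e) = p ⊗ pow p e

eval-pow : ∀ p e n → eval (pow p e) n ≡ eval p n ^ e
eval-pow p zero    n = refl
eval-pow p (suc e) n = cong (eval p n *_) (eval-pow p e n)

bits-size : ∀ (bs : List Bool) → ∥ bs ∥ ≤ 1 + 4 * length bs
bits-size []       = ≤-refl
bits-size (b ∷ bs) = ≤-trans (s≤s (+-mono-≤ (size-Bool b) (bits-size bs))) (≤-reflexive (shift (length bs)))
  where
  shift : ∀ n → suc (3 + (1 + 4 * n)) ≡ 1 + 4 * suc n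
  shift = solve-∀

length≤∥∥ : ∀ (bs : List Bool) → length bs ≤ ∥ bs ∥
length≤∥∥ bs = subst (_≤ ∥ bs ∥) (spine-List bs) (spine-≤ ⌜ bs ⌝)

module _ {f : List Bool → List Bool × List Bool} (fᴾ : Poly f) (c e : ℕ) where

  private
    inputSize outputSize : Polynomial
    inputSize  = constant 1 ⊕ constant 4 ⊗ var
    outputSize = growth fᴾ ⊚ inputSize

  through-time : Polynomial
  through-time = constant 3 ⊕ constant 11 ⊗ var ⊕ (bound fᴾ ⊚ inputSize
    ⊕ ((constant 1 ⊕ ((constant 6 ⊕ constant 8 ⊗ outputSize) ⊕ ((constant 1 ⊕ constant 4 ⊗ outputSize)
        ⊕ ((constant 6 ⊕ constant 8 ⊗ outputSize) ⊕ (constant 1 ⊕ constant 4 ⊗ outputSize)))))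
    ⊕ ((constant c ⊗ pow outputSize e ⊕ constant c) ⊕ ((constant 6 ⊗ var ⊕ constant 1) ⊕ (constant 1 ⊕ constant 4 ⊗ var)))))

  -- Merging and copying back take time linear in the answer `out`, whence the assumption on its
  -- length. It will hold because a solution has one bit per vertex and the input is at least as
  -- long as the number of vertices.
  through-outputs : ∀ {k} (P : Program (suc k)) input {X Y out} → f input ≡ (X , Y) → length out ≤ length input →
    P OnInput X Outputs out Within (c * length X ^ e + c) →
    through fᴾ P OnInput input Outputs merge out Y Within eval through-time (length input)
  through-outputs {k} P input {X} {Y} {out} refl out≤ (t , x ∷ S , run , refl , t≤) =
    let s , head≡ , r = through-runs fᴾ P input (ran t≤ run) in time r , s , halts r , head≡ , ≤-trans (time≤ r) bounded
    where
    G : ℕ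
    G = eval outputSize (length input)
    output≤ : ∥ f input ∥ ≤ G
    output≤ = ≤-trans (size-bound fᴾ input) (≤-trans (eval-mono (growth fᴾ) (bits-size input)) (≤-reflexive (sym (eval-⊚ (growth fᴾ) inputSize (length input)))))
    X≤ : length X ≤ G
    X≤ = ≤-trans (length≤∥∥ X) (≤-trans (≤-trans (m≤m+n ∥ X ∥ ∥ Y ∥) (n≤1+n _)) output≤)
    Y≤ : length Y ≤ G
    Y≤ = ≤-trans (length≤∥∥ Y) (≤-trans (≤-trans (m≤n+m ∥ Y ∥ ∥ X ∥) (n≤1+n _)) output≤)
    transfer : ∀ {a b} → a ≤ b → 1 + 4 * a ≤ 1 + 4 * b
    transfer le = s≤s (*-monoʳ-≤ 4 le)
    extract : ∀ {a b} → a ≤ b → 6 + 8 * a ≤ 6 + 8 * b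
    extract le = +-monoʳ-≤ 6 (*-monoʳ-≤ 8 le)
    bounded : 3 + 11 * length input + (eval (bound fᴾ) ∥ input ∥
          + ((1 + ((6 + 8 * length X) + ((1 + 4 * length X) + ((6 + 8 * length Y) + (1 + 4 * length Y)))))
          + ((c * length X ^ e + c) + ((6 * length out + 1) + (1 + 4 * length out))))) ≤ eval through-time (length input)
    bounded = +-monoʳ-≤ (3 + 11 * length input) (+-mono-≤
      (≤-trans (eval-mono (bound fᴾ) (bits-size input)) (≤-reflexive (sym (eval-⊚ (bound fᴾ) inputSize (length input)))))
      (+-mono-≤ (s≤s (+-mono-≤ (extract X≤) (+-mono-≤ (transfer X≤) (+-mono-≤ (extract Y≤) (transfer Y≤)))))
        (+-mono-≤ (+-monoˡ-≤ c (*-monoʳ-≤ c (≤-trans (^-monoˡ-≤ e X≤) (≤-reflexive (sym (eval-pow outputSize e (length input)))))))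
          (+-mono-≤ (+-monoˡ-≤ 1 (*-monoʳ-≤ 6 out≤)) (transfer out≤)))))

theorem2 : (α : ℝ) →
  PolynomialTimeAlgorithm (LPRelativeDiskMulticover α) →
  PolynomialTimeAlgorithm (ApproximateUnitDiskDomination (twice α))
theorem2 α (k , A , c , e , works) = k + (depth reduceᴾ + 4) , through reduceᴾ A , proj₁ time-bound , proj₁ (proj₂ time-bound) ,
  λ J _ → approximate J (heavySet (Input.parsed J)) refl
  where
  time-bound : ∃[ c′ ] ∃[ e′ ] ∀ n → eval (through-time reduceᴾ c e) n ≤ c′ * n ^ e′ + c′
  time-bound = eval-bound (through-time reduceᴾ c e)

  upper : ∀ {q} → ℝ.Upper α q → ι 3 ℚ.≤ q ℚ.* ι 2
  upper = let D , met , _ = works Gap.gap Gap.feasible in upper≥3/2 α {D} met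

  approximate : ∀ J L → heavySet (Input.parsed J) ≡ L → ∃[ S ] SearchProblem.Meets (ApproximateUnitDiskDomination (twice α)) J S ×
    through reduceᴾ A OnInput UnitDiskDomination.encode J Outputs encodeSubset S
      Within (proj₁ time-bound * length (UnitDiskDomination.encode J) ^ proj₁ (proj₂ time-bound) + proj₁ time-bound)
  approximate J L L≡ = finish (works instance′ multicover-feasible)
    where
    minimum : ∃ (IsMinimizer (UnitDiskDomination.IsMDominating J) (weightOf (UnitDiskDomination.weight J)))
    minimum = minimum-dominating J
    open Reduction J L L≡ {proj₁ minimum} (proj₂ minimum)
    finish : ∃[ D ] SearchProblem.Meets (LPRelativeDiskMulticover α) instance′ D ×
        A OnInput I′.encode Outputs encodeSubset D Within (c * length I′.encode ^ e + c) →
      ∃[ S ] SearchProblem.Meets (ApproximateUnitDiskDomination (twice α)) J S ×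
        through reduceᴾ A OnInput bits Outputs encodeSubset S Within (proj₁ time-bound * length bits ^ proj₁ (proj₂ time-bound) + proj₁ time-bound)
    finish (D , met , run) = solution D , meets {α} {D} {proj₁ minimum} (proj₂ minimum) minimum-scaled upper met , relax (through-outputs reduceᴾ c e A bits (reduce-bits L≡) out≤ run)
      where
      out≤ : length (encodeSubset D) ≤ length bits
      out≤ = ≤-trans (≤-reflexive (Vec.length-toList D)) n≤bits
      relax : through reduceᴾ A OnInput bits Outputs merge (encodeSubset D) L Within eval (through-time reduceᴾ c e) (length bits) →
        through reduceᴾ A OnInput bits Outputs encodeSubset (solution D) Within (proj₁ time-bound * length bits ^ proj₁ (proj₂ time-bound) + proj₁ time-bound)
      relax (t , s , run , head≡ , t≤) = t , s , run , trans head≡ (sym (encode-solution D)) , ≤-trans t≤ (proj₂ (proj₂ time-bound) (length bits))
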